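{- Let $(\vartheta_0,D_6,D_5)$ be one of the triples $(0.924,4,6)$, $(0.739,6,8)$, $(0.643,6,12)$, $(0.584,10,16)$, $(0.544,12,20)$, $(0.516,14,26)$, and suppose some $\vartheta>\vartheta_0$ satisfies both conditions (A) and (B) below. Then at least one of the following holds: (i) there exist absolute constants $C$, $c>0$, an odd integer $b\le C$ and an even integer $d$ with $0<|d|\le D_6$ such that $P^-(p+d)>p^c$ and $\Omega(p+d)=b$ for infinitely many primes $p$; (ii) $\liminf_{n\to\infty}(p_{n+1}-p_n)\le D_5$.
   Context: $p_n$ is the $n$-th prime; $P^-(n)$ is the smallest prime factor of $n$; $\Omega(n)$ is the number of prime factors of $n$ counted with multiplicity and $\lambda(n)=(-1)^{\Omega(n)}$. Condition (A): for every $\varepsilon>0$, $A>0$, $\sum_{q\le N^{\vartheta-\varepsilon}}\max_{a:(a,q)=1}\bigl|\sum_{p\le N,\,p\equiv a\ (\mathrm{mod}\ q)}\log p-\frac{N}{\varphi(q)}\bigr|\ll_{\varepsilon,A}\frac{N}{(\log N)^A}$ ($p$ over primes). Condition (B): for every $\varepsilon>0$, $A>0$, $\sum_{q\le N^{\vartheta-\varepsilon}}\max_{y\le N}\max_a\bigl|\sum_{n\le y,\,n\equiv a\ (\mathrm{mod}\ q)}\lambda(n)\bigr|\ll_{\varepsilon,A}\frac{N}{(\log N)^A}$. -}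

module Defs where

open import Data.Bool.Base using (true; false; if_then_else_)
open import Data.Integer.Base as ℤ using (ℤ; +_)
import Data.Integer.Divisibility as ℤ
import Data.Integer.Properties as ℤₚ
open import Data.List.Base using (List; []; _∷_; map; filter; foldr; length; upTo; applyUpTo)
open import Data.List.Extrema.Nat using (min; max)
open import Data.List.Properties using (filter-accept)
open import Data.List.Relation.Unary.All using (_∷_)
open import Data.Nat.Base as ℕ using (ℕ; zero; suc; NonZero; _!; z≤n; s≤s)
import Data.Nat.Properties as ℕₚ
open import Data.Nat.Coprimality using (coprime?; 1-coprimeTo)
open import Data.Nat.Divisibility using (_∣_; _∣?_; ∣1⇒≡1; ∣m+n∣m⇒∣n; m∣m*n; ∣-trans; m≤n⇒m!∣n!)
open import Data.Nat.ListAction using (product)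
open import Data.Nat.Primality using (Prime; prime?; prime⇒nonZero; ¬prime[1])
open import Data.Nat.Primality.Factorisation using (PrimeFactorisation; factorise; factors)
open import Data.Product.Base using (Σ-syntax; ∃-syntax; _×_; _,_; proj₁; proj₂)
open import Data.Rational.Base using (ℚ; 0ℚ; 1ℚ; ½; _/_; _+_; _*_; _-_; -_; 1/_; _≤_; _<_; ∣_∣; _⊔_; _⊓_; positive; nonNegative; ≢-nonZero; toℚᵘ)
import Data.Rational.Base as ℚ
open import Data.Rational.Properties as ℚₚ using (_≟_)
import Data.Rational.Unnormalised.Base as ℚᵘ
import Data.Rational.Unnormalised.Properties as ℚᵘₚ
open import Data.Rational.Solver using (module +-*-Solver)
open import Data.Sum.Base using (_⊎_; inj₁; inj₂)
open import Relation.Binary.PropositionalEquality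
open import Relation.Nullary using (Dec; yes; no; does; ¬_; contradiction; _×-dec_)

open +-*-Solver using (solve; _:=_; _:+_; _:*_; :-_; _:-_; con)

fromℕ : ℕ → ℚ
fromℕ n = + n / 1

fromℕ-toℚᵘ : ∀ n → toℚᵘ (fromℕ n) ℚᵘ.≃ ℚᵘ.mkℚᵘ (+ n) 0
fromℕ-toℚᵘ n = ℚₚ.toℚᵘ-fromℚᵘ (ℚᵘ.mkℚᵘ (+ n) 0)

0≤fromℕ : ∀ n → 0ℚ ≤ fromℕ n
0≤fromℕ n = ℚₚ.nonNegative⁻¹ _ {{ℚₚ.normalize-nonNeg n 1}}

fromℕ-mono : ∀ {m n} → m ℕ.≤ n → fromℕ m ≤ fromℕ n
fromℕ-mono {m} {n} m≤n = ℚₚ.toℚᵘ-cancel-≤ (ℚᵘₚ.≤-respˡ-≃ (ℚᵘₚ.≃-sym (fromℕ-toℚᵘ m))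
  (ℚᵘₚ.≤-respʳ-≃ (ℚᵘₚ.≃-sym (fromℕ-toℚᵘ n))
    (ℚᵘ.*≤* (ℤₚ.*-monoʳ-≤-nonNeg (+ 1) (ℤ.+≤+ m≤n)))))

fromℕ-* : ∀ m n → fromℕ (m ℕ.* n) ≡ fromℕ m * fromℕ n
fromℕ-* m n = ℚₚ.toℚᵘ-injective (begin
  toℚᵘ (fromℕ (m ℕ.* n))                       ≈⟨ fromℕ-toℚᵘ (m ℕ.* n) ⟩
  ℚᵘ.mkℚᵘ (+ (m ℕ.* n)) 0                      ≡⟨ cong (λ i → ℚᵘ.mkℚᵘ i 0) (ℤₚ.pos-* m n) ⟩
  ℚᵘ.mkℚᵘ (+ m) 0 ℚᵘ.* ℚᵘ.mkℚᵘ (+ n) 0         ≈⟨ ℚᵘₚ.≃-sym (ℚᵘₚ.*-cong (fromℕ-toℚᵘ m) (fromℕ-toℚᵘ n)) ⟩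
  toℚᵘ (fromℕ m) ℚᵘ.* toℚᵘ (fromℕ n)           ≈⟨ ℚᵘₚ.≃-sym (ℚₚ.toℚᵘ-homo-* (fromℕ m) (fromℕ n)) ⟩
  toℚᵘ (fromℕ m * fromℕ n)                     ∎)
  where
  open ℚᵘₚ.≃-Reasoning

fromℕ-suc : ∀ n → fromℕ (suc n) ≡ 1ℚ + fromℕ n
fromℕ-suc n = ℚₚ.toℚᵘ-injective (begin
  toℚᵘ (fromℕ (suc n))                         ≈⟨ fromℕ-toℚᵘ (suc n) ⟩
  ℚᵘ.mkℚᵘ (+ suc n) 0                          ≈⟨ ℚᵘ.*≡* (cong (ℤ._* (+ 1)) (cong (λ i → + 1 ℤ.+ i) (sym (ℤₚ.*-identityʳ (+ n))))) ⟩
  ℚᵘ.mkℚᵘ (+ 1) 0 ℚᵘ.+ ℚᵘ.mkℚᵘ (+ n) 0         ≈⟨ ℚᵘₚ.≃-sym (ℚᵘₚ.+-cong (ℚᵘₚ.≃-refl {toℚᵘ 1ℚ}) (fromℕ-toℚᵘ n)) ⟩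
  toℚᵘ 1ℚ ℚᵘ.+ toℚᵘ (fromℕ n)                  ≈⟨ ℚᵘₚ.≃-sym (ℚₚ.toℚᵘ-homo-+ 1ℚ (fromℕ n)) ⟩
  toℚᵘ (1ℚ + fromℕ n)                          ∎)
  where
  open ℚᵘₚ.≃-Reasoning

/-fromℕ : ∀ m n .{{_ : NonZero n}} → (+ m / n) * fromℕ n ≡ fromℕ m
/-fromℕ m n@(suc n-1) = ℚₚ.toℚᵘ-injective (begin
  toℚᵘ ((+ m / n) * fromℕ n)                   ≈⟨ ℚₚ.toℚᵘ-homo-* (+ m / n) (fromℕ n) ⟩
  toℚᵘ (+ m / n) ℚᵘ.* toℚᵘ (fromℕ n)           ≈⟨ ℚᵘₚ.*-cong (ℚₚ.toℚᵘ-fromℚᵘ (ℚᵘ.mkℚᵘ (+ m) n-1)) (fromℕ-toℚᵘ n) ⟩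
  ℚᵘ.mkℚᵘ (+ m) n-1 ℚᵘ.* ℚᵘ.mkℚᵘ (+ n) 0       ≈⟨ ℚᵘ.*≡* (trans (ℤₚ.*-identityʳ (+ m ℤ.* + n)) (cong (λ k → + m ℤ.* + k) (sym (ℕₚ.*-identityʳ n)))) ⟩
  ℚᵘ.mkℚᵘ (+ m) 0                              ≈⟨ ℚᵘₚ.≃-sym (fromℕ-toℚᵘ m) ⟩
  toℚᵘ (fromℕ m)                               ∎)
  where
  open ℚᵘₚ.≃-Reasoning

archimedean : ∀ q → ∃[ n ] q ≤ fromℕ n
archimedean q@(ℚ.mkℚ i d-1 _) = ℤ.∣ i ∣ , ℚₚ.toℚᵘ-cancel-≤
  (ℚᵘₚ.≤-respʳ-≃ (ℚᵘₚ.≃-sym (fromℕ-toℚᵘ ℤ.∣ i ∣)) (ℚᵘ.*≤* (lem i)))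
  where
  lem : ∀ i → i ℤ.* + 1 ℤ.≤ + ℤ.∣ i ∣ ℤ.* + suc d-1
  lem (+ n) = subst₂ ℤ._≤_ (ℤₚ.pos-* n 1) (ℤₚ.pos-* n (suc d-1)) (ℤ.+≤+ (ℕₚ.*-monoʳ-≤ n (s≤s z≤n)))
  lem ℤ.-[1+ n ] = ℤ.-≤+

0≤* : ∀ {p q} → 0ℚ ≤ p → 0ℚ ≤ q → 0ℚ ≤ p * q
0≤* {p} {q} 0≤p 0≤q = ℚₚ.nonNegative⁻¹ (p * q) {{ℚₚ.nonNeg*nonNeg⇒nonNeg p {{nonNegative 0≤p}} q {{nonNegative 0≤q}}}}

0<* : ∀ {p q} → 0ℚ < p → 0ℚ < q → 0ℚ < p * q
0<* {p} {q} 0<p 0<q = ℚₚ.positive⁻¹ (p * q) {{ℚₚ.pos*pos⇒pos p {{positive 0<p}} q {{positive 0<q}}}}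

*-mono : ∀ {p q r s} → 0ℚ ≤ p → 0ℚ ≤ s → p ≤ q → r ≤ s → p * r ≤ q * s
*-mono {p} {q} {r} {s} 0≤p 0≤s p≤q r≤s =
  ℚₚ.≤-trans (ℚₚ.*-monoˡ-≤-nonNeg p {{nonNegative 0≤p}} r≤s) (ℚₚ.*-monoʳ-≤-nonNeg s {{nonNegative 0≤s}} p≤q)

≤-≡ : ∀ {p q r s} → p ≡ q → q ≤ r → r ≡ s → p ≤ s
≤-≡ refl q≤r refl = q≤r

p≤∣p∣ : ∀ p → p ≤ ∣ p ∣
p≤∣p∣ p with ℚₚ.≤-total 0ℚ p
... | inj₁ 0≤p = ℚₚ.≤-reflexive (sym (ℚₚ.0≤p⇒∣p∣≡p 0≤p))
... | inj₂ p≤0 = ℚₚ.≤-trans p≤0 (ℚₚ.0≤∣p∣ p)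

∣∣-lub : ∀ {p e} → p ≤ e → - p ≤ e → ∣ p ∣ ≤ e
∣∣-lub {p} p≤e -p≤e with ℚₚ.∣p∣≡p∨∣p∣≡-p p
... | inj₁ eq = subst (_≤ _) (sym eq) p≤e
... | inj₂ eq = subst (_≤ _) (sym eq) -p≤e

-- Total inverse with inv₀ 0 = 0.
inv₀ : ℚ → ℚ
inv₀ q with q ≟ 0ℚ
... | yes _   = 0ℚ
... | no q≢0 = 1/_ q {{≢-nonZero q≢0}}

inv₀-inverse : ∀ {q} → 0ℚ < q → q * inv₀ q ≡ 1ℚ
inv₀-inverse {q} 0<q with q ≟ 0ℚ
... | yes q≡0 = contradiction (sym q≡0) (ℚₚ.<⇒≢ 0<q)
... | no q≢0 = ℚₚ.*-inverseʳ q {{≢-nonZero q≢0}}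

0<inv₀ : ∀ {q} → 0ℚ < q → 0ℚ < inv₀ q
0<inv₀ {q} 0<q = ℚₚ.*-cancelˡ-<-nonNeg q {{nonNegative (ℚₚ.<⇒≤ 0<q)}}
  (subst₂ _<_ (sym (ℚₚ.*-zeroʳ q)) (sym (inv₀-inverse 0<q)) (ℚₚ.positive⁻¹ 1ℚ))

inv₀-anti : ∀ {p q} → 0ℚ < p → p ≤ q → inv₀ q ≤ inv₀ p
inv₀-anti {p} {q} 0<p p≤q = ≤-≡
  (trans (sym (ℚₚ.*-identityˡ v)) (cong (_* v) (sym (inv₀-inverse 0<p))))
  (ℚₚ.*-monoʳ-≤-nonNeg v {{nonNegative (ℚₚ.<⇒≤ (0<inv₀ 0<q))}}
    (ℚₚ.*-monoʳ-≤-nonNeg u {{nonNegative (ℚₚ.<⇒≤ (0<inv₀ 0<p))}} p≤q))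
  (trans (solve 3 (λ q u v → q :* u :* v := q :* v :* u) refl q u v)
    (trans (cong (_* u) (inv₀-inverse 0<q)) (ℚₚ.*-identityˡ u)))
  where
  0<q = ℚₚ.<-≤-trans 0<p p≤q
  u = inv₀ p
  v = inv₀ q

infixr 8 _^_
_^_ : ℚ → ℕ → ℚ
q ^ zero  = 1ℚ
q ^ suc n = q * q ^ n

0≤^ : ∀ {q} → 0ℚ ≤ q → ∀ n → 0ℚ ≤ q ^ n
0≤^ 0≤q zero    = ℚₚ.nonNegative⁻¹ 1ℚ
0≤^ 0≤q (suc n) = 0≤* 0≤q (0≤^ 0≤q n)

∣^∣≤ : ∀ {z ρ} → ∣ z ∣ ≤ ρ → ∀ n → ∣ z ^ n ∣ ≤ ρ ^ n
∣^∣≤ ∣z∣≤ρ zero = ℚₚ.≤-refl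
∣^∣≤ {z} {ρ} ∣z∣≤ρ (suc n) = subst (_≤ ρ * ρ ^ n) (sym (ℚₚ.∣p*q∣≡∣p∣*∣q∣ z (z ^ n)))
  (*-mono (ℚₚ.0≤∣p∣ z) (0≤^ (ℚₚ.≤-trans (ℚₚ.0≤∣p∣ z) ∣z∣≤ρ) n) ∣z∣≤ρ (∣^∣≤ ∣z∣≤ρ n))

*-^ : ∀ p q n → (p * q) ^ n ≡ p ^ n * q ^ n
*-^ p q zero = refl
*-^ p q (suc n) = trans (cong (p * q *_) (*-^ p q n))
  (solve 4 (λ p q a b → p :* q :* (a :* b) := p :* a :* (q :* b)) refl p q (p ^ n) (q ^ n))

1^ : ∀ n → 1ℚ ^ n ≡ 1ℚ
1^ zero = refl
1^ (suc n) = trans (ℚₚ.*-identityˡ (1ℚ ^ n)) (1^ n)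

fromℕ-^ : ∀ m n → fromℕ (m ℕ.^ n) ≡ fromℕ m ^ n
fromℕ-^ m zero = refl
fromℕ-^ m (suc n) = trans (fromℕ-* m (m ℕ.^ n)) (cong (fromℕ m *_) (fromℕ-^ m n))

powerSum : (ℕ → ℚ) → ℚ → ℕ → ℚ
powerSum a z zero    = 0ℚ
powerSum a z (suc n) = powerSum a z n + a n * z ^ n

Cauchy : (ℕ → ℚ) → Set
Cauchy f = ∀ ε → 0ℚ < ε → ∃[ N ] (∀ m n → N ℕ.≤ m → N ℕ.≤ n → ∣ f m - f n ∣ < ε)

Cauchy≤ : ℚ → (ℕ → ℚ) → Set
Cauchy≤ K f = ∀ ε → 0ℚ < ε → ∃[ N ] (∀ m n → N ℕ.≤ m → N ℕ.≤ n → f m ≤ f n + K * ε)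

cauchy⁺ : ∀ f K → 0ℚ < K → Cauchy≤ K f → Cauchy f
cauchy⁺ f K 0<K h ε 0<ε = N , λ m n N≤m N≤n → ℚₚ.≤-<-trans
  (∣∣-lub (one m n (hN m n N≤m N≤n))
          (subst (_≤ ε * ½) (solve 2 (λ a b → b :- a := :- (a :- b)) refl (f m) (f n)) (one n m (hN n m N≤n N≤m))))
  half<
  where
  ε′ = ε * ½ * inv₀ K
  N,hN = h ε′ (0<* (0<* 0<ε (ℚₚ.positive⁻¹ ½)) (0<inv₀ 0<K))
  N = proj₁ N,hN
  hN = proj₂ N,hN
  Kε′ : K * ε′ ≡ ε * ½
  Kε′ = trans (solve 3 (λ k e v → k :* (e :* v) := e :* (k :* v)) refl K (ε * ½) (inv₀ K))
    (trans (cong (ε * ½ *_) (inv₀-inverse 0<K)) (ℚₚ.*-identityʳ (ε * ½)))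
  one : ∀ m n → f m ≤ f n + K * ε′ → f m - f n ≤ ε * ½
  one m n le = ≤-≡ refl (ℚₚ.+-monoˡ-≤ (- f n) le)
    (trans (solve 2 (λ a b → a :+ b :- a := b) refl (f n) (K * ε′)) Kε′)
  half< : ε * ½ < ε
  half< = subst₂ _<_ (ℚₚ.+-identityʳ (ε * ½)) (solve 1 (λ e → e :* con ½ :+ e :* con ½ := e) refl ε)
    (ℚₚ.+-monoʳ-< (ε * ½) (0<* 0<ε (ℚₚ.positive⁻¹ ½)))

cauchy⁻ : ∀ f → Cauchy f → ∀ ε → 0ℚ < ε → ∃[ N ] (∀ m n → N ℕ.≤ m → N ℕ.≤ n → f m ≤ f n + ε)
cauchy⁻ f cf ε 0<ε with cf ε 0<ε
... | N , h = N , λ m n N≤m N≤n → ≤-≡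
  (solve 2 (λ a b → a := b :+ (a :- b)) refl (f m) (f n))
  (ℚₚ.+-monoʳ-≤ (f n) (ℚₚ.≤-trans (p≤∣p∣ (f m - f n)) (ℚₚ.<⇒≤ (h m n N≤m N≤n)))) refl

bounded : ∀ f → Cauchy f → ∃[ B ] 0ℚ < B × ∃[ N ] (∀ n → N ℕ.≤ n → ∣ f n ∣ ≤ B)
bounded f cf with cf 1ℚ (ℚₚ.positive⁻¹ 1ℚ)
... | N , h = ∣ f N ∣ + 1ℚ , ℚₚ.+-mono-≤-< (ℚₚ.0≤∣p∣ (f N)) (ℚₚ.positive⁻¹ 1ℚ) , N , λ n N≤n →
  ℚₚ.≤-trans (subst (λ t → ∣ t ∣ ≤ ∣ f N ∣ + ∣ f n - f N ∣) (solve 2 (λ a b → b :+ (a :- b) := a) refl (f n) (f N))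
               (ℚₚ.∣p+q∣≤∣p∣+∣q∣ (f N) (f n - f N)))
    (ℚₚ.+-monoʳ-≤ ∣ f N ∣ (ℚₚ.<⇒≤ (h n N N≤n ℕₚ.≤-refl)))

⊔-l : ∀ m n {o} → m ℕ.⊔ n ℕ.≤ o → m ℕ.≤ o
⊔-l m n le = ℕₚ.≤-trans (ℕₚ.m≤m⊔n m n) le

⊔-r : ∀ m n {o} → m ℕ.⊔ n ℕ.≤ o → n ℕ.≤ o
⊔-r m n le = ℕₚ.≤-trans (ℕₚ.m≤n⊔m m n) le

2ℚ : ℚ
2ℚ = 1ℚ + 1ℚ

const-cauchy : ∀ q → Cauchy (λ _ → q)
const-cauchy q ε 0<ε = 0 , λ _ _ _ _ → subst (λ t → ∣ t ∣ < ε) (sym (ℚₚ.+-inverseʳ q)) 0<ε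

+-cauchy : ∀ {f g} → Cauchy f → Cauchy g → Cauchy (λ n → f n + g n)
+-cauchy {f} {g} cf cg = cauchy⁺ (λ n → f n + g n) 2ℚ (ℚₚ.positive⁻¹ 2ℚ) λ ε 0<ε →
  let M , hf = cauchy⁻ f cf ε 0<ε ; N , hg = cauchy⁻ g cg ε 0<ε in
  M ℕ.⊔ N , λ m n ≤m ≤n → ≤-≡ refl
    (ℚₚ.+-mono-≤ (hf m n (⊔-l M N ≤m) (⊔-l M N ≤n))
                 (hg m n (⊔-r M N ≤m) (⊔-r M N ≤n)))
    (solve 3 (λ a b e → (a :+ e) :+ (b :+ e) := (a :+ b) :+ con 2ℚ :* e) refl (f n) (g n) ε)

neg-cauchy : ∀ {f} → Cauchy f → Cauchy (λ n → - f n)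
neg-cauchy {f} cf = cauchy⁺ (λ n → - f n) 1ℚ (ℚₚ.positive⁻¹ 1ℚ) λ ε 0<ε →
  let M , hf = cauchy⁻ f cf ε 0<ε in
  M , λ m n ≤m ≤n → ≤-≡
    (solve 2 (λ a b → :- a := b :+ (:- a :- b)) refl (f m) (f n))
    (ℚₚ.+-monoˡ-≤ (- f m - f n) (hf n m ≤n ≤m))
    (solve 3 (λ a b e → (a :+ e) :+ (:- a :- b) := :- b :+ con 1ℚ :* e) refl (f m) (f n) ε)

⊔-cauchy : ∀ {f g} → Cauchy f → Cauchy g → Cauchy (λ n → f n ⊔ g n)
⊔-cauchy {f} {g} cf cg = cauchy⁺ (λ n → f n ⊔ g n) 1ℚ (ℚₚ.positive⁻¹ 1ℚ) λ ε 0<ε →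
  let M , hf = cauchy⁻ f cf ε 0<ε ; N , hg = cauchy⁻ g cg ε 0<ε in
  M ℕ.⊔ N , λ m n ≤m ≤n → subst (λ e → f m ⊔ g m ≤ f n ⊔ g n + e) (sym (ℚₚ.*-identityˡ ε)) (ℚₚ.⊔-lub
    (ℚₚ.≤-trans (hf m n (⊔-l M N ≤m) (⊔-l M N ≤n)) (ℚₚ.+-monoˡ-≤ ε (ℚₚ.p≤p⊔q (f n) (g n))))
    (ℚₚ.≤-trans (hg m n (⊔-r M N ≤m) (⊔-r M N ≤n)) (ℚₚ.+-monoˡ-≤ ε (ℚₚ.p≤q⊔p (f n) (g n)))))

product-diff : ∀ a b c d → a * b ≡ c * d + (a * (b - d) + d * (a - c))
product-diff = solve 4 (λ a b c d → a :* b := c :* d :+ (a :* (b :- d) :+ d :* (a :- c))) refl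

*-cauchy : ∀ {f g} → Cauchy f → Cauchy g → Cauchy (λ n → f n * g n)
*-cauchy {f} {g} cf cg = bounds (bounded f cf) (bounded g cg)
  where
  Bounded : (ℕ → ℚ) → Set
  Bounded f = ∃[ B ] 0ℚ < B × ∃[ N ] (∀ n → N ℕ.≤ n → ∣ f n ∣ ≤ B)
  bd : ∀ ε → 0ℚ < ε → ∀ p q C → ∣ p ∣ ≤ C → ∣ q ∣ < ε → p * q ≤ C * ε
  bd ε 0<ε p q C hp hq = ℚₚ.≤-trans (p≤∣p∣ (p * q)) (subst (_≤ C * ε) (sym (ℚₚ.∣p*q∣≡∣p∣*∣q∣ p q))
    (*-mono (ℚₚ.0≤∣p∣ p) (ℚₚ.<⇒≤ 0<ε) hp (ℚₚ.<⇒≤ hq)))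
  step : ∀ ε → 0ℚ < ε → ∀ A B x y x′ y′ → ∣ x ∣ ≤ A → ∣ y′ ∣ ≤ B → ∣ x - x′ ∣ < ε → ∣ y - y′ ∣ < ε →
         x * y ≤ x′ * y′ + (A + B) * ε
  step ε 0<ε A B x y x′ y′ hA hB hf hg = ≤-≡ (product-diff x y x′ y′)
    (ℚₚ.+-monoʳ-≤ (x′ * y′) (ℚₚ.+-mono-≤ (bd ε 0<ε x (y - y′) A hA hg) (bd ε 0<ε y′ (x - x′) B hB hf)))
    (cong (λ t → x′ * y′ + t) (sym (ℚₚ.*-distribʳ-+ ε A B)))
  bounds : Bounded f → Bounded g → Cauchy (λ n → f n * g n)
  bounds (A , 0<A , NA , hA) (B , 0<B , NB , hB) = cauchy⁺ (λ n → f n * g n) (A + B) (ℚₚ.+-mono-< 0<A 0<B) λ ε 0<ε →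
    let M , hf = cf ε 0<ε ; N , hg = cg ε 0<ε in
    (NA ℕ.⊔ NB) ℕ.⊔ (M ℕ.⊔ N) , λ m n ≤m ≤n →
    let ≤m₁ = ⊔-l (NA ℕ.⊔ NB) (M ℕ.⊔ N) ≤m ; ≤n₁ = ⊔-l (NA ℕ.⊔ NB) (M ℕ.⊔ N) ≤n
        ≤m₂ = ⊔-r (NA ℕ.⊔ NB) (M ℕ.⊔ N) ≤m ; ≤n₂ = ⊔-r (NA ℕ.⊔ NB) (M ℕ.⊔ N) ≤n in
    step ε 0<ε A B (f m) (g m) (f n) (g n) (hA m (⊔-l NA NB ≤m₁)) (hB n (⊔-r NA NB ≤n₁))
      (hf m n (⊔-l M N ≤m₂) (⊔-l M N ≤n₂)) (hg m n (⊔-r M N ≤m₂) (⊔-r M N ≤n₂))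

EventuallyPositive : (ℕ → ℚ) → Set
EventuallyPositive f = ∃[ δ ] 0ℚ < δ × ∃[ N ] (∀ n → N ℕ.≤ n → δ ≤ f n)

inv-cauchy : ∀ {f} → Cauchy f → EventuallyPositive f → Cauchy (λ n → inv₀ (f n))
inv-cauchy {f} cf (δ , 0<δ , P , hδ) = cauchy⁺ (λ n → inv₀ (f n)) (D * D) (0<* 0<D 0<D) go
  where
  D = inv₀ δ
  0<D = 0<inv₀ 0<δ
  go : Cauchy≤ (D * D) (λ n → inv₀ (f n))
  go ε 0<ε = P ℕ.⊔ M , λ m n ≤m ≤n → step {f m} {f n} (hδ m (⊔-l P M ≤m)) (hδ n (⊔-l P M ≤n)) (hf n m (⊔-r P M ≤n) (⊔-r P M ≤m))
    where
    M,hf = cauchy⁻ f cf ε 0<ε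
    M = proj₁ M,hf
    hf = proj₂ M,hf
    step : ∀ {x y} → δ ≤ x → δ ≤ y → y ≤ x + ε → inv₀ x ≤ inv₀ y + D * D * ε
    step {x} {y} δ≤x δ≤y y≤x+ε = ℚₚ.≤-trans le₁ (ℚₚ.+-monoʳ-≤ v le₂)
      where
      u = inv₀ x
      v = inv₀ y
      0<x = ℚₚ.<-≤-trans 0<δ δ≤x
      0<y = ℚₚ.<-≤-trans 0<δ δ≤y
      0≤u = ℚₚ.<⇒≤ (0<inv₀ 0<x)
      0≤v = ℚₚ.<⇒≤ (0<inv₀ 0<y)
      le₁ : u ≤ v + u * v * ε
      le₁ = ≤-≡
        (trans (sym (ℚₚ.*-identityʳ u)) (trans (cong (u *_) (sym (inv₀-inverse 0<y)))
          (solve 3 (λ u y v → u :* (y :* v) := u :* v :* y) refl u y v)))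
        (ℚₚ.*-monoˡ-≤-nonNeg (u * v) {{nonNegative (0≤* 0≤u 0≤v)}} y≤x+ε)
        (trans (solve 4 (λ u v x e → u :* v :* (x :+ e) := x :* u :* v :+ u :* v :* e) refl u v x ε)
          (cong (λ t → t + u * v * ε) (trans (cong (_* v) (inv₀-inverse 0<x)) (ℚₚ.*-identityˡ v))))
      le₂ : u * v * ε ≤ D * D * ε
      le₂ = ℚₚ.*-monoʳ-≤-nonNeg ε {{nonNegative (ℚₚ.<⇒≤ 0<ε)}}
        (*-mono 0≤u (ℚₚ.<⇒≤ 0<D) (inv₀-anti 0<δ δ≤x) (inv₀-anti 0<δ δ≤y))

^-cauchy : ∀ {f} → Cauchy f → ∀ k → Cauchy (λ n → f n ^ k)
^-cauchy {f} cf zero    = const-cauchy 1ℚ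
^-cauchy {f} cf (suc k) = *-cauchy {f} {λ n → f n ^ k} cf (^-cauchy {f} cf k)

polynomial-cauchy : ∀ a {f} → Cauchy f → ∀ k → Cauchy (λ n → powerSum a (f n) k)
polynomial-cauchy a {f} cf zero    = const-cauchy 0ℚ
polynomial-cauchy a {f} cf (suc k) = +-cauchy {λ n → powerSum a (f n) k} {λ n → a k * f n ^ k}
  (polynomial-cauchy a {f} cf k)
  (*-cauchy {λ _ → a k} {λ n → f n ^ k} (const-cauchy (a k)) (^-cauchy {f} cf k))

geometric : ℚ → ℕ → ℚ
geometric = powerSum (λ _ → 1ℚ)

geometric-eq : ∀ σ n → (1ℚ - σ) * geometric σ n ≡ 1ℚ - σ ^ n
geometric-eq σ zero = ℚₚ.*-zeroʳ (1ℚ - σ)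
geometric-eq σ (suc n) = trans
  (solve 3 (λ s g p → (con 1ℚ :- s) :* (g :+ con 1ℚ :* p) := (con 1ℚ :- s) :* g :+ (p :- s :* p)) refl σ (geometric σ n) (σ ^ n))
  (trans (cong (_+ (σ ^ n - σ * σ ^ n)) (geometric-eq σ n))
    (solve 3 (λ s p q → con 1ℚ :- p :+ (p :- q) := con 1ℚ :- q) refl σ (σ ^ n) (σ * σ ^ n)))

module _ {σ : ℚ} (0≤σ : 0ℚ ≤ σ) (σ<1 : σ < 1ℚ) where

  0<1-σ : 0ℚ < 1ℚ - σ
  0<1-σ = subst (_< 1ℚ - σ) (ℚₚ.+-inverseʳ σ) (ℚₚ.+-monoˡ-< (- σ) σ<1)

  ^-step : ∀ n → σ * σ ^ n ≤ σ ^ n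
  ^-step n = subst (σ * σ ^ n ≤_) (ℚₚ.*-identityˡ (σ ^ n))
    (ℚₚ.*-monoʳ-≤-nonNeg (σ ^ n) {{nonNegative (0≤^ 0≤σ n)}} (ℚₚ.<⇒≤ σ<1))

  n*σ^n≤geometric : ∀ n → fromℕ n * σ ^ n ≤ geometric σ n
  n*σ^n≤geometric zero = ℚₚ.≤-reflexive (ℚₚ.*-zeroˡ 1ℚ)
  n*σ^n≤geometric (suc n) = ≤-≡ (cong (_* σ ^ suc n) (fromℕ-suc n))
    (ℚₚ.≤-trans (ℚₚ.*-monoˡ-≤-nonNeg (1ℚ + fromℕ n) {{nonNegative (ℚₚ.≤-trans (ℚₚ.nonNegative⁻¹ 1ℚ) (≤-≡ (sym (ℚₚ.+-identityʳ 1ℚ)) (ℚₚ.+-monoʳ-≤ 1ℚ (0≤fromℕ n)) refl))}} (^-step n))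
      (ℚₚ.≤-trans (ℚₚ.≤-reflexive (solve 2 (λ n p → (con 1ℚ :+ n) :* p := n :* p :+ con 1ℚ :* p) refl (fromℕ n) (σ ^ n)))
        (ℚₚ.+-monoˡ-≤ (1ℚ * σ ^ n) (n*σ^n≤geometric n))))
    refl

  ^-small : ∀ ε → 0ℚ < ε → ∃[ N ] (∀ n → N ℕ.≤ n → σ ^ n ≤ ε)
  ^-small ε 0<ε = suc N₀ , λ n N<n → small n (ℚₚ.≤-trans hN₀ (fromℕ-mono (ℕₚ.≤-trans (ℕₚ.n≤1+n N₀) N<n))) (ℕₚ.≤-trans (s≤s z≤n) N<n)
    where
    τ = 1ℚ - σ
    N₀,hN₀ = archimedean (inv₀ (τ * ε))
    N₀ = proj₁ N₀,hN₀
    hN₀ = proj₂ N₀,hN₀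
    0<τε : 0ℚ < τ * ε
    0<τε = 0<* 0<1-σ 0<ε
    small : ∀ n → inv₀ (τ * ε) ≤ fromℕ n → 0 ℕ.< n → σ ^ n ≤ ε
    small n le 0<n = ℚₚ.*-cancelˡ-≤-pos (τ * fromℕ n) {{positive (0<* 0<1-σ (ℚₚ.<-≤-trans (0<inv₀ 0<τε) le))}}
      (ℚₚ.≤-trans le₁ le₂)
      where
      le₁ : τ * fromℕ n * σ ^ n ≤ 1ℚ
      le₁ = ℚₚ.≤-trans
        (≤-≡ (ℚₚ.*-assoc τ (fromℕ n) (σ ^ n))
          (ℚₚ.*-monoˡ-≤-nonNeg τ {{nonNegative (ℚₚ.<⇒≤ 0<1-σ)}} (n*σ^n≤geometric n))
          (geometric-eq σ n))
        (ℚₚ.+-monoʳ-≤ 1ℚ (ℚₚ.neg-antimono-≤ (0≤^ 0≤σ n)))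
      le₂ : 1ℚ ≤ τ * fromℕ n * ε
      le₂ = ≤-≡ (sym (inv₀-inverse 0<τε)) (ℚₚ.*-monoˡ-≤-nonNeg (τ * ε) {{nonNegative (ℚₚ.<⇒≤ 0<τε)}} le)
        (solve 3 (λ t e n → t :* e :* n := t :* n :* e) refl τ ε (fromℕ n))

  -- Weierstrass-type criterion: a power series majorised by B σᵏ may be
  -- evaluated along the diagonal of a Cauchy sequence.
  module _ {a : ℕ → ℚ} {ρ B : ℚ} (0<B : 0ℚ < B) (0≤ρ : 0ℚ ≤ ρ) (major : ∀ k → ∣ a k ∣ * ρ ^ k ≤ B * σ ^ k) where

    tail : ∀ {z} → ∣ z ∣ ≤ ρ → ∀ M j →
           ∣ powerSum a z (j ℕ.+ M) - powerSum a z M ∣ ≤ B * (geometric σ (j ℕ.+ M) - geometric σ M)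
    tail {z} hz M zero = ≤-≡ (cong ∣_∣ (ℚₚ.+-inverseʳ (powerSum a z M))) ℚₚ.≤-refl
      (sym (trans (cong (B *_) (ℚₚ.+-inverseʳ (geometric σ M))) (ℚₚ.*-zeroʳ B)))
    tail {z} hz M (suc j) = ≤-≡
      (cong ∣_∣ (solve 3 (λ p t q → p :+ t :- q := (p :- q) :+ t) refl (powerSum a z k) (a k * z ^ k) (powerSum a z M)))
      (ℚₚ.≤-trans (ℚₚ.∣p+q∣≤∣p∣+∣q∣ (powerSum a z k - powerSum a z M) (a k * z ^ k))
        (ℚₚ.+-mono-≤ (tail hz M j) term))
      (solve 4 (λ b g h p → b :* (g :- h) :+ b :* p := b :* (g :+ con 1ℚ :* p :- h)) refl B (geometric σ k) (geometric σ M) (σ ^ k))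
      where
      k = j ℕ.+ M
      term : ∣ a k * z ^ k ∣ ≤ B * σ ^ k
      term = ℚₚ.≤-trans (≤-≡ (ℚₚ.∣p*q∣≡∣p∣*∣q∣ (a k) (z ^ k))
        (ℚₚ.*-monoˡ-≤-nonNeg ∣ a k ∣ {{nonNegative (ℚₚ.0≤∣p∣ (a k))}} (∣^∣≤ hz k)) refl) (major k)

    L : ℚ
    L = B * inv₀ (1ℚ - σ)

    0<L : 0ℚ < L
    0<L = 0<* 0<B (0<inv₀ 0<1-σ)

    geometric-tail : ∀ M j → B * (geometric σ (j ℕ.+ M) - geometric σ M) ≤ L * σ ^ M
    geometric-tail M j = ≤-≡
      (trans (cong (B *_) (trans (sym (ℚₚ.*-identityˡ d)) (cong (_* d) (sym (inv₀-inverse 0<1-σ)))))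
        (trans (solve 5 (λ b t v g h → b :* (t :* v :* (g :- h)) := b :* v :* (t :* g :- t :* h)) refl B (1ℚ - σ) (inv₀ (1ℚ - σ)) (geometric σ (j ℕ.+ M)) (geometric σ M))
          (cong₂ (λ x y → L * (x - y)) (geometric-eq σ (j ℕ.+ M)) (geometric-eq σ M))))
      (ℚₚ.*-monoˡ-≤-nonNeg L {{nonNegative (ℚₚ.<⇒≤ 0<L)}}
        (≤-≡ (solve 2 (λ p q → (con 1ℚ :- p) :- (con 1ℚ :- q) := q :+ :- p) refl (σ ^ (j ℕ.+ M)) (σ ^ M))
          (ℚₚ.+-monoʳ-≤ (σ ^ M) (ℚₚ.neg-antimono-≤ (0≤^ 0≤σ (j ℕ.+ M)))) (ℚₚ.+-identityʳ (σ ^ M))))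
      refl
      where d = geometric σ (j ℕ.+ M) - geometric σ M

    powerSeries-cauchy : ∀ {f} → Cauchy f → ∃[ N ] (∀ n → N ℕ.≤ n → ∣ f n ∣ ≤ ρ) → Cauchy (λ n → powerSum a (f n) n)
    powerSeries-cauchy {f} cf (N₀ , hρ) = cauchy⁺ (λ n → powerSum a (f n) n) (2ℚ * L + 1ℚ) (ℚₚ.+-mono-< (0<* (ℚₚ.positive⁻¹ 2ℚ) 0<L) (ℚₚ.positive⁻¹ 1ℚ)) go
      where
      go : Cauchy≤ (2ℚ * L + 1ℚ) (λ n → powerSum a (f n) n)
      go ε 0<ε = (N₀ ℕ.⊔ M) ℕ.⊔ N , λ m n ≤m ≤n →
        let ≤m₁ = ⊔-l (N₀ ℕ.⊔ M) N ≤m ; ≤n₁ = ⊔-l (N₀ ℕ.⊔ M) N ≤n in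
        ≤-≡ (solve 2 (λ s p → s := p :+ (s :- p)) refl (s m) (p m))
          (ℚₚ.+-mono-≤ (hN m n (⊔-r (N₀ ℕ.⊔ M) N ≤m) (⊔-r (N₀ ℕ.⊔ M) N ≤n))
            (ℚₚ.≤-trans (p≤∣p∣ (s m - p m)) (near m ≤m₁)))
          refl
        ⟫ ≤-≡ (solve 3 (λ p e l → p :+ e :+ l := p :+ (e :+ l)) refl (p n) ε (L * ε))
          (ℚₚ.+-monoˡ-≤ (ε + L * ε) (p≤s n ≤n₁))
          (solve 3 (λ s e l → s :+ l :* e :+ (e :+ l :* e) := s :+ (con 2ℚ :* l :+ con 1ℚ) :* e) refl (s n) ε L)
        where
        M,hM = ^-small ε 0<ε
        M = proj₁ M,hM
        hM = proj₂ M,hM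
        N,hN = cauchy⁻ (λ n → powerSum a (f n) M) (polynomial-cauchy a {f} cf M) ε 0<ε
        N = proj₁ N,hN
        hN = proj₂ N,hN
        infixr 5 _⟫_
        _⟫_ : ∀ {p q r} → p ≤ q → q ≤ r → p ≤ r
        _⟫_ = ℚₚ.≤-trans
        s p : ℕ → ℚ
        s n = powerSum a (f n) n
        p n = powerSum a (f n) M
        near : ∀ n → N₀ ℕ.⊔ M ℕ.≤ n → ∣ s n - p n ∣ ≤ L * ε
        near n ≤n = ℚₚ.≤-trans
          (subst (λ k → ∣ powerSum a (f n) k - p n ∣ ≤ L * σ ^ M) (ℕₚ.m∸n+n≡m (⊔-r N₀ M ≤n))
            (ℚₚ.≤-trans (tail (hρ n (⊔-l N₀ M ≤n)) M (n ℕ.∸ M)) (geometric-tail M (n ℕ.∸ M))))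
          (ℚₚ.*-monoˡ-≤-nonNeg L {{nonNegative (ℚₚ.<⇒≤ 0<L)}} (hM M ℕₚ.≤-refl))
        p≤s : ∀ n → N₀ ℕ.⊔ M ℕ.≤ n → p n ≤ s n + L * ε
        p≤s n ≤n = ≤-≡ (solve 2 (λ s p → p := s :+ :- (s :- p)) refl (s n) (p n))
          (ℚₚ.+-monoʳ-≤ (s n) (ℚₚ.≤-trans (subst (- (s n - p n) ≤_) (ℚₚ.∣-p∣≡∣p∣ (s n - p n)) (p≤∣p∣ (- (s n - p n)))) (near n ≤n)))
          refl

record ℝ : Set where
  constructor _,ᴿ_
  field
    seq    : ℕ → ℚ
    cauchy : Cauchy seq
open ℝ public

infix  4 _<ᴿ_ _≤ᴿ_
infixl 6 _+ᴿ_ _-ᴿ_ _⊔ᴿ_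
infixl 7 _*ᴿ_
infix  8 -ᴿ_

_<ᴿ_ : ℝ → ℝ → Set
x <ᴿ y = ∃[ δ ] 0ℚ < δ × ∃[ N ] (∀ n → N ℕ.≤ n → seq x n + δ ≤ seq y n)

_≤ᴿ_ : ℝ → ℝ → Set
x ≤ᴿ y = ¬ (y <ᴿ x)

fromℚᴿ : ℚ → ℝ
fromℚᴿ q = (λ _ → q) ,ᴿ const-cauchy q

fromℕᴿ : ℕ → ℝ
fromℕᴿ n = fromℚᴿ (fromℕ n)

0ᴿ 1ᴿ : ℝ
0ᴿ = fromℚᴿ 0ℚ
1ᴿ = fromℚᴿ 1ℚ

_+ᴿ_ : ℝ → ℝ → ℝ
(f ,ᴿ cf) +ᴿ (g ,ᴿ cg) = (λ n → f n + g n) ,ᴿ +-cauchy {f} {g} cf cg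

-ᴿ_ : ℝ → ℝ
-ᴿ (f ,ᴿ cf) = (λ n → - f n) ,ᴿ neg-cauchy {f} cf

_-ᴿ_ : ℝ → ℝ → ℝ
x -ᴿ y = x +ᴿ (-ᴿ y)

_*ᴿ_ : ℝ → ℝ → ℝ
(f ,ᴿ cf) *ᴿ (g ,ᴿ cg) = (λ n → f n * g n) ,ᴿ *-cauchy {f} {g} cf cg

_⊔ᴿ_ : ℝ → ℝ → ℝ
(f ,ᴿ cf) ⊔ᴿ (g ,ᴿ cg) = (λ n → f n ⊔ g n) ,ᴿ ⊔-cauchy {f} {g} cf cg

∣_∣ᴿ : ℝ → ℝ
∣ x ∣ᴿ = x ⊔ᴿ (-ᴿ x)

eventuallyPositive : ∀ x → 0ᴿ <ᴿ x → EventuallyPositive (seq x)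
eventuallyPositive x (δ , 0<δ , N , h) = δ , 0<δ , N , λ n N≤n → subst (_≤ seq x n) (ℚₚ.+-identityˡ δ) (h n N≤n)

inverse : (x : ℝ) → 0ᴿ <ᴿ x → ℝ
inverse x 0<x = (λ n → inv₀ (seq x n)) ,ᴿ inv-cauchy {seq x} (cauchy x) (eventuallyPositive x 0<x)

-- exp x = ∑ₖ xᵏ / k!; the n-th rational approximation is the n-th partial sum at the
-- n-th approximation of x (similarly for log).
expCoeff : ℕ → ℚ
expCoeff k = _/_ (+ 1) (k !) {{k ℕₚ.!≢0}}

R^k≤R^R*k! : ∀ R .{{_ : NonZero R}} k → R ℕ.^ k ℕ.≤ R ℕ.^ R ℕ.* k !
R^k≤R^R*k! R zero = ℕₚ.≤-trans (ℕₚ.m^n>0 R R) (ℕₚ.≤-reflexive (sym (ℕₚ.*-identityʳ (R ℕ.^ R))))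
R^k≤R^R*k! R (suc k) with ℕₚ.≤-total (suc k) R
... | inj₁ k<R = ℕₚ.≤-trans (ℕₚ.^-monoʳ-≤ R k<R) (ℕₚ.m≤m*n (R ℕ.^ R) (suc k !) {{suc k ℕₚ.!≢0}})
... | inj₂ R≤k+1 = ℕₚ.≤-trans (ℕₚ.*-mono-≤ R≤k+1 (R^k≤R^R*k! R k)) (ℕₚ.≤-reflexive eq)
  where
  eq : suc k ℕ.* (R ℕ.^ R ℕ.* k !) ≡ R ℕ.^ R ℕ.* (suc k ℕ.* k !)
  eq = trans (sym (ℕₚ.*-assoc (suc k) (R ℕ.^ R) (k !)))
    (trans (cong (ℕ._* k !) (ℕₚ.*-comm (suc k) (R ℕ.^ R))) (ℕₚ.*-assoc (R ℕ.^ R) (suc k) (k !)))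

0≤expCoeff : ∀ k → 0ℚ ≤ expCoeff k
0≤expCoeff k = ℚₚ.nonNegative⁻¹ (expCoeff k) {{ℚₚ.normalize-nonNeg 1 (k !) {{k ℕₚ.!≢0}}}}

exp-major : ∀ M .{{_ : NonZero M}} k →
            ∣ expCoeff k ∣ * fromℕ M ^ k ≤ fromℕ ((2 ℕ.* M) ℕ.^ (2 ℕ.* M)) * ½ ^ k
exp-major M k = ≤-≡ eq₁ (ℚₚ.*-monoˡ-≤-nonNeg (a * h) {{nonNegative (0≤* (0≤expCoeff k) (0≤^ (ℚₚ.nonNegative⁻¹ ½) k))}}
    (fromℕ-mono (R^k≤R^R*k! R {{ℕₚ.m*n≢0 2 M}} k))) eq₂
  where
  R = 2 ℕ.* M
  a = expCoeff k
  h = ½ ^ k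
  eq₀ : fromℕ M ^ k ≡ h * fromℕ (R ℕ.^ k)
  eq₀ = trans (cong (_^ k) (trans (sym (ℚₚ.*-identityˡ (fromℕ M)))
          (trans (ℚₚ.*-assoc ½ (fromℕ 2) (fromℕ M)) (cong (½ *_) (sym (fromℕ-* 2 M))))))
        (trans (*-^ ½ (fromℕ R) k) (cong (h *_) (sym (fromℕ-^ R k))))
  eq₁ : ∣ a ∣ * fromℕ M ^ k ≡ a * h * fromℕ (R ℕ.^ k)
  eq₁ = trans (cong₂ _*_ (ℚₚ.0≤p⇒∣p∣≡p (0≤expCoeff k)) eq₀) (sym (ℚₚ.*-assoc a h (fromℕ (R ℕ.^ k))))
  eq₂ : a * h * fromℕ (R ℕ.^ R ℕ.* k !) ≡ fromℕ (R ℕ.^ R) * h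
  eq₂ = trans (cong (a * h *_) (fromℕ-* (R ℕ.^ R) (k !)))
    (trans (shuffle a h (fromℕ (R ℕ.^ R)) (fromℕ (k !)))
      (trans (cong (fromℕ (R ℕ.^ R) * h *_) (/-fromℕ 1 (k !) {{k ℕₚ.!≢0}})) (ℚₚ.*-identityʳ _)))
    where
    shuffle : ∀ a h r f → a * h * (r * f) ≡ r * h * (a * f)
    shuffle = solve 4 (λ a h r f → a :* h :* (r :* f) := r :* h :* (a :* f)) refl

exp : ℝ → ℝ
exp x = (λ n → powerSum expCoeff (seq x n) n) ,ᴿ
  powerSeries-cauchy {½} (ℚₚ.nonNegative⁻¹ ½) ½<1 {expCoeff} {fromℕ M} {fromℕ R^R}
    (ℚₚ.<-≤-trans (ℚₚ.positive⁻¹ 1ℚ) (fromℕ-mono (ℕₚ.m^n>0 (2 ℕ.* M) (2 ℕ.* M))))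
    (0≤fromℕ M) (exp-major M) {seq x} (cauchy x) (N , λ n N≤n → ℚₚ.≤-trans (h n N≤n) B≤M)
  where
  bdd = bounded (seq x) (cauchy x)
  B = proj₁ bdd
  N = proj₁ (proj₂ (proj₂ bdd))
  h = proj₂ (proj₂ (proj₂ bdd))
  arch = archimedean B
  M = suc (proj₁ arch)
  R^R = (2 ℕ.* M) ℕ.^ (2 ℕ.* M)
  B≤M : B ≤ fromℕ M
  B≤M = ℚₚ.≤-trans (proj₂ arch) (fromℕ-mono (ℕₚ.n≤1+n (proj₁ arch)))
  ½<1 : ½ < 1ℚ
  ½<1 = ℚ.*<* (ℤ.+<+ (s≤s (s≤s z≤n)))

-- log x = 2 artanh z = ∑_{k odd} 2 zᵏ / k with z = (x - 1) / (x + 1).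
logCoeff : ℕ → ℚ
logCoeff zero    = 0ℚ
logCoeff (suc k) = if does (2 ∣? k) then + 2 / suc k else 0ℚ

0≤logCoeff : ∀ k → 0ℚ ≤ logCoeff k
0≤logCoeff zero = ℚₚ.≤-refl
0≤logCoeff (suc k) with does (2 ∣? k)
... | true  = ℚₚ.nonNegative⁻¹ (+ 2 / suc k) {{ℚₚ.normalize-nonNeg 2 (suc k)}}
... | false = ℚₚ.≤-refl

2/k≤2 : ∀ k → + 2 / suc k ≤ fromℕ 2
2/k≤2 k = ≤-≡ (sym (ℚₚ.*-identityʳ (+ 2 / suc k)))
  (ℚₚ.*-monoˡ-≤-nonNeg (+ 2 / suc k) {{ℚₚ.normalize-nonNeg 2 (suc k)}} (fromℕ-mono {1} {suc k} (s≤s z≤n)))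
  (/-fromℕ 2 (suc k))

logCoeff≤2 : ∀ k → logCoeff k ≤ fromℕ 2
logCoeff≤2 zero = 0≤fromℕ 2
logCoeff≤2 (suc k) with does (2 ∣? k)
... | true  = 2/k≤2 k
... | false = 0≤fromℕ 2

log-major : ∀ {ρ} → 0ℚ ≤ ρ → ∀ k → ∣ logCoeff k ∣ * ρ ^ k ≤ fromℕ 2 * ρ ^ k
log-major {ρ} 0≤ρ k = ℚₚ.*-monoʳ-≤-nonNeg (ρ ^ k) {{nonNegative (0≤^ 0≤ρ k)}}
  (subst (_≤ fromℕ 2) (sym (ℚₚ.0≤p⇒∣p∣≡p (0≤logCoeff k))) (logCoeff≤2 k))

0<x+1 : ∀ x → 0ᴿ <ᴿ x → 0ᴿ <ᴿ x +ᴿ 1ᴿ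
0<x+1 x (δ , 0<δ , N , h) = δ , 0<δ , N , λ n N≤n → ℚₚ.≤-trans (h n N≤n)
  (≤-≡ (sym (ℚₚ.+-identityʳ (seq x n))) (ℚₚ.+-monoʳ-≤ (seq x n) (ℚₚ.nonNegative⁻¹ 1ℚ)) refl)

möbius : (x : ℝ) → 0ᴿ <ᴿ x → ℝ
möbius x 0<x = (x -ᴿ 1ᴿ) *ᴿ inverse (x +ᴿ 1ᴿ) (0<x+1 x 0<x)

module _ {x δ B : ℚ} (0<δ : 0ℚ < δ) (δ≤x : δ ≤ x) (x≤B : x ≤ B) where
  private
    v = inv₀ (x + 1ℚ)
    w = inv₀ (B + 1ℚ)
    z = (x - 1ℚ) * v
    0<x : 0ℚ < x
    0<x = ℚₚ.<-≤-trans 0<δ δ≤x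
    0<x1 : 0ℚ < x + 1ℚ
    0<x1 = ℚₚ.+-mono-< 0<x (ℚₚ.positive⁻¹ 1ℚ)
    0<B1 : 0ℚ < B + 1ℚ
    0<B1 = ℚₚ.<-≤-trans 0<x1 (ℚₚ.+-monoˡ-≤ 1ℚ x≤B)
    0≤w = ℚₚ.<⇒≤ (0<inv₀ 0<B1)
    0≤v = ℚₚ.<⇒≤ (0<inv₀ 0<x1)
    w≤v : w ≤ v
    w≤v = inv₀-anti 0<x1 (ℚₚ.+-monoˡ-≤ 1ℚ x≤B)
    η = (δ ⊓ 1ℚ) * w
    0≤μ : 0ℚ ≤ δ ⊓ 1ℚ
    0≤μ = ℚₚ.⊓-glb (ℚₚ.<⇒≤ 0<δ) (ℚₚ.nonNegative⁻¹ 1ℚ)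
    double : ∀ {p} → 0ℚ ≤ p → p ≤ p + p
    double {p} 0≤p = ≤-≡ (sym (ℚₚ.+-identityʳ p)) (ℚₚ.+-monoʳ-≤ p 0≤p) refl
    id₁ : ∀ x v → (x + 1ℚ) * v - (x - 1ℚ) * v ≡ v + v
    id₁ = solve 2 (λ x v → (x :+ con 1ℚ) :* v :- (x :- con 1ℚ) :* v := v :+ v) refl
    id₂ : ∀ x v → (x + 1ℚ) * v - - ((x - 1ℚ) * v) ≡ x * v + x * v
    id₂ = solve 2 (λ x v → (x :+ con 1ℚ) :* v :- :- ((x :- con 1ℚ) :* v) := x :* v :+ x :* v) refl
    move : ∀ {t e} → e ≤ 1ℚ - t → t ≤ 1ℚ - e
    move {t} {e} le = ≤-≡ (solve 2 (λ t e → t := e :+ (t :- e)) refl t e) (ℚₚ.+-monoˡ-≤ (t - e) le)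
      (solve 2 (λ t e → con 1ℚ :- t :+ (t :- e) := con 1ℚ :- e) refl t e)

  möbius-bound : ∣ z ∣ ≤ 1ℚ - η
  möbius-bound = ∣∣-lub {z}
    (move {z} (ℚₚ.≤-trans (*-mono {δ ⊓ 1ℚ} {1ℚ} {w} {v} 0≤μ 0≤v (ℚₚ.p⊓q≤q δ 1ℚ) w≤v)
      (≤-≡ (ℚₚ.*-identityˡ v) (double 0≤v) (trans (sym (id₁ x v)) (cong (_- z) (inv₀-inverse 0<x1))))))
    (move { - z} (ℚₚ.≤-trans (*-mono {δ ⊓ 1ℚ} {x} {w} {v} 0≤μ 0≤v (ℚₚ.≤-trans (ℚₚ.p⊓q≤p δ 1ℚ) δ≤x) w≤v)
      (≤-≡ refl (double {x * v} (0≤* (ℚₚ.<⇒≤ 0<x) 0≤v)) (trans (sym (id₂ x v)) (cong (_- - z) (inv₀-inverse 0<x1))))))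

log : (x : ℝ) → 0ᴿ <ᴿ x → ℝ
log x 0<x = (λ n → powerSum logCoeff (seq (möbius x 0<x) n) n) ,ᴿ
  powerSeries-cauchy {ρ} 0≤ρ ρ<1 {logCoeff} {ρ} {fromℕ 2} (ℚₚ.<-≤-trans (ℚₚ.positive⁻¹ 1ℚ) (fromℕ-mono {1} {2} (s≤s z≤n)))
    0≤ρ (log-major 0≤ρ) {seq (möbius x 0<x)} (cauchy (möbius x 0<x)) (N₁ ℕ.⊔ N₂ , bound)
  where
  ep = eventuallyPositive x 0<x
  δ = proj₁ ep
  0<δ = proj₁ (proj₂ ep)
  N₁ = proj₁ (proj₂ (proj₂ ep))
  h₁ = proj₂ (proj₂ (proj₂ ep))
  bdd = bounded (seq x) (cauchy x)
  B = proj₁ bdd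
  N₂ = proj₁ (proj₂ (proj₂ bdd))
  h₂ = proj₂ (proj₂ (proj₂ bdd))
  η = (δ ⊓ 1ℚ) * inv₀ (B + 1ℚ)
  ρ = 1ℚ - η
  bound : ∀ n → N₁ ℕ.⊔ N₂ ℕ.≤ n → ∣ seq (möbius x 0<x) n ∣ ≤ ρ
  bound n ≤n = möbius-bound {seq x n} {δ} {B} 0<δ (h₁ n (⊔-l N₁ N₂ ≤n)) (ℚₚ.≤-trans (p≤∣p∣ (seq x n)) (h₂ n (⊔-r N₁ N₂ ≤n)))
  0≤ρ : 0ℚ ≤ ρ
  0≤ρ = ℚₚ.≤-trans (ℚₚ.0≤∣p∣ _) (bound (N₁ ℕ.⊔ N₂) ℕₚ.≤-refl)
  0<μ : 0ℚ < δ ⊓ 1ℚ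
  0<μ = ⊓-pos (ℚₚ.⊓-sel δ 1ℚ)
    where
    ⊓-pos : (δ ⊓ 1ℚ ≡ δ) ⊎ (δ ⊓ 1ℚ ≡ 1ℚ) → 0ℚ < δ ⊓ 1ℚ
    ⊓-pos (inj₁ eq) = subst (0ℚ <_) (sym eq) 0<δ
    ⊓-pos (inj₂ eq) = subst (0ℚ <_) (sym eq) (ℚₚ.positive⁻¹ 1ℚ)
  ρ<1 : ρ < 1ℚ
  ρ<1 = subst (ρ <_) (ℚₚ.+-identityʳ 1ℚ) (ℚₚ.+-monoʳ-< 1ℚ (ℚₚ.neg-antimono-<
    (0<* 0<μ (0<inv₀ (ℚₚ.+-mono-< (proj₁ (proj₂ bdd)) (ℚₚ.positive⁻¹ 1ℚ))))))

-- pow x _ s = xˢ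
pow : (x : ℝ) → 0ᴿ <ᴿ x → ℝ → ℝ
pow x 0<x s = exp (s *ᴿ log x 0<x)

0<fromℕ : ∀ n .{{_ : NonZero n}} → 0ᴿ <ᴿ fromℕᴿ n
0<fromℕ (suc n) = 1ℚ , ℚₚ.positive⁻¹ 1ℚ , 0 , λ _ _ → fromℕ-mono {1} {suc n} (s≤s z≤n)

logℕ : (n : ℕ) .{{_ : NonZero n}} → ℝ
logℕ n = log (fromℕᴿ n) (0<fromℕ n)

powℕ : (n : ℕ) .{{_ : NonZero n}} → ℝ → ℝ
powℕ n = pow (fromℕᴿ n) (0<fromℕ n)

0<logℕ : ∀ n .{{_ : ℕ.NonTrivial n}} → 0ᴿ <ᴿ logℕ n {{ℕ.nonTrivial⇒nonZero n}}
0<logℕ n@(suc (suc m)) = fromℕ 2 * z , 0<* (ℚₚ.positive⁻¹ (fromℕ 2)) 0<z , 2 , λ { (suc zero) (s≤s ()) ; (suc (suc k)) _ → ≤-≡ (ℚₚ.+-identityˡ (fromℕ 2 * z)) (ge k) refl }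
  where
  q = fromℕ n
  z = (q - 1ℚ) * inv₀ (q + 1ℚ)
  1<q : 1ℚ < q
  1<q = ℚₚ.<-≤-trans (ℚ.*<* (ℤ.+<+ (s≤s (s≤s z≤n)))) (fromℕ-mono {2} {n} (s≤s (s≤s z≤n)))
  0<z : 0ℚ < z
  0<z = 0<* (subst (_< q - 1ℚ) (ℚₚ.+-inverseʳ 1ℚ) (ℚₚ.+-monoˡ-< (- 1ℚ) 1<q))
            (0<inv₀ (ℚₚ.+-mono-< (ℚₚ.<-trans (ℚₚ.positive⁻¹ 1ℚ) 1<q) (ℚₚ.positive⁻¹ 1ℚ)))
  ge : ∀ k → fromℕ 2 * z ≤ powerSum logCoeff z (suc (suc k))
  ge zero = ℚₚ.≤-reflexive (solve 1 (λ z → con (fromℕ 2) :* z := con 0ℚ :+ con 0ℚ :* con 1ℚ :+ con (fromℕ 2) :* (z :* con 1ℚ)) refl z)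
  ge (suc k) = ≤-≡ (sym (ℚₚ.+-identityʳ (fromℕ 2 * z))) (ℚₚ.+-mono-≤ (ge k) (0≤* (0≤logCoeff (suc (suc k))) (0≤^ (ℚₚ.<⇒≤ 0<z) (suc (suc k))))) refl

∑₁ : {A : Set} → A → (A → A → A) → (N : ℕ) → ((n : ℕ) .{{_ : NonZero n}} → A) → A
∑₁ 0# _+#_ zero    f = 0#
∑₁ 0# _+#_ (suc N) f = ∑₁ 0# _+#_ N f +# f (suc N)

-- ∑ᴿ N f = f 1 + ⋯ + f N, and likewise below
∑ᴿ : (N : ℕ) → ((n : ℕ) .{{_ : NonZero n}} → ℝ) → ℝ
∑ᴿ = ∑₁ 0ᴿ _+ᴿ_

∑ℤ : (N : ℕ) → ((n : ℕ) .{{_ : NonZero n}} → ℤ) → ℤ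
∑ℤ = ∑₁ ℤ.0ℤ ℤ._+_

∑ℕ : (N : ℕ) → ((n : ℕ) .{{_ : NonZero n}} → ℕ) → ℕ
∑ℕ = ∑₁ 0 ℕ._+_

Ω : (n : ℕ) .{{_ : NonZero n}} → ℕ
Ω n = length (factors (factorise n))

-- The bound n of the minimum is harmless for n ≥ 2, since all prime factors
-- are at most n; for n = 1 it gives the value 1.
P⁻ : (n : ℕ) .{{_ : NonZero n}} → ℕ
P⁻ n = min n (factors (factorise n))

liouville : (n : ℕ) .{{_ : NonZero n}} → ℤ
liouville n = ℤ.-1ℤ ℤ.^ Ω n

φ : ℕ → ℕ
φ q = length (filter (λ a → coprime? a q) (applyUpTo suc q))

φ≢0 : ∀ q .{{_ : NonZero q}} → NonZero (φ q)
φ≢0 q@(suc q-1) = subst (λ xs → NonZero (length xs))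
  (sym (filter-accept (λ a → coprime? a q) {1} {applyUpTo (λ i → suc (suc i)) q-1} (1-coprimeTo q))) _

infix 4 _≡_[mod_] _≡?_[mod_]

_≡_[mod_] : ℕ → ℕ → ℕ → Set
m ≡ n [mod q ] = q ∣ ℕ.∣ m - n ∣

_≡?_[mod_] : ∀ m n q → Dec (m ≡ n [mod q ])
m ≡? n [mod q ] = q ∣? ℕ.∣ m - n ∣

nextPrime : ∀ n → ∃[ p ] n ℕ.< p × Prime p × (∀ r → n ℕ.< r → Prime r → p ℕ.≤ r)
nextPrime n = search (proj₁ euclid) n ℕₚ.≤-refl (proj₂ euclid) λ r n<r _ → n<r
  where
  primeDivisor : ∀ m → 2 ℕ.≤ m → ∃[ p ] Prime p × p ∣ m
  primeDivisor m@(suc _) 2≤m = pick (factorise m)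
    where
    pick : PrimeFactorisation m → ∃[ p ] Prime p × p ∣ m
    pick record { factors = []     ; isFactorisation = eq } = contradiction eq (ℕₚ.>⇒≢ 2≤m)
    pick record { factors = p ∷ ps ; isFactorisation = eq ; factorsPrime = pp ∷ _ } =
      p , pp , subst (p ∣_) (sym eq) (m∣m*n (product ps))

  p∣n! : ∀ {p} → NonZero p → p ℕ.≤ n → p ∣ n !
  p∣n! {suc p} _ p≤n = ∣-trans (m∣m*n (p !)) (m≤n⇒m!∣n! p≤n)

  euclid : ∃[ k ] Prime (k ℕ.+ suc n)
  euclid = case (primeDivisor (suc (n !)) (s≤s (ℕₚ.1≤n! n)))
    where
    case : (∃[ p ] Prime p × p ∣ suc (n !)) → ∃[ k ] Prime (k ℕ.+ suc n)
    case (p , pp , p∣n!+1) = p ℕ.∸ suc n , subst Prime (sym (ℕₚ.m∸n+n≡m n<p)) pp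
      where
      n<p : n ℕ.< p
      n<p = ℕₚ.≰⇒> λ p≤n → ¬prime[1] (subst Prime
        (∣1⇒≡1 (∣m+n∣m⇒∣n (subst (p ∣_) (sym (ℕₚ.+-comm (n !) 1)) p∣n!+1) (p∣n! (prime⇒nonZero pp) p≤n))) pp)

  search : ∀ k m → n ℕ.≤ m → Prime (k ℕ.+ suc m) → (∀ r → n ℕ.< r → Prime r → m ℕ.< r) →
           ∃[ p ] n ℕ.< p × Prime p × (∀ r → n ℕ.< r → Prime r → p ℕ.≤ r)
  search zero    m n≤m pr below = suc m , s≤s n≤m , pr , below
  search (suc k) m n≤m pr below with prime? (suc m)
  ... | yes p = suc m , s≤s n≤m , p , below
  ... | no ¬p = search k (suc m) (ℕₚ.m≤n⇒m≤1+n n≤m) (subst Prime (sym (ℕₚ.+-suc k (suc m))) pr)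
    λ r n<r pr′ → ℕₚ.≤∧≢⇒< (below r n<r pr′) λ eq → ¬p (subst Prime (sym eq) pr′)

-- Indexed from 0: nthPrime n is p_{n+1}.
nthPrime : ℕ → ℕ
nthPrime zero    = 2
nthPrime (suc n) = proj₁ (nextPrime (nthPrime n))

primeGap : ℕ → ℕ
primeGap n = nthPrime (suc n) ℕ.∸ nthPrime n

IsTailInf : (ℕ → ℕ) → ℕ → ℕ → Set
IsTailInf f m i = (∀ n → m ℕ.≤ n → i ℕ.≤ f n) × (∀ j → (∀ n → m ℕ.≤ n → j ℕ.≤ f n) → j ℕ.≤ i)

-- liminf f = sup_m inf_{n ≥ m} f n.  No L satisfies this when the lower limit is ∞.
IsLiminf : (ℕ → ℕ) → ℕ → Set
IsLiminf f L = (∀ m i → IsTailInf f m i → i ℕ.≤ L) × (∀ U → (∀ m i → IsTailInf f m i → i ℕ.≤ U) → L ℕ.≤ U)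

IsFloor : ℝ → ℕ → Set
IsFloor x Q = fromℕᴿ Q ≤ᴿ x × x <ᴿ fromℕᴿ (suc Q)

-- Used only for nonnegative entries, so the base value 0 is harmless (as in
-- liouvilleError).
maxᴿ : List ℝ → ℝ
maxᴿ = foldr _⊔ᴿ_ 0ᴿ

-- S N Q stands for a sum over 1 ≤ q ≤ Q, so that Q = ⌊N^{ϑ-ε}⌋ gives the sum over
-- q ≤ N^{ϑ-ε}.  The bound is ≪_{ε,A} N / (log N)^A, for N ≥ 2 so that log N > 0.
LevelOfDistribution : ((N Q : ℕ) → ℝ) → ℝ → Set
LevelOfDistribution S ϑ = ∀ ε A → 0ᴿ <ᴿ ε → 0ᴿ <ᴿ A → ∃[ C ] (∀ N → .{{nt : ℕ.NonTrivial N}} → ∀ Q →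
  let instance N≢0 = ℕ.nonTrivial⇒nonZero N in
  IsFloor (powℕ N (ϑ -ᴿ ε)) Q →
  S N Q ≤ᴿ C *ᴿ (fromℕᴿ N *ᴿ pow (logℕ N) (0<logℕ N) (-ᴿ A)))

θ : (N q a : ℕ) → ℝ
θ N q a = ∑ᴿ N λ p → if does (prime? p ×-dec p ≡? a [mod q ]) then logℕ p else 0ᴿ

primeError : (N q : ℕ) .{{_ : NonZero q}} → ℝ
primeError N q = maxᴿ (map (λ a → ∣ θ N q a -ᴿ fromℚᴿ (_/_ (+ N) (φ q) {{φ≢0 q}}) ∣ᴿ)
                           (filter (λ a → coprime? a q) (upTo q)))

ConditionA : ℝ → Set
ConditionA = LevelOfDistribution λ N Q → ∑ᴿ Q λ q → primeError N q

liouvilleSum : (y q a : ℕ) → ℤ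
liouvilleSum y q a = ∑ℤ y λ n → if does (n ≡? a [mod q ]) then liouville n else ℤ.0ℤ

liouvilleError : (N q : ℕ) → ℕ
liouvilleError N q = max 0 (map (λ y → max 0 (map (λ a → ℤ.∣ liouvilleSum y q a ∣) (upTo q))) (upTo (suc N)))

ConditionB : ℝ → Set
ConditionB = LevelOfDistribution λ N Q → fromℕᴿ (∑ℕ Q λ q → liouvilleError N q)

triples : List (ℚ × ℕ × ℕ)
triples = (+ 924 / 1000 , 4 , 6)
        ∷ (+ 739 / 1000 , 6 , 8)
        ∷ (+ 643 / 1000 , 6 , 12)
        ∷ (+ 584 / 1000 , 10 , 16)
        ∷ (+ 544 / 1000 , 12 , 20)
        ∷ (+ 516 / 1000 , 14 , 26)
        ∷ []

-- p + d is required to be a positive integer n, which excludes only finitely many p.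
AlmostPrimeShift : (c : ℝ) (b : ℕ) (d : ℤ) (p : ℕ) → Prime p → Set
AlmostPrimeShift c b d p pr = ∃[ n ] Σ[ n≢0 ∈ NonZero n ] let instance _ = n≢0 ; _ = prime⇒nonZero pr in
  + n ≡ + p ℤ.+ d × powℕ p c <ᴿ fromℕᴿ (P⁻ n) × Ω n ≡ b

AlternativeI : (C c : ℝ) (D₆ : ℕ) → Set
AlternativeI C c D₆ = ∃[ b ] ∃[ d ]
  ¬ 2 ∣ b × fromℕᴿ b ≤ᴿ C × + 2 ℤ.∣ d × 0 ℕ.< ℤ.∣ d ∣ × ℤ.∣ d ∣ ℕ.≤ D₆ ×
  (∀ m → ∃[ p ] m ℕ.< p × Σ[ pr ∈ Prime p ] AlmostPrimeShift c b d p pr)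

AlternativeII : (D₅ : ℕ) → Set
AlternativeII D₅ = ∃[ L ] IsLiminf primeGap L × L ℕ.≤ D₅

{-# OPTIONS --safe #-}
module Submission where

-- Fix an admissible k-tuple hs with a marked element j₀, and weight the n ∈ (N, 2N] in a
-- suitable class modulo W = D! by the square A(n) of a k-dimensional Selberg sieve sum of
-- level R = N^{ϑ₀/2} with weight function 1 + a (1 - u), u = log d / log R.  Condition (A)
-- evaluates the sum of A(n) over the n with n + h prime, for each h ≠ j₀, and condition (B)
-- shows that λ(n + j₀) is uncorrelated with A(n).  The n for which some n + h has a prime
-- factor at most y₀ = N^c contribute little, since on multiples of p the sieve sum becomes
-- one of the differences of a Lipschitz weight.  For the chosen a, the weighted number of
-- h ≠ j₀ with n + h prime exceeds on average (1 + λ(n + j₀))/2.  So for some n, all of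
-- whose n + h are free of prime factors up to y₀, either two of the n + h are prime, or one
-- is prime and n + j₀ has an odd number of prime factors.
--
-- Logarithms are replaced by harmonic numbers H, and the real numbers in (A) and (B) by
-- their rational approximations at a large index ι, so that the sieve is purely rational.

open import Axiom.ExcludedMiddle using (ExcludedMiddle)
open import Data.Bool.Base using (true; false; if_then_else_; _∧_)
open import Data.Empty using (⊥-elim)
open import Data.Integer.Base as ℤ using (ℤ)
import Data.Integer.Properties as ℤₚ
import Data.Integer.Divisibility as ℤ
import Data.Integer.Solver as ℤS
open import Data.List.Base using (List; []; _∷_; _++_; map; filter; length; upTo; applyUpTo)
open import Data.List.Extrema.Nat using (min; max; xs≤max; v<min⁺)
open import Data.List.Properties using (filter-accept; filter-reject)
open import Data.List.Membership.Propositional using (_∈_; lose)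
open import Data.List.Membership.Propositional.Properties using (∈-map⁺; ∈-filter⁺; ∈-upTo⁺; ∈-upTo⁻)
open import Data.List.Relation.Unary.All using (All; []; _∷_)
import Data.List.Relation.Unary.All as All
open import Data.List.Relation.Unary.AllPairs using (AllPairs; []; _∷_)
import Data.List.Relation.Unary.AllPairs as AllPairs
open import Data.List.Relation.Unary.Any using (Any; here; there; any?)
open import Data.Nat.Base as ℕ using (ℕ; zero; suc; NonZero; _!; z≤n; s≤s)
import Data.Nat.Properties as ℕₚ
import Data.Nat.DivMod as ℕ
import Data.Nat.Divisibility as ℕ
import Data.Nat.Solver as ℕS
open import Data.Nat.GCD using (module Bézout)
open import Data.Nat.Coprimality as Coprimality using (Coprime; coprime?)
open import Data.Nat.Divisibility using (_∣_; _∣?_; divides)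
open import Data.Nat.ListAction using (product)
open import Data.Nat.Primality using (Prime; prime?; prime⇒nonZero; prime⇒nonTrivial; prime⇒irreducible; ¬prime[1]; euclidsLemma)
open import Data.Nat.Primality.Factorisation using (PrimeFactorisation; factorise; factors)
open import Data.Product.Base using (Σ-syntax; ∃-syntax; _×_; _,_; proj₁; proj₂)
open import Data.Rational.Base using (ℚ; 0ℚ; 1ℚ; ½; _/_; _+_; _*_; _-_; -_; _≤_; _<_; ∣_∣; _⊔_; _⊓_; positive; nonNegative)
import Data.Rational.Base as ℚ
import Data.Rational.Properties as ℚₚ
import Data.Rational.Unnormalised.Base as ℚᵘ
import Data.Rational.Unnormalised.Properties as ℚᵘₚ
open import Data.Rational.Solver using (module +-*-Solver)
open import Data.Sum.Base using (_⊎_; inj₁; inj₂; [_,_]′)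
open import Function.Base using (_∘_; id; case_of_)
open import Level using (0ℓ)
open import Relation.Binary.PropositionalEquality
open import Relation.Nullary using (Dec; yes; no; does; ¬_; contradiction; _×-dec_; ¬?)
open import Relation.Nullary.Decidable using (dec-true; dec-false; from-yes; toSum)
open import Defs hiding (L; 0<L; tail; geometric-tail)
import Defs as D
open +-*-Solver using (solve; _:=_; _:+_; _:*_; :-_; _:-_; con)
open ℤS.+-*-Solver using () renaming (solve to solveℤ; _:=_ to _:=ᶻ_; _:+_ to _:+ᶻ_; _:-_ to _:-ᶻ_)
open ℕS.+-*-Solver using () renaming (solve to solveℕ; _:=_ to _:=ᴺ_; _:+_ to _:+ᴺ_; _:*_ to _:*ᴺ_; con to conᴺ)

-- In common units the weighted number of `h ≠ j₀` with `n + h` prime is about (k - 1) (ϑ₀/2) β,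
-- where ϑ₀/2 = log R / log N, and the weighted mean of (1 + λ)/2 is about α/2. So the whole proof
-- rests on (k - 1) ϑ₀ β > α, where, over 0 ≤ u ≤ 1, α = ∫ u^(k-1)/(k-1)! (1 + a (1-u))² du and β =
-- ∫ u^(k-2)/(k-2)! g(u)² du with g(u) = (1-u) + a (1-u)²/2. Asymptotic formulas would need an error
-- term at every stage. Instead the main terms are bounded above and below by two families of
-- functions, `full` and `cut`, each stable under summation, in which all lower order terms are
-- absorbed into a shift of one parameter. `W` stays constant, so each main term is only known up to
-- a factor 1 ± η; a fixed small η suffices because the six inequalities are strict. Divisor sums
-- are never indexed by divisors. They are products of operators over a list of primes, so that
-- Selberg's diagonalisation is an identity at a single prime and every estimate is an induction on
-- the list.

-- Rational inequalities, reciprocals and indicators.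

0≤1 : 0ℚ ≤ 1ℚ
0≤1 = ℚₚ.nonNegative⁻¹ 1ℚ

0<1 : 0ℚ < 1ℚ
0<1 = ℚₚ.positive⁻¹ 1ℚ

<⇒≱ : ∀ {p q} → p < q → ¬ q ≤ p
<⇒≱ p<q q≤p = ℚₚ.<-irrefl refl (ℚₚ.<-≤-trans p<q q≤p)

by-difference : ∀ {p q d} → 0ℚ ≤ d → d ≡ q - p → p ≤ q
by-difference {p} {q} 0≤d refl = ≤-≡ (sym (ℚₚ.+-identityˡ p)) (ℚₚ.+-monoˡ-≤ p 0≤d)
  (solve 2 (λ p q → q :- p :+ p := q) refl p q)

difference : ∀ {p q} → p ≤ q → 0ℚ ≤ q - p
difference {p} {q} p≤q = subst (_≤ q - p) (ℚₚ.+-inverseʳ p) (ℚₚ.+-monoˡ-≤ (- p) p≤q)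

difference< : ∀ {p q} → p < q → 0ℚ < q - p
difference< {p} {q} p<q = subst (_< q - p) (ℚₚ.+-inverseʳ p) (ℚₚ.+-monoˡ-< (- p) p<q)

0≤+ : ∀ {p q} → 0ℚ ≤ p → 0ℚ ≤ q → 0ℚ ≤ p + q
0≤+ = ℚₚ.+-mono-≤

*-monoˡ : ∀ {p q r} → 0ℚ ≤ r → p ≤ q → r * p ≤ r * q
*-monoˡ {r = r} 0≤r = ℚₚ.*-monoˡ-≤-nonNeg r {{nonNegative 0≤r}}

*-monoʳ : ∀ {p q r} → 0ℚ ≤ r → p ≤ q → p * r ≤ q * r
*-monoʳ {r = r} 0≤r = ℚₚ.*-monoʳ-≤-nonNeg r {{nonNegative 0≤r}}

*-cancelˡ : ∀ {p q r} → 0ℚ < r → r * p ≤ r * q → p ≤ q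
*-cancelˡ {r = r} 0<r = ℚₚ.*-cancelˡ-≤-pos r {{positive 0<r}}

p≤p+q : ∀ {p q} → 0ℚ ≤ q → p ≤ p + q
p≤p+q {p} 0≤q = ≤-≡ (sym (ℚₚ.+-identityʳ p)) (ℚₚ.+-monoʳ-≤ p 0≤q) refl

p≤q+p : ∀ {p q} → 0ℚ ≤ q → p ≤ q + p
p≤q+p {p} 0≤q = ≤-≡ (sym (ℚₚ.+-identityˡ p)) (ℚₚ.+-monoˡ-≤ p 0≤q) refl

0≤p² : ∀ p → 0ℚ ≤ p * p
0≤p² p with ℚₚ.≤-total 0ℚ p
... | inj₁ 0≤p = 0≤* 0≤p 0≤p
... | inj₂ p≤0 = subst (0ℚ ≤_) (solve 1 (λ p → :- p :* :- p := p :* p) refl p) (0≤* 0≤-p 0≤-p)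
  where 0≤-p = ℚₚ.neg-antimono-≤ p≤0

^-mono : ∀ {p q} → 0ℚ ≤ p → p ≤ q → ∀ n → p ^ n ≤ q ^ n
^-mono 0≤p p≤q zero    = ℚₚ.≤-refl
^-mono 0≤p p≤q (suc n) = *-mono 0≤p (0≤^ (ℚₚ.≤-trans 0≤p p≤q) n) p≤q (^-mono 0≤p p≤q n)

1≤^ : ∀ {p} → 1ℚ ≤ p → ∀ n → 1ℚ ≤ p ^ n
1≤^ 1≤p n = ≤-≡ (sym (1^ n)) (^-mono 0≤1 1≤p n) refl

0<^ : ∀ {p} → 0ℚ < p → ∀ n → 0ℚ < p ^ n
0<^ 0<p zero    = 0<1
0<^ 0<p (suc n) = 0<* 0<p (0<^ 0<p n)

^-+ : ∀ p m n → p ^ (m ℕ.+ n) ≡ p ^ m * p ^ n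
^-+ p zero n = sym (ℚₚ.*-identityˡ _)
^-+ p (suc m) n = trans (cong (p *_) (^-+ p m n)) (sym (ℚₚ.*-assoc p _ _))

fromℕ-+ : ∀ m n → fromℕ (m ℕ.+ n) ≡ fromℕ m + fromℕ n
fromℕ-+ zero n = sym (ℚₚ.+-identityˡ _)
fromℕ-+ (suc m) n = trans (fromℕ-suc (m ℕ.+ n)) (trans (cong (1ℚ +_) (fromℕ-+ m n))
  (trans (sym (ℚₚ.+-assoc 1ℚ (fromℕ m) (fromℕ n))) (cong (_+ fromℕ n) (sym (fromℕ-suc m)))))

0<fromℕ⁺ : ∀ {n} → 1 ℕ.≤ n → 0ℚ < fromℕ n
0<fromℕ⁺ 1≤n = ℚₚ.<-≤-trans 0<1 (fromℕ-mono 1≤n)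

fromℕ-cancel-≤ : ∀ {m n} → fromℕ m ≤ fromℕ n → m ℕ.≤ n
fromℕ-cancel-≤ {m} {n} le with m ℕₚ.≤? n
... | yes m≤n = m≤n
... | no m≰n = contradiction le (<⇒≱ (ℚₚ.<-≤-trans
  (subst (fromℕ n <_) (sym (fromℕ-suc n)) (subst (_< 1ℚ + fromℕ n) (ℚₚ.+-identityˡ _) (ℚₚ.+-monoˡ-< (fromℕ n) 0<1)))
  (fromℕ-mono (ℕₚ.≰⇒> m≰n))))

-- Reciprocals with 1/0 = 0.
rec : ℕ → ℚ
rec n = inv₀ (fromℕ n)

n*rec : ∀ {n} → 1 ℕ.≤ n → fromℕ n * rec n ≡ 1ℚ
n*rec 1≤n = inv₀-inverse (0<fromℕ⁺ 1≤n)

0<rec : ∀ {n} → 1 ℕ.≤ n → 0ℚ < rec n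
0<rec 1≤n = 0<inv₀ (0<fromℕ⁺ 1≤n)

0≤rec : ∀ n → 0ℚ ≤ rec n
0≤rec zero    = ℚₚ.≤-refl
0≤rec (suc n) = ℚₚ.<⇒≤ (0<rec {suc n} (s≤s z≤n))

rec-anti : ∀ {m n} → 1 ℕ.≤ m → m ℕ.≤ n → rec n ≤ rec m
rec-anti 1≤m m≤n = inv₀-anti (0<fromℕ⁺ 1≤m) (fromℕ-mono m≤n)

rec≤1 : ∀ n → rec n ≤ 1ℚ
rec≤1 zero    = 0≤1
rec≤1 (suc n) = rec-anti {1} {suc n} (s≤s z≤n) (s≤s z≤n)

inv₀-unique : ∀ {p q} → 0ℚ < p → p * q ≡ 1ℚ → q ≡ inv₀ p
inv₀-unique {p} {q} 0<p eq = trans (sym (ℚₚ.*-identityˡ q)) (trans (cong (_* q) (sym (inv₀-inverse 0<p)))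
  (trans (solve 3 (λ p i q → p :* i :* q := p :* q :* i) refl p (inv₀ p) q) (trans (cong (_* inv₀ p) eq) (ℚₚ.*-identityˡ _))))

inv₀-* : ∀ {p q} → 0ℚ < p → 0ℚ < q → inv₀ (p * q) ≡ inv₀ p * inv₀ q
inv₀-* {p} {q} 0<p 0<q = sym (inv₀-unique (0<* 0<p 0<q)
  (trans (solve 4 (λ p q i j → p :* q :* (i :* j) := (p :* i) :* (q :* j)) refl p q (inv₀ p) (inv₀ q))
    (cong₂ _*_ (inv₀-inverse 0<p) (inv₀-inverse 0<q))))

rec-* : ∀ {m n} → 1 ℕ.≤ m → 1 ℕ.≤ n → rec (m ℕ.* n) ≡ rec m * rec n
rec-* {m} {n} 1≤m 1≤n = trans (cong inv₀ (fromℕ-* m n)) (inv₀-* (0<fromℕ⁺ 1≤m) (0<fromℕ⁺ 1≤n))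

inv₀≤ : ∀ {p q} → 0ℚ < q → 1ℚ ≤ p * q → inv₀ q ≤ p
inv₀≤ {p} {q} 0<q 1≤pq = ≤-≡ (sym (ℚₚ.*-identityˡ _))
  (*-monoʳ (ℚₚ.<⇒≤ (0<inv₀ 0<q)) 1≤pq)
  (trans (ℚₚ.*-assoc p q _) (trans (cong (p *_) (inv₀-inverse 0<q)) (ℚₚ.*-identityʳ p)))

χ : {A : Set} → Dec A → ℚ
χ d = if does d then 1ℚ else 0ℚ

χ-yes : {A : Set} (d : Dec A) → A → χ d ≡ 1ℚ
χ-yes (yes _) _ = refl
χ-yes (no ¬a) a = contradiction a ¬a

χ-no : {A : Set} (d : Dec A) → ¬ A → χ d ≡ 0ℚ
χ-no (no _)  _  = refl
χ-no (yes a) ¬a = contradiction a ¬a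

0≤χ : {A : Set} (d : Dec A) → 0ℚ ≤ χ d
0≤χ (yes _) = 0≤1
0≤χ (no _)  = ℚₚ.≤-refl

χ≤1 : {A : Set} (d : Dec A) → χ d ≤ 1ℚ
χ≤1 (yes _) = ℚₚ.≤-refl
χ≤1 (no _)  = 0≤1

χ-mono : {A B : Set} (d : Dec A) (e : Dec B) → (A → B) → χ d ≤ χ e
χ-mono (yes a) e f = ℚₚ.≤-reflexive (sym (χ-yes e (f a)))
χ-mono (no _)  e f = 0≤χ e

χ-cong : {A B : Set} (d : Dec A) (e : Dec B) → (A → B) → (B → A) → χ d ≡ χ e
χ-cong d e f g = ℚₚ.≤-antisym (χ-mono d e f) (χ-mono e d g)

χ-× : {A B C : Set} (d : Dec A) (e : Dec B) (f : Dec C) → (A → B → C) → (C → A × B) → χ d * χ e ≡ χ f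
χ-× (yes a) (yes b) f g h = sym (χ-yes f (g a b))
χ-× (yes a) (no ¬b) f g h = sym (χ-no f λ c → ¬b (proj₂ (h c)))
χ-× (no ¬a) e f g h = trans (ℚₚ.*-zeroˡ (χ e)) (sym (χ-no f λ c → ¬a (proj₁ (h c))))

χ² : {A : Set} (d : Dec A) → χ d * χ d ≡ χ d
χ² d = χ-× d d d (λ a _ → a) λ a → a , a

-- Finite sums.

-- ∑ N f = f 1 + ⋯ + f N
∑ : ℕ → (ℕ → ℚ) → ℚ
∑ zero    f = 0ℚ
∑ (suc N) f = ∑ N f + f (suc N)

∑-cong : ∀ N {f g : ℕ → ℚ} → (∀ n → 1 ℕ.≤ n → n ℕ.≤ N → f n ≡ g n) → ∑ N f ≡ ∑ N g
∑-cong zero h = refl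
∑-cong (suc N) h = cong₂ _+_ (∑-cong N λ n 1≤n n≤N → h n 1≤n (ℕₚ.m≤n⇒m≤1+n n≤N)) (h (suc N) (s≤s z≤n) ℕₚ.≤-refl)

∑-mono : ∀ N {f g : ℕ → ℚ} → (∀ n → 1 ℕ.≤ n → n ℕ.≤ N → f n ≤ g n) → ∑ N f ≤ ∑ N g
∑-mono zero h = ℚₚ.≤-refl
∑-mono (suc N) h = ℚₚ.+-mono-≤ (∑-mono N λ n 1≤n n≤N → h n 1≤n (ℕₚ.m≤n⇒m≤1+n n≤N)) (h (suc N) (s≤s z≤n) ℕₚ.≤-refl)

∑-zero : ∀ N {f : ℕ → ℚ} → (∀ n → 1 ℕ.≤ n → n ℕ.≤ N → f n ≡ 0ℚ) → ∑ N f ≡ 0ℚ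
∑-zero zero h = refl
∑-zero (suc N) h = cong₂ _+_ (∑-zero N λ n 1≤n n≤N → h n 1≤n (ℕₚ.m≤n⇒m≤1+n n≤N)) (h (suc N) (s≤s z≤n) ℕₚ.≤-refl)

∑-+ : ∀ N (f g : ℕ → ℚ) → ∑ N (λ n → f n + g n) ≡ ∑ N f + ∑ N g
∑-+ zero f g = refl
∑-+ (suc N) f g = trans (cong (_+ (f (suc N) + g (suc N))) (∑-+ N f g))
  (solve 4 (λ a b c d → a :+ b :+ (c :+ d) := a :+ c :+ (b :+ d)) refl (∑ N f) (∑ N g) (f (suc N)) (g (suc N)))

∑-* : ∀ N c (f : ℕ → ℚ) → ∑ N (λ n → c * f n) ≡ c * ∑ N f
∑-* zero c f = sym (ℚₚ.*-zeroʳ c)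
∑-* (suc N) c f = trans (cong (_+ c * f (suc N)) (∑-* N c f)) (sym (ℚₚ.*-distribˡ-+ c _ _))

∑-*ʳ : ∀ N c (f : ℕ → ℚ) → ∑ N (λ n → f n * c) ≡ ∑ N f * c
∑-*ʳ N c f = trans (∑-cong N λ n _ _ → ℚₚ.*-comm (f n) c) (trans (∑-* N c f) (ℚₚ.*-comm c _))

∑-neg : ∀ N (f : ℕ → ℚ) → ∑ N (λ n → - f n) ≡ - ∑ N f
∑-neg N f = trans (∑-cong N λ n _ _ → solve 1 (λ x → :- x := (:- con 1ℚ) :* x) refl (f n))
  (trans (∑-* N (- 1ℚ) f) (solve 1 (λ x → (:- con 1ℚ) :* x := :- x) refl (∑ N f)))

0≤∑ : ∀ N {f : ℕ → ℚ} → (∀ n → 1 ℕ.≤ n → n ℕ.≤ N → 0ℚ ≤ f n) → 0ℚ ≤ ∑ N f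
0≤∑ N h = ≤-≡ (sym (∑-zero N λ _ _ _ → refl)) (∑-mono N h) refl

∑-const : ∀ N c → ∑ N (λ _ → c) ≡ fromℕ N * c
∑-const zero c = sym (ℚₚ.*-zeroˡ c)
∑-const (suc N) c = trans (cong (_+ c) (∑-const N c)) (trans
  (solve 2 (λ n c → n :* c :+ c := (con 1ℚ :+ n) :* c) refl (fromℕ N) c) (cong (_* c) (sym (fromℕ-suc N))))

∑-split : ∀ M N (f : ℕ → ℚ) → ∑ (M ℕ.+ N) f ≡ ∑ M f + ∑ N (λ i → f (M ℕ.+ i))
∑-split M zero f = trans (cong (λ m → ∑ m f) (ℕₚ.+-identityʳ M)) (sym (ℚₚ.+-identityʳ _))
∑-split M (suc N) f = trans (cong (λ m → ∑ m f) (ℕₚ.+-suc M N))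
  (trans (cong₂ _+_ (∑-split M N f) (cong f (sym (ℕₚ.+-suc M N)))) (ℚₚ.+-assoc (∑ M f) (∑ N (λ i → f (M ℕ.+ i))) (f (M ℕ.+ suc N))))

∑-extend : ∀ {M N} {f : ℕ → ℚ} → M ℕ.≤ N → (∀ n → 0ℚ ≤ f n) → ∑ M f ≤ ∑ N f
∑-extend {M} {N} {f} M≤N 0≤f = subst (λ n → ∑ M f ≤ ∑ n f) (ℕₚ.m+[n∸m]≡n M≤N)
  (≤-≡ refl (p≤p+q (0≤∑ (N ℕ.∸ M) λ n _ _ → 0≤f _)) (sym (∑-split M (N ℕ.∸ M) f)))

∑-truncate : ∀ {M N} {f : ℕ → ℚ} → M ℕ.≤ N → (∀ n → M ℕ.< n → f n ≡ 0ℚ) → ∑ N f ≡ ∑ M f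
∑-truncate {M} {N} {f} M≤N h = subst (λ n → ∑ n f ≡ ∑ M f) (ℕₚ.m+[n∸m]≡n M≤N)
  (trans (∑-split M (N ℕ.∸ M) f) (trans (cong (λ x → ∑ M f + x) (∑-zero (N ℕ.∸ M) λ n 1≤n _ → h (M ℕ.+ n) (ℕₚ.m<m+n M 1≤n))) (ℚₚ.+-identityʳ (∑ M f))))

∑-term : ∀ N {f : ℕ → ℚ} → (∀ n → 0ℚ ≤ f n) → ∀ {m} → 1 ℕ.≤ m → m ℕ.≤ N → f m ≤ ∑ N f
∑-term N {f} 0≤f {suc m} 1≤m m≤N = ℚₚ.≤-trans (p≤q+p (0≤∑ m λ n _ _ → 0≤f n)) (∑-extend m≤N 0≤f)

∑-swap : ∀ M N (f : ℕ → ℕ → ℚ) → ∑ M (λ m → ∑ N (f m)) ≡ ∑ N (λ n → ∑ M (λ m → f m n))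
∑-swap zero N f = sym (∑-zero N λ _ _ _ → refl)
∑-swap (suc M) N f = trans (cong (_+ ∑ N (f (suc M))) (∑-swap M N f)) (sym (∑-+ N _ _))

∣∑∣≤ : ∀ N (f : ℕ → ℚ) → ∣ ∑ N f ∣ ≤ ∑ N (λ n → ∣ f n ∣)
∣∑∣≤ zero f = ℚₚ.≤-refl
∣∑∣≤ (suc N) f = ℚₚ.≤-trans (ℚₚ.∣p+q∣≤∣p∣+∣q∣ (∑ N f) (f (suc N))) (ℚₚ.+-monoˡ-≤ _ (∣∑∣≤ N f))

-- Approximate additivity of harmonic numbers on products.

-- Harmonic numbers play the part of the logarithm.
H : ℕ → ℚ
H n = ∑ n rec

0≤H : ∀ n → 0ℚ ≤ H n
0≤H n = 0≤∑ n λ i _ _ → 0≤rec i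

H-mono : ∀ {m n} → m ℕ.≤ n → H m ≤ H n
H-mono m≤n = ∑-extend m≤n 0≤rec

1≤H : ∀ {n} → 1 ℕ.≤ n → 1ℚ ≤ H n
1≤H 1≤n = H-mono {1} 1≤n

H-cancel-< : ∀ {m n} → H m < H n → m ℕ.< n
H-cancel-< {m} {n} lt = ℕₚ.≰⇒> λ n≤m → <⇒≱ lt (H-mono n≤m)

m*rec[mn] : ∀ {m n} → 1 ℕ.≤ m → 1 ℕ.≤ n → fromℕ m * rec (m ℕ.* n) ≡ rec n
m*rec[mn] {m} {n} 1≤m 1≤n = trans (cong (fromℕ m *_) (rec-* 1≤m 1≤n))
  (trans (sym (ℚₚ.*-assoc (fromℕ m) _ _)) (trans (cong (_* rec n) (n*rec 1≤m)) (ℚₚ.*-identityˡ _)))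

-- The blocks (mi, m(i+1)] of H (m n) have sums between 1/(i+1) and 1/i.
H[m*suc] : ∀ m n → H (m ℕ.* suc n) ≡ H (m ℕ.* n) + ∑ m (λ i → rec (m ℕ.* n ℕ.+ i))
H[m*suc] m n = trans (cong H (trans (ℕₚ.*-suc m n) (ℕₚ.+-comm m _))) (∑-split (m ℕ.* n) m rec)

block-≥ : ∀ {m} → 1 ℕ.≤ m → ∀ n → rec (suc n) ≤ ∑ m (λ i → rec (m ℕ.* n ℕ.+ i))
block-≥ {m} 1≤m n = ≤-≡ (trans (sym (m*rec[mn] 1≤m (s≤s z≤n))) (sym (∑-const m _)))
  (∑-mono m λ i 1≤i i≤m → rec-anti (ℕₚ.≤-trans 1≤i (ℕₚ.m≤n+m i _))
    (ℕₚ.≤-trans (ℕₚ.+-monoʳ-≤ (m ℕ.* n) i≤m) (ℕₚ.≤-reflexive (trans (ℕₚ.+-comm (m ℕ.* n) m) (sym (ℕₚ.*-suc m n)))))) refl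

block-≤ : ∀ {m n} → 1 ℕ.≤ m → 1 ℕ.≤ n → ∑ m (λ i → rec (m ℕ.* n ℕ.+ i)) ≤ rec n
block-≤ {m} {n} 1≤m 1≤n = ≤-≡ refl
  (∑-mono m λ i 1≤i i≤m → rec-anti (ℕₚ.*-mono-≤ 1≤m 1≤n) (ℕₚ.m≤m+n (m ℕ.* n) i))
  (trans (∑-const m _) (m*rec[mn] 1≤m 1≤n))

-- The blocks are compared one by one; the 1 on the right pays for the term `H 1` at `n = 0`. With
-- `H-*-≤` this is log (m n) = log m + log n up to 1: `H` is subadditive and `H - 1` superadditive
-- on products.
H-*-≥ : ∀ {m} → 1 ℕ.≤ m → ∀ n → H m + H (suc n) ≤ H (m ℕ.* suc n) + 1ℚ
H-*-≥ {m} 1≤m zero = ≤-≡ (cong (λ x → H m + x) (ℚₚ.+-identityˡ (rec 1))) ℚₚ.≤-refl (cong (λ x → H x + 1ℚ) (sym (ℕₚ.*-identityʳ m)))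
H-*-≥ {m} 1≤m (suc n) = ≤-≡ (sym (ℚₚ.+-assoc (H m) _ _)) (ℚₚ.+-mono-≤ (H-*-≥ 1≤m n) (block-≥ 1≤m (suc n)))
  (trans (solve 3 (λ a b c → a :+ b :+ c := a :+ c :+ b) refl (H (m ℕ.* suc n)) 1ℚ _) (cong (_+ 1ℚ) (sym (H[m*suc] m (suc n)))))

H-*suc-≤ : ∀ {m} → 1 ℕ.≤ m → ∀ n → H (m ℕ.* suc n) ≤ H m + H n
H-*suc-≤ {m} 1≤m zero = ≤-≡ (cong H (ℕₚ.*-identityʳ m)) (p≤p+q ℚₚ.≤-refl) refl
H-*suc-≤ {m} 1≤m (suc n) = ≤-≡ (H[m*suc] m (suc n))
  (ℚₚ.+-mono-≤ (H-*suc-≤ 1≤m n) (block-≤ {m} {suc n} 1≤m (s≤s z≤n)))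
  (ℚₚ.+-assoc (H m) _ _)

H-*-≤ : ∀ m n → H (m ℕ.* n) ≤ H m + H n
H-*-≤ zero n = ≤-≡ refl (0≤H n) (sym (ℚₚ.+-identityˡ _))
H-*-≤ m@(suc _) zero = ≤-≡ (cong H (ℕₚ.*-zeroʳ m)) (0≤H m) (sym (ℚₚ.+-identityʳ (H m)))
H-*-≤ m@(suc _) (suc n) = ℚₚ.≤-trans (H-*suc-≤ {m} (s≤s z≤n) n) (ℚₚ.+-monoʳ-≤ (H m) (H-mono (ℕₚ.n≤1+n n)))

-- Products of dilation operators over a list of primes.

-- Op β ps g n = ∑ β(s) g(s n) over the products s of sublists of ps, that is,
-- the operator ∏ (1 + β_p T_p) with T_p g n = g (p n).
Op : (ℕ → ℚ) → List ℕ → (ℕ → ℚ) → ℕ → ℚ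
Op β []       g n = g n
Op β (p ∷ ps) g n = Op β ps g n + β p * Op β ps g (p ℕ.* n)

Positive : List ℕ → Set
Positive = All (1 ℕ.≤_)

Weight : (ℕ → ℚ) → List ℕ → Set
Weight β = All (λ p → 0ℚ ≤ β p)

Op-cong : ∀ β ps {f g : ℕ → ℚ} → (∀ n → f n ≡ g n) → ∀ n → Op β ps f n ≡ Op β ps g n
Op-cong β [] h n = h n
Op-cong β (p ∷ ps) h n = cong₂ (λ a b → a + β p * b) (Op-cong β ps h n) (Op-cong β ps h (p ℕ.* n))

Op-mono : ∀ {β ps} → Weight β ps → Positive ps → {f g : ℕ → ℚ} → (∀ n → 1 ℕ.≤ n → f n ≤ g n) →
          ∀ n → 1 ℕ.≤ n → Op β ps f n ≤ Op β ps g n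
Op-mono [] [] h n 1≤n = h n 1≤n
Op-mono {ps = p ∷ ps} (0≤β ∷ w) (1≤p ∷ pos) h n 1≤n =
  ℚₚ.+-mono-≤ (Op-mono w pos h n 1≤n) (*-monoˡ 0≤β (Op-mono w pos h (p ℕ.* n) (ℕₚ.*-mono-≤ 1≤p 1≤n)))

Op-+ : ∀ β ps (f g : ℕ → ℚ) n → Op β ps (λ m → f m + g m) n ≡ Op β ps f n + Op β ps g n
Op-+ β [] f g n = refl
Op-+ β (p ∷ ps) f g n = trans (cong₂ (λ a b → a + β p * b) (Op-+ β ps f g n) (Op-+ β ps f g (p ℕ.* n)))
  (solve 5 (λ a b c d e → a :+ b :+ e :* (c :+ d) := a :+ e :* c :+ (b :+ e :* d)) refl
    (Op β ps f n) (Op β ps g n) (Op β ps f (p ℕ.* n)) (Op β ps g (p ℕ.* n)) (β p))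

Op-* : ∀ β ps c (f : ℕ → ℚ) n → Op β ps (λ m → c * f m) n ≡ c * Op β ps f n
Op-* β [] c f n = refl
Op-* β (p ∷ ps) c f n = trans (cong₂ (λ a b → a + β p * b) (Op-* β ps c f n) (Op-* β ps c f (p ℕ.* n)))
  (solve 4 (λ a b c e → c :* a :+ e :* (c :* b) := c :* (a :+ e :* b)) refl
    (Op β ps f n) (Op β ps f (p ℕ.* n)) c (β p))

Op-0≤ : ∀ {β ps} → Weight β ps → {f : ℕ → ℚ} → (∀ n → 0ℚ ≤ f n) → ∀ n → 0ℚ ≤ Op β ps f n
Op-0≤ [] h n = h n
Op-0≤ {ps = p ∷ ps} (0≤β ∷ w) h n = 0≤+ (Op-0≤ w h n) (0≤* 0≤β (Op-0≤ w h (p ℕ.* n)))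

swap-factors : ∀ p q n → p ℕ.* (q ℕ.* n) ≡ q ℕ.* (p ℕ.* n)
swap-factors p q n = trans (sym (ℕₚ.*-assoc p q n)) (trans (cong (ℕ._* n) (ℕₚ.*-comm p q)) (ℕₚ.*-assoc q p n))

Op-shift : ∀ β ps (g : ℕ → ℚ) q n → Op β ps (λ m → g (q ℕ.* m)) n ≡ Op β ps g (q ℕ.* n)
Op-shift β [] g q n = refl
Op-shift β (p ∷ ps) g q n = cong₂ (λ a b → a + β p * b) (Op-shift β ps g q n)
  (trans (Op-shift β ps g q (p ℕ.* n)) (cong (Op β ps g) (swap-factors q p n)))

-- The operators commute, so the head factor may act on the function first. The quadratic forms
-- below consume their primes in that order.
Op-inner : ∀ β p ps (g : ℕ → ℚ) n → Op β (p ∷ ps) g n ≡ Op β ps (λ m → g m + β p * g (p ℕ.* m)) n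
Op-inner β p ps g n = sym (trans (Op-+ β ps g _ n) (cong (λ x → Op β ps g n + x)
  (trans (Op-* β ps (β p) (λ m → g (p ℕ.* m)) n) (cong (β p *_) (Op-shift β ps g p n)))))

-- Brings a prescribed prime to the front, for the count of the `n` such that this prime divides
-- some `n + h`.
Op-move : ∀ β qs p ps (g : ℕ → ℚ) n → Op β (qs ++ p ∷ ps) g n ≡ Op β (p ∷ qs ++ ps) g n
Op-move β [] p ps g n = refl
Op-move β (q ∷ qs) p ps g n = trans (cong₂ (λ a b → a + β q * b) (Op-move β qs p ps g n) (Op-move β qs p ps g (q ℕ.* n)))
  (trans (cong (λ x → Op β (qs ++ ps) g n + β p * Op β (qs ++ ps) g (p ℕ.* n) + β q * (Op β (qs ++ ps) g (q ℕ.* n) + β p * Op β (qs ++ ps) g x))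
               (swap-factors p q n))
    (solve 6 (λ a b c d e f → a :+ e :* b :+ f :* (c :+ e :* d) := a :+ f :* c :+ e :* (b :+ f :* d)) refl
      (Op β (qs ++ ps) g n) (Op β (qs ++ ps) g (p ℕ.* n)) (Op β (qs ++ ps) g (q ℕ.* n)) (Op β (qs ++ ps) g (q ℕ.* (p ℕ.* n))) (β p) (β q)))

Decreasing : (ℕ → ℚ) → Set
Decreasing g = ∀ m n → 1 ℕ.≤ m → m ℕ.≤ n → g n ≤ g m

Op-decreasing : ∀ {β ps} → Weight β ps → Positive ps → {g : ℕ → ℚ} → Decreasing g → Decreasing (Op β ps g)
Op-decreasing [] [] h = h
Op-decreasing {ps = p ∷ ps} (0≤β ∷ w) (1≤p ∷ pos) h m n 1≤m m≤n = ℚₚ.+-mono-≤ (IH m n 1≤m m≤n)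
  (*-monoˡ 0≤β (IH (p ℕ.* m) (p ℕ.* n) (ℕₚ.*-mono-≤ 1≤p 1≤m) (ℕₚ.*-monoʳ-≤ p m≤n)))
  where IH = Op-decreasing w pos h

m≤p*m : ∀ {p} → 1 ℕ.≤ p → ∀ m → m ℕ.≤ p ℕ.* m
m≤p*m {p} 1≤p m = ℕₚ.≤-trans (ℕₚ.≤-reflexive (sym (ℕₚ.*-identityˡ m))) (ℕₚ.*-monoˡ-≤ m 1≤p)

-- On decreasing functions T_p² ≤ T_p.
Op-compose-≤ : ∀ {α β γ ps} → Weight α ps → Weight β ps → Weight γ ps → Positive ps →
  All (λ p → α p + β p + α p * β p ≤ γ p) ps → ∀ {g} → (∀ n → 0ℚ ≤ g n) → Decreasing g →
  ∀ n → 1 ℕ.≤ n → Op α ps (Op β ps g) n ≤ Op γ ps g n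
Op-compose-≤ [] [] [] [] [] 0≤g dec n 1≤n = ℚₚ.≤-refl
Op-compose-≤ {α} {β} {γ} {p ∷ ps} (0≤α ∷ wα) (0≤β ∷ wβ) (0≤γ ∷ wγ) (1≤p ∷ pos) (le ∷ les) {g} 0≤g dec n 1≤n =
  ≤-≡ (cong₂ (λ a b → a + α p * b) (expand n) (expand (p ℕ.* n)))
    (ℚₚ.≤-trans (by-difference {d = A (p ℕ.* n) * (γ p - (α p + β p + α p * β p)) + α p * β p * (A (p ℕ.* n) - A (p ℕ.* (p ℕ.* n)))}
       (0≤+ (0≤* (0≤A (p ℕ.* n)) (difference le))
            (0≤* (0≤* 0≤α 0≤β) (difference (decA (p ℕ.* n) (p ℕ.* (p ℕ.* n)) 1≤pn (m≤p*m 1≤p (p ℕ.* n))))))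
       (solve 6 (λ a b c d e f → b :* (f :- (d :+ e :+ d :* e)) :+ d :* e :* (b :- c) :=
           a :+ f :* b :- (a :+ e :* b :+ d :* (b :+ e :* c))) refl
         (A n) (A (p ℕ.* n)) (A (p ℕ.* (p ℕ.* n))) (α p) (β p) (γ p)))
      (ℚₚ.+-mono-≤ (IH n 1≤n) (*-monoˡ 0≤γ (IH (p ℕ.* n) 1≤pn))))
    refl
  where
  A = Op α ps (Op β ps g)
  0≤A = Op-0≤ wα (Op-0≤ wβ 0≤g)
  decA = Op-decreasing wα pos (Op-decreasing wβ pos dec)
  1≤pn = ℕₚ.*-mono-≤ 1≤p 1≤n
  IH = Op-compose-≤ wα wβ wγ pos les 0≤g dec
  expand : ∀ m → Op α ps (Op β (p ∷ ps) g) m ≡ A m + β p * A (p ℕ.* m)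
  expand m = trans (Op-+ α ps (Op β ps g) _ m) (cong (λ x → A m + x)
    (trans (Op-* α ps (β p) (λ k → Op β ps g (p ℕ.* k)) m) (cong (β p *_) (Op-shift α ps (Op β ps g) p m))))

-- In this direction the terms in T_p² are nonnegative and are dropped.
Op-compose-≥ : ∀ {α β γ ps} → Weight α ps → Weight β ps → Weight γ ps → Positive ps →
  All (λ p → γ p ≤ α p + β p) ps → ∀ {g} → (∀ n → 0ℚ ≤ g n) →
  ∀ n → 1 ℕ.≤ n → Op γ ps g n ≤ Op α ps (Op β ps g) n
Op-compose-≥ [] [] [] [] [] 0≤g n 1≤n = ℚₚ.≤-refl
Op-compose-≥ {α} {β} {γ} {p ∷ ps} (0≤α ∷ wα) (0≤β ∷ wβ) (0≤γ ∷ wγ) (1≤p ∷ pos) (le ∷ les) {g} 0≤g n 1≤n =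
  ≤-≡ refl
    (ℚₚ.≤-trans (ℚₚ.+-mono-≤ (IH n 1≤n) (*-monoˡ 0≤γ (IH (p ℕ.* n) (ℕₚ.*-mono-≤ 1≤p 1≤n))))
      (by-difference {d = A (p ℕ.* n) * (α p + β p - γ p) + α p * β p * A (p ℕ.* (p ℕ.* n))}
       (0≤+ (0≤* (0≤A (p ℕ.* n)) (difference le)) (0≤* (0≤* 0≤α 0≤β) (0≤A (p ℕ.* (p ℕ.* n)))))
       (solve 6 (λ a b c d e f → b :* (d :+ e :- f) :+ d :* e :* c :=
           a :+ e :* b :+ d :* (b :+ e :* c) :- (a :+ f :* b)) refl
         (A n) (A (p ℕ.* n)) (A (p ℕ.* (p ℕ.* n))) (α p) (β p) (γ p))))
    (sym (cong₂ (λ a b → a + α p * b) (expand n) (expand (p ℕ.* n))))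
  where
  A = Op α ps (Op β ps g)
  0≤A = Op-0≤ wα (Op-0≤ wβ 0≤g)
  IH = Op-compose-≥ wα wβ wγ pos les 0≤g
  expand : ∀ m → Op α ps (Op β (p ∷ ps) g) m ≡ A m + β p * A (p ℕ.* m)
  expand m = trans (Op-+ α ps (Op β ps g) _ m) (cong (λ x → A m + x)
    (trans (Op-* α ps (β p) (λ k → Op β ps g (p ℕ.* k)) m) (cong (β p *_) (Op-shift α ps (Op β ps g) p m))))

-- Products of sieving primes against sums over integers coprime to W.

coprime-*ʳ : ∀ {m a b} → Coprime m a → Coprime m b → Coprime m (a ℕ.* b)
coprime-*ʳ ca cb (d∣m , d∣ab) =
  cb (d∣m , Coprimality.coprime-divisor (λ (e∣d , e∣a) → ca (ℕ.∣-trans e∣d d∣m , e∣a)) d∣ab)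

coprime-∣ : ∀ {m n m′ n′} → m′ ∣ m → n′ ∣ n → Coprime m n → Coprime m′ n′
coprime-∣ m′∣m n′∣n c (d∣m′ , d∣n′) = c (ℕ.∣-trans d∣m′ m′∣m , ℕ.∣-trans d∣n′ n′∣n)

prime-∤⇒coprime : ∀ {p n} → Prime p → ¬ p ∣ n → Coprime n p
prime-∤⇒coprime pr p∤n (d∣n , d∣p) with prime⇒irreducible pr d∣p
... | inj₁ d≡1 = d≡1
... | inj₂ refl = contradiction d∣n p∤n

prime-coprime⇒∤ : ∀ {p n} → Prime p → Coprime n p → ¬ p ∣ n
prime-coprime⇒∤ pr c p∣n = ¬prime[1] (subst Prime (c (p∣n , ℕ.∣-refl)) pr)

prime⇒1≤ : ∀ {p} → Prime p → 1 ℕ.≤ p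
prime⇒1≤ {p} pr = ℕ.>-nonZero⁻¹ p {{prime⇒nonZero pr}}

prime⇒2≤ : ∀ {p} → Prime p → 2 ℕ.≤ p
prime⇒2≤ {p} pr = ℕ.nonTrivial⇒n>1 p {{prime⇒nonTrivial pr}}

∑-multiples′ : ∀ p (F : ℕ → ℚ) K → 1 ℕ.≤ p → ∑ (p ℕ.* K) (λ n → χ (p ∣? n) * F n) ≡ ∑ K (λ m → F (p ℕ.* m))
∑-multiples′ p F zero _ = cong (λ n → ∑ n (λ n → χ (p ∣? n) * F n)) (ℕₚ.*-zeroʳ p)
∑-multiples′ p@(suc q) F (suc K) 1≤p = trans (cong (λ n → ∑ n f) (trans (ℕₚ.*-suc p K) (ℕₚ.+-comm p _)))
  (trans (∑-split (p ℕ.* K) p f) (cong₂ _+_ (∑-multiples′ p F K 1≤p)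
    (trans (cong₂ _+_ (∑-zero q λ i 1≤i i≤q → trans (cong (_* F (p ℕ.* K ℕ.+ i)) (χ-no (p ∣? _) λ p∣ →
        ℕₚ.<⇒≱ (s≤s i≤q) (ℕ.∣⇒≤ {{ℕ.>-nonZero 1≤i}} (ℕ.∣m+n∣m⇒∣n p∣ (ℕ.m∣m*n K))))) (ℚₚ.*-zeroˡ (F (p ℕ.* K ℕ.+ i))))
      (trans (cong (_* F (p ℕ.* K ℕ.+ p)) (χ-yes (p ∣? _) (ℕ.∣m∣n⇒∣m+n (ℕ.m∣m*n K) ℕ.∣-refl))) (ℚₚ.*-identityˡ (F (p ℕ.* K ℕ.+ p)))))
      (trans (ℚₚ.+-identityˡ (F (p ℕ.* K ℕ.+ p))) (cong F (trans (ℕₚ.+-comm (p ℕ.* K) p) (sym (ℕₚ.*-suc p K))))))))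
  where
  f : ℕ → ℚ
  f n = χ (p ∣? n) * F n

∑-multiples : ∀ p (F : ℕ → ℚ) M → 1 ℕ.≤ p → (∀ n → M ℕ.< n → F n ≡ 0ℚ) → ∑ M (λ n → χ (p ∣? n) * F n) ≡ ∑ M (λ m → F (p ℕ.* m))
∑-multiples p F M 1≤p vanish = trans (sym (∑-truncate (m≤p*m 1≤p M)
  λ n M<n → trans (cong (χ (p ∣? n) *_) (vanish n M<n)) (ℚₚ.*-zeroʳ (χ (p ∣? n))))) (∑-multiples′ p F M 1≤p)

coprimeSum : ℕ → ℕ → (ℕ → ℚ) → ℚ
coprimeSum M W F = ∑ M (λ n → χ (coprime? n W) * F n)

coprimeSum-mono : ∀ M W {F G : ℕ → ℚ} → (∀ n → 1 ℕ.≤ n → F n ≤ G n) → coprimeSum M W F ≤ coprimeSum M W G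
coprimeSum-mono M W h = ∑-mono M λ n 1≤n _ → *-monoˡ (0≤χ (coprime? n W)) (h n 1≤n)

-- An integer coprime to `W` is coprime to `p W` or is `p m` with `m` coprime to `W`. Since `F`
-- vanishes beyond `M`, both parts keep the range `M`, so that the lemma can be iterated.
coprimeSum-split : ∀ {p W} → Prime p → ¬ p ∣ W → ∀ M (F : ℕ → ℚ) → (∀ n → M ℕ.< n → F n ≡ 0ℚ) →
  coprimeSum M W F ≡ coprimeSum M (p ℕ.* W) F + coprimeSum M W (λ n → F (p ℕ.* n))
coprimeSum-split {p} {W} pr p∤W M F vanish = trans
  (∑-cong M λ n _ _ → trans (cong (_* F n) (pointwise n))
    (solve 4 (λ a b c f → (a :+ b :* c) :* f := a :* f :+ c :* (b :* f)) refl (χ (coprime? n (p ℕ.* W))) (χ (coprime? n W)) (χ (p ∣? n)) (F n)))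
  (trans (∑-+ M (λ n → χ (coprime? n (p ℕ.* W)) * F n) (λ n → χ (p ∣? n) * (χ (coprime? n W) * F n)))
    (cong (λ x → coprimeSum M (p ℕ.* W) F + x)
      (trans (∑-multiples p (λ n → χ (coprime? n W) * F n) M (prime⇒1≤ pr) λ n M<n →
          trans (cong (χ (coprime? n W) *_) (vanish n M<n)) (ℚₚ.*-zeroʳ (χ (coprime? n W))))
        (∑-cong M λ n _ _ → cong (_* F (p ℕ.* n)) (χ-cong (coprime? (p ℕ.* n) W) (coprime? n W)
          (coprime-∣ (ℕ.n∣m*n p) ℕ.∣-refl)
          λ c → Coprimality.sym (coprime-*ʳ (prime-∤⇒coprime pr p∤W) (Coprimality.sym c)))))))
  where
  pointwise : ∀ n → χ (coprime? n W) ≡ χ (coprime? n (p ℕ.* W)) + χ (coprime? n W) * χ (p ∣? n)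
  pointwise n with p ∣? n
  ... | yes p∣n = sym (trans (cong₂ _+_ (χ-no (coprime? n (p ℕ.* W)) λ c → prime-coprime⇒∤ pr (coprime-∣ ℕ.∣-refl (ℕ.m∣m*n W) c) p∣n) (ℚₚ.*-identityʳ (χ (coprime? n W)))) (ℚₚ.+-identityˡ (χ (coprime? n W))))
  ... | no p∤n = trans (χ-cong (coprime? n W) (coprime? n (p ℕ.* W)) (coprime-*ʳ (prime-∤⇒coprime pr p∤n)) (coprime-∣ ℕ.∣-refl (ℕ.n∣m*n p)))
    (sym (trans (cong (λ x → χ (coprime? n (p ℕ.* W)) + x) (ℚₚ.*-zeroʳ (χ (coprime? n W)))) (ℚₚ.+-identityʳ (χ (coprime? n (p ℕ.* W))))))

coprimeSum-∣ : ∀ M p W {F : ℕ → ℚ} → (∀ n → 0ℚ ≤ F n) → coprimeSum M (p ℕ.* W) F ≤ coprimeSum M W F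
coprimeSum-∣ M p W 0≤F = ∑-mono M λ n _ _ → *-monoʳ (0≤F n) (χ-mono (coprime? n (p ℕ.* W)) (coprime? n W) (coprime-∣ ℕ.∣-refl (ℕ.n∣m*n p)))

-- A list of distinct primes not dividing W.
data Sieving (W : ℕ) : List ℕ → Set where
  []  : Sieving W []
  _∷_ : ∀ {p ps} → Prime p × ¬ p ∣ W → Sieving (p ℕ.* W) ps → Sieving W (p ∷ ps)

sieving⇒positive : ∀ {W ps} → Sieving W ps → Positive ps
sieving⇒positive [] = []
sieving⇒positive ((pr , _) ∷ s) = prime⇒1≤ pr ∷ sieving⇒positive s

sieving⇒weight : ∀ {W ps β} → (∀ p → 0ℚ ≤ β p) → Sieving W ps → Weight β ps
sieving⇒weight h [] = []
sieving⇒weight h (_ ∷ s) = h _ ∷ sieving⇒weight h s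

vanish-* : ∀ {M} {F : ℕ → ℚ} {p} → 1 ℕ.≤ p → (∀ n → M ℕ.< n → F n ≡ 0ℚ) → ∀ n → M ℕ.< n → F (p ℕ.* n) ≡ 0ℚ
vanish-* {p = p} 1≤p vanish n M<n = vanish (p ℕ.* n) (ℕₚ.≤-trans M<n (m≤p*m 1≤p n))

one : ℕ → ℚ
one _ = 1ℚ

-- Products of sublists are distinct integers coprime to `W`. In the induction the multiples of `p²`
-- on the right have no counterpart on the left; `coprimeSum-∣` discards them.
sublists≤coprimeSum : ∀ {W ps} → Sieving W ps → ∀ M → 1 ℕ.≤ M → (F : ℕ → ℚ) → (∀ n → 0ℚ ≤ F n) → (∀ n → M ℕ.< n → F n ≡ 0ℚ) →
  Op one ps F 1 ≤ coprimeSum M W F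
sublists≤coprimeSum {W} [] M 1≤M F 0≤F vanish =
  ≤-≡ (sym (trans (cong (_* F 1) (χ-yes (coprime? 1 W) (Coprimality.1-coprimeTo W))) (ℚₚ.*-identityˡ (F 1))))
    (∑-term M {λ n → χ (coprime? n W) * F n} (λ n → 0≤* (0≤χ (coprime? n W)) (0≤F n)) ℕₚ.≤-refl 1≤M) refl
sublists≤coprimeSum {W} {p ∷ ps} ((pr , p∤W) ∷ s) M 1≤M F 0≤F vanish =
  ≤-≡ (cong (λ x → Op one ps F 1 + x) (trans (ℚₚ.*-identityˡ (Op one ps F (p ℕ.* 1))) (sym (Op-shift one ps F p 1))))
    (ℚₚ.+-mono-≤ (sublists≤coprimeSum s M 1≤M F 0≤F vanish)
      (ℚₚ.≤-trans (sublists≤coprimeSum s M 1≤M (λ n → F (p ℕ.* n)) (λ n → 0≤F (p ℕ.* n)) (vanish-* (prime⇒1≤ pr) vanish))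
        (coprimeSum-∣ M p W λ n → 0≤F (p ℕ.* n))))
    (sym (coprimeSum-split pr p∤W M F vanish))

Op-rec : ∀ ps → Positive ps → (g : ℕ → ℚ) → ∀ n → 1 ℕ.≤ n → Op one ps (λ m → rec m * g m) n ≡ rec n * Op rec ps g n
Op-rec [] [] g n 1≤n = refl
Op-rec (p ∷ ps) (1≤p ∷ pos) g n 1≤n = trans (cong₂ _+_ (Op-rec ps pos g n 1≤n) (cong (1ℚ *_) (trans (Op-rec ps pos g (p ℕ.* n) (ℕₚ.*-mono-≤ 1≤p 1≤n)) (cong (_* Op rec ps g (p ℕ.* n)) (rec-* 1≤p 1≤n)))))
  (solve 4 (λ a b r q → r :* a :+ con 1ℚ :* (q :* r :* b) := r :* (a :+ q :* b)) refl (Op rec ps g n) (Op rec ps g (p ℕ.* n)) (rec n) (rec p))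

harmonic≥Op : ∀ {W ps} → Sieving W ps → ∀ M → 1 ℕ.≤ M → (g : ℕ → ℚ) → (∀ n → 0ℚ ≤ g n) → (∀ n → M ℕ.< n → g n ≡ 0ℚ) →
  Op rec ps g 1 ≤ coprimeSum M W (λ n → rec n * g n)
harmonic≥Op {W} {ps} s M 1≤M g 0≤g vanish = ≤-≡ (sym (trans (Op-rec ps (sieving⇒positive s) g 1 ℕₚ.≤-refl) (ℚₚ.*-identityˡ (Op rec ps g 1))))
  (sublists≤coprimeSum s M 1≤M (λ n → rec n * g n) (λ n → 0≤* (0≤rec n) (0≤g n))
    λ n M<n → trans (cong (rec n *_) (vanish n M<n)) (ℚₚ.*-zeroʳ (rec n))) refl

recφ : ℕ → ℚ
recφ p = rec (p ℕ.∸ 1)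

recφ-eq : ∀ {p} → 2 ℕ.≤ p → rec p * (1ℚ + recφ p) ≡ recφ p
recφ-eq {suc n} (s≤s 1≤n) = trans (cong (rec (suc n) *_) (trans (cong (_+ rec n) (sym (n*rec 1≤n)))
    (trans (solve 2 (λ n r → n :* r :+ r := (con 1ℚ :+ n) :* r) refl (fromℕ n) (rec n)) (cong (_* rec n) (sym (fromℕ-suc n))))))
  (trans (solve 3 (λ r n s → r :* (n :* s) := n :* r :* s) refl (rec (suc n)) (fromℕ (suc n)) (rec n))
    (trans (cong (_* rec n) (n*rec {suc n} (s≤s z≤n))) (ℚₚ.*-identityˡ (rec n))))

-- 1/(p-1) = 1/p + 1/p² + ⋯ accounts for the multiples of all powers of p.
harmonic≤Op : ∀ {W ps} → Sieving W ps → ∀ M → (∀ n → 2 ℕ.≤ n → n ℕ.≤ M → Coprime n W → ∃[ p ] p ∈ ps × p ∣ n) →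
  (g : ℕ → ℚ) → (∀ n → 0ℚ ≤ g n) → Decreasing g → (∀ n → M ℕ.< n → g n ≡ 0ℚ) →
  coprimeSum M W (λ n → rec n * g n) ≤ Op recφ ps g 1
harmonic≤Op {W} [] zero cover g 0≤g dec vanish = 0≤g 1
harmonic≤Op {W} [] (suc M) cover g 0≤g dec vanish = ≤-≡
  (trans (∑-truncate {1} {suc M} {λ n → χ (coprime? n W) * (rec n * g n)} (s≤s z≤n) λ n 1<n → small n 1<n (n ℕₚ.≤? suc M))
    (ℚₚ.+-identityˡ (χ (coprime? 1 W) * (rec 1 * g 1))))
  (*-monoʳ {r = rec 1 * g 1} (0≤* (0≤rec 1) (0≤g 1)) (χ≤1 (coprime? 1 W)))
  (solve 1 (λ g → con 1ℚ :* (con 1ℚ :* g) := g) refl (g 1))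
  where
  small : ∀ n → 1 ℕ.< n → Dec (n ℕ.≤ suc M) → χ (coprime? n W) * (rec n * g n) ≡ 0ℚ
  small n 1<n (yes n≤M) = trans (cong (_* (rec n * g n)) (χ-no (coprime? n W) λ c → case cover n 1<n n≤M c of λ { (_ , () , _) })) (ℚₚ.*-zeroˡ (rec n * g n))
  small n 1<n (no n≰M) = trans (cong (λ x → χ (coprime? n W) * (rec n * x)) (vanish n (ℕₚ.≰⇒> n≰M)))
    (solve 2 (λ a b → a :* (b :* con 0ℚ) := con 0ℚ) refl (χ (coprime? n W)) (rec n))
harmonic≤Op {W} {p ∷ ps} ((pr , p∤W) ∷ s) M cover g 0≤g dec vanish = ≤-≡ (split g vanish)
  (ℚₚ.+-mono-≤ (IH g 0≤g dec vanish)
    (ℚₚ.≤-trans key (*-monoˡ (0≤rec (p ℕ.∸ 1)) (IH gp (λ n → 0≤g (p ℕ.* n)) decp vanishp))))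
  (cong (λ x → Op recφ ps g 1 + recφ p * x) (Op-shift recφ ps g p 1))
  where
  1≤p = prime⇒1≤ pr
  gp gpp : ℕ → ℚ
  gp n = g (p ℕ.* n)
  gpp n = g (p ℕ.* (p ℕ.* n))
  vanishp = vanish-* {F = g} 1≤p vanish
  decp : Decreasing gp
  decp m n 1≤m m≤n = dec (p ℕ.* m) (p ℕ.* n) (ℕₚ.*-mono-≤ 1≤p 1≤m) (ℕₚ.*-monoʳ-≤ p m≤n)
  cover′ : ∀ n → 2 ℕ.≤ n → n ℕ.≤ M → Coprime n (p ℕ.* W) → ∃[ q ] q ∈ ps × q ∣ n
  cover′ n 2≤n n≤M c with cover n 2≤n n≤M (coprime-∣ ℕ.∣-refl (ℕ.n∣m*n p) c)
  ... | q , there q∈ , q∣n = q , q∈ , q∣n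
  ... | q , here refl , q∣n = contradiction q∣n (prime-coprime⇒∤ pr (coprime-∣ ℕ.∣-refl (ℕ.m∣m*n W) c))
  IH = harmonic≤Op s M cover′
  X Y : (ℕ → ℚ) → ℚ
  X h = coprimeSum M W (λ n → rec n * h n)
  Y h = coprimeSum M (p ℕ.* W) (λ n → rec n * h n)
  split : ∀ h → (∀ n → M ℕ.< n → h n ≡ 0ℚ) → X h ≡ Y h + rec p * X (λ n → h (p ℕ.* n))
  split h v = trans (coprimeSum-split pr p∤W M (λ n → rec n * h n) λ n M<n → trans (cong (rec n *_) (v n M<n)) (ℚₚ.*-zeroʳ (rec n)))
    (cong (λ x → Y h + x) (trans (∑-cong M λ n 1≤n _ → trans (cong (λ r → χ (coprime? n W) * (r * h (p ℕ.* n))) (rec-* 1≤p 1≤n))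
      (solve 4 (λ c a b h → c :* (a :* b :* h) := a :* (c :* (b :* h))) refl (χ (coprime? n W)) (rec p) (rec n) (h (p ℕ.* n))))
      (∑-* M (rec p) (λ n → χ (coprime? n W) * (rec n * h (p ℕ.* n))))))
  -- Splitting off `p` once more produces the sum of `g (p² n)`, which is at most `X gp` as `g`
  -- decreases. Solving for `X gp` sums the whole geometric series over powers of `p` at once: (1 -
  -- 1/p) `X gp` ≤ `Y gp`.
  le : X gp ≤ Y gp + rec p * X gp
  le = ≤-≡ (split gp vanishp) (ℚₚ.+-monoʳ-≤ (Y gp) (*-monoˡ (0≤rec p) (coprimeSum-mono M W {λ n → rec n * gpp n} {λ n → rec n * gp n} λ n 1≤n →
    *-monoˡ (0≤rec n) (dec (p ℕ.* n) (p ℕ.* (p ℕ.* n)) (ℕₚ.*-mono-≤ 1≤p 1≤n) (m≤p*m 1≤p (p ℕ.* n)))))) refl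
  key : rec p * X gp ≤ recφ p * Y gp
  key = by-difference (0≤* (0≤rec (p ℕ.∸ 1)) (difference le))
    (trans (solve 4 (λ r f x y → f :* (y :+ r :* x :- x) := f :* y :- (f :- r :* f) :* x) refl (rec p) (recφ p) (X gp) (Y gp))
      (cong (λ c → recφ p * Y gp - c * X gp) (trans (cong (_- rec p * recφ p) (sym (recφ-eq (prime⇒2≤ pr))))
        (solve 2 (λ r f → r :* (con 1ℚ :+ f) :- r :* f := r) refl (rec p) (recφ p)))))

-- The density of the integers coprime to W, and summation by parts.

coprimeCount : ℕ → ℚ
coprimeCount W = ∑ W (λ n → χ (coprime? n W))

density : ℕ → ℚ
density W = coprimeCount W * rec W

0<density : ∀ {W} → 1 ℕ.≤ W → 0ℚ < density W
0<density {W} 1≤W = 0<* (ℚₚ.<-≤-trans 0<1 (≤-≡ (sym (χ-yes (coprime? 1 W) (Coprimality.1-coprimeTo W)))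
  (∑-term W (λ n → 0≤χ (coprime? n W)) ℕₚ.≤-refl 1≤W) refl)) (0<rec 1≤W)

χ-periodic : ∀ W j i → χ (coprime? (W ℕ.* j ℕ.+ i) W) ≡ χ (coprime? i W)
χ-periodic W j i = χ-cong (coprime? (W ℕ.* j ℕ.+ i) W) (coprime? i W)
  (λ c (d∣i , d∣W) → c (ℕ.∣m∣n⇒∣m+n (ℕ.∣-trans d∣W (ℕ.m∣m*n j)) d∣i , d∣W))
  (λ c (d∣ , d∣W) → c (ℕ.∣m+n∣m⇒∣n d∣ (ℕ.∣-trans d∣W (ℕ.m∣m*n j)) , d∣W))

coprimeHarmonic : ℕ → ℕ → ℚ
coprimeHarmonic W x = ∑ x (λ n → χ (coprime? n W) * rec n)

coprimeHarmonic-suc : ∀ W j → coprimeHarmonic W (W ℕ.* suc j) ≡ coprimeHarmonic W (W ℕ.* j) + ∑ W (λ i → χ (coprime? i W) * rec (W ℕ.* j ℕ.+ i))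
coprimeHarmonic-suc W j = trans (cong (coprimeHarmonic W) (trans (ℕₚ.*-suc W j) (ℕₚ.+-comm W _)))
  (trans (∑-split (W ℕ.* j) W (λ n → χ (coprime? n W) * rec n)) (cong (λ x → coprimeHarmonic W (W ℕ.* j) + x)
    (∑-cong W λ i _ _ → cong (_* rec (W ℕ.* j ℕ.+ i)) (χ-periodic W j i))))

density-rec : ∀ {W n} → 1 ℕ.≤ W → 1 ℕ.≤ n → ∑ W (λ i → χ (coprime? i W) * rec (W ℕ.* n)) ≡ density W * rec n
density-rec {W} {n} 1≤W 1≤n = trans (∑-*ʳ W (rec (W ℕ.* n)) (λ i → χ (coprime? i W))) (trans (cong (coprimeCount W *_) (rec-* 1≤W 1≤n)) (sym (ℚₚ.*-assoc (coprimeCount W) (rec W) (rec n))))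

coprimeHarmonic-block-≤ : ∀ {W} → 1 ℕ.≤ W → ∀ n → coprimeHarmonic W (W ℕ.* suc n) ≤ fromℕ W + density W * H n
coprimeHarmonic-block-≤ {W} 1≤W zero = ≤-≡ (cong (coprimeHarmonic W) (ℕₚ.*-identityʳ W))
  (∑-mono W {g = λ _ → 1ℚ} λ n _ _ → *-mono (0≤χ (coprime? n W)) 0≤1 (χ≤1 (coprime? n W)) (rec≤1 n))
  (trans (∑-const W 1ℚ) (solve 2 (λ w d → w :* con 1ℚ := w :+ d :* con 0ℚ) refl (fromℕ W) (density W)))
coprimeHarmonic-block-≤ {W} 1≤W (suc n) = ≤-≡ (coprimeHarmonic-suc W (suc n))
  (ℚₚ.+-mono-≤ (coprimeHarmonic-block-≤ 1≤W n) (∑-mono W λ i 1≤i _ → *-monoˡ (0≤χ (coprime? i W))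
    (rec-anti (ℕₚ.*-mono-≤ 1≤W (s≤s z≤n)) (ℕₚ.m≤m+n (W ℕ.* suc n) i))))
  (trans (cong (λ x → fromℕ W + density W * H n + x) (density-rec {W} {suc n} 1≤W (s≤s z≤n)))
    (solve 4 (λ w d h r → w :+ d :* h :+ d :* r := w :+ d :* (h :+ r)) refl (fromℕ W) (density W) (H n) (rec (suc n))))

coprimeHarmonic-block-≥ : ∀ {W} → 1 ℕ.≤ W → ∀ n → density W * H n ≤ coprimeHarmonic W (W ℕ.* n)
coprimeHarmonic-block-≥ {W} 1≤W zero = ≤-≡ (ℚₚ.*-zeroʳ (density W)) (0≤∑ (W ℕ.* 0) λ n _ _ → 0≤* (0≤χ (coprime? n W)) (0≤rec n)) refl
coprimeHarmonic-block-≥ {W} 1≤W (suc n) = ≤-≡ (trans (ℚₚ.*-distribˡ-+ (density W) (H n) (rec (suc n))) (cong (λ x → density W * H n + x) (sym (density-rec {W} {suc n} 1≤W (s≤s z≤n)))))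
  (ℚₚ.+-mono-≤ (coprimeHarmonic-block-≥ 1≤W n) (∑-mono W λ i 1≤i i≤W → *-monoˡ (0≤χ (coprime? i W))
    (rec-anti (ℕₚ.≤-trans 1≤i (ℕₚ.m≤n+m i _)) (ℕₚ.≤-trans (ℕₚ.+-monoʳ-≤ (W ℕ.* n) i≤W) (ℕₚ.≤-reflexive (trans (ℕₚ.+-comm (W ℕ.* n) W) (sym (ℕₚ.*-suc W n))))))))
  (sym (coprimeHarmonic-suc W n))

coprimeHarmonic-extend : ∀ {W x y} → x ℕ.≤ y → coprimeHarmonic W x ≤ coprimeHarmonic W y
coprimeHarmonic-extend {W} x≤y = ∑-extend x≤y λ n → 0≤* (0≤χ (coprime? n W)) (0≤rec n)

module _ (W x : ℕ) (1≤W : 1 ℕ.≤ W) where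
  private
    instance W≢0 = ℕ.>-nonZero 1≤W
    n = x ℕ./ W
    W*n≤x : W ℕ.* n ℕ.≤ x
    W*n≤x = ℕₚ.≤-trans (ℕₚ.≤-reflexive (ℕₚ.*-comm W n)) (ℕ.m/n*n≤m x W)
    x≤W*suc : x ℕ.≤ W ℕ.* suc n
    x≤W*suc = ℕₚ.≤-trans (ℕₚ.≤-reflexive (ℕ.m≡m%n+[m/n]*n x W)) (ℕₚ.≤-trans (ℕₚ.+-monoˡ-≤ (n ℕ.* W) (ℕₚ.<⇒≤ (ℕ.m%n<n x W))) (ℕₚ.≤-reflexive (ℕₚ.*-comm (suc n) W)))
    0≤κ = ℚₚ.<⇒≤ (0<density 1≤W)

  coprimeHarmonic-≤ : coprimeHarmonic W x ≤ fromℕ W + density W * H x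
  coprimeHarmonic-≤ = ℚₚ.≤-trans (coprimeHarmonic-extend {W} x≤W*suc) (ℚₚ.≤-trans (coprimeHarmonic-block-≤ 1≤W n)
    (ℚₚ.+-monoʳ-≤ (fromℕ W) (*-monoˡ 0≤κ (H-mono (ℕₚ.≤-trans (m≤p*m 1≤W n) W*n≤x)))))

  coprimeHarmonic-≥ : density W * H x ≤ coprimeHarmonic W x + density W * H W
  coprimeHarmonic-≥ = ℚₚ.≤-trans (*-monoˡ 0≤κ (ℚₚ.≤-trans (H-mono x≤W*suc) (H-*suc-≤ 1≤W n)))
    (≤-≡ (solve 3 (λ d a b → d :* (a :+ b) := d :* b :+ d :* a) refl (density W) (H W) (H n))
      (ℚₚ.+-monoˡ-≤ (density W * H W) (ℚₚ.≤-trans (coprimeHarmonic-block-≥ 1≤W n) (coprimeHarmonic-extend {W} W*n≤x))) refl)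

-- Summation by parts with one-sided bounds. It is applied to the difference between the coprime
-- harmonic terms and their expected density, once with either sign, so that `B` depends on `W`
-- alone.
abel : ∀ {B} (c g : ℕ → ℚ) → (∀ x → ∑ x c ≤ B) → (∀ n → 0ℚ ≤ g n) → Decreasing g → ∀ M → ∑ M (λ n → c n * g n) ≤ B * g 1
abel {B} c g bound 0≤g dec zero = 0≤* (bound 0) (0≤g 1)
abel {B} c g bound 0≤g dec (suc M) = ℚₚ.≤-trans (go M)
  (by-difference (0≤* (difference (bound (suc M))) (0≤g (suc M)))
    (solve 4 (λ b a x y → (b :- a) :* y := b :* x :- (b :* (x :- y) :+ a :* y)) refl B (∑ (suc M) c) (g 1) (g (suc M))))
  where
  go : ∀ M → ∑ (suc M) (λ n → c n * g n) ≤ B * (g 1 - g (suc M)) + ∑ (suc M) c * g (suc M)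
  go zero = ℚₚ.≤-reflexive (solve 3 (λ b c g → con 0ℚ :+ c :* g := b :* (g :- g) :+ (con 0ℚ :+ c) :* g) refl B (c 1) (g 1))
  go (suc M) = ℚₚ.≤-trans (ℚₚ.+-monoˡ-≤ (c (suc (suc M)) * g (suc (suc M))) (go M))
    (by-difference (0≤* (difference (bound (suc M))) (difference (dec (suc M) (suc (suc M)) (s≤s z≤n) (ℕₚ.n≤1+n _))))
      (solve 6 (λ b a c x y z → (b :- a) :* (y :- z) := b :* (x :- z) :+ (a :+ c) :* z :- (b :* (x :- y) :+ a :* y :+ c :* z)) refl
        B (∑ (suc M) c) (c (suc (suc M))) (g 1) (g (suc M)) (g (suc (suc M)))))

coprimeSum-≤ : ∀ {W} → 1 ℕ.≤ W → ∀ M (g : ℕ → ℚ) → (∀ n → 0ℚ ≤ g n) → Decreasing g →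
  coprimeSum M W (λ n → rec n * g n) ≤ density W * ∑ M (λ n → rec n * g n) + fromℕ W * g 1
coprimeSum-≤ {W} 1≤W M g 0≤g dec = by-difference
  (difference (abel (λ n → χ (coprime? n W) * rec n + (- density W) * rec n) g
    (λ x → ≤-≡ (trans (∑-+ x (λ n → χ (coprime? n W) * rec n) (λ n → (- density W) * rec n)) (cong (coprimeHarmonic W x +_) (∑-* x (- density W) rec)))
      (ℚₚ.+-monoˡ-≤ ((- density W) * H x) (coprimeHarmonic-≤ W x 1≤W))
      (solve 3 (λ w d h → w :+ d :* h :+ (:- d) :* h := w) refl (fromℕ W) (density W) (H x))) 0≤g dec M))
  (trans (cong (λ x → fromℕ W * g 1 - x) (trans (∑-cong M λ n _ _ → solve 4 (λ c d r g → (c :* r :+ (:- d) :* r) :* g := c :* (r :* g) :+ (:- d) :* (r :* g)) refl (χ (coprime? n W)) (density W) (rec n) (g n))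
      (trans (∑-+ M (λ n → χ (coprime? n W) * (rec n * g n)) (λ n → (- density W) * (rec n * g n))) (cong (coprimeSum M W (λ n → rec n * g n) +_) (∑-* M (- density W) (λ n → rec n * g n))))))
    (solve 4 (λ w c d s → w :- (c :+ (:- d) :* s) := d :* s :+ w :- c) refl (fromℕ W * g 1) (coprimeSum M W (λ n → rec n * g n)) (density W) (∑ M (λ n → rec n * g n))))

coprimeSum-≥ : ∀ {W} → 1 ℕ.≤ W → ∀ M (g : ℕ → ℚ) → (∀ n → 0ℚ ≤ g n) → Decreasing g →
  density W * ∑ M (λ n → rec n * g n) ≤ coprimeSum M W (λ n → rec n * g n) + density W * H W * g 1
coprimeSum-≥ {W} 1≤W M g 0≤g dec = by-difference
  (difference (abel (λ n → density W * rec n + - (χ (coprime? n W) * rec n)) g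
    (λ x → ≤-≡ (trans (∑-+ x (λ n → density W * rec n) (λ n → - (χ (coprime? n W) * rec n))) (cong₂ _+_ (∑-* x (density W) rec) (∑-neg x (λ n → χ (coprime? n W) * rec n))))
      (ℚₚ.+-monoˡ-≤ (- coprimeHarmonic W x) (coprimeHarmonic-≥ W x 1≤W))
      (solve 2 (λ c b → c :+ b :+ :- c := b) refl (coprimeHarmonic W x) (density W * H W))) 0≤g dec M))
  (trans (cong (λ x → density W * H W * g 1 - x) (trans (∑-cong M λ n _ _ → solve 4 (λ c d r g → (d :* r :+ :- (c :* r)) :* g := d :* (r :* g) :+ :- (c :* (r :* g))) refl (χ (coprime? n W)) (density W) (rec n) (g n))
      (trans (∑-+ M (λ n → density W * (rec n * g n)) (λ n → - (χ (coprime? n W) * (rec n * g n)))) (cong₂ _+_ (∑-* M (density W) (λ n → rec n * g n)) (∑-neg M (λ n → χ (coprime? n W) * (rec n * g n)))))))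
    (solve 3 (λ w c d → w :- (d :+ :- c) := c :+ w :- d) refl (density W * H W * g 1) (coprimeSum M W (λ n → rec n * g n)) (density W * ∑ M (λ n → rec n * g n))))

-- Convexity of powers, with the slope at the lower end here and at the upper end in
-- `^-increment-≤`. The pair replaces integration of x^m, both in the sieve sums and in the series
-- for log and exp.
^-increment-≥ : ∀ {b h} → 0ℚ ≤ b → 0ℚ ≤ h → ∀ m → b ^ suc m + fromℕ (suc m) * h * b ^ m ≤ (b + h) ^ suc m
^-increment-≥ {b} {h} 0≤b 0≤h zero = ℚₚ.≤-reflexive (solve 2 (λ b h → b :* con 1ℚ :+ con 1ℚ :* h :* con 1ℚ := (b :+ h) :* con 1ℚ) refl b h)
^-increment-≥ {b} {h} 0≤b 0≤h (suc m) = ℚₚ.≤-trans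
  (by-difference (0≤* (0≤* (0≤* (0≤fromℕ (suc m)) 0≤h) 0≤h) (0≤^ 0≤b m))
    (trans (solve 4 (λ b h f p → f :* h :* h :* p := (b :+ h) :* (b :* p :+ f :* h :* p) :- (b :* (b :* p) :+ (con 1ℚ :+ f) :* h :* (b :* p))) refl b h (fromℕ (suc m)) (b ^ m))
      (cong (λ f → (b + h) * (b ^ suc m + fromℕ (suc m) * h * b ^ m) - (b ^ suc (suc m) + f * h * b ^ suc m)) (sym (fromℕ-suc (suc m))))))
  (*-monoˡ (0≤+ 0≤b 0≤h) (^-increment-≥ 0≤b 0≤h m))

^-increment-≤ : ∀ {a b} → 0ℚ ≤ b → b ≤ a → ∀ m → a ^ suc m ≤ b ^ suc m + fromℕ (suc m) * a ^ m * (a - b)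
^-increment-≤ {a} {b} 0≤b b≤a zero = ℚₚ.≤-reflexive (solve 2 (λ a b → a :* con 1ℚ := b :* con 1ℚ :+ con 1ℚ :* con 1ℚ :* (a :- b)) refl a b)
^-increment-≤ {a} {b} 0≤b b≤a (suc m) = ℚₚ.≤-trans (*-monoˡ (ℚₚ.≤-trans 0≤b b≤a) (^-increment-≤ 0≤b b≤a m))
  (by-difference (0≤* (difference b≤a) (difference (^-mono 0≤b b≤a (suc m))))
    (trans (solve 5 (λ a b f p q → (a :- b) :* (a :* p :- b :* q) := b :* (b :* q) :+ (con 1ℚ :+ f) :* (a :* p) :* (a :- b) :- a :* (b :* q :+ f :* p :* (a :- b))) refl a b (fromℕ (suc m)) (a ^ m) (b ^ m))
      (cong (λ f → b ^ suc (suc m) + f * a ^ suc m * (a - b) - a * (b ^ suc m + fromℕ (suc m) * a ^ m * (a - b))) (sym (fromℕ-suc (suc m))))))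

-- Powers of log (R/n) and their sums over multiples.

-- t R n plays the part of the positive part of log (R / n).
t : ℕ → ℕ → ℚ
t R n = H R - H (n ℕ.⊓ R)

0≤t : ∀ R n → 0ℚ ≤ t R n
0≤t R n = difference (H-mono (ℕₚ.m⊓n≤n n R))

t-decreasing : ∀ R {m n} → m ℕ.≤ n → t R n ≤ t R m
t-decreasing R m≤n = ℚₚ.+-monoʳ-≤ (H R) (ℚₚ.neg-antimono-≤ (H-mono (ℕₚ.⊓-monoˡ-≤ R m≤n)))

t≤H : ∀ R n → t R n ≤ H R
t≤H R n = by-difference (0≤H (n ℕ.⊓ R)) (solve 2 (λ a b → b := a :- (a :- b)) refl (H R) (H (n ℕ.⊓ R)))

t-beyond : ∀ {R n} → R ℕ.≤ n → t R n ≡ 0ℚ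
t-beyond {R} {n} R≤n = trans (cong (λ k → H R - H k) (ℕₚ.m≥n⇒m⊓n≡n R≤n)) (ℚₚ.+-inverseʳ (H R))

t-suc : ∀ {R n} → suc n ℕ.≤ R → t R n ≡ t R (suc n) + rec (suc n)
t-suc {R} {n} n<R = trans (cong (λ k → H R - H k) (ℕₚ.m≤n⇒m⊓n≡m (ℕₚ.<⇒≤ n<R)))
  (trans (solve 3 (λ a b r → a :- b := a :- (b :+ r) :+ r) refl (H R) (H n) (rec (suc n)))
    (cong (λ k → H R - H k + rec (suc n)) (sym (ℕₚ.m≤n⇒m⊓n≡m n<R))))

t-suc-≤ : ∀ R n → t R n ≤ t R (suc n) + rec (suc n)
t-suc-≤ R n = case suc n ℕₚ.≤? R of λ
  { (yes n<R) → ℚₚ.≤-reflexive (t-suc n<R)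
  ; (no n≮R) → ≤-≡ (t-beyond (ℕₚ.≮⇒≥ n≮R)) (0≤+ (0≤t R (suc n)) (0≤rec (suc n))) refl }

-- Majorants and minorants of log^m (R/n). Each summation raises `m` by one and enlarges `c`,
-- upwards in `full` and downwards in `cut`; the enlarged `c` absorbs the lower order terms. `full`
-- needs the indicator of `n ≤ R` because `t + c` does not vanish beyond `R`, whereas `cut` with
-- `c > 0` vanishes there by itself.
full : ℕ → ℕ → ℚ → ℕ → ℚ
full R m c n = χ (n ℕₚ.≤? R) * (t R n + c) ^ m

cut : ℕ → ℕ → ℚ → ℕ → ℚ
cut R m c n = χ (c ℚₚ.≤? t R n) * (t R n - c) ^ m

full-yes : ∀ {R n} m c → n ℕ.≤ R → full R m c n ≡ (t R n + c) ^ m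
full-yes {R} {n} m c n≤R = trans (cong (_* (t R n + c) ^ m) (χ-yes (n ℕₚ.≤? R) n≤R)) (ℚₚ.*-identityˡ ((t R n + c) ^ m))

full-no : ∀ {R n} m c → R ℕ.< n → full R m c n ≡ 0ℚ
full-no {R} {n} m c R<n = trans (cong (_* (t R n + c) ^ m) (χ-no (n ℕₚ.≤? R) (ℕₚ.<⇒≱ R<n))) (ℚₚ.*-zeroˡ ((t R n + c) ^ m))

cut-yes : ∀ R n m {c} → c ≤ t R n → cut R m c n ≡ (t R n - c) ^ m
cut-yes R n m {c} c≤t = trans (cong (_* (t R n - c) ^ m) (χ-yes (c ℚₚ.≤? t R n) c≤t)) (ℚₚ.*-identityˡ ((t R n - c) ^ m))

cut-no : ∀ R n m {c} → t R n < c → cut R m c n ≡ 0ℚ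
cut-no R n m {c} t<c = trans (cong (_* (t R n - c) ^ m) (χ-no (c ℚₚ.≤? t R n) (<⇒≱ t<c))) (ℚₚ.*-zeroˡ ((t R n - c) ^ m))

≤⊎> : ∀ p q → p ≤ q ⊎ q < p
≤⊎> p q with p ℚₚ.≤? q
... | yes p≤q = inj₁ p≤q
... | no p≰q = inj₂ (ℚₚ.≰⇒> p≰q)

module _ (R m : ℕ) {c : ℚ} (0≤c : 0ℚ ≤ c) where
  0≤t+c : ∀ n → 0ℚ ≤ t R n + c
  0≤t+c n = 0≤+ (0≤t R n) 0≤c

  0≤full : ∀ n → 0ℚ ≤ full R m c n
  0≤full n = 0≤* (0≤χ (n ℕₚ.≤? R)) (0≤^ (0≤t+c n) m)

  full-decreasing : Decreasing (full R m c)
  full-decreasing k n _ k≤n = *-mono (0≤χ (n ℕₚ.≤? R)) (0≤^ (0≤t+c k) m) (χ-mono (n ℕₚ.≤? R) (k ℕₚ.≤? R) (ℕₚ.≤-trans k≤n))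
    (^-mono (0≤t+c n) (ℚₚ.+-monoˡ-≤ c (t-decreasing R k≤n)) m)

  full-telescope : ∀ n → fromℕ (suc m) * (rec (suc n) * full R m c (suc n)) ≤ (t R n + c) ^ suc m - (t R (suc n) + c) ^ suc m
  full-telescope n = case ℕₚ.<-≤-connex n R of λ
    { (inj₁ n<R) → by-difference
        (difference (≤-≡ refl (^-increment-≥ (0≤t+c (suc n)) (0≤rec (suc n)) m) (cong (_^ suc m)
          (trans (solve 3 (λ a b r → a :+ b :+ r := a :+ r :+ b) refl (t R (suc n)) c (rec (suc n))) (cong (_+ c) (sym (t-suc n<R)))))))
        (trans (solve 5 (λ x y f r p → x :- (y :+ f :* r :* p) := x :- y :- f :* (r :* p)) refl ((t R n + c) ^ suc m) ((t R (suc n) + c) ^ suc m) (fromℕ (suc m)) (rec (suc n)) ((t R (suc n) + c) ^ m))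
          (cong (λ x → (t R n + c) ^ suc m - (t R (suc n) + c) ^ suc m - fromℕ (suc m) * (rec (suc n) * x)) (sym (full-yes m c n<R))))
    ; (inj₂ R≤n) → ℚₚ.≤-reflexive (trans (cong (λ x → fromℕ (suc m) * (rec (suc n) * x)) (full-no m c (s≤s R≤n)))
        (trans (solve 2 (λ f r → f :* (r :* con 0ℚ) := con 0ℚ) refl (fromℕ (suc m)) (rec (suc n)))
          (sym (trans (cong₂ (λ x y → (x + c) ^ suc m - (y + c) ^ suc m) (t-beyond R≤n) (t-beyond (ℕₚ.m≤n⇒m≤1+n R≤n))) (ℚₚ.+-inverseʳ ((0ℚ + c) ^ suc m)))))) }

  full-tail : ∀ r K → fromℕ (suc m) * ∑ K (λ i → rec (r ℕ.+ i) * full R m c (r ℕ.+ i)) ≤ (t R r + c) ^ suc m - (t R (r ℕ.+ K) + c) ^ suc m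
  full-tail r zero = ℚₚ.≤-reflexive (trans (ℚₚ.*-zeroʳ (fromℕ (suc m))) (sym (trans (cong (λ k → (t R r + c) ^ suc m - (t R k + c) ^ suc m) (ℕₚ.+-identityʳ r)) (ℚₚ.+-inverseʳ ((t R r + c) ^ suc m)))))
  full-tail r (suc K) = ≤-≡ (trans (cong (λ k → fromℕ (suc m) * (∑ K (λ i → rec (r ℕ.+ i) * full R m c (r ℕ.+ i)) + rec k * full R m c k)) (ℕₚ.+-suc r K))
      (ℚₚ.*-distribˡ-+ (fromℕ (suc m)) (∑ K (λ i → rec (r ℕ.+ i) * full R m c (r ℕ.+ i))) (rec (suc (r ℕ.+ K)) * full R m c (suc (r ℕ.+ K)))))
    (ℚₚ.+-mono-≤ (full-tail r K) (full-telescope (r ℕ.+ K)))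
    (trans (solve 3 (λ a b c → a :- b :+ (b :- c) := a :- c) refl ((t R r + c) ^ suc m) ((t R (r ℕ.+ K) + c) ^ suc m) ((t R (suc (r ℕ.+ K)) + c) ^ suc m))
      (cong (λ k → (t R r + c) ^ suc m - (t R k + c) ^ suc m) (sym (ℕₚ.+-suc r K))))

-- A term `rec s * G (r s)` is `r` copies of `rec (r s) * G (r s)`, which are spread over the block
-- of `r` integers ending at `r s`. The term with `s = 1` has no block and remains as `G r`.
multiples-≤ : ∀ {G : ℕ → ℚ} → (∀ n → 0ℚ ≤ G n) → Decreasing G → ∀ {r} → 1 ℕ.≤ r → ∀ S →
  ∑ (suc S) (λ s → rec s * G (r ℕ.* s)) ≤ G r + ∑ (r ℕ.* S) (λ i → rec (r ℕ.+ i) * G (r ℕ.+ i))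
multiples-≤ {G} 0≤G dec {r} 1≤r zero = ℚₚ.≤-reflexive (trans (solve 1 (λ g → con 0ℚ :+ con 1ℚ :* g := g :+ con 0ℚ) refl (G (r ℕ.* 1)))
  (cong₂ (λ a b → G a + ∑ b (λ i → rec (r ℕ.+ i) * G (r ℕ.+ i))) (ℕₚ.*-identityʳ r) (sym (ℕₚ.*-zeroʳ r))))
multiples-≤ {G} 0≤G dec {r} 1≤r (suc S) = ≤-≡ refl (ℚₚ.+-mono-≤ (multiples-≤ 0≤G dec 1≤r S) block)
  (trans (ℚₚ.+-assoc (G r) (∑ (r ℕ.* S) f) (∑ r (λ i → f (r ℕ.* S ℕ.+ i)))) (cong (G r +_)
    (trans (sym (∑-split (r ℕ.* S) r f)) (cong (λ k → ∑ k f) (trans (ℕₚ.+-comm (r ℕ.* S) r) (sym (ℕₚ.*-suc r S)))))))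
  where
  f : ℕ → ℚ
  f i = rec (r ℕ.+ i) * G (r ℕ.+ i)
  end : ℕ
  end = r ℕ.* suc (suc S)
  below : ∀ {i} → i ℕ.≤ r → r ℕ.+ (r ℕ.* S ℕ.+ i) ℕ.≤ end
  below i≤r = ℕₚ.≤-trans (ℕₚ.+-monoʳ-≤ r (ℕₚ.+-monoʳ-≤ (r ℕ.* S) i≤r))
    (ℕₚ.≤-reflexive (trans (cong (r ℕ.+_) (trans (ℕₚ.+-comm (r ℕ.* S) r) (sym (ℕₚ.*-suc r S)))) (sym (ℕₚ.*-suc r (suc S)))))
  block : rec (suc (suc S)) * G end ≤ ∑ r (λ i → f (r ℕ.* S ℕ.+ i))
  block = ≤-≡ (trans (cong (_* G end) (sym (m*rec[mn] {r} {suc (suc S)} 1≤r (s≤s z≤n)))) (trans (ℚₚ.*-assoc (fromℕ r) (rec end) (G end)) (sym (∑-const r (rec end * G end)))))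
    (∑-mono r λ i _ i≤r → let 1≤ = ℕₚ.≤-trans 1≤r (ℕₚ.m≤m+n r (r ℕ.* S ℕ.+ i)) in
      *-mono (0≤rec end) (0≤G (r ℕ.+ (r ℕ.* S ℕ.+ i))) (rec-anti 1≤ (below i≤r)) (dec (r ℕ.+ (r ℕ.* S ℕ.+ i)) end 1≤ (below i≤r))) refl

-- Now the block begins at `r s`; this is the effect of `∸ 1`, the indices running from `r` to
-- `r + r S - 1`.
multiples-≥ : ∀ {G : ℕ → ℚ} → (∀ n → 0ℚ ≤ G n) → Decreasing G → ∀ {r} → 1 ℕ.≤ r → ∀ S →
  ∑ (r ℕ.* S) (λ i → rec (r ℕ.+ i ℕ.∸ 1) * G (r ℕ.+ i ℕ.∸ 1)) ≤ ∑ S (λ s → rec s * G (r ℕ.* s))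
multiples-≥ {G} 0≤G dec {r} 1≤r zero = ℚₚ.≤-reflexive (cong (λ k → ∑ k (λ i → rec (r ℕ.+ i ℕ.∸ 1) * G (r ℕ.+ i ℕ.∸ 1))) (ℕₚ.*-zeroʳ r))
multiples-≥ {G} 0≤G dec {r} 1≤r (suc S) = ≤-≡
  (trans (cong (λ k → ∑ k f) (trans (ℕₚ.*-suc r S) (ℕₚ.+-comm r (r ℕ.* S)))) (∑-split (r ℕ.* S) r f))
  (ℚₚ.+-mono-≤ (multiples-≥ 0≤G dec 1≤r S) block) refl
  where
  f : ℕ → ℚ
  f i = rec (r ℕ.+ i ℕ.∸ 1) * G (r ℕ.+ i ℕ.∸ 1)
  start : ℕ
  start = r ℕ.* suc S
  above : ∀ {i} → 1 ℕ.≤ i → start ℕ.≤ r ℕ.+ (r ℕ.* S ℕ.+ i) ℕ.∸ 1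
  above {suc i} _ = ℕₚ.≤-trans (ℕₚ.≤-reflexive (ℕₚ.*-suc r S)) (ℕₚ.≤-trans (ℕₚ.m≤m+n (r ℕ.+ r ℕ.* S) i)
    (ℕₚ.≤-reflexive (trans (ℕₚ.+-assoc r (r ℕ.* S) i) (sym (cong (ℕ._∸ 1) (trans (cong (r ℕ.+_) (ℕₚ.+-suc (r ℕ.* S) i)) (ℕₚ.+-suc r _)))))))
  1≤start : 1 ℕ.≤ start
  1≤start = ℕₚ.*-mono-≤ 1≤r (s≤s z≤n)
  block : ∑ r (λ i → f (r ℕ.* S ℕ.+ i)) ≤ rec (suc S) * G start
  block = ≤-≡ refl
    (∑-mono r λ i 1≤i _ → *-mono (0≤rec (r ℕ.+ (r ℕ.* S ℕ.+ i) ℕ.∸ 1)) (0≤G start) (rec-anti 1≤start (above 1≤i)) (dec start (r ℕ.+ (r ℕ.* S ℕ.+ i) ℕ.∸ 1) 1≤start (above 1≤i)))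
    (trans (∑-const r (rec start * G start)) (trans (sym (ℚₚ.*-assoc (fromℕ r) (rec start) (G start))) (cong (_* G start) (m*rec[mn] {r} {suc S} 1≤r (s≤s z≤n)))))

module _ (R m : ℕ) {c : ℚ} (0<c : 0ℚ < c) where
  0≤cut : ∀ n → 0ℚ ≤ cut R m c n
  0≤cut n = case ≤⊎> c (t R n) of λ
    { (inj₁ c≤t) → ≤-≡ refl (0≤^ (difference c≤t) m) (sym (cut-yes R n m c≤t))
    ; (inj₂ t<c) → ℚₚ.≤-reflexive (sym (cut-no R n m t<c)) }

  cut-decreasing : Decreasing (cut R m c)
  cut-decreasing k n _ k≤n = case ≤⊎> c (t R n) of λ
    { (inj₁ c≤t) → ≤-≡ (cut-yes R n m c≤t) (^-mono (difference c≤t) (ℚₚ.+-monoˡ-≤ (- c) tn≤tk) m) (sym (cut-yes R k m (ℚₚ.≤-trans c≤t tn≤tk)))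
    ; (inj₂ t<c) → ≤-≡ (cut-no R n m t<c) (0≤cut k) refl }
    where tn≤tk = t-decreasing R k≤n

  cut-vanish : ∀ n → R ℕ.≤ n → cut R m c n ≡ 0ℚ
  cut-vanish n R≤n = cut-no R n m (subst (_< c) (sym (t-beyond R≤n)) 0<c)

  cut-telescope : ∀ n → 1 ℕ.≤ n → cut R (suc m) c n - cut R (suc m) c (suc n) ≤ fromℕ (suc m) * (rec n * cut R m c n)
  cut-telescope n 1≤n = cases (≤⊎> c (t R n)) (≤⊎> c (t R (suc n)))
    where
    x = t R n - c
    y = t R (suc n) - c
    f = fromℕ (suc m)
    step : x - y ≤ rec n
    step = ℚₚ.≤-trans (by-difference (difference (t-suc-≤ R n)) (solve 4 (λ a b r c → b :+ r :- a := r :- (a :- c :- (b :- c))) refl (t R n) (t R (suc n)) (rec (suc n)) c))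
      (rec-anti 1≤n (ℕₚ.n≤1+n n))
    small : t R (suc n) < c → x ≤ rec n
    small b = ℚₚ.≤-trans (by-difference (0≤+ (difference (t-suc-≤ R n)) (difference (ℚₚ.<⇒≤ b))) (solve 4 (λ x y r c → y :+ r :- x :+ (c :- y) := r :- (x :- c)) refl (t R n) (t R (suc n)) (rec (suc n)) c))
      (rec-anti 1≤n (ℕₚ.n≤1+n n))
    cases : c ≤ t R n ⊎ t R n < c → c ≤ t R (suc n) ⊎ t R (suc n) < c → cut R (suc m) c n - cut R (suc m) c (suc n) ≤ fromℕ (suc m) * (rec n * cut R m c n)
    cases (inj₂ a) (inj₁ b) = contradiction (ℚₚ.≤-trans b (t-decreasing R (ℕₚ.n≤1+n n))) (<⇒≱ a)
    cases (inj₂ a) (inj₂ b) = ℚₚ.≤-reflexive (trans (cong₂ _-_ (cut-no R n (suc m) a) (cut-no R (suc n) (suc m) b))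
        (sym (trans (cong (λ x → fromℕ (suc m) * (rec n * x)) (cut-no R n m a)) (solve 2 (λ f r → f :* (r :* con 0ℚ) := con 0ℚ) refl (fromℕ (suc m)) (rec n)))))
    cases (inj₁ a) (inj₁ b) = ≤-≡ (cong₂ _-_ (cut-yes R n (suc m) a) (cut-yes R (suc n) (suc m) b))
        (by-difference {d = (y ^ suc m + f * x ^ m * (x - y) - x ^ suc m) + f * x ^ m * (rec n - (x - y))}
          (0≤+ (difference (^-increment-≤ (difference b) (ℚₚ.+-monoˡ-≤ (- c) (t-decreasing R (ℕₚ.n≤1+n n))) m))
               (0≤* (0≤* (0≤fromℕ (suc m)) (0≤^ (difference a) m)) (difference step)))
          (solve 6 (λ f u v p r w → (v :+ f :* p :* w :- u) :+ f :* p :* (r :- w) := f :* (r :* p) :- (u :- v)) refl f (x ^ suc m) (y ^ suc m) (x ^ m) (rec n) (x - y)))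
        (cong (λ z → f * (rec n * z)) (sym (cut-yes R n m a)))
    -- At the last point above the cutoff the whole x^(m+1) is lost in one step. There `x` is less
    -- than one step of `t`, hence at most 1/n, and the factor m + 1 is spare.
    cases (inj₁ a) (inj₂ b) = ≤-≡ (trans (cong₂ _-_ (cut-yes R n (suc m) a) (cut-no R (suc n) (suc m) b)) (ℚₚ.+-identityʳ (x ^ suc m)))
        (ℚₚ.≤-trans (*-monoʳ (0≤^ (difference a) m) (small b))
          (≤-≡ (sym (ℚₚ.*-identityˡ (rec n * x ^ m))) (*-monoʳ (0≤* (0≤rec n) (0≤^ (difference a) m)) (fromℕ-mono {1} {suc m} (s≤s z≤n))) refl))
        (cong (λ z → f * (rec n * z)) (sym (cut-yes R n m a)))

  cut-tail : ∀ {r} → 1 ℕ.≤ r → ∀ K → cut R (suc m) c r - cut R (suc m) c (r ℕ.+ K) ≤ fromℕ (suc m) * ∑ K (λ i → rec (r ℕ.+ i ℕ.∸ 1) * cut R m c (r ℕ.+ i ℕ.∸ 1))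
  cut-tail {r} 1≤r zero = ℚₚ.≤-reflexive (trans (cong (λ k → cut R (suc m) c r - cut R (suc m) c k) (ℕₚ.+-identityʳ r)) (trans (ℚₚ.+-inverseʳ (cut R (suc m) c r)) (sym (ℚₚ.*-zeroʳ (fromℕ (suc m))))))
  cut-tail {r} 1≤r (suc K) = ≤-≡ (trans (cong (λ k → cut R (suc m) c r - cut R (suc m) c k) (ℕₚ.+-suc r K)) (solve 3 (λ a b c → a :- c := a :- b :+ (b :- c)) refl (cut R (suc m) c r) (cut R (suc m) c (r ℕ.+ K)) (cut R (suc m) c (suc (r ℕ.+ K)))))
    (ℚₚ.+-mono-≤ (cut-tail 1≤r K) (cut-telescope (r ℕ.+ K) (ℕₚ.≤-trans 1≤r (ℕₚ.m≤m+n r K))))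
    (trans (sym (ℚₚ.*-distribˡ-+ (fromℕ (suc m)) (∑ K g) (rec (r ℕ.+ K) * cut R m c (r ℕ.+ K))))
      (cong (λ k → fromℕ (suc m) * (∑ K g + rec (k ℕ.∸ 1) * cut R m c (k ℕ.∸ 1))) (sym (ℕₚ.+-suc r K))))
    where
    g : ℕ → ℚ
    g i = rec (r ℕ.+ i ℕ.∸ 1) * cut R m c (r ℕ.+ i ℕ.∸ 1)

Op-zero : ∀ β ps n → Op β ps (λ _ → 0ℚ) n ≡ 0ℚ
Op-zero β [] n = refl
Op-zero β (p ∷ ps) n = trans (cong₂ (λ a b → a + β p * b) (Op-zero β ps n) (Op-zero β ps (p ℕ.* n))) (solve 1 (λ b → con 0ℚ :+ b :* con 0ℚ := con 0ℚ) refl (β p))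

∏₁ : (ℕ → ℚ) → List ℕ → ℚ
∏₁ e []       = 1ℚ
∏₁ e (p ∷ ps) = (1ℚ + e p) * ∏₁ e ps

1≤∏₁ : ∀ {e ps} → Weight e ps → 1ℚ ≤ ∏₁ e ps
1≤∏₁ [] = ℚₚ.≤-refl
1≤∏₁ {e} {p ∷ ps} (0≤e ∷ w) = ≤-≡ (sym (ℚₚ.*-identityˡ 1ℚ)) (*-mono {1ℚ} {1ℚ + e p} {1ℚ} {∏₁ e ps} 0≤1 (ℚₚ.≤-trans 0≤1 (1≤∏₁ w)) (p≤p+q 0≤e) (1≤∏₁ w)) refl

-- On decreasing functions T_p ≤ 1, so an extra weight `e p` costs at most a factor 1 + e p. It is
-- used to replace 1/(p - k) by 1/p, where the product of these factors over primes above `D` is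
-- close to 1.
Op-compare : ∀ {α β e ps} → Weight α ps → Weight β ps → Weight e ps → Positive ps → All (λ p → β p ≤ α p + e p) ps →
  ∀ {g} → (∀ n → 0ℚ ≤ g n) → Decreasing g → ∀ n → 1 ℕ.≤ n → Op β ps g n ≤ ∏₁ e ps * Op α ps g n
Op-compare [] [] [] [] [] {g} 0≤g dec n 1≤n = ℚₚ.≤-reflexive (sym (ℚₚ.*-identityˡ (g n)))
Op-compare {α} {β} {e} {p ∷ ps} (0≤α ∷ wα) (0≤β ∷ wβ) (0≤e ∷ we) (1≤p ∷ pos) (le ∷ les) {g} 0≤g dec n 1≤n =
  ℚₚ.≤-trans (ℚₚ.+-mono-≤ (IH n 1≤n) (*-monoˡ 0≤β (IH (p ℕ.* n) (ℕₚ.*-mono-≤ 1≤p 1≤n))))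
    (by-difference {d = ∏₁ e ps * (e p * (A - B) + (α p + e p - β p) * B + e p * α p * B)}
      (0≤* (ℚₚ.≤-trans 0≤1 (1≤∏₁ we)) (0≤+ (0≤+ (0≤* 0≤e (difference (Op-decreasing wα pos dec n (p ℕ.* n) 1≤n (m≤p*m 1≤p n)))) (0≤* (difference le) 0≤B)) (0≤* (0≤* 0≤e 0≤α) 0≤B)))
      (solve 6 (λ π a b e α β → π :* (e :* (a :- b) :+ (α :+ e :- β) :* b :+ e :* α :* b) := (con 1ℚ :+ e) :* π :* (a :+ α :* b) :- (π :* a :+ β :* (π :* b))) refl (∏₁ e ps) A B (e p) (α p) (β p)))
  where
  A = Op α ps g n
  B = Op α ps g (p ℕ.* n)
  0≤B = Op-0≤ wα 0≤g (p ℕ.* n)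
  IH = Op-compare wα wβ we pos les 0≤g dec

weaken-Op : ∀ {β qs} p {ps} → Weight β qs → 0ℚ ≤ β p → Weight β ps → ∀ {g} → (∀ n → 0ℚ ≤ g n) → ∀ n → Op β (qs ++ ps) g n ≤ Op β (qs ++ p ∷ ps) g n
weaken-Op {β} p {ps} [] 0≤β w 0≤g n = p≤p+q (0≤* 0≤β (Op-0≤ w 0≤g (p ℕ.* n)))
weaken-Op {β} {q ∷ qs} p {ps} (0≤βq ∷ wq) 0≤β w 0≤g n = ℚₚ.+-mono-≤ (weaken-Op p wq 0≤β w 0≤g n) (*-monoˡ 0≤βq (weaken-Op p wq 0≤β w 0≤g (q ℕ.* n)))

-- Sieve sums of one and of several dimensions.

record SieveRange (W R : ℕ) (ps : List ℕ) : Set where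
  field
    1≤W   : 1 ℕ.≤ W
    1≤R   : 1 ℕ.≤ R
    sieving : Sieving W ps
    covers  : ∀ n → 2 ℕ.≤ n → n ℕ.≤ R → Coprime n W → ∃[ p ] p ∈ ps × p ∣ n

-- In `Op-full` two boundary terms are multiples of (t + c)^m: the term `s = 1` of `multiples-≤`,
-- which gives the 1, and the error of `coprimeSum-≤`, which gives W/κ. By `^-increment-≥` a shift
-- of this size in the next power covers both.
upperShift : ℕ → ℚ
upperShift W = 1ℚ + fromℕ W * inv₀ (density W)

module _ {W R ps} (range : SieveRange W R ps) where
  open SieveRange range
  private
    κ = density W
    0<κ = 0<density 1≤W
    0≤κ = ℚₚ.<⇒≤ 0<κ
    positive-ps = sieving⇒positive sieving

  0≤upperShift : 0ℚ ≤ upperShift W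
  0≤upperShift = 0≤+ 0≤1 (0≤* (0≤fromℕ W) (ℚₚ.<⇒≤ (0<inv₀ 0<κ)))

  Op-full : ∀ m {c} → 0ℚ ≤ c → ∀ n → 1 ℕ.≤ n →
    Op rec ps (full R m c) n ≤ κ * (rec (suc m) * full R (suc m) (c + upperShift W) n)
  Op-full m {c} 0≤c n 1≤n = case ℕₚ.≤-<-connex n R of λ
    { (inj₁ n≤R) → inside n≤R
    ; (inj₂ R<n) → ≤-≡ (sym (trans (Op-shift rec ps F n 1) (cong (Op rec ps F) (ℕₚ.*-identityʳ n))))
        (ℚₚ.≤-trans (Op-mono (sieving⇒weight 0≤rec sieving) positive-ps (λ s 1≤s → ℚₚ.≤-reflexive (full-no m c (ℕₚ.≤-trans R<n (ℕₚ.≤-trans (ℕₚ.≤-reflexive (sym (ℕₚ.*-identityʳ n))) (ℕₚ.*-monoʳ-≤ n 1≤s))))) 1 ℕₚ.≤-refl)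
          (≤-≡ (Op-zero rec ps 1) (0≤* 0≤κ (0≤* (0≤rec (suc m)) (0≤full R (suc m) (0≤+ 0≤c 0≤upperShift) n))) refl)) refl }
    where
    F = full R m c
    G : ℕ → ℚ
    G s = F (n ℕ.* s)
    T = t R n + c
    S = ℕ.pred R
    sucS≡R : suc S ≡ R
    sucS≡R = ℕₚ.suc-pred R {{ℕ.>-nonZero 1≤R}}
    tail-sum = ∑ (n ℕ.* S) (λ i → rec (n ℕ.+ i) * F (n ℕ.+ i))
    inside : n ℕ.≤ R → Op rec ps (full R m c) n ≤ κ * (rec (suc m) * full R (suc m) (c + upperShift W) n)
    inside n≤R = ≤-≡ (sym (trans (Op-shift rec ps F n 1) (cong (Op rec ps F) (ℕₚ.*-identityʳ n))))
      (ℚₚ.≤-trans (harmonic≥Op sieving R 1≤R G (λ s → 0≤full R m 0≤c (n ℕ.* s)) λ s R<s → full-no m c (ℕₚ.≤-trans R<s (m≤p*m 1≤n s)))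
      (ℚₚ.≤-trans (coprimeSum-≤ 1≤W R G (λ s → 0≤full R m 0≤c (n ℕ.* s)) λ a b 1≤a a≤b → full-decreasing R m 0≤c (n ℕ.* a) (n ℕ.* b) (ℕₚ.*-mono-≤ 1≤n 1≤a) (ℕₚ.*-monoʳ-≤ n a≤b))
      (ℚₚ.≤-trans (ℚₚ.+-mono-≤ (*-monoˡ 0≤κ (subst (λ k → ∑ k (λ s → rec s * G s) ≤ F n + tail-sum) sucS≡R (multiples-≤ (0≤full R m 0≤c) (full-decreasing R m 0≤c) 1≤n S)))
                    (ℚₚ.≤-reflexive (cong (λ k → fromℕ W * F k) (ℕₚ.*-identityʳ n))))
      (by-difference {d = κ * (rec (suc m) * (T ^ suc m - fromℕ (suc m) * tail-sum)) + κ * (rec (suc m) * ((T + upperShift W) ^ suc m - (T ^ suc m + fromℕ (suc m) * upperShift W * T ^ m)))}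
        (0≤+ (0≤* 0≤κ (0≤* (0≤rec (suc m)) (difference {q = T ^ suc m} (ℚₚ.≤-trans (full-tail R m 0≤c n (n ℕ.* S)) (by-difference (0≤^ (0≤t+c R m 0≤c (n ℕ.+ n ℕ.* S)) (suc m)) (solve 2 (λ a b → b := a :- (a :- b)) refl (T ^ suc m) ((t R (n ℕ.+ n ℕ.* S) + c) ^ suc m)))))))
             (0≤* 0≤κ (0≤* (0≤rec (suc m)) (difference (^-increment-≥ (0≤t+c R m 0≤c n) 0≤upperShift m)))))
        (trans (solve 8 (λ κ r f s a b p u → κ :* (r :* (a :- f :* s)) :+ κ :* (r :* (b :- (a :+ f :* u :* p))) := κ :* (r :* b) :- (κ :* ((f :* r) :* s) :+ κ :* (con 1ℚ :+ (u :- con 1ℚ)) :* (f :* r) :* p)) refl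
            κ (rec (suc m)) (fromℕ (suc m)) tail-sum (T ^ suc m) ((T + upperShift W) ^ suc m) (T ^ m) (upperShift W))
          (trans (cong (λ x → κ * (rec (suc m) * (T + upperShift W) ^ suc m) - (κ * (x * tail-sum) + κ * (1ℚ + (upperShift W - 1ℚ)) * x * T ^ m)) (n*rec {suc m} (s≤s z≤n)))
            (trans (solve 6 (λ κ a s w i p → a :- (κ :* (con 1ℚ :* s) :+ κ :* (con 1ℚ :+ (con 1ℚ :+ w :* i :- con 1ℚ)) :* con 1ℚ :* p) := a :- (κ :* (p :+ s) :+ w :* (κ :* i) :* p)) refl κ (κ * (rec (suc m) * (T + upperShift W) ^ suc m)) tail-sum (fromℕ W) (inv₀ κ) (T ^ m))
              (cong₂ (λ x y → κ * (rec (suc m) * x) - y) (trans (cong (_^ suc m) (ℚₚ.+-assoc (t R n) c (upperShift W))) (sym (full-yes (suc m) (c + upperShift W) n≤R)))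
                (cong₂ (λ x y → κ * (x + tail-sum) + y * x) (sym (full-yes m c n≤R)) (trans (cong (fromℕ W *_) (inv₀-inverse 0<κ)) (ℚₚ.*-identityʳ (fromℕ W))))))))))))
      refl

  -- With x = t - c, the boundary loss κ `H W` x^m turns x^(m+1) into x^m (x - (m+1) `H W`), which
  -- is at least (x - (m+1) `H W`)^(m+1): hence the raised cutoff. The weights are 1/(p-1) because
  -- prime powers have to be accounted for in a lower bound.
  Op-cut : ∀ m {c} → 0ℚ < c → ∀ n → 1 ℕ.≤ n →
    κ * (rec (suc m) * cut R (suc m) (c + fromℕ (suc m) * H W) n) ≤ Op recφ ps (cut R m c) n
  Op-cut m {c} 0<c n 1≤n = case ≤⊎> (c + fromℕ (suc m) * H W) (t R n) of λ
    { (inj₁ le) → inside le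
    ; (inj₂ gt) → ≤-≡ (trans (cong (λ x → κ * (rec (suc m) * x)) (cut-no R n (suc m) gt)) (solve 2 (λ a b → a :* (b :* con 0ℚ) := con 0ℚ) refl κ (rec (suc m))))
        (Op-0≤ (sieving⇒weight (λ p → 0≤rec (p ℕ.∸ 1)) sieving) (0≤cut R m 0<c) n) refl }
    where
    F = cut R m c
    f = fromℕ (suc m)
    G : ℕ → ℚ
    G s = F (n ℕ.* s)
    x = t R n - c
    sum-F = ∑ (n ℕ.* R) (λ i → rec (n ℕ.+ i ℕ.∸ 1) * F (n ℕ.+ i ℕ.∸ 1))
    C = coprimeSum R W (λ s → rec s * G s)
    inside : c + f * H W ≤ t R n → κ * (rec (suc m) * cut R (suc m) (c + f * H W) n) ≤ Op recφ ps (cut R m c) n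
    inside le = ℚₚ.≤-trans (≤-≡ (cong (λ z → κ * (rec (suc m) * z)) (cut-yes R n (suc m) le))
        (by-difference {d = κ * rec (suc m) * (f * sum-F - x ^ suc m) + κ * rec (suc m) * ((x - f * H W) * (x ^ m - y ^ m)) + (C + κ * H W * x ^ m - κ * sum-F)}
          (0≤+ (0≤+ (0≤* (0≤* 0≤κ (0≤rec (suc m))) (difference (≤-≡ (sym (trans (cong₂ _-_ (cut-yes R n (suc m) c≤t) (cut-vanish R (suc m) 0<c (n ℕ.+ n ℕ.* R) (ℕₚ.≤-trans (m≤p*m 1≤n R) (ℕₚ.m≤n+m (n ℕ.* R) n)))) (ℚₚ.+-identityʳ (x ^ suc m)))) (cut-tail R m 0<c 1≤n (n ℕ.* R)) refl)))
                    (0≤* (0≤* 0≤κ (0≤rec (suc m))) (0≤* (difference shift≤x) (difference (^-mono 0≤y y≤x m)))))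
               (difference (≤-≡ refl (ℚₚ.≤-trans (*-monoˡ 0≤κ (multiples-≥ (0≤cut R m 0<c) (cut-decreasing R m 0<c) 1≤n R))
                 (coprimeSum-≥ 1≤W R G (λ s → 0≤cut R m 0<c (n ℕ.* s)) decG)) (cong (λ z → C + κ * H W * z) (trans (cong F (ℕₚ.*-identityʳ n)) (cut-yes R n m c≤t))))))
          (trans (solve 9 (λ κ r f s x p h q C → κ :* r :* (f :* s :- x :* p) :+ κ :* r :* ((x :- f :* h) :* (p :- q)) :+ (C :+ κ :* h :* p :- κ :* s)
              := C :- κ :* (r :* ((x :- f :* h) :* q)) :+ κ :* (f :* r :- con 1ℚ) :* (s :- h :* p)) refl κ (rec (suc m)) f sum-F x (x ^ m) (H W) (y ^ m) C)
            (trans (cong (λ z → C - κ * (rec (suc m) * ((x - f * H W) * y ^ m)) + κ * (z - 1ℚ) * (sum-F - H W * x ^ m)) (n*rec {suc m} (s≤s z≤n)))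
              (trans (solve 3 (λ a k s → a :+ k :* (con 1ℚ :- con 1ℚ) :* s := a) refl (C - κ * (rec (suc m) * ((x - f * H W) * y ^ m))) κ (sum-F - H W * x ^ m))
                (cong (λ z → C - κ * (rec (suc m) * (z * y ^ m))) (solve 3 (λ t c h → t :- c :- h := t :- (c :+ h)) refl (t R n) c (f * H W)))))))
        refl)
      (≤-≡ refl (harmonic≤Op sieving R covers G (λ s → 0≤cut R m 0<c (n ℕ.* s)) decG λ s R<s → cut-vanish R m 0<c (n ℕ.* s) (ℕₚ.≤-trans (ℕₚ.<⇒≤ R<s) (m≤p*m 1≤n s)))
        (trans (Op-shift recφ ps F n 1) (cong (Op recφ ps F) (ℕₚ.*-identityʳ n))))
      where
      0≤fh = 0≤* (0≤fromℕ (suc m)) (0≤H W)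
      c≤t = ℚₚ.≤-trans (p≤p+q 0≤fh) le
      y = t R n - (c + f * H W)
      0≤y = difference le
      y≤x : y ≤ x
      y≤x = by-difference 0≤fh (solve 3 (λ t c h → h := t :- c :- (t :- (c :+ h))) refl (t R n) c (f * H W))
      shift≤x : f * H W ≤ x
      shift≤x = by-difference 0≤y (solve 3 (λ t c h → t :- (c :+ h) := t :- c :- h) refl (t R n) c (f * H W))
      decG : Decreasing G
      decG a b 1≤a a≤b = cut-decreasing R m 0<c (n ℕ.* a) (n ℕ.* b) (ℕₚ.*-mono-≤ 1≤n 1≤a) (ℕₚ.*-monoʳ-≤ n a≤b)

-- fall m j = m! / (m + j)!
fall : ℕ → ℕ → ℚ
fall m zero    = 1ℚ
fall m (suc j) = rec (suc (j ℕ.+ m)) * fall m j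

0≤fall : ∀ m j → 0ℚ ≤ fall m j
0≤fall m zero = 0≤1
0≤fall m (suc j) = 0≤* (0≤rec (suc (j ℕ.+ m))) (0≤fall m j)

Op-weight0 : ∀ (β : ℕ → ℚ) ps g n → Op (λ p → fromℕ 0 * β p) ps g n ≡ g n
Op-weight0 β [] g n = refl
Op-weight0 β (p ∷ ps) g n = trans (cong₂ (λ a b → a + fromℕ 0 * β p * b) (Op-weight0 β ps g n) (Op-weight0 β ps g (p ℕ.* n)))
  (solve 3 (λ a b c → a :+ con 0ℚ :* b :* c := a) refl (g n) (β p) (g (p ℕ.* n)))

cut-anti : ∀ R m {c c′} → c ≤ c′ → ∀ n → cut R m c′ n ≤ cut R m c n
cut-anti R m {c} {c′} c≤c′ n = case ≤⊎> c′ (t R n) of λ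
  { (inj₁ c′≤t) → ≤-≡ (cut-yes R n m c′≤t) (^-mono (difference c′≤t) (ℚₚ.+-monoʳ-≤ (t R n) (ℚₚ.neg-antimono-≤ c≤c′)) m) (sym (cut-yes R n m (ℚₚ.≤-trans c≤c′ c′≤t)))
  ; (inj₂ t<c′) → ≤-≡ (cut-no R n m t<c′) (nonneg (≤⊎> c (t R n))) refl }
  where
  nonneg : c ≤ t R n ⊎ t R n < c → 0ℚ ≤ cut R m c n
  nonneg (inj₁ c≤t) = ≤-≡ refl (0≤^ (difference c≤t) m) (sym (cut-yes R n m c≤t))
  nonneg (inj₂ t<c) = ℚₚ.≤-reflexive (sym (cut-no R n m t<c))

cut-* : ∀ R m m′ c n → cut R m c n * cut R m′ c n ≡ cut R (m ℕ.+ m′) c n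
cut-* R m m′ c n = case ≤⊎> c (t R n) of λ
  { (inj₁ c≤t) → trans (cong₂ _*_ (cut-yes R n m c≤t) (cut-yes R n m′ c≤t)) (trans (sym (^-+ (t R n - c) m m′)) (sym (cut-yes R n (m ℕ.+ m′) c≤t)))
  ; (inj₂ t<c) → trans (cong₂ _*_ (cut-no R n m t<c) (cut-no R n m′ t<c)) (sym (cut-no R n (m ℕ.+ m′) t<c)) }

excess : ℕ → ℕ → ℚ
excess k p = rec (p ℕ.∸ k) - rec p

module _ {W R ps} (range : SieveRange W R ps) (k : ℕ) (large : All (k ℕ.<_) ps) where
  open SieveRange range
  private
    κ = density W
    0<κ = 0<density 1≤W
    0≤κ = ℚₚ.<⇒≤ 0<κ
    u = upperShift W
    0≤u = 0≤upperShift range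
    positive-ps = sieving⇒positive sieving
    weight : ∀ {β} → (∀ p → 0ℚ ≤ β p) → Weight β ps
    weight h = sieving⇒weight h sieving
    E = ∏₁ (excess k) ps
    weight-excess : Weight (excess k) ps
    weight-excess = All.map (λ {p} k<p → difference (rec-anti {p ℕ.∸ k} {p} (ℕₚ.m<n⇒0<n∸m k<p) (ℕₚ.m∸n≤m p k))) large
    0≤E = ℚₚ.≤-trans 0≤1 (1≤∏₁ weight-excess)
    z ζ : ℕ → ℕ → ℚ
    z j p = fromℕ j * rec (p ℕ.∸ k)
    ζ j p = fromℕ j * rec (p ℕ.∸ suc j)
    0≤z : ∀ j p → 0ℚ ≤ z j p
    0≤z j p = 0≤* (0≤fromℕ j) (0≤rec (p ℕ.∸ k))
    0≤ζ : ∀ j p → 0ℚ ≤ ζ j p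
    0≤ζ j p = 0≤* (0≤fromℕ j) (0≤rec (p ℕ.∸ suc j))
    0≤recφ : ∀ p → 0ℚ ≤ recφ p
    0≤recφ p = 0≤rec (p ℕ.∸ 1)

  -- The weight j/(p-k) is dominated by j successive weights 1/(p-k). Each of these is replaced by
  -- 1/p at the cost of a factor `E` and then summed by `Op-full`.
  Op^-full : ∀ m {c} → 0ℚ ≤ c → ∀ j n → 1 ℕ.≤ n →
    Op (λ p → fromℕ j * rec (p ℕ.∸ k)) ps (full R m c) n ≤ (E * κ) ^ j * (fall m j * full R (j ℕ.+ m) (c + fromℕ j * u) n)
  Op^-full m {c} 0≤c zero n 1≤n = ℚₚ.≤-reflexive (trans (Op-weight0 (λ p → rec (p ℕ.∸ k)) ps (full R m c) n)
    (trans (cong (λ x → full R m x n) (solve 2 (λ c u → c := c :+ con 0ℚ :* u) refl c u)) (solve 1 (λ x → x := con 1ℚ :* (con 1ℚ :* x)) refl (full R m (c + fromℕ 0 * u) n))))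
  Op^-full m {c} 0≤c (suc j) n 1≤n =
    ℚₚ.≤-trans (Op-compose-≥ (weight 0≤β) (weight (0≤z j)) (weight (0≤z (suc j))) positive-ps
        (All.universal (λ p → ℚₚ.≤-reflexive (trans (cong (_* β p) (fromℕ-suc j)) (solve 2 (λ f b → (con 1ℚ :+ f) :* b := b :+ f :* b) refl (fromℕ j) (β p)))) ps)
        (0≤full R m 0≤c) n 1≤n)
    (ℚₚ.≤-trans (Op-mono (weight 0≤β) positive-ps (Op^-full m 0≤c j) n 1≤n)
    (≤-≡ (trans (Op-cong β ps (λ s → sym (ℚₚ.*-assoc ((E * κ) ^ j) (fall m j) (F s))) n) (Op-* β ps ((E * κ) ^ j * fall m j) F n))
      (*-monoˡ (0≤* (0≤^ (0≤* 0≤E 0≤κ) j) (0≤fall m j))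
        (ℚₚ.≤-trans (Op-compare (weight 0≤rec) (weight 0≤β) weight-excess positive-ps
            (All.universal (λ p → ℚₚ.≤-reflexive (solve 2 (λ a b → b := a :+ (b :- a)) refl (rec p) (β p))) ps) (0≤full R (j ℕ.+ m) 0≤c′) (full-decreasing R (j ℕ.+ m) 0≤c′) n 1≤n)
          (*-monoˡ 0≤E (Op-full range (j ℕ.+ m) 0≤c′ n 1≤n))))
      (trans (solve 6 (λ q f e k r x → q :* f :* (e :* (k :* (r :* x))) := e :* k :* q :* (r :* f :* x)) refl ((E * κ) ^ j) (fall m j) E κ (rec (suc (j ℕ.+ m))) (full R (suc (j ℕ.+ m)) (c + fromℕ j * u + u) n))
        (cong (λ x → (E * κ) ^ suc j * (fall m (suc j) * full R (suc (j ℕ.+ m)) x n))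
          (trans (solve 3 (λ c f u → c :+ f :* u :+ u := c :+ (con 1ℚ :+ f) :* u) refl c (fromℕ j) u) (cong (λ f → c + f * u) (sym (fromℕ-suc j))))))))
    where
    β : ℕ → ℚ
    β p = rec (p ℕ.∸ k)
    0≤β : ∀ p → 0ℚ ≤ β p
    0≤β p = 0≤rec (p ℕ.∸ k)
    F = full R (j ℕ.+ m) (c + fromℕ j * u)
    0≤c′ : 0ℚ ≤ c + fromℕ j * u
    0≤c′ = 0≤+ 0≤c (0≤* (0≤fromℕ j) 0≤u)

  lowerShift : ℕ → ℕ → ℚ
  lowerShift m zero    = 0ℚ
  lowerShift m (suc j) = lowerShift m j + fromℕ (suc (j ℕ.+ m)) * H W

  0≤lowerShift : ∀ m j → 0ℚ ≤ lowerShift m j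
  0≤lowerShift m zero = ℚₚ.≤-refl
  0≤lowerShift m (suc j) = 0≤+ (0≤lowerShift m j) (0≤* (0≤fromℕ (suc (j ℕ.+ m))) (0≤H W))

  -- With A = p - 1 and B = p - j - 1 one has 1/A + j/B + j/(A B) = (j + 1)/B.
  compose-weights : ∀ j p → suc (suc j) ℕ.< p → recφ p + ζ j p + recφ p * ζ j p ≤ ζ (suc j) p
  compose-weights j p j<p = ≤-≡
    (trans (solve 3 (λ a j r → a :+ j :* r :+ a :* (j :* r) := j :* r :+ a :* (con 1ℚ :+ j :* r)) refl a (fromℕ j) r)
      (trans (cong (λ x → fromℕ j * r + a * (x + fromℕ j * r)) (sym (n*rec {B} 1≤B)))
        (trans (solve 4 (λ a j r B → j :* r :+ a :* (B :* r :+ j :* r) := j :* r :+ (B :+ j) :* a :* r) refl a (fromℕ j) r (fromℕ B))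
          (trans (cong (λ x → fromℕ j * r + x * a * r) (trans (sym (fromℕ-+ B j)) (cong fromℕ A≡)))
            (trans (cong (λ x → fromℕ j * r + x * r) (n*rec {p ℕ.∸ 1} (ℕₚ.m<n⇒0<n∸m (ℕₚ.<-trans (s≤s (s≤s z≤n)) j<p)))) (solve 2 (λ j r → j :* r :+ con 1ℚ :* r := (con 1ℚ :+ j) :* r) refl (fromℕ j) r))))))
    (*-monoˡ (0≤+ 0≤1 (0≤fromℕ j)) (rec-anti {p ℕ.∸ suc (suc j)} {B} (ℕₚ.m<n⇒0<n∸m j<p) (ℕₚ.∸-monoʳ-≤ p (ℕₚ.n≤1+n (suc j)))))
    (cong (_* rec (p ℕ.∸ suc (suc j))) (sym (fromℕ-suc j)))
    where
    B = p ℕ.∸ suc j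
    1≤B : 1 ℕ.≤ B
    1≤B = ℕₚ.m<n⇒0<n∸m (ℕₚ.<-trans (ℕₚ.n<1+n (suc j)) j<p)
    a = recφ p
    r = rec B
    A≡ : B ℕ.+ j ≡ p ℕ.∸ 1
    A≡ = trans (cong (ℕ._+ j) (sym (ℕₚ.∸-+-assoc p 1 j))) (ℕₚ.m∸n+n≡m {p ℕ.∸ 1} {j} (ℕₚ.≤-trans (ℕₚ.≤-trans (ℕₚ.n≤1+n j) (ℕₚ.n≤1+n (suc j))) (ℕₚ.∸-monoˡ-≤ 1 j<p)))

  -- The weights j/(p-j-1) form a chain: following one of them by 1/(p-1) stays below the next. For
  -- j = k - 1 the chain ends at (k-1)/(p-k), the weight that the count of primes produces.
  Op^-cut : ∀ m {c} → 0ℚ < c → ∀ j → suc j ℕ.≤ k → ∀ n → 1 ℕ.≤ n →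
    κ ^ j * (fall m j * cut R (j ℕ.+ m) (c + lowerShift m j) n) ≤ Op (λ p → fromℕ j * rec (p ℕ.∸ suc j)) ps (cut R m c) n
  Op^-cut m {c} 0<c zero _ n 1≤n = ℚₚ.≤-reflexive (trans (solve 1 (λ x → con 1ℚ :* (con 1ℚ :* x) := x) refl (cut R m (c + 0ℚ) n))
    (trans (cong (λ x → cut R m x n) (ℚₚ.+-identityʳ c)) (sym (Op-weight0 (λ p → rec (p ℕ.∸ 1)) ps (cut R m c) n))))
  Op^-cut m {c} 0<c (suc j) j<k n 1≤n =
    ℚₚ.≤-trans (≤-≡ (trans (solve 5 (λ q k r f x → k :* q :* (r :* f :* x) := q :* f :* (k :* (r :* x))) refl (κ ^ j) κ (rec (suc (j ℕ.+ m))) (fall m j) (cut R (suc (j ℕ.+ m)) (c + (lowerShift m j + s)) n))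
          (cong (λ x → κ ^ j * fall m j * (κ * (rec (suc (j ℕ.+ m)) * cut R (suc (j ℕ.+ m)) x n))) (sym (ℚₚ.+-assoc c (lowerShift m j) s))))
        (*-monoˡ (0≤* (0≤^ 0≤κ j) (0≤fall m j)) (Op-cut range (j ℕ.+ m) (ℚₚ.+-mono-<-≤ 0<c (0≤lowerShift m j)) n 1≤n))
        (trans (sym (Op-* recφ ps (κ ^ j * fall m j) F n)) (Op-cong recφ ps (λ s → ℚₚ.*-assoc (κ ^ j) (fall m j) (F s)) n)))
    (ℚₚ.≤-trans (Op-mono (weight 0≤recφ) positive-ps (Op^-cut m 0<c j (ℕₚ.<⇒≤ j<k)) n 1≤n)
      (Op-compose-≤ (weight 0≤recφ) (weight (0≤ζ j)) (weight (0≤ζ (suc j))) positive-ps (All.map (λ {p} k<p → compose-weights j p (ℕₚ.≤-trans (s≤s j<k) k<p)) large)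
        (0≤cut R m 0<c) (cut-decreasing R m 0<c) n 1≤n))
    where
    s = fromℕ (suc (j ℕ.+ m)) * H W
    F = cut R (j ℕ.+ m) (c + lowerShift m j)

-- The sieve weight and the main terms.

module _ (R : ℕ) (d a : ℚ) (0<d : 0ℚ < d) (0≤a : 0ℚ ≤ a) where
  -- The sieve weight 1 + a (1 - u), u = log r / log R, made continuous at u = 1
  -- and multiplied by H R.
  sieveWeight : ℕ → ℚ
  sieveWeight r = (H R ⊓ (d * t R r)) + a * t R r

  0≤sieveWeight : ∀ r → 0ℚ ≤ sieveWeight r
  0≤sieveWeight r = 0≤+ (ℚₚ.⊓-glb (0≤H R) (0≤* (ℚₚ.<⇒≤ 0<d) (0≤t R r))) (0≤* 0≤a (0≤t R r))

  sieveWeight-decreasing : Decreasing sieveWeight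
  sieveWeight-decreasing m n _ m≤n = ℚₚ.+-mono-≤ (ℚₚ.⊓-monoʳ-≤ (H R) (*-monoˡ (ℚₚ.<⇒≤ 0<d) (t-decreasing R m≤n))) (*-monoˡ 0≤a (t-decreasing R m≤n))

  sieveWeight-vanish : ∀ n → R ℕ.≤ n → sieveWeight n ≡ 0ℚ
  sieveWeight-vanish n R≤n = trans (cong (λ x → (H R ⊓ (d * x)) + a * x) (t-beyond R≤n))
    (trans (cong₂ (λ x y → (H R ⊓ x) + y) (ℚₚ.*-zeroʳ d) (ℚₚ.*-zeroʳ a)) (trans (ℚₚ.+-identityʳ (H R ⊓ 0ℚ)) (ℚₚ.p≥q⇒p⊓q≡q (0≤H R))))

  sieveWeight-≤ : ∀ n → sieveWeight n ≤ H R + a * t R n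
  sieveWeight-≤ n = ℚₚ.+-monoˡ-≤ (a * t R n) (ℚₚ.p⊓q≤p (H R) (d * t R n))

  sieveWeight²-≤ : ∀ n → sieveWeight n * sieveWeight n ≤
    H R * H R * full R 0 0ℚ n + fromℕ 2 * a * H R * full R 1 0ℚ n + a * a * full R 2 0ℚ n
  sieveWeight²-≤ n = case ℕₚ.≤-<-connex n R of λ
    { (inj₁ n≤R) → ≤-≡ refl (*-mono (0≤sieveWeight n) (0≤+ (0≤H R) (0≤* 0≤a (0≤t R n))) (sieveWeight-≤ n) (sieveWeight-≤ n))
        (trans (solve 3 (λ l a t → (l :+ a :* t) :* (l :+ a :* t) := l :* l :* con 1ℚ :+ con (fromℕ 2) :* a :* l :* ((t :+ con 0ℚ) :* con 1ℚ) :+ a :* a :* ((t :+ con 0ℚ) :* ((t :+ con 0ℚ) :* con 1ℚ))) refl (H R) a (t R n))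
          (sym (cong₂ _+_ (cong₂ (λ x y → H R * H R * x + fromℕ 2 * a * H R * y) (full-yes 0 0ℚ n≤R) (full-yes 1 0ℚ n≤R)) (cong (a * a *_) (full-yes 2 0ℚ n≤R)))))
    ; (inj₂ R<n) → ≤-≡ (trans (cong (λ x → x * x) (sieveWeight-vanish n (ℕₚ.<⇒≤ R<n))) refl)
        (0≤+ (0≤+ (0≤* (0≤* (0≤H R) (0≤H R)) (0≤full R 0 ℚₚ.≤-refl n)) (0≤* (0≤* (0≤* (0≤fromℕ 2) 0≤a) (0≤H R)) (0≤full R 1 ℚₚ.≤-refl n))) (0≤* (0≤* 0≤a 0≤a) (0≤full R 2 ℚₚ.≤-refl n))) refl }

  sieveWeight-≥ : ∀ {c} → d * c ≡ H R → 0ℚ < c → ∀ n → H R * cut R 0 c n + a * cut R 1 c n ≤ sieveWeight n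
  sieveWeight-≥ {c} dc≡L 0<c n = case ≤⊎> c (t R n) of λ
    { (inj₁ c≤t) → ≤-≡ (trans (cong₂ (λ x y → H R * x + a * y) (cut-yes R n 0 c≤t) (cut-yes R n 1 c≤t)) (solve 3 (λ l a x → l :* con 1ℚ :+ a :* (x :* con 1ℚ) := l :+ a :* x) refl (H R) a (t R n - c)))
        (ℚₚ.+-mono-≤ (ℚₚ.⊓-glb ℚₚ.≤-refl (≤-≡ (sym dc≡L) (*-monoˡ (ℚₚ.<⇒≤ 0<d) c≤t) refl)) (*-monoˡ 0≤a (by-difference (ℚₚ.<⇒≤ 0<c) (solve 2 (λ t c → c := t :- (t :- c)) refl (t R n) c)))) refl
    ; (inj₂ t<c) → ≤-≡ (trans (cong₂ (λ x y → H R * x + a * y) (cut-no R n 0 t<c) (cut-no R n 1 t<c)) (solve 2 (λ l a → l :* con 0ℚ :+ a :* con 0ℚ := con 0ℚ) refl (H R) a)) (0≤sieveWeight n) refl }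

  t-lipschitz : ∀ {p} → 1 ℕ.≤ p → ∀ {n} → 1 ℕ.≤ n → t R n - t R (p ℕ.* n) ≤ H p
  t-lipschitz {p} 1≤p {n} 1≤n = ≤-≡ (solve 3 (λ l a b → l :- a :- (l :- b) := b :- a) refl (H R) (H (n ℕ.⊓ R)) (H (p ℕ.* n ℕ.⊓ R)))
    (case ℕₚ.≤-total n R of λ
      { (inj₁ n≤R) → by-difference (0≤+ (difference (H-mono (ℕₚ.m⊓n≤m (p ℕ.* n) R))) (difference (H-*-≤ p n)))
          (trans (solve 4 (λ x y p n → (x :- y) :+ (p :+ n :- x) := p :- (y :- n)) refl (H (p ℕ.* n)) (H (p ℕ.* n ℕ.⊓ R)) (H p) (H n)) (cong (λ x → H p - (H (p ℕ.* n ℕ.⊓ R) - H x)) (sym (ℕₚ.m≤n⇒m⊓n≡m n≤R))))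
      ; (inj₂ R≤n) → ≤-≡ (trans (cong₂ (λ x y → H x - H y) (ℕₚ.m≥n⇒m⊓n≡n (ℕₚ.≤-trans R≤n (m≤p*m 1≤p n))) (ℕₚ.m≥n⇒m⊓n≡n R≤n)) (ℚₚ.+-inverseʳ (H R))) (0≤H p) refl }) refl

  sieveWeight-lipschitz : ∀ {p} → 1 ℕ.≤ p → ∀ {n} → 1 ℕ.≤ n → sieveWeight n - sieveWeight (p ℕ.* n) ≤ (d + a) * H p
  sieveWeight-lipschitz {p} 1≤p {n} 1≤n = ℚₚ.≤-trans
    (by-difference {d = (m′ + d * (x - x′) - m)} (difference min-lip) (solve 6 (λ m m′ d x x′ a → m′ :+ d :* (x :- x′) :- m := (d :+ a) :* (x :- x′) :- (m :+ a :* x :- (m′ :+ a :* x′))) refl m m′ d x x′ a))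
    (*-monoˡ (0≤+ (ℚₚ.<⇒≤ 0<d) 0≤a) (t-lipschitz 1≤p 1≤n))
    where
    x = t R n
    x′ = t R (p ℕ.* n)
    m = H R ⊓ (d * x)
    m′ = H R ⊓ (d * x′)
    gap = difference (t-decreasing R (m≤p*m 1≤p n))
    min-lip : m ≤ m′ + d * (x - x′)
    min-lip = case ℚₚ.⊓-sel (H R) (d * x′) of λ
      { (inj₁ eq) → ℚₚ.≤-trans (ℚₚ.p⊓q≤p (H R) (d * x)) (≤-≡ (sym eq) (p≤p+q (0≤* (ℚₚ.<⇒≤ 0<d) gap)) refl)
      ; (inj₂ eq) → ℚₚ.≤-trans (ℚₚ.p⊓q≤q (H R) (d * x)) (ℚₚ.≤-reflexive (trans (solve 3 (λ d x y → d :* x := d :* y :+ d :* (x :- y)) refl d x x′) (cong (_+ d * (x - x′)) (sym eq)))) }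

module _ {W R ps} (range : SieveRange W R ps) (k : ℕ) (large : All (k ℕ.<_) ps) (d a : ℚ) (0<d : 0ℚ < d) (0≤a : 0ℚ ≤ a) where
  open SieveRange range
  private
    κ = density W
    0<κ = 0<density 1≤W
    0≤κ = ℚₚ.<⇒≤ 0<κ
    L = H R
    y = sieveWeight R d a 0<d 0≤a
    positive-ps = sieving⇒positive sieving
    weight : ∀ {β} → (∀ p → 0ℚ ≤ β p) → Weight β ps
    weight h = sieving⇒weight h sieving
    u = upperShift W
    E = ∏₁ (excess k) ps
    z : ℕ → ℚ
    z p = fromℕ k * rec (p ℕ.∸ k)
    0≤z : ∀ p → 0ℚ ≤ z p
    0≤z p = 0≤* (0≤fromℕ k) (0≤rec (p ℕ.∸ k))

  -- Since `fall m k` is the integral of u^(k-1)/(k-1)! (1-u)^m over [0, 1] for k ≥ 1, this is the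
  -- integral of u^(k-1)/(k-1)! (1 + a (1-u))².
  quadraticConst : ℚ
  quadraticConst = fall 0 k + fromℕ 2 * a * fall 1 k + a * a * fall 2 k

  private
    Y = L + fromℕ k * u
    0≤L = 0≤H R
    0≤ku = 0≤* (0≤fromℕ k) (0≤upperShift range)
    0≤Y = 0≤+ 0≤L 0≤ku
    L≤Y : L ≤ Y
    L≤Y = p≤p+q 0≤ku
    0≤E : 0ℚ ≤ E
    0≤E = ℚₚ.≤-trans 0≤1 (1≤∏₁ (All.map (λ {p} k<p → difference (rec-anti {p ℕ.∸ k} {p} (ℕₚ.m<n⇒0<n∸m k<p) (ℕₚ.m∸n≤m p k))) large))
    0≤C = 0≤^ (0≤* 0≤E 0≤κ) k

  Op-full-1 : ∀ m → Op z ps (full R m 0ℚ) 1 ≤ (E * κ) ^ k * (fall m k * (Y ^ k * Y ^ m))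
  Op-full-1 m = ℚₚ.≤-trans (Op^-full range k large m ℚₚ.≤-refl k 1 ℕₚ.≤-refl)
    (*-monoˡ 0≤C (*-monoˡ (0≤fall m k) (ℚₚ.≤-trans
      (*-mono (0≤χ (1 ℕₚ.≤? R)) (0≤^ 0≤Y (k ℕ.+ m)) (χ≤1 (1 ℕₚ.≤? R)) (^-mono (0≤+ (0≤t R 1) (0≤+ ℚₚ.≤-refl 0≤ku)) (≤-≡ refl (ℚₚ.+-monoˡ-≤ (0ℚ + fromℕ k * u) (t≤H R 1)) (cong (L +_) (ℚₚ.+-identityˡ (fromℕ k * u)))) (k ℕ.+ m)))
      (ℚₚ.≤-reflexive (trans (ℚₚ.*-identityˡ (Y ^ (k ℕ.+ m))) (^-+ Y k m))))))

  main-upper : Op z ps (λ n → y n * y n) 1 ≤ (E * κ) ^ k * (Y ^ k * Y ^ 2) * quadraticConst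
  main-upper = ℚₚ.≤-trans (Op-mono (weight 0≤z) positive-ps (λ n _ → sieveWeight²-≤ R d a 0<d 0≤a n) 1 ℕₚ.≤-refl)
    (≤-≡ (trans (Op-+ z ps (λ n → L * L * full R 0 0ℚ n + fromℕ 2 * a * L * full R 1 0ℚ n) (λ n → a * a * full R 2 0ℚ n) 1)
        (cong₂ _+_ (trans (Op-+ z ps (λ n → L * L * full R 0 0ℚ n) (λ n → fromℕ 2 * a * L * full R 1 0ℚ n) 1)
          (cong₂ _+_ (Op-* z ps (L * L) (full R 0 0ℚ) 1) (Op-* z ps (fromℕ 2 * a * L) (full R 1 0ℚ) 1))) (Op-* z ps (a * a) (full R 2 0ℚ) 1)))
      (ℚₚ.+-mono-≤ (ℚₚ.+-mono-≤
        (*-mono (0≤* 0≤L 0≤L) (big 0) (*-mono 0≤L 0≤Y L≤Y L≤Y) (Op-full-1 0))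
        (*-mono (0≤* 0≤2a 0≤L) (big 1) (*-monoˡ 0≤2a L≤Y) (Op-full-1 1)))
        (*-monoˡ (0≤* 0≤a 0≤a) (Op-full-1 2)))
      (solve 7 (λ C Y q a f g h → Y :* Y :* (C :* (f :* (q :* con 1ℚ))) :+ con (fromℕ 2) :* a :* Y :* (C :* (g :* (q :* (Y :* con 1ℚ)))) :+ a :* a :* (C :* (h :* (q :* (Y :* (Y :* con 1ℚ)))))
          := C :* (q :* (Y :* (Y :* con 1ℚ))) :* (f :+ con (fromℕ 2) :* a :* g :+ a :* a :* h)) refl ((E * κ) ^ k) Y (Y ^ k) a (fall 0 k) (fall 1 k) (fall 2 k)))
    where
    0≤2a = 0≤* (0≤fromℕ 2) 0≤a
    big : ∀ m → 0ℚ ≤ (E * κ) ^ k * (fall m k * (Y ^ k * Y ^ m))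
    big m = 0≤* 0≤C (0≤* (0≤fall m k) (0≤* (0≤^ 0≤Y k) (0≤^ 0≤Y m)))

  lowerShift-mono : ∀ {m m′} → m ℕ.≤ m′ → ∀ j → lowerShift range k large m j ≤ lowerShift range k large m′ j
  lowerShift-mono m≤m′ zero = ℚₚ.≤-refl
  lowerShift-mono m≤m′ (suc j) = ℚₚ.+-mono-≤ (lowerShift-mono m≤m′ j) (*-monoʳ (0≤H W) (fromℕ-mono (s≤s (ℕₚ.+-monoʳ-≤ j m≤m′))))

  module _ (j : ℕ) (j<k : suc j ℕ.≤ k) {c : ℚ} (0<c : 0ℚ < c) (dc≡L : d * c ≡ L) where
    private
      ζ : ℕ → ℚ
      ζ p = fromℕ j * rec (p ℕ.∸ suc j)
      0≤ζ : ∀ p → 0ℚ ≤ ζ p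
      0≤ζ p = 0≤* (0≤fromℕ j) (0≤rec (p ℕ.∸ suc j))
      0≤recφ : ∀ p → 0ℚ ≤ recφ p
      0≤recφ p = 0≤rec (p ℕ.∸ 1)
      -- One cutoff for both parts of the weight: `Op-cut` asks for a shift by `H W` from the
      -- constant part and by 2 `H W` from the linear part. Likewise the shift in `c₃` is the one
      -- for exponent 4, the largest of the three.
      c₂ = c + fromℕ 2 * H W
      0<c₂ : 0ℚ < c₂
      0<c₂ = ℚₚ.+-mono-<-≤ 0<c (0≤* (0≤fromℕ 2) (0≤H W))
      c₃ = c₂ + lowerShift range k large 4 j
      lower₁ : ℕ → ℚ
      lower₁ n = κ * (L * cut R 1 c₂ n + ½ * a * cut R 2 c₂ n)
      0≤½a = 0≤* (ℚₚ.nonNegative⁻¹ ½) 0≤a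
      inner : ∀ n → 1 ℕ.≤ n → lower₁ n ≤ Op recφ ps y n
      inner n 1≤n = ℚₚ.≤-trans (≤-≡ (solve 5 (λ k l a x y → k :* (l :* x :+ con ½ :* a :* y) := l :* (k :* (con 1ℚ :* x)) :+ a :* (k :* (con ½ :* y))) refl κ L a (cut R 1 c₂ n) (cut R 2 c₂ n))
          (ℚₚ.+-mono-≤
            (*-monoˡ 0≤L (ℚₚ.≤-trans (*-monoˡ 0≤κ (*-monoˡ 0≤1 (cut-anti R 1 (ℚₚ.+-monoʳ-≤ c (*-monoʳ (0≤H W) (fromℕ-mono {1} {2} (s≤s z≤n)))) n))) (Op-cut range 0 0<c n 1≤n)))
            (*-monoˡ 0≤a (Op-cut range 1 0<c n 1≤n)))
          (sym (trans (Op-+ recφ ps (λ n → L * cut R 0 c n) (λ n → a * cut R 1 c n) n) (cong₂ _+_ (Op-* recφ ps L (cut R 0 c) n) (Op-* recφ ps a (cut R 1 c) n)))))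
        (Op-mono (weight 0≤recφ) positive-ps (λ n _ → sieveWeight-≥ R d a 0<d 0≤a dc≡L 0<c n) n 1≤n)
      0≤lower₁ : ∀ n → 0ℚ ≤ lower₁ n
      0≤lower₁ n = 0≤* 0≤κ (0≤+ (0≤* 0≤L (0≤cut R 1 0<c₂ n)) (0≤* 0≤½a (0≤cut R 2 0<c₂ n)))
      lower₂ : ℕ → ℚ
      lower₂ n = κ * κ * (L * L * cut R 2 c₂ n + a * L * cut R 3 c₂ n + ½ * ½ * (a * a) * cut R 4 c₂ n)
      square : ∀ n → lower₂ n ≡ lower₁ n * lower₁ n
      square n = trans (cong₂ (λ x y → κ * κ * (L * L * x + a * L * y + ½ * ½ * (a * a) * cut R 4 c₂ n)) (sym (cut-* R 1 1 c₂ n)) (sym (cut-* R 1 2 c₂ n)))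
        (trans (cong (λ x → κ * κ * (L * L * (cut R 1 c₂ n * cut R 1 c₂ n) + a * L * (cut R 1 c₂ n * cut R 2 c₂ n) + ½ * ½ * (a * a) * x)) (sym (cut-* R 2 2 c₂ n)))
          (solve 5 (λ k l a x y → k :* k :* (l :* l :* (x :* x) :+ a :* l :* (x :* y) :+ con ½ :* con ½ :* (a :* a) :* (y :* y)) := k :* (l :* x :+ con ½ :* a :* y) :* (k :* (l :* x :+ con ½ :* a :* y))) refl κ L a (cut R 1 c₂ n) (cut R 2 c₂ n)))

    -- The integral of u^(j-1)/(j-1)! ((1-u) + a (1-u)²/2)² over [0, 1] for j ≥ 1. The inner
    -- function is the integral of 1 + a (1-v) over v from u to 1: one variable of the weight has
    -- been summed out before squaring.
    linearConst : ℚ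
    linearConst = fall 2 j + a * fall 3 j + ½ * ½ * (a * a) * fall 4 j

    private
      X = t R 1 - c₃

    main-lower : 0ℚ ≤ X → κ * κ * κ ^ j * (X ^ j * X ^ 4) * linearConst ≤ Op ζ ps (λ n → Op recφ ps y n * Op recφ ps y n) 1
    main-lower 0≤X = ℚₚ.≤-trans (≤-≡
        (solve 8 (λ k q X p a f g h → k :* k :* q :* (p :* (X :* (X :* (X :* (X :* con 1ℚ))))) :* (f :+ a :* g :+ con ½ :* con ½ :* (a :* a) :* h)
            := k :* k :* (X :* X :* (q :* (f :* (p :* (X :* (X :* con 1ℚ))))) :+ a :* X :* (q :* (g :* (p :* (X :* (X :* (X :* con 1ℚ)))))) :+ con ½ :* con ½ :* (a :* a) :* (q :* (h :* (p :* (X :* (X :* (X :* (X :* con 1ℚ)))))))))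
          refl κ (κ ^ j) X (X ^ j) a (fall 2 j) (fall 3 j) (fall 4 j))
        (*-monoˡ (0≤* 0≤κ 0≤κ) (ℚₚ.+-mono-≤ (ℚₚ.+-mono-≤
          (*-mono (0≤* 0≤X 0≤X) (nn 2) (*-mono 0≤X 0≤L X≤L X≤L) (term 2 (s≤s (s≤s z≤n))))
          (*-mono (0≤* 0≤a 0≤X) (nn 3) (*-monoˡ 0≤a X≤L) (term 3 (s≤s (s≤s (s≤s z≤n))))))
          (*-monoˡ (0≤* (0≤* (ℚₚ.nonNegative⁻¹ ½) (ℚₚ.nonNegative⁻¹ ½)) (0≤* 0≤a 0≤a)) (term 4 ℕₚ.≤-refl))))
        (sym (trans (Op-* ζ ps (κ * κ) (λ n → L * L * cut R 2 c₂ n + a * L * cut R 3 c₂ n + ½ * ½ * (a * a) * cut R 4 c₂ n) 1)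
          (cong (κ * κ *_) (trans (Op-+ ζ ps (λ n → L * L * cut R 2 c₂ n + a * L * cut R 3 c₂ n) (λ n → ½ * ½ * (a * a) * cut R 4 c₂ n) 1)
            (cong₂ _+_ (trans (Op-+ ζ ps (λ n → L * L * cut R 2 c₂ n) (λ n → a * L * cut R 3 c₂ n) 1) (cong₂ _+_ (Op-* ζ ps (L * L) (cut R 2 c₂) 1) (Op-* ζ ps (a * L) (cut R 3 c₂) 1))) (Op-* ζ ps (½ * ½ * (a * a)) (cut R 4 c₂) 1)))))))
      (Op-mono (weight 0≤ζ) positive-ps (λ n 1≤n → ≤-≡ (square n) (*-mono (0≤lower₁ n) (ℚₚ.≤-trans (0≤lower₁ n) (inner n 1≤n)) (inner n 1≤n) (inner n 1≤n)) refl) 1 ℕₚ.≤-refl)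
      where
      X≤L : X ≤ L
      X≤L = ℚₚ.≤-trans (by-difference (0≤+ (ℚₚ.<⇒≤ 0<c₂) (0≤lowerShift range k large 4 j)) (solve 2 (λ t c → c := t :- (t :- c)) refl (t R 1) c₃)) (t≤H R 1)
      nn : ∀ m → 0ℚ ≤ Op ζ ps (cut R m c₂) 1
      nn m = Op-0≤ (weight 0≤ζ) (0≤cut R m 0<c₂) 1
      c₃≤t : c₃ ≤ t R 1
      c₃≤t = by-difference 0≤X refl
      term : ∀ m → m ℕ.≤ 4 → κ ^ j * (fall m j * (X ^ j * X ^ m)) ≤ Op ζ ps (cut R m c₂) 1
      term m m≤4 = ℚₚ.≤-trans (*-monoˡ (0≤^ 0≤κ j) (*-monoˡ (0≤fall m j) (≤-≡ (trans (sym (^-+ X j m)) (sym (cut-yes R 1 (j ℕ.+ m) c₃≤t))) (cut-anti R (j ℕ.+ m) (ℚₚ.+-monoʳ-≤ c₂ (lowerShift-mono m≤4 j)) 1) refl)))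
        (Op^-cut range k large m 0<c₂ j j<k 1 ℕₚ.≤-refl)

-- Quadratic forms in the sieve weights.

-- Quadratic in the weights: G₂ u τ ps Y evaluates ∏ (1 + u_p (T_p ⊗ 1 + 1 ⊗ T_p) + τ_p T_p ⊗ T_p) Y at (1, 1).
step₂ : ℚ → ℚ → ℕ → (ℕ → ℕ → ℚ) → ℕ → ℕ → ℚ
step₂ u τ p Y m n = Y m n + u * (Y (p ℕ.* m) n + Y m (p ℕ.* n)) + τ * Y (p ℕ.* m) (p ℕ.* n)

G₂ : (ℕ → ℚ) → (ℕ → ℚ) → List ℕ → (ℕ → ℕ → ℚ) → ℚ
G₂ u τ []       Y = Y 1 1
G₂ u τ (p ∷ ps) Y = G₂ u τ ps (step₂ (u p) (τ p) p Y)

G₂-cong : ∀ u τ ps {Y Z : ℕ → ℕ → ℚ} → (∀ m n → Y m n ≡ Z m n) → G₂ u τ ps Y ≡ G₂ u τ ps Z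
G₂-cong u τ [] h = h 1 1
G₂-cong u τ (p ∷ ps) h = G₂-cong u τ ps λ m n → cong₂ _+_ (cong₂ (λ a b → a + u p * b) (h m n) (cong₂ _+_ (h (p ℕ.* m) n) (h m (p ℕ.* n)))) (cong (τ p *_) (h (p ℕ.* m) (p ℕ.* n)))

G₂-linear : ∀ u τ ps c (Y Z : ℕ → ℕ → ℚ) → G₂ u τ ps (λ m n → Y m n + c * Z m n) ≡ G₂ u τ ps Y + c * G₂ u τ ps Z
G₂-linear u τ [] c Y Z = refl
G₂-linear u τ (p ∷ ps) c Y Z = trans (G₂-cong u τ ps λ m n →
    solve 11 (λ u t c a b d e a′ b′ d′ e′ → a :+ c :* a′ :+ u :* (b :+ c :* b′ :+ (d :+ c :* d′)) :+ t :* (e :+ c :* e′) := a :+ u :* (b :+ d) :+ t :* e :+ c :* (a′ :+ u :* (b′ :+ d′) :+ t :* e′)) refl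
      (u p) (τ p) c (Y m n) (Y (p ℕ.* m) n) (Y m (p ℕ.* n)) (Y (p ℕ.* m) (p ℕ.* n)) (Z m n) (Z (p ℕ.* m) n) (Z m (p ℕ.* n)) (Z (p ℕ.* m) (p ℕ.* n)))
  (G₂-linear u τ ps c (step₂ (u p) (τ p) p Y) (step₂ (u p) (τ p) p Z))

infix 7 _⊗_
_⊗_ : (ℕ → ℚ) → (ℕ → ℚ) → ℕ → ℕ → ℚ
(f ⊗ g) m n = f m * g n

G₂-square : ∀ ξ ps y → G₂ ξ (λ p → ξ p * ξ p) ps (y ⊗ y) ≡ Op ξ ps y 1 * Op ξ ps y 1
G₂-square ξ [] y = refl
G₂-square ξ (p ∷ ps) y = trans (G₂-cong ξ (λ p → ξ p * ξ p) ps λ m n →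
    solve 5 (λ x a b c d → a :* b :+ x :* (c :* b :+ a :* d) :+ x :* x :* (c :* d) := (a :+ x :* c) :* (b :+ x :* d)) refl (ξ p) (y m) (y n) (y (p ℕ.* m)) (y (p ℕ.* n)))
  (trans (G₂-square ξ ps (λ n → y n + ξ p * y (p ℕ.* n))) (cong (λ x → x * x) (sym (Op-inner ξ p ps y 1))))

-- The diagonal form obtained by completing squares prime by prime.
V : (ℕ → ℚ) → (ℕ → ℚ) → List ℕ → (ℕ → ℚ) → ℚ
V u σ []       y = y 1 * y 1
V u σ (p ∷ ps) y = V u σ ps (λ n → y n + u p * y (p ℕ.* n)) + σ p * V u σ ps (λ n → y (p ℕ.* n))

G₂≡V : ∀ {u σ τ} ps → All (λ p → τ p ≡ u p * u p + σ p) ps → ∀ y → G₂ u τ ps (y ⊗ y) ≡ V u σ ps y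
G₂≡V [] [] y = refl
G₂≡V {u} {σ} {τ} (p ∷ ps) (eq ∷ eqs) y = trans (G₂-cong u τ ps λ m n → trans (cong (λ t → y m * y n + u p * (y (p ℕ.* m) * y n + y m * y (p ℕ.* n)) + t * (y (p ℕ.* m) * y (p ℕ.* n))) eq)
    (solve 6 (λ x s a b c d → a :* b :+ x :* (c :* b :+ a :* d) :+ (x :* x :+ s) :* (c :* d) := (a :+ x :* c) :* (b :+ x :* d) :+ s :* (c :* d)) refl (u p) (σ p) (y m) (y n) (y (p ℕ.* m)) (y (p ℕ.* n))))
  (trans (G₂-linear u τ ps (σ p) ((λ n → y n + u p * y (p ℕ.* n)) ⊗ (λ n → y n + u p * y (p ℕ.* n))) ((λ n → y (p ℕ.* n)) ⊗ (λ n → y (p ℕ.* n))))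
    (cong₂ (λ a b → a + σ p * b) (G₂≡V ps eqs (λ n → y n + u p * y (p ℕ.* n))) (G₂≡V ps eqs (λ n → y (p ℕ.* n)))))

V-diagonal : ∀ {u σ} ps → All (λ p → u p ≡ 0ℚ) ps → ∀ y → V u σ ps y ≡ Op σ ps (λ n → y n * y n) 1
V-diagonal [] [] y = refl
V-diagonal {u} {σ} (p ∷ ps) (eq ∷ eqs) y = cong₂ (λ a b → a + σ p * b)
  (trans (V-diagonal ps eqs (λ n → y n + u p * y (p ℕ.* n))) (Op-cong σ ps (λ n → cong (λ x → x * x) (trans (cong (λ z → y n + z * y (p ℕ.* n)) eq) (solve 2 (λ a b → a :+ con 0ℚ :* b := a) refl (y n) (y (p ℕ.* n))))) 1))
  (trans (V-diagonal ps eqs (λ n → y (p ℕ.* n))) (Op-shift σ ps (λ n → y n * y n) p 1))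

V-mono : ∀ {u σ ps} → Weight u ps → Weight σ ps → Positive ps → ∀ {f g : ℕ → ℚ} → (∀ n → 1 ℕ.≤ n → 0ℚ ≤ f n) → (∀ n → 1 ℕ.≤ n → f n ≤ g n) → V u σ ps f ≤ V u σ ps g
V-mono [] [] [] 0≤f f≤g = *-mono (0≤f 1 ℕₚ.≤-refl) (ℚₚ.≤-trans (0≤f 1 ℕₚ.≤-refl) (f≤g 1 ℕₚ.≤-refl)) (f≤g 1 ℕₚ.≤-refl) (f≤g 1 ℕₚ.≤-refl)
V-mono {ps = p ∷ ps} (0≤u ∷ wu) (0≤σ ∷ wσ) (1≤p ∷ pos) 0≤f f≤g = ℚₚ.+-mono-≤
  (V-mono wu wσ pos (λ n 1≤n → 0≤+ (0≤f n 1≤n) (0≤* 0≤u (0≤f (p ℕ.* n) (ℕₚ.*-mono-≤ 1≤p 1≤n)))) (λ n 1≤n → ℚₚ.+-mono-≤ (f≤g n 1≤n) (*-monoˡ 0≤u (f≤g (p ℕ.* n) (ℕₚ.*-mono-≤ 1≤p 1≤n)))))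
  (*-monoˡ 0≤σ (V-mono wu wσ pos (λ n 1≤n → 0≤f (p ℕ.* n) (ℕₚ.*-mono-≤ 1≤p 1≤n)) (λ n 1≤n → f≤g (p ℕ.* n) (ℕₚ.*-mono-≤ 1≤p 1≤n))))

V-scale : ∀ u σ ps c y → V u σ ps (λ n → c * y n) ≡ c * c * V u σ ps y
V-scale u σ [] c y = solve 2 (λ c y → c :* y :* (c :* y) := c :* c :* (y :* y)) refl c (y 1)
V-scale u σ (p ∷ ps) c y = trans (cong₂ (λ a b → a + σ p * b)
    (trans (V-cong u σ ps λ n → solve 4 (λ c u a b → c :* a :+ u :* (c :* b) := c :* (a :+ u :* b)) refl c (u p) (y n) (y (p ℕ.* n))) (V-scale u σ ps c (λ n → y n + u p * y (p ℕ.* n))))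
    (V-scale u σ ps c (λ n → y (p ℕ.* n))))
  (solve 4 (λ c a s b → c :* c :* a :+ s :* (c :* c :* b) := c :* c :* (a :+ s :* b)) refl c (V u σ ps (λ n → y n + u p * y (p ℕ.* n))) (σ p) (V u σ ps (λ n → y (p ℕ.* n))))
  where
  V-cong : ∀ u σ ps {f g : ℕ → ℚ} → (∀ n → f n ≡ g n) → V u σ ps f ≡ V u σ ps g
  V-cong u σ [] h = cong₂ _*_ (h 1) (h 1)
  V-cong u σ (p ∷ ps) h = cong₂ (λ a b → a + σ p * b) (V-cong u σ ps λ n → cong₂ (λ a b → a + u p * b) (h n) (h (p ℕ.* n))) (V-cong u σ ps λ n → h (p ℕ.* n))

-- In the branch of `V` weighted by σ = ζ (1+u)² the factor (1+u)² goes into the function. As `y`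
-- decreases, (1+u) y(p n) dominates y(p n) + u y(p² n), so this branch is at least ζ times the
-- square of the complete operator `Op u` at `p n`.
V-≥ : ∀ {u ζ ps} → Weight u ps → Weight ζ ps → Positive ps → ∀ {y} → (∀ n → 0ℚ ≤ y n) → Decreasing y →
  Op ζ ps (λ n → Op u ps y n * Op u ps y n) 1 ≤ V u (λ p → ζ p * ((1ℚ + u p) * (1ℚ + u p))) ps y
V-≥ [] [] [] 0≤y dec = ℚₚ.≤-refl
V-≥ {u} {ζ} {p ∷ ps} (0≤u ∷ wu) (0≤ζ ∷ wζ) (1≤p ∷ pos) {y} 0≤y dec = ≤-≡
  (cong₂ (λ a b → a + ζ p * b) (Op-cong ζ ps (λ n → cong (λ x → x * x) (Op-inner u p ps y n)) 1)
    (trans (sym (Op-shift ζ ps (λ n → Op u (p ∷ ps) y n * Op u (p ∷ ps) y n) p 1)) (Op-cong ζ ps (λ n → cong (λ x → x * x) (trans (Op-inner u p ps y (p ℕ.* n)) (sym (Op-shift u ps y′ p n)))) 1)))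
  (ℚₚ.+-mono-≤ (V-≥ wu wζ pos 0≤y′ dec′)
    (*-monoˡ 0≤ζ (ℚₚ.≤-trans (V-≥ wu wζ pos (λ n → 0≤y′ (p ℕ.* n)) (λ m n 1≤m m≤n → dec′ (p ℕ.* m) (p ℕ.* n) (ℕₚ.*-mono-≤ 1≤p 1≤m) (ℕₚ.*-monoʳ-≤ p m≤n)))
      (≤-≡ refl (V-mono wu (σ-weight wu wζ) pos (λ n _ → 0≤y′ (p ℕ.* n)) (λ n 1≤n →
          by-difference (0≤* 0≤u (difference (dec (p ℕ.* n) (p ℕ.* (p ℕ.* n)) (ℕₚ.*-mono-≤ 1≤p 1≤n) (m≤p*m 1≤p (p ℕ.* n))))) (solve 3 (λ u a b → u :* (a :- b) := (con 1ℚ :+ u) :* a :- (a :+ u :* b)) refl (u p) (y (p ℕ.* n)) (y (p ℕ.* (p ℕ.* n))))))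
        (V-scale u σ ps (1ℚ + u p) (λ n → y (p ℕ.* n)))))))
  (cong (λ x → V u σ ps y′ + x) (sym (ℚₚ.*-assoc (ζ p) ((1ℚ + u p) * (1ℚ + u p)) (V u σ ps (λ n → y (p ℕ.* n))))))
  where
  σ y′ : ℕ → ℚ
  σ p = ζ p * ((1ℚ + u p) * (1ℚ + u p))
  y′ n = y n + u p * y (p ℕ.* n)
  0≤y′ : ∀ n → 0ℚ ≤ y′ n
  0≤y′ n = 0≤+ (0≤y n) (0≤* 0≤u (0≤y (p ℕ.* n)))
  dec′ : Decreasing y′
  dec′ m n 1≤m m≤n = ℚₚ.+-mono-≤ (dec m n 1≤m m≤n) (*-monoˡ 0≤u (dec (p ℕ.* m) (p ℕ.* n) (ℕₚ.*-mono-≤ 1≤p 1≤m) (ℕₚ.*-monoʳ-≤ p m≤n)))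
  σ-weight : ∀ {ps} → Weight u ps → Weight ζ ps → Weight σ ps
  σ-weight [] [] = []
  σ-weight {q ∷ _} (_ ∷ wu) (0≤ζ ∷ wζ) = 0≤* 0≤ζ (0≤p² (1ℚ + u q)) ∷ σ-weight wu wζ

-- Expansion of squared sieve sums over congruence conditions.

module Expansion (z : ℕ → ℚ) where
  v : ℕ → ℚ
  v p = 1ℚ + z p

  -- The contribution of the two values of the indicator b: ξ = z - v b and ξ² = z² + (v² - 2 z v) b.
  keep hit : ℕ → (ℕ → ℕ → ℚ) → ℕ → ℕ → ℚ
  keep p Y m n = step₂ (z p) (z p * z p) p Y m n
  hit p Y m n = (- v p) * (Y (p ℕ.* m) n + Y m (p ℕ.* n)) + (v p * (1ℚ - z p)) * Y (p ℕ.* m) (p ℕ.* n)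

  -- The list collects the primes at which the indicator has been chosen from the expansion. The
  -- functional `φ` then stands for a weighted count of the `n` hit by all primes of that list, or
  -- for an approximation to it, and `Bil` is linear in it.
  Bil : (List ℕ → ℚ) → List ℕ → (ℕ → ℕ → ℚ) → List ℕ → ℚ
  Bil φ []       Y qs = Y 1 1 * φ qs
  Bil φ (p ∷ ps) Y qs = Bil φ ps (keep p Y) qs + Bil φ ps (hit p Y) (p ∷ qs)

  Bil-- : ∀ φ ψ ps Y qs → Bil (λ qs → φ qs - ψ qs) ps Y qs ≡ Bil φ ps Y qs - Bil ψ ps Y qs
  Bil-- φ ψ [] Y qs = solve 3 (λ y a b → y :* (a :- b) := y :* a :- y :* b) refl (Y 1 1) (φ qs) (ψ qs)
  Bil-- φ ψ (p ∷ ps) Y qs = trans (cong₂ _+_ (Bil-- φ ψ ps (keep p Y) qs) (Bil-- φ ψ ps (hit p Y) (p ∷ qs)))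
    (solve 4 (λ a b c d → a :- b :+ (c :- d) := a :+ c :- (b :+ d)) refl (Bil φ ps (keep p Y) qs) (Bil ψ ps (keep p Y) qs) (Bil φ ps (hit p Y) (p ∷ qs)) (Bil ψ ps (hit p Y) (p ∷ qs)))

  module _ (b : ℕ → ℕ → ℚ) (b² : ∀ p n → b p n * b p n ≡ b p n) where
    ξ : ℕ → ℕ → ℚ
    ξ n p = z p - v p * b p n

    bs : List ℕ → ℕ → ℚ
    bs []       n = 1ℚ
    bs (q ∷ qs) n = b q n * bs qs n

    expand : ∀ N (w : ℕ → ℚ) ps Y qs →
      ∑ N (λ n → w n * bs qs n * G₂ (ξ n) (λ p → ξ n p * ξ n p) ps Y) ≡ Bil (λ qs → ∑ N (λ n → w n * bs qs n)) ps Y qs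
    expand N w [] Y qs = trans (∑-*ʳ N (Y 1 1) (λ n → w n * bs qs n)) (ℚₚ.*-comm (∑ N (λ n → w n * bs qs n)) (Y 1 1))
    expand N w (p ∷ ps) Y qs = trans (∑-cong N λ n _ _ → trans (cong (w n * bs qs n *_) (trans (G₂-cong (ξ n) (λ p → ξ n p * ξ n p) ps (split n)) (G₂-linear (ξ n) (λ p → ξ n p * ξ n p) ps (b p n) (keep p Y) (hit p Y))))
        (solve 5 (λ w s b x y → w :* s :* (x :+ b :* y) := w :* s :* x :+ w :* (b :* s) :* y) refl (w n) (bs qs n) (b p n) (G₂ (ξ n) (λ p → ξ n p * ξ n p) ps (keep p Y)) (G₂ (ξ n) (λ p → ξ n p * ξ n p) ps (hit p Y))))
      (trans (∑-+ N (λ n → w n * bs qs n * G₂ (ξ n) (λ p → ξ n p * ξ n p) ps (keep p Y)) (λ n → w n * (b p n * bs qs n) * G₂ (ξ n) (λ p → ξ n p * ξ n p) ps (hit p Y)))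
        (cong₂ _+_ (expand N w ps (keep p Y) qs) (expand N w ps (hit p Y) (p ∷ qs))))
      where
      split : ∀ n m l → step₂ (ξ n p) (ξ n p * ξ n p) p Y m l ≡ keep p Y m l + b p n * hit p Y m l
      split n m l = trans (cong (λ x → Y m l + ξ n p * (Y (p ℕ.* m) l + Y m (p ℕ.* l)) + x * Y (p ℕ.* m) (p ℕ.* l))
          (trans (solve 3 (λ z v b → (z :- v :* b) :* (z :- v :* b) := z :* z :- (z :+ z) :* v :* b :+ v :* v :* (b :* b)) refl (z p) (v p) (b p n)) (cong (λ x → z p * z p - (z p + z p) * v p * b p n + v p * v p * x) (b² p n))))
        (solve 5 (λ z b x y w → x :+ (z :- (con 1ℚ :+ z) :* b) :* y :+ (z :* z :- (z :+ z) :* (con 1ℚ :+ z) :* b :+ (con 1ℚ :+ z) :* (con 1ℚ :+ z) :* b) :* w := x :+ z :* y :+ z :* z :* w :+ b :* ((:- (con 1ℚ :+ z)) :* y :+ ((con 1ℚ :+ z) :* (con 1ℚ :- z)) :* w)) refl (z p) (b p n) (Y m l) (Y (p ℕ.* m) l + Y m (p ℕ.* l)) (Y (p ℕ.* m) (p ℕ.* l)))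

  module _ (x : ℕ → ℚ) where
    density-product : ℚ → List ℕ → ℚ
    density-product X []       = X
    density-product X (q ∷ qs) = x q * density-product X qs

    mean second : ℕ → ℚ
    mean p = z p - v p * x p
    second p = z p * z p + v p * (1ℚ - z p) * x p

    -- For a multiplicative density the expansion folds up again prime by prime: `mean` and `second`
    -- are the first two moments of `ξ` when the indicator has mean `x`.
    Bil-main : ∀ X ps Y qs → Bil (density-product X) ps Y qs ≡ density-product X qs * G₂ mean second ps Y
    Bil-main X [] Y qs = ℚₚ.*-comm (Y 1 1) (density-product X qs)
    Bil-main X (p ∷ ps) Y qs = trans (cong₂ _+_ (Bil-main X ps (keep p Y) qs) (Bil-main X ps (hit p Y) (p ∷ qs)))
      (trans (solve 4 (λ d x a b → d :* a :+ x :* d :* b := d :* (a :+ x :* b)) refl (density-product X qs) (x p) (G₂ mean second ps (keep p Y)) (G₂ mean second ps (hit p Y)))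
        (cong (density-product X qs *_) (trans (sym (G₂-linear mean second ps (x p) (keep p Y) (hit p Y)))
          (G₂-cong mean second ps λ m n → solve 5 (λ z x y s w → y :+ z :* s :+ z :* z :* w :+ x :* ((:- (con 1ℚ :+ z)) :* s :+ ((con 1ℚ :+ z) :* (con 1ℚ :- z)) :* w) := y :+ (z :- (con 1ℚ :+ z) :* x) :* s :+ (z :* z :+ (con 1ℚ :+ z) :* (con 1ℚ :- z) :* x) :* w) refl (z p) (x p) (Y m n) (Y (p ℕ.* m) n + Y m (p ℕ.* n)) (Y (p ℕ.* m) (p ℕ.* n))))))

∣∣≤⇒ : ∀ {p q} → ∣ p ∣ ≤ q → p ≤ q
∣∣≤⇒ {p} = ℚₚ.≤-trans (p≤∣p∣ p)

∣+∣≤ : ∀ {p q r s} → ∣ p ∣ ≤ r → ∣ q ∣ ≤ s → ∣ p + q ∣ ≤ r + s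
∣+∣≤ {p} {q} a b = ℚₚ.≤-trans (ℚₚ.∣p+q∣≤∣p∣+∣q∣ p q) (ℚₚ.+-mono-≤ a b)

∣*∣≤ : ∀ {p q r s} → ∣ p ∣ ≤ r → ∣ q ∣ ≤ s → ∣ p * q ∣ ≤ r * s
∣*∣≤ {p} {q} a b = ≤-≡ (ℚₚ.∣p*q∣≡∣p∣*∣q∣ p q) (*-mono (ℚₚ.0≤∣p∣ p) (ℚₚ.≤-trans (ℚₚ.0≤∣p∣ q) b) a b) refl

0≤⇒∣∣≤ : ∀ {p} → 0ℚ ≤ p → ∣ p ∣ ≤ p
0≤⇒∣∣≤ 0≤p = ℚₚ.≤-reflexive (ℚₚ.0≤p⇒∣p∣≡p 0≤p)

0≤⇒∣-∣≤ : ∀ {p} → 0ℚ ≤ p → ∣ - p ∣ ≤ p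
0≤⇒∣-∣≤ {p} 0≤p = ≤-≡ (ℚₚ.∣-p∣≡∣p∣ p) (0≤⇒∣∣≤ 0≤p) refl

module ExpansionError (z : ℕ → ℚ) where
  open Expansion z

  hit⁺ : ℕ → (ℕ → ℕ → ℚ) → ℕ → ℕ → ℚ
  hit⁺ p Y m n = v p * (Y (p ℕ.* m) n + Y m (p ℕ.* n) + Y (p ℕ.* m) (p ℕ.* n))

  Bil⁺ : (List ℕ → ℚ) → List ℕ → (ℕ → ℕ → ℚ) → List ℕ → ℚ
  Bil⁺ e []       Y qs = Y 1 1 * e qs
  Bil⁺ e (p ∷ ps) Y qs = Bil⁺ e ps (keep p Y) qs + Bil⁺ e ps (hit⁺ p Y) (p ∷ qs)

  Bil⁺-cong : ∀ e ps {Y Z : ℕ → ℕ → ℚ} → (∀ m n → Y m n ≡ Z m n) → ∀ qs → Bil⁺ e ps Y qs ≡ Bil⁺ e ps Z qs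
  Bil⁺-cong e [] h qs = cong (_* e qs) (h 1 1)
  Bil⁺-cong e (p ∷ ps) h qs = cong₂ _+_
    (Bil⁺-cong e ps (λ m n → cong₂ _+_ (cong₂ (λ a b → a + z p * b) (h m n) (cong₂ _+_ (h (p ℕ.* m) n) (h m (p ℕ.* n)))) (cong (z p * z p *_) (h (p ℕ.* m) (p ℕ.* n)))) qs)
    (Bil⁺-cong e ps (λ m n → cong (v p *_) (cong₂ _+_ (cong₂ _+_ (h (p ℕ.* m) n) (h m (p ℕ.* n))) (h (p ℕ.* m) (p ℕ.* n)))) (p ∷ qs))

  Bil⁺-+ : ∀ e ps (Y Z : ℕ → ℕ → ℚ) qs → Bil⁺ e ps (λ m n → Y m n + Z m n) qs ≡ Bil⁺ e ps Y qs + Bil⁺ e ps Z qs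
  Bil⁺-+ e [] Y Z qs = ℚₚ.*-distribʳ-+ (e qs) (Y 1 1) (Z 1 1)
  Bil⁺-+ e (p ∷ ps) Y Z qs = trans (cong₂ _+_
      (trans (Bil⁺-cong e ps (λ m n → solve 9 (λ u a b d e a′ b′ d′ e′ → a :+ a′ :+ u :* (b :+ b′ :+ (d :+ d′)) :+ u :* u :* (e :+ e′) := a :+ u :* (b :+ d) :+ u :* u :* e :+ (a′ :+ u :* (b′ :+ d′) :+ u :* u :* e′)) refl
        (z p) (Y m n) (Y (p ℕ.* m) n) (Y m (p ℕ.* n)) (Y (p ℕ.* m) (p ℕ.* n)) (Z m n) (Z (p ℕ.* m) n) (Z m (p ℕ.* n)) (Z (p ℕ.* m) (p ℕ.* n))) qs) (Bil⁺-+ e ps (keep p Y) (keep p Z) qs))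
      (trans (Bil⁺-cong e ps (λ m n → solve 7 (λ u b d e b′ d′ e′ → u :* (b :+ b′ :+ (d :+ d′) :+ (e :+ e′)) := u :* (b :+ d :+ e) :+ u :* (b′ :+ d′ :+ e′)) refl
        (v p) (Y (p ℕ.* m) n) (Y m (p ℕ.* n)) (Y (p ℕ.* m) (p ℕ.* n)) (Z (p ℕ.* m) n) (Z m (p ℕ.* n)) (Z (p ℕ.* m) (p ℕ.* n))) (p ∷ qs)) (Bil⁺-+ e ps (hit⁺ p Y) (hit⁺ p Z) (p ∷ qs))))
    (solve 4 (λ a b c d → a :+ b :+ (c :+ d) := a :+ c :+ (b :+ d)) refl (Bil⁺ e ps (keep p Y) qs) (Bil⁺ e ps (keep p Z) qs) (Bil⁺ e ps (hit⁺ p Y) (p ∷ qs)) (Bil⁺ e ps (hit⁺ p Z) (p ∷ qs)))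

  Bil⁺-* : ∀ e ps c (Y : ℕ → ℕ → ℚ) qs → Bil⁺ e ps (λ m n → c * Y m n) qs ≡ c * Bil⁺ e ps Y qs
  Bil⁺-* e [] c Y qs = ℚₚ.*-assoc c (Y 1 1) (e qs)
  Bil⁺-* e (p ∷ ps) c Y qs = trans (cong₂ _+_
      (trans (Bil⁺-cong e ps (λ m n → solve 6 (λ c u a b d e → c :* a :+ u :* (c :* b :+ c :* d) :+ u :* u :* (c :* e) := c :* (a :+ u :* (b :+ d) :+ u :* u :* e)) refl c (z p) (Y m n) (Y (p ℕ.* m) n) (Y m (p ℕ.* n)) (Y (p ℕ.* m) (p ℕ.* n))) qs) (Bil⁺-* e ps c (keep p Y) qs))
      (trans (Bil⁺-cong e ps (λ m n → solve 5 (λ c u b d e → u :* (c :* b :+ c :* d :+ c :* e) := c :* (u :* (b :+ d :+ e))) refl c (v p) (Y (p ℕ.* m) n) (Y m (p ℕ.* n)) (Y (p ℕ.* m) (p ℕ.* n))) (p ∷ qs)) (Bil⁺-* e ps c (hit⁺ p Y) (p ∷ qs))))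
    (sym (ℚₚ.*-distribˡ-+ c (Bil⁺ e ps (keep p Y) qs) (Bil⁺ e ps (hit⁺ p Y) (p ∷ qs))))

  Small : List ℕ → Set
  Small = All (λ p → 1 ℕ.≤ p × 0ℚ ≤ z p × z p ≤ 1ℚ)

  small⇒weight : ∀ {ps} → Small ps → Weight z ps
  small⇒weight = All.map λ (_ , 0≤z , _) → 0≤z

  small⇒positive : ∀ {ps} → Small ps → Positive ps
  small⇒positive = All.map proj₁

  ∣Bil∣≤ : ∀ φ {ps} → Small ps → ∀ {Y Z : ℕ → ℕ → ℚ} → (∀ m n → 1 ℕ.≤ m → 1 ℕ.≤ n → ∣ Y m n ∣ ≤ Z m n) →
    ∀ qs → ∣ Bil φ ps Y qs ∣ ≤ Bil⁺ (λ qs → ∣ φ qs ∣) ps Z qs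
  ∣Bil∣≤ φ [] {Y} {Z} h qs = ∣*∣≤ {Y 1 1} {φ qs} (h 1 1 ℕₚ.≤-refl ℕₚ.≤-refl) ℚₚ.≤-refl
  ∣Bil∣≤ φ {p ∷ ps} ((1≤p , 0≤z , z≤1) ∷ small) {Y} {Z} h qs = ∣+∣≤ {Bil φ ps (keep p Y) qs} {Bil φ ps (hit p Y) (p ∷ qs)}
    (∣Bil∣≤ φ small (λ m n 1≤m 1≤n → ∣+∣≤ {Y m n + z p * (Y (p ℕ.* m) n + Y m (p ℕ.* n))} {z p * z p * Y (p ℕ.* m) (p ℕ.* n)}
      (∣+∣≤ {Y m n} {z p * (Y (p ℕ.* m) n + Y m (p ℕ.* n))} (h m n 1≤m 1≤n) (∣*∣≤ {z p} {Y (p ℕ.* m) n + Y m (p ℕ.* n)} (0≤⇒∣∣≤ 0≤z) (mixed m n 1≤m 1≤n)))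
      (∣*∣≤ {z p * z p} {Y (p ℕ.* m) (p ℕ.* n)} (0≤⇒∣∣≤ (0≤* 0≤z 0≤z)) (both m n 1≤m 1≤n))) qs)
    (∣Bil∣≤ φ small (λ m n 1≤m 1≤n → ≤-≡ refl (∣+∣≤ {(- v p) * (Y (p ℕ.* m) n + Y m (p ℕ.* n))} {v p * (1ℚ - z p) * Y (p ℕ.* m) (p ℕ.* n)}
      (∣*∣≤ { - v p} {Y (p ℕ.* m) n + Y m (p ℕ.* n)} (0≤⇒∣-∣≤ 0≤v) (mixed m n 1≤m 1≤n))
      (∣*∣≤ {v p * (1ℚ - z p)} {Y (p ℕ.* m) (p ℕ.* n)} (ℚₚ.≤-trans (0≤⇒∣∣≤ (0≤* 0≤v (difference z≤1))) (≤-≡ refl (*-monoˡ 0≤v (by-difference 0≤z (solve 1 (λ z → z := con 1ℚ :- (con 1ℚ :- z)) refl (z p)))) (ℚₚ.*-identityʳ (v p)))) (both m n 1≤m 1≤n)))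
      (sym (ℚₚ.*-distribˡ-+ (v p) (Z (p ℕ.* m) n + Z m (p ℕ.* n)) (Z (p ℕ.* m) (p ℕ.* n))))) (p ∷ qs))
    where
    0≤v = 0≤+ 0≤1 0≤z
    up : ∀ {m} → 1 ℕ.≤ m → 1 ℕ.≤ p ℕ.* m
    up = ℕₚ.*-mono-≤ 1≤p
    mixed : ∀ m n → 1 ℕ.≤ m → 1 ℕ.≤ n → ∣ Y (p ℕ.* m) n + Y m (p ℕ.* n) ∣ ≤ Z (p ℕ.* m) n + Z m (p ℕ.* n)
    mixed m n 1≤m 1≤n = ∣+∣≤ {Y (p ℕ.* m) n} {Y m (p ℕ.* n)} (h (p ℕ.* m) n (up 1≤m) 1≤n) (h m (p ℕ.* n) 1≤m (up 1≤n))
    both : ∀ m n → 1 ℕ.≤ m → 1 ℕ.≤ n → ∣ Y (p ℕ.* m) (p ℕ.* n) ∣ ≤ Z (p ℕ.* m) (p ℕ.* n)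
    both m n 1≤m 1≤n = h (p ℕ.* m) (p ℕ.* n) (up 1≤m) (up 1≤n)

-- Error sums with divisor weights.

-- ∑ 6^ω(m) e(m) over the products m ≤ M of sublists
module _ (M : ℕ) where
  U : (List ℕ → ℚ) → List ℕ → List ℕ → ℚ
  U e []       qs = χ (product qs ℕₚ.≤? M) * e qs
  U e (p ∷ ps) qs = U e ps qs + fromℕ 6 * U e ps (p ∷ qs)

  0≤U : ∀ {e} → (∀ qs → 0ℚ ≤ e qs) → ∀ ps qs → 0ℚ ≤ U e ps qs
  0≤U 0≤e [] qs = 0≤* (0≤χ (product qs ℕₚ.≤? M)) (0≤e qs)
  0≤U 0≤e (p ∷ ps) qs = 0≤+ (0≤U 0≤e ps qs) (0≤* (0≤fromℕ 6) (0≤U 0≤e ps (p ∷ qs)))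

module _ (z : ℕ → ℚ) (R : ℕ) where
  open Expansion z
  open ExpansionError z

  -- Here `f` is to be thought of as a weight supported on [1, R] that has already been dilated by
  -- `a`. This memory bounds the modulus `product qs` by `R * R` wherever a term survives.
  record Supported (a : ℕ) (f : ℕ → ℚ) : Set where
    constructor supported
    field vanishes : ∀ m → 1 ℕ.≤ m → R ℕ.< a ℕ.* m → f m ≡ 0ℚ
  open Supported

  -- A hit prime leads to three dilated products, each with the factor `v p ≤ 2`: this is the 6 of
  -- `U`. Dilating a decreasing function does not increase its `Op`, so all terms share the bound
  -- with the undilated `f` and `g`.
  Bil⁺-≤ : ∀ {e} → (∀ qs → 0ℚ ≤ e qs) → ∀ {ps} → Small ps → ∀ {f g a b} → (∀ n → 0ℚ ≤ f n) → (∀ n → 0ℚ ≤ g n) → Decreasing f → Decreasing g →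
    Supported a f → Supported b g → ∀ {qs} → product qs ℕ.≤ a ℕ.* b → Bil⁺ e ps (f ⊗ g) qs ≤ Op z ps f 1 * Op z ps g 1 * U (R ℕ.* R) e ps qs
  Bil⁺-≤ {e} 0≤e [] {f} {g} {a} {b} 0≤f 0≤g df dg sf sg {qs} qs≤ab = cases (ℕₚ.≤-<-connex a R) (ℕₚ.≤-<-connex b R)
    where
    vanishing : f 1 * g 1 ≡ 0ℚ → f 1 * g 1 * e qs ≤ f 1 * g 1 * U (R ℕ.* R) e [] qs
    vanishing eq = ≤-≡ (trans (cong (_* e qs) eq) (ℚₚ.*-zeroˡ (e qs))) (0≤* (0≤* (0≤f 1) (0≤g 1)) (0≤U (R ℕ.* R) 0≤e [] qs)) refl
    cases : a ℕ.≤ R ⊎ R ℕ.< a → b ℕ.≤ R ⊎ R ℕ.< b → f 1 * g 1 * e qs ≤ f 1 * g 1 * U (R ℕ.* R) e [] qs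
    cases (inj₁ a≤R) (inj₁ b≤R) = ℚₚ.≤-reflexive (cong (f 1 * g 1 *_) (sym (trans (cong (_* e qs) (χ-yes (product qs ℕₚ.≤? R ℕ.* R) (ℕₚ.≤-trans qs≤ab (ℕₚ.*-mono-≤ a≤R b≤R)))) (ℚₚ.*-identityˡ (e qs)))))
    cases (inj₂ R<a) _ = vanishing (trans (cong (_* g 1) (vanishes sf 1 ℕₚ.≤-refl (ℕₚ.≤-trans R<a (ℕₚ.≤-reflexive (sym (ℕₚ.*-identityʳ a)))))) (ℚₚ.*-zeroˡ (g 1)))
    cases _ (inj₂ R<b) = vanishing (trans (cong (f 1 *_) (vanishes sg 1 ℕₚ.≤-refl (ℕₚ.≤-trans R<b (ℕₚ.≤-reflexive (sym (ℕₚ.*-identityʳ b)))))) (ℚₚ.*-zeroʳ (f 1)))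
  Bil⁺-≤ {e} 0≤e {p ∷ ps} ((1≤p , 0≤z , z≤1) ∷ small) {f} {g} {a} {b} 0≤f 0≤g df dg sf sg {qs} qs≤ab =
    ℚₚ.≤-trans (ℚₚ.+-mono-≤ keepPart hitPart)
      (by-difference {d = F * G * u₁ * (fromℕ 6 - v p * fromℕ 3)} (0≤* (0≤* (0≤* 0≤F 0≤G) 0≤u₁) (by-difference′ z≤1))
        (solve 5 (λ f g x y v → f :* g :* y :* (con (fromℕ 6) :- v :* con (fromℕ 3)) := f :* g :* (x :+ con (fromℕ 6) :* y) :- (f :* g :* x :+ v :* (f :* g :* y :+ f :* g :* y :+ f :* g :* y))) refl F G (U (R ℕ.* R) e ps qs) u₁ (v p)))
    where
    w = small⇒weight small
    pos = small⇒positive small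
    F = Op z (p ∷ ps) f 1
    G = Op z (p ∷ ps) g 1
    u₁ = U (R ℕ.* R) e ps (p ∷ qs)
    0≤u₁ = 0≤U (R ℕ.* R) 0≤e ps (p ∷ qs)
    0≤F : 0ℚ ≤ F
    0≤F = Op-0≤ (0≤z ∷ w) 0≤f 1
    0≤G : 0ℚ ≤ G
    0≤G = Op-0≤ (0≤z ∷ w) 0≤g 1
    by-difference′ : z p ≤ 1ℚ → 0ℚ ≤ fromℕ 6 - v p * fromℕ 3
    by-difference′ z≤1 = ≤-≡ refl (0≤* (difference z≤1) (0≤fromℕ 3)) (solve 1 (λ z → (con 1ℚ :- z) :* con (fromℕ 3) := con (fromℕ 6) :- (con 1ℚ :+ z) :* con (fromℕ 3)) refl (z p))
    T : (ℕ → ℚ) → ℕ → ℚ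
    T h n = h (p ℕ.* n)
    dT : ∀ {h} → Decreasing h → Decreasing (T h)
    dT d m n 1≤m m≤n = d (p ℕ.* m) (p ℕ.* n) (ℕₚ.*-mono-≤ 1≤p 1≤m) (ℕₚ.*-monoʳ-≤ p m≤n)
    sT : ∀ {c h} → Supported c h → Supported (c ℕ.* p) (T h)
    sT {c} s = supported λ m 1≤m R< → vanishes s (p ℕ.* m) (ℕₚ.*-mono-≤ 1≤p 1≤m) (ℕₚ.≤-trans R< (ℕₚ.≤-reflexive (ℕₚ.*-assoc c p m)))
    plus : (ℕ → ℚ) → ℕ → ℚ
    plus h n = h n + z p * h (p ℕ.* n)
    0≤plus : ∀ {h} → (∀ n → 0ℚ ≤ h n) → ∀ n → 0ℚ ≤ plus h n
    0≤plus 0≤h n = 0≤+ (0≤h n) (0≤* 0≤z (0≤h (p ℕ.* n)))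
    d-plus : ∀ {h} → Decreasing h → Decreasing (plus h)
    d-plus d m n 1≤m m≤n = ℚₚ.+-mono-≤ (d m n 1≤m m≤n) (*-monoˡ 0≤z (dT d m n 1≤m m≤n))
    s-plus : ∀ {c h} → Supported c h → Supported c (plus h)
    s-plus {c} {h} s = supported λ m 1≤m R< → trans (cong₂ (λ x y → x + z p * y) (vanishes s m 1≤m R<) (vanishes s (p ℕ.* m) (ℕₚ.*-mono-≤ 1≤p 1≤m) (ℕₚ.≤-trans R< (ℕₚ.*-monoʳ-≤ c (m≤p*m 1≤p m))))) (solve 1 (λ z → con 0ℚ :+ z :* con 0ℚ := con 0ℚ) refl (z p))
    keepPart : Bil⁺ e ps (keep p (f ⊗ g)) qs ≤ F * G * U (R ℕ.* R) e ps qs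
    keepPart = ≤-≡ (Bil⁺-cong e ps (λ m n → solve 5 (λ x a b c d → a :* b :+ x :* (c :* b :+ a :* d) :+ x :* x :* (c :* d) := (a :+ x :* c) :* (b :+ x :* d)) refl (z p) (f m) (g n) (f (p ℕ.* m)) (g (p ℕ.* n))) qs)
      (Bil⁺-≤ 0≤e small (0≤plus 0≤f) (0≤plus 0≤g) (d-plus df) (d-plus dg) (s-plus sf) (s-plus sg) qs≤ab)
      (cong₂ (λ x y → x * y * U (R ℕ.* R) e ps qs) (sym (Op-inner z p ps f 1)) (sym (Op-inner z p ps g 1)))
    same : ∀ {h} → (∀ n → 0ℚ ≤ h n) → Op z ps h 1 ≤ Op z (p ∷ ps) h 1
    same 0≤h = p≤p+q (0≤* 0≤z (Op-0≤ w 0≤h (p ℕ.* 1)))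
    shifted : ∀ {h} → (∀ n → 0ℚ ≤ h n) → Decreasing h → Op z ps (T h) 1 ≤ Op z (p ∷ ps) h 1
    shifted {h} 0≤h d = ≤-≡ (Op-shift z ps h p 1) (ℚₚ.≤-trans (Op-decreasing w pos d 1 (p ℕ.* 1) ℕₚ.≤-refl (m≤p*m 1≤p 1)) (same 0≤h)) refl
    part : ∀ {h i c d} → (∀ n → 0ℚ ≤ h n) → (∀ n → 0ℚ ≤ i n) → Decreasing h → Decreasing i → Supported c h → Supported d i → p ℕ.* (a ℕ.* b) ℕ.≤ c ℕ.* d →
      Op z ps h 1 ≤ F → Op z ps i 1 ≤ G → Bil⁺ e ps (h ⊗ i) (p ∷ qs) ≤ F * G * u₁
    part 0≤h 0≤i dh di sh si le h≤ i≤ = ℚₚ.≤-trans (Bil⁺-≤ 0≤e small 0≤h 0≤i dh di sh si (ℕₚ.≤-trans (ℕₚ.*-monoʳ-≤ p qs≤ab) le))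
      (*-monoʳ 0≤u₁ (*-mono (Op-0≤ w 0≤h 1) 0≤G h≤ i≤))
    hitPart : Bil⁺ e ps (hit⁺ p (f ⊗ g)) (p ∷ qs) ≤ v p * (F * G * u₁ + F * G * u₁ + F * G * u₁)
    hitPart = ≤-≡ (trans (Bil⁺-* e ps (v p) (λ m n → (T f ⊗ g) m n + (f ⊗ T g) m n + (T f ⊗ T g) m n) (p ∷ qs))
        (cong (v p *_) (trans (Bil⁺-+ e ps (λ m n → (T f ⊗ g) m n + (f ⊗ T g) m n) (T f ⊗ T g) (p ∷ qs)) (cong (_+ Bil⁺ e ps (T f ⊗ T g) (p ∷ qs)) (Bil⁺-+ e ps (T f ⊗ g) (f ⊗ T g) (p ∷ qs))))))
      (*-monoˡ (0≤+ 0≤1 0≤z) (ℚₚ.+-mono-≤ (ℚₚ.+-mono-≤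
        (part (λ n → 0≤f (p ℕ.* n)) 0≤g (dT df) dg (sT sf) sg (ℕₚ.≤-reflexive (trans (sym (ℕₚ.*-assoc p a b)) (cong (ℕ._* b) (ℕₚ.*-comm p a)))) (shifted 0≤f df) (same 0≤g))
        (part 0≤f (λ n → 0≤g (p ℕ.* n)) df (dT dg) sf (sT sg) (ℕₚ.≤-reflexive (trans (ℕₚ.*-comm p (a ℕ.* b)) (ℕₚ.*-assoc a b p))) (same 0≤f) (shifted 0≤g dg)))
        (part (λ n → 0≤f (p ℕ.* n)) (λ n → 0≤g (p ℕ.* n)) (dT df) (dT dg) (sT sf) (sT sg)
          (ℕₚ.≤-trans (ℕₚ.≤-reflexive (trans (sym (ℕₚ.*-assoc p a b)) (cong (ℕ._* b) (ℕₚ.*-comm p a)))) (ℕₚ.*-monoʳ-≤ (a ℕ.* p) (ℕₚ.≤-trans (ℕₚ.≤-reflexive (sym (ℕₚ.*-identityʳ b))) (ℕₚ.*-monoʳ-≤ b 1≤p))))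
          (shifted 0≤f df) (shifted 0≤g dg))))
      refl

-- Distinct primes above D, not dividing W, in the order in which they were chosen.
data Chosen (D W : ℕ) : List ℕ → Set where
  []  : Chosen D W []
  _∷_ : ∀ {q qs} → Prime q × D ℕ.< q × ¬ q ∣ product qs ℕ.* W → Chosen D W qs → Chosen D W (q ∷ qs)

Sieving-∣ : ∀ {W W′ ps} → W′ ∣ W → Sieving W ps → Sieving W′ ps
Sieving-∣ W′∣W [] = []
Sieving-∣ W′∣W (_∷_ {p} (pr , p∤W) s) = (pr , λ p∣W′ → p∤W (ℕ.∣-trans p∣W′ W′∣W)) ∷ Sieving-∣ (ℕ.*-monoʳ-∣ p W′∣W) s

U-≤ : ∀ {D W M c e} {h : ℕ → ℚ} → 0ℚ ≤ c → (∀ n → 0ℚ ≤ h n) →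
  (∀ qs → Chosen D W qs → product qs ℕ.≤ M → e qs ≤ c ^ length qs * h (product qs)) →
  ∀ {ps} → All (D ℕ.<_) ps → ∀ qs → Chosen D W qs → Sieving (product qs ℕ.* W) ps →
  U M e ps qs ≤ c ^ length qs * Op (λ _ → fromℕ 6 * c) ps (λ m → χ (m ℕₚ.≤? M) * h m) (product qs)
U-≤ {M = M} {c} {e} {h} 0≤c 0≤h bound [] qs ch _ = case product qs ℕₚ.≤? M of λ
  { (yes le) → ≤-≡ (trans (cong (_* e qs) (χ-yes (product qs ℕₚ.≤? M) le)) (ℚₚ.*-identityˡ (e qs))) (bound qs ch le)
      (cong (c ^ length qs *_) (sym (trans (cong (_* h (product qs)) (χ-yes (product qs ℕₚ.≤? M) le)) (ℚₚ.*-identityˡ (h (product qs))))))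
  ; (no ¬le) → ≤-≡ (trans (cong (_* e qs) (χ-no (product qs ℕₚ.≤? M) ¬le)) (ℚₚ.*-zeroˡ (e qs))) (0≤* (0≤^ 0≤c (length qs)) (0≤* (0≤χ (product qs ℕₚ.≤? M)) (0≤h (product qs)))) refl }
U-≤ {W = W} {M} {c} {e} {h} 0≤c 0≤h bound {p ∷ ps} (D<p ∷ large) qs ch ((pr , p∤) ∷ s) = ≤-≡ refl
  (ℚₚ.+-mono-≤ (U-≤ 0≤c 0≤h bound large qs ch (Sieving-∣ (ℕ.n∣m*n p) s))
    (*-monoˡ (0≤fromℕ 6) (U-≤ 0≤c 0≤h bound large (p ∷ qs) ((pr , D<p , p∤) ∷ ch) (subst (λ x → Sieving x ps) (sym (ℕₚ.*-assoc p (product qs) W)) s))))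
  (solve 4 (λ q c a b → q :* a :+ con (fromℕ 6) :* (c :* q :* b) := q :* (a :+ con (fromℕ 6) :* c :* b)) refl (c ^ length qs) c (Op _ ps _ (product qs)) (Op _ ps _ (p ℕ.* product qs)))

Op-const-rec : ∀ c ps → Positive ps → (g : ℕ → ℚ) → ∀ n → 1 ℕ.≤ n → Op (λ _ → c) ps (λ m → rec m * g m) n ≡ rec n * Op (λ p → c * rec p) ps g n
Op-const-rec c [] [] g n 1≤n = refl
Op-const-rec c (p ∷ ps) (1≤p ∷ pos) g n 1≤n = trans (cong₂ _+_ (Op-const-rec c ps pos g n 1≤n) (cong (c *_) (trans (Op-const-rec c ps pos g (p ℕ.* n) (ℕₚ.*-mono-≤ 1≤p 1≤n)) (cong (_* Op (λ p → c * rec p) ps g (p ℕ.* n)) (rec-* 1≤p 1≤n)))))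
  (solve 5 (λ c a b r q → r :* a :+ c :* (q :* r :* b) := r :* (a :+ c :* q :* b)) refl c (Op (λ p → c * rec p) ps g n) (Op (λ p → c * rec p) ps g (p ℕ.* n)) (rec n) (rec p))

module _ {W ps} (sieving : Sieving W ps) {M : ℕ} (1≤M : 1 ℕ.≤ M) where
  private
    I : ℕ → ℚ
    I n = χ (n ℕₚ.≤? M)
    pos = sieving⇒positive sieving
    weight : ∀ {β} → (∀ p → 0ℚ ≤ β p) → Weight β ps
    weight h = sieving⇒weight h sieving

  Op-rec-indicator : ∀ n → 1 ℕ.≤ n → Op rec ps I n ≤ H M * I n
  Op-rec-indicator n 1≤n = ≤-≡ (sym (trans (Op-shift rec ps I n 1) (cong (Op rec ps I) (ℕₚ.*-identityʳ n))))
    (ℚₚ.≤-trans (harmonic≥Op sieving M 1≤M (λ s → I (n ℕ.* s)) (λ s → 0≤χ (n ℕ.* s ℕₚ.≤? M)) λ s M<s → χ-no (n ℕ.* s ℕₚ.≤? M) λ le → ℕₚ.<⇒≱ M<s (ℕₚ.≤-trans (m≤p*m 1≤n s) le))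
      (∑-mono M λ s 1≤s _ → ≤-≡ refl (*-mono {χ (coprime? s W)} {1ℚ} (0≤χ (coprime? s W)) (0≤* (0≤rec s) (0≤χ (n ℕₚ.≤? M))) (χ≤1 (coprime? s W)) (*-monoˡ (0≤rec s) (χ-mono (n ℕ.* s ℕₚ.≤? M) (n ℕₚ.≤? M) (ℕₚ.≤-trans (ℕₚ.≤-trans (ℕₚ.≤-reflexive (sym (ℕₚ.*-identityʳ n))) (ℕₚ.*-monoʳ-≤ n 1≤s)))))) (ℚₚ.*-identityˡ (rec s * I n))))
    (∑-*ʳ M (I n) rec)

  -- The sum of j^ω(m)/m over m ≤ M is at most the j-th power of the sum of 1/m; one of the j
  -- factors is peeled off at a time.
  Op-log-power : ∀ j n → 1 ℕ.≤ n → Op (λ p → fromℕ j * rec p) ps I n ≤ H M ^ j * I n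
  Op-log-power zero n 1≤n = ℚₚ.≤-reflexive (trans (Op-weight0 rec ps I n) (sym (ℚₚ.*-identityˡ (I n))))
  Op-log-power (suc j) n 1≤n = ℚₚ.≤-trans
    (Op-compose-≥ (weight 0≤rec) (weight (λ p → 0≤* (0≤fromℕ j) (0≤rec p))) (weight (λ p → 0≤* (0≤fromℕ (suc j)) (0≤rec p))) pos
      (All.universal (λ p → ℚₚ.≤-reflexive (trans (cong (_* rec p) (fromℕ-suc j)) (solve 2 (λ f b → (con 1ℚ :+ f) :* b := b :+ f :* b) refl (fromℕ j) (rec p)))) ps)
      (λ m → 0≤χ (m ℕₚ.≤? M)) n 1≤n)
    (ℚₚ.≤-trans (Op-mono (weight 0≤rec) pos (Op-log-power j) n 1≤n)
      (≤-≡ (Op-* rec ps (H M ^ j) I n) (*-monoˡ (0≤^ (0≤H M) j) (Op-rec-indicator n 1≤n)) (solve 3 (λ q h i → q :* (h :* i) := h :* q :* i) refl (H M ^ j) (H M) (I n))))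

  Op-divisor-sum : ∀ j K → 0ℚ ≤ K → Op (λ _ → fromℕ j) ps (λ m → I m * (K * rec m)) 1 ≤ K * H M ^ j
  Op-divisor-sum j K 0≤K = ≤-≡ (trans (Op-cong (λ _ → fromℕ j) ps (λ m → solve 3 (λ i k r → i :* (k :* r) := k :* (r :* i)) refl (I m) K (rec m)) 1)
      (trans (Op-* (λ _ → fromℕ j) ps K (λ m → rec m * I m) 1) (cong (K *_) (trans (Op-const-rec (fromℕ j) ps pos I 1 ℕₚ.≤-refl) (ℚₚ.*-identityˡ (Op (λ p → fromℕ j * rec p) ps I 1))))))
    (*-monoˡ 0≤K (ℚₚ.≤-trans (Op-log-power j 1 ℕₚ.≤-refl) (*-monoˡ (0≤^ (0≤H M) j) (χ≤1 (1 ℕₚ.≤? M)))))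
    (cong (K *_) (ℚₚ.*-identityʳ (H M ^ j)))

  Op-one-≤ : ∀ {E : ℕ → ℚ} → (∀ n → 0ℚ ≤ E n) → 1 ℕ.≤ W → Op one ps (λ m → I m * E (W ℕ.* m)) 1 ≤ ∑ (W ℕ.* M) E
  Op-one-≤ {E} 0≤E 1≤W = ℚₚ.≤-trans (sublists≤coprimeSum sieving M 1≤M (λ m → I m * E (W ℕ.* m)) (λ m → 0≤* (0≤χ (m ℕₚ.≤? M)) (0≤E (W ℕ.* m)))
      λ m M<m → trans (cong (_* E (W ℕ.* m)) (χ-no (m ℕₚ.≤? M) (ℕₚ.<⇒≱ M<m))) (ℚₚ.*-zeroˡ (E (W ℕ.* m))))
    (ℚₚ.≤-trans (∑-mono M λ m _ _ → ≤-≡ refl (*-mono {χ (coprime? m W)} {1ℚ} (0≤χ (coprime? m W)) (0≤* 0≤1 (0≤E (W ℕ.* m))) (χ≤1 (coprime? m W)) (*-monoʳ (0≤E (W ℕ.* m)) (χ≤1 (m ℕₚ.≤? M)))) (solve 1 (λ e → con 1ℚ :* (con 1ℚ :* e) := e) refl (E (W ℕ.* m))))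
      (≤-≡ (sym (∑-multiples′ W E M 1≤W)) (∑-mono (W ℕ.* M) λ q _ _ → *-monoʳ (0≤E q) (χ≤1 (W ∣? q))) (∑-cong (W ℕ.* M) λ q _ _ → ℚₚ.*-identityˡ (E q))))

-- s ≤ T + s² / T, applied to every term of the sum
Op-trade : ∀ {ps} T C → 0ℚ < T → 0ℚ ≤ C → {f f₁ f₂ : ℕ → ℚ} → (∀ n → 0ℚ ≤ f n) → (∀ n → f n ≤ f₁ n) → (∀ n → f n ≤ f₂ n) →
  ∀ s → 0ℚ ≤ s → ∀ n → s * Op (λ _ → C) ps f n ≤ T * Op one ps f₁ n + s * s * inv₀ T * Op (λ _ → C * C) ps f₂ n
Op-trade {[]} T C 0<T 0≤C {f} {f₁} {f₂} 0≤f f≤f₁ f≤f₂ s 0≤s n = case ℚₚ.≤-total s T of λ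
  { (inj₁ s≤T) → ℚₚ.≤-trans (*-mono 0≤s (ℚₚ.≤-trans (0≤f n) (f≤f₁ n)) s≤T (f≤f₁ n)) (p≤p+q (0≤* (0≤* (0≤* 0≤s 0≤s) 0≤i) (ℚₚ.≤-trans (0≤f n) (f≤f₂ n))))
  ; (inj₂ T≤s) → ℚₚ.≤-trans (*-mono 0≤s (ℚₚ.≤-trans (0≤f n) (f≤f₂ n)) (≤-≡ (trans (sym (ℚₚ.*-identityʳ s)) (trans (cong (s *_) (sym (inv₀-inverse 0<T))) (sym (ℚₚ.*-assoc s T (inv₀ T))))) (*-monoʳ 0≤i (*-monoˡ 0≤s T≤s)) refl) (f≤f₂ n))
      (p≤q+p (0≤* (ℚₚ.<⇒≤ 0<T) (ℚₚ.≤-trans (0≤f n) (f≤f₁ n)))) }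
  where 0≤i = ℚₚ.<⇒≤ (0<inv₀ 0<T)
Op-trade {p ∷ ps} T C 0<T 0≤C {f} {f₁} {f₂} 0≤f f≤f₁ f≤f₂ s 0≤s n = ≤-≡
  (solve 4 (λ s c a b → s :* (a :+ c :* b) := s :* a :+ s :* c :* b) refl s C (Op (λ _ → C) ps f n) (Op (λ _ → C) ps f (p ℕ.* n)))
  (ℚₚ.+-mono-≤ (Op-trade {ps} T C 0<T 0≤C 0≤f f≤f₁ f≤f₂ s 0≤s n) (Op-trade {ps} T C 0<T 0≤C 0≤f f≤f₁ f≤f₂ (s * C) (0≤* 0≤s 0≤C) (p ℕ.* n)))
  (solve 8 (λ t s i c a b x y → t :* a :+ s :* s :* i :* x :+ (t :* b :+ s :* c :* (s :* c) :* i :* y) := t :* (a :+ con 1ℚ :* b) :+ s :* s :* i :* (x :+ c :* c :* y)) refl T s (inv₀ T) C (Op one ps f₁ n) (Op one ps f₁ (p ℕ.* n)) (Op (λ _ → C * C) ps f₂ n) (Op (λ _ → C * C) ps f₂ (p ℕ.* n)))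

module _ {D W ps} (sieving : Sieving W ps) (large : All (D ℕ.<_) ps) {M : ℕ} (1≤M : 1 ℕ.≤ M) (1≤W : 1 ℕ.≤ W) where
  private
    sieving₁ : Sieving (1 ℕ.* W) ps
    sieving₁ = subst (λ w → Sieving w ps) (sym (ℕₚ.*-identityˡ W)) sieving

  U-divisor-bound : ∀ {e} c K → 0ℚ ≤ K → (∀ qs → Chosen D W qs → product qs ℕ.≤ M → e qs ≤ fromℕ c ^ length qs * (K * rec (product qs))) →
    U M e ps [] ≤ K * H M ^ (6 ℕ.* c)
  U-divisor-bound {e} c K 0≤K bound = ℚₚ.≤-trans (U-≤ {h = λ m → K * rec m} (0≤fromℕ c) (λ m → 0≤* 0≤K (0≤rec m)) bound large [] [] sieving₁)
    (≤-≡ (trans (ℚₚ.*-identityˡ _) (cong (λ x → Op (λ _ → x) ps (λ m → χ (m ℕₚ.≤? M) * (K * rec m)) 1) (sym (fromℕ-* 6 c)))) (Op-divisor-sum sieving 1≤M (6 ℕ.* c) K 0≤K) refl)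

  -- Conditions (A) and (B) bound `E` on average but without divisor weights, while the trivial
  -- bound K/m tolerates such weights. Trading with `T`, later a power of log N, takes the place of
  -- the Cauchy-Schwarz inequality.
  U-trade : ∀ {e} c K T → 0ℚ ≤ K → 0ℚ < T → {E : ℕ → ℚ} → (∀ n → 0ℚ ≤ E n) →
    (∀ qs → Chosen D W qs → product qs ℕ.≤ M → e qs ≤ fromℕ c ^ length qs * E (W ℕ.* product qs)) →
    (∀ qs → Chosen D W qs → product qs ℕ.≤ M → e qs ≤ fromℕ c ^ length qs * (K * rec (product qs))) →
    U M e ps [] ≤ T * ∑ (W ℕ.* M) E + inv₀ T * (K * H M ^ (6 ℕ.* c ℕ.* (6 ℕ.* c)))
  U-trade {e} c K T 0≤K 0<T {E} 0≤E bound₁ bound₂ = ℚₚ.≤-trans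
    (U-≤ {h = h} (0≤fromℕ c) 0≤h (λ qs ch le → case ℚₚ.⊓-sel (E (W ℕ.* product qs)) (K * rec (product qs)) of λ
      { (inj₁ eq) → ≤-≡ refl (bound₁ qs ch le) (cong (fromℕ c ^ length qs *_) (sym eq))
      ; (inj₂ eq) → ≤-≡ refl (bound₂ qs ch le) (cong (fromℕ c ^ length qs *_) (sym eq)) }) large [] [] sieving₁)
    (≤-≡ (cong (λ x → 1ℚ * Op (λ _ → x) ps f 1) (sym (fromℕ-* 6 c)))
      (ℚₚ.≤-trans (Op-trade {ps} T (fromℕ C) 0<T (0≤fromℕ C) {f} {λ m → χ (m ℕₚ.≤? M) * E (W ℕ.* m)} {λ m → χ (m ℕₚ.≤? M) * (K * rec m)} (λ m → 0≤* (0≤χ (m ℕₚ.≤? M)) (0≤h m))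
          (λ m → *-monoˡ (0≤χ (m ℕₚ.≤? M)) (ℚₚ.p⊓q≤p (E (W ℕ.* m)) (K * rec m))) (λ m → *-monoˡ (0≤χ (m ℕₚ.≤? M)) (ℚₚ.p⊓q≤q (E (W ℕ.* m)) (K * rec m))) 1ℚ 0≤1 1)
        (ℚₚ.+-mono-≤ (*-monoˡ (ℚₚ.<⇒≤ 0<T) (Op-one-≤ sieving 1≤M 0≤E 1≤W))
          (≤-≡ (cong₂ _*_ (ℚₚ.*-identityˡ (inv₀ T)) (cong (λ x → Op (λ _ → x) ps (λ m → χ (m ℕₚ.≤? M) * (K * rec m)) 1) (sym (fromℕ-* C C)))) (*-monoˡ (ℚₚ.<⇒≤ (0<inv₀ 0<T)) (Op-divisor-sum sieving 1≤M (C ℕ.* C) K 0≤K)) refl)))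
      refl)
    where
    C = 6 ℕ.* c
    h f : ℕ → ℚ
    h m = E (W ℕ.* m) ⊓ (K * rec m)
    f m = χ (m ℕₚ.≤? M) * h m
    0≤h : ∀ m → 0ℚ ≤ h m
    0≤h m = ℚₚ.⊓-glb (0≤E (W ℕ.* m)) (0≤* 0≤K (0≤rec m))

-- Primes in an interval and products over them.

-- The primes in (D, n].
primes : ℕ → ℕ → List ℕ
primes D zero = []
primes D (suc n) with prime? (suc n) | D ℕₚ.<? suc n
... | yes _ | yes _ = suc n ∷ primes D n
... | _     | _     = primes D n

primes-sieving : ∀ D n {W} → (∀ q → Prime q → D ℕ.< q → q ℕ.≤ n → ¬ q ∣ W) → Sieving W (primes D n)
primes-sieving D zero h = []
primes-sieving D (suc n) {W} h with prime? (suc n) | D ℕₚ.<? suc n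
... | yes pr | yes D< = (pr , h (suc n) pr D< ℕₚ.≤-refl) ∷ primes-sieving D n λ q prq D<q q≤n q∣ → case euclidsLemma (suc n) W prq q∣ of λ
  { (inj₁ q∣p) → case prime⇒irreducible pr q∣p of λ { (inj₁ refl) → ¬prime[1] prq ; (inj₂ refl) → ℕₚ.<-irrefl refl q≤n }
  ; (inj₂ q∣W) → h q prq D<q (ℕₚ.m≤n⇒m≤1+n q≤n) q∣W }
... | yes _ | no _ = primes-sieving D n λ q prq D<q q≤n → h q prq D<q (ℕₚ.m≤n⇒m≤1+n q≤n)
... | no _ | yes _ = primes-sieving D n λ q prq D<q q≤n → h q prq D<q (ℕₚ.m≤n⇒m≤1+n q≤n)
... | no _ | no _ = primes-sieving D n λ q prq D<q q≤n → h q prq D<q (ℕₚ.m≤n⇒m≤1+n q≤n)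

∈-primes : ∀ D n {p} → Prime p → D ℕ.< p → p ℕ.≤ n → p ∈ primes D n
∈-primes D zero pr D<p p≤0 = contradiction (subst Prime (ℕₚ.n≤0⇒n≡0 p≤0) pr) λ pr₀ → ℕₚ.<⇒≱ (prime⇒1≤ pr₀) z≤n
∈-primes D (suc n) {p} pr D<p p≤n with prime? (suc n) | D ℕₚ.<? suc n | p ℕₚ.≟ suc n
... | yes _ | yes _ | yes refl = here refl
... | yes _ | yes _ | no p≢ = there (∈-primes D n pr D<p (ℕₚ.≤-pred (ℕₚ.≤∧≢⇒< p≤n p≢)))
... | no ¬pr | _ | yes refl = contradiction pr ¬pr
... | yes _ | no ¬D< | yes refl = contradiction D<p ¬D<
... | no _ | yes _ | no p≢ = ∈-primes D n pr D<p (ℕₚ.≤-pred (ℕₚ.≤∧≢⇒< p≤n p≢))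
... | no _ | no _ | no p≢ = ∈-primes D n pr D<p (ℕₚ.≤-pred (ℕₚ.≤∧≢⇒< p≤n p≢))
... | yes _ | no _ | no p≢ = ∈-primes D n pr D<p (ℕₚ.≤-pred (ℕₚ.≤∧≢⇒< p≤n p≢))

primes-large : ∀ D n → All (D ℕ.<_) (primes D n)
primes-large D zero = []
primes-large D (suc n) with prime? (suc n) | D ℕₚ.<? suc n
... | yes _ | yes D< = D< ∷ primes-large D n
... | yes _ | no _ = primes-large D n
... | no _ | yes _ = primes-large D n
... | no _ | no _ = primes-large D n

primes-prime : ∀ D n → All Prime (primes D n)
primes-prime D zero = []
primes-prime D (suc n) with prime? (suc n) | D ℕₚ.<? suc n
... | yes pr | yes D< = pr ∷ primes-prime D n
... | yes _ | no _ = primes-prime D n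
... | no _ | yes _ = primes-prime D n
... | no _ | no _ = primes-prime D n

primes-step : ∀ D n → (D ℕ.< suc n × primes D (suc n) ≡ suc n ∷ primes D n) ⊎ primes D (suc n) ≡ primes D n
primes-step D n with prime? (suc n) | D ℕₚ.<? suc n
... | yes _ | yes D< = inj₁ (D< , refl)
... | yes _ | no _   = inj₂ refl
... | no _  | yes _  = inj₂ refl
... | no _  | no _   = inj₂ refl

-- A telescoping substitute for the convergence of ∏ (1 + O(1/p²)). The second factor decreases by c
-- (1/n - 1/(n+1)) at every integer, prime or not, and at a prime this pays for the new factor 1 +
-- e.
∏₁-primes : ∀ {D e c} → 1 ℕ.≤ D → 0ℚ ≤ c → (∀ p → D ℕ.< p → 0ℚ ≤ e p) → (∀ p → D ℕ.< p → e p ≤ c * (rec (p ℕ.∸ 1) - rec p)) →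
  ∀ n → D ℕ.≤ n → ∏₁ e (primes D n) * (1ℚ - c * (rec D - rec n)) ≤ 1ℚ
∏₁-primes {D} {e} {c} 1≤D 0≤c 0≤e e≤ n D≤n = go n D≤n (ℕₚ.m≤n⇒m<n∨m≡n D≤n)
  where
  0≤∏ : ∀ n → 0ℚ ≤ ∏₁ e (primes D n)
  0≤∏ n = ℚₚ.≤-trans 0≤1 (1≤∏₁ (All.map (λ {p} → 0≤e p) (primes-large D n)))
  X : ℕ → ℚ
  X n = 1ℚ - c * (rec D - rec n)
  X≤1 : ∀ {n} → D ℕ.≤ n → X n ≤ 1ℚ
  X≤1 {n} D≤n = by-difference (0≤* 0≤c (difference (rec-anti 1≤D D≤n))) (solve 1 (λ x → x := con 1ℚ :- (con 1ℚ :- x)) refl (c * (rec D - rec n)))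
  X-step : ∀ {n} → D ℕ.≤ n → X (suc n) ≤ X n
  X-step {n} D≤n = by-difference (0≤* 0≤c (difference (rec-anti {n} {suc n} (ℕₚ.≤-trans 1≤D D≤n) (ℕₚ.n≤1+n n)))) (solve 4 (λ c d a b → c :* (a :- b) := con 1ℚ :- c :* (d :- a) :- (con 1ℚ :- c :* (d :- b))) refl c (rec D) (rec n) (rec (suc n)))
  empty : ∀ m → m ℕ.≤ D → primes D m ≡ []
  empty zero _ = refl
  empty (suc m) m<D with primes-step D m
  ... | inj₁ (D< , _) = contradiction m<D (ℕₚ.<⇒≱ D<)
  ... | inj₂ eq = trans eq (empty m (ℕₚ.<⇒≤ m<D))
  step : ∀ n → D ℕ.≤ n → ∏₁ e (primes D n) * X n ≤ 1ℚ → (D ℕ.< suc n × primes D (suc n) ≡ suc n ∷ primes D n) ⊎ primes D (suc n) ≡ primes D n → ∏₁ e (primes D (suc n)) * X (suc n) ≤ 1ℚ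
  step n D≤n IH (inj₁ (D< , eq)) = ≤-≡ (cong (λ ps → ∏₁ e ps * X (suc n)) eq) (ℚₚ.≤-trans (by-difference {d = ∏₁ e (primes D n) * ((c * (rec n - rec (suc n)) - e (suc n)) + e (suc n) * (1ℚ - X n) + e (suc n) * (X n - X (suc n)))}
        (0≤* (0≤∏ n) (0≤+ (0≤+ (difference (e≤ (suc n) D<)) (0≤* (0≤e (suc n) D<) (difference (X≤1 D≤n)))) (0≤* (0≤e (suc n) D<) (difference (X-step D≤n)))))
        (solve 6 (λ π c d a b e → π :* ((c :* (a :- b) :- e) :+ e :* (con 1ℚ :- (con 1ℚ :- c :* (d :- a))) :+ e :* ((con 1ℚ :- c :* (d :- a)) :- (con 1ℚ :- c :* (d :- b)))) := π :* (con 1ℚ :- c :* (d :- a)) :- (con 1ℚ :+ e) :* π :* (con 1ℚ :- c :* (d :- b))) refl (∏₁ e (primes D n)) c (rec D) (rec n) (rec (suc n)) (e (suc n))))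
      IH) refl
  step n D≤n IH (inj₂ eq) = ≤-≡ (cong (λ ps → ∏₁ e ps * X (suc n)) eq) (ℚₚ.≤-trans (*-monoˡ (0≤∏ n) (X-step D≤n)) IH) refl
  go : ∀ n → D ℕ.≤ n → D ℕ.< n ⊎ D ≡ n → ∏₁ e (primes D n) * X n ≤ 1ℚ
  go n D≤n (inj₂ refl) = ℚₚ.≤-reflexive (trans (cong (λ ps → ∏₁ e ps * X D) (empty D ℕₚ.≤-refl)) (solve 2 (λ c d → con 1ℚ :* (con 1ℚ :- c :* (d :- d)) := con 1ℚ) refl c (rec D)))
  go (suc n) _ (inj₁ (s≤s D≤n)) = step n D≤n (go n D≤n (ℕₚ.m≤n⇒m<n∨m≡n D≤n)) (primes-step D n)

-- Congruences and the Chinese remainder theorem.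

mod-intro : ∀ {n c d} a b → n ℕ.+ a ℕ.* d ≡ c ℕ.+ b ℕ.* d → n ≡ c [mod d ]
mod-intro {n} {c} {d} a b eq = subst (d ∣_) (sym (begin
  ℕ.∣ n - c ∣                                       ≡⟨ sym (ℕₚ.∣m+n-m+o∣≡∣n-o∣ (a ℕ.* d) n c) ⟩
  ℕ.∣ a ℕ.* d ℕ.+ n - a ℕ.* d ℕ.+ c ∣               ≡⟨ cong₂ ℕ.∣_-_∣ (trans (ℕₚ.+-comm (a ℕ.* d) n) eq) (ℕₚ.+-comm (a ℕ.* d) c) ⟩
  ℕ.∣ c ℕ.+ b ℕ.* d - c ℕ.+ a ℕ.* d ∣               ≡⟨ ℕₚ.∣m+n-m+o∣≡∣n-o∣ c (b ℕ.* d) (a ℕ.* d) ⟩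
  ℕ.∣ b ℕ.* d - a ℕ.* d ∣                           ≡⟨ sym (ℕₚ.*-distribʳ-∣-∣ d b a) ⟩
  ℕ.∣ b - a ∣ ℕ.* d                                 ∎)) (ℕ.n∣m*n ℕ.∣ b - a ∣)
  where open ≡-Reasoning

mod-elim : ∀ {n c d} → n ≡ c [mod d ] → ∃[ a ] ∃[ b ] n ℕ.+ a ℕ.* d ≡ c ℕ.+ b ℕ.* d
mod-elim {n} {c} {d} (divides k eq) = case ℕₚ.≤-total n c of λ
  { (inj₁ n≤c) → k , 0 , trans (cong (n ℕ.+_) (sym (trans (sym (ℕₚ.m≤n⇒∣m-n∣≡n∸m n≤c)) eq))) (trans (ℕₚ.m+[n∸m]≡n n≤c) (sym (ℕₚ.+-identityʳ c)))
  ; (inj₂ c≤n) → 0 , k , sym (trans (cong (c ℕ.+_) (sym (trans (sym (ℕₚ.m≤n⇒∣n-m∣≡n∸m c≤n)) eq))) (trans (ℕₚ.m+[n∸m]≡n c≤n) (sym (ℕₚ.+-identityʳ n)))) }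

mod-sym : ∀ {n c d} → n ≡ c [mod d ] → c ≡ n [mod d ]
mod-sym {n} {c} {d} = subst (d ∣_) (ℕₚ.∣-∣-comm n c)

mod-trans : ∀ {n c e d} → n ≡ c [mod d ] → c ≡ e [mod d ] → n ≡ e [mod d ]
mod-trans {n} {c} {e} {d} x y with mod-elim x | mod-elim y
... | a , b , eq | a′ , b′ , eq′ = mod-intro (a ℕ.+ a′) (b ℕ.+ b′) (begin
  n ℕ.+ (a ℕ.+ a′) ℕ.* d            ≡⟨ lemma n a a′ d ⟩
  (n ℕ.+ a ℕ.* d) ℕ.+ a′ ℕ.* d      ≡⟨ cong (ℕ._+ a′ ℕ.* d) eq ⟩
  (c ℕ.+ b ℕ.* d) ℕ.+ a′ ℕ.* d      ≡⟨ lemma′ c b a′ d ⟩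
  (c ℕ.+ a′ ℕ.* d) ℕ.+ b ℕ.* d      ≡⟨ cong (ℕ._+ b ℕ.* d) eq′ ⟩
  (e ℕ.+ b′ ℕ.* d) ℕ.+ b ℕ.* d      ≡⟨ sym (trans (lemma e b b′ d) (lemma′ e b b′ d)) ⟩
  e ℕ.+ (b ℕ.+ b′) ℕ.* d            ∎)
  where
  open ≡-Reasoning
  lemma : ∀ n a b d → n ℕ.+ (a ℕ.+ b) ℕ.* d ≡ n ℕ.+ a ℕ.* d ℕ.+ b ℕ.* d
  lemma = solveℕ 4 (λ n a b d → n :+ᴺ (a :+ᴺ b) :*ᴺ d :=ᴺ n :+ᴺ a :*ᴺ d :+ᴺ b :*ᴺ d) refl
  lemma′ : ∀ n a b d → n ℕ.+ a ℕ.* d ℕ.+ b ℕ.* d ≡ n ℕ.+ b ℕ.* d ℕ.+ a ℕ.* d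
  lemma′ n a b d = trans (ℕₚ.+-assoc n (a ℕ.* d) (b ℕ.* d)) (trans (cong (n ℕ.+_) (ℕₚ.+-comm (a ℕ.* d) (b ℕ.* d))) (sym (ℕₚ.+-assoc n (b ℕ.* d) (a ℕ.* d))))

mod-shift : ∀ {n c d} h → n ≡ c [mod d ] → n ℕ.+ h ≡ c ℕ.+ h [mod d ]
mod-shift {n} {c} {d} h = subst (d ∣_) (sym (trans (cong₂ ℕ.∣_-_∣ (ℕₚ.+-comm n h) (ℕₚ.+-comm c h)) (ℕₚ.∣m+n-m+o∣≡∣n-o∣ h n c)))

mod-unshift : ∀ {n c d} h → n ℕ.+ h ≡ c ℕ.+ h [mod d ] → n ≡ c [mod d ]
mod-unshift {n} {c} {d} h = subst (d ∣_) (trans (cong₂ ℕ.∣_-_∣ (ℕₚ.+-comm n h) (ℕₚ.+-comm c h)) (ℕₚ.∣m+n-m+o∣≡∣n-o∣ h n c))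

mod-∣ : ∀ {n c d} → n ≡ c [mod d ] → d ∣ c → d ∣ n
mod-∣ {n} {c} {d} x d∣c with mod-elim x
... | a , b , eq = ℕ.∣m+n∣m⇒∣n (subst (d ∣_) (trans (sym eq) (ℕₚ.+-comm n (a ℕ.* d))) (ℕ.∣m∣n⇒∣m+n d∣c (ℕ.n∣m*n b))) (ℕ.n∣m*n a)

∣∣⇒mod : ∀ {n c d} → d ∣ n → d ∣ c → n ≡ c [mod d ]
∣∣⇒mod {n} {c} {d} (divides i refl) (divides j refl) = subst (d ∣_) (ℕₚ.*-distribʳ-∣-∣ d i j) (ℕ.n∣m*n ℕ.∣ i - j ∣)

coprime-∣* : ∀ {m n x} → Coprime m n → m ∣ x → n ∣ x → m ℕ.* n ∣ x
coprime-∣* {m} {n} cop m∣x (divides k refl) with Coprimality.coprime-divisor cop (subst (m ∣_) (ℕₚ.*-comm k n) m∣x)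
... | m∣k = ℕ.*-monoˡ-∣ n m∣k

-- Solves x ≡ c (mod M) and x ≡ -h (mod q). If the Bézout identity makes `x M` congruent to 1 mod
-- `q`, then `q ∸ 1` supplies the sign; in the other case `x M` is already -1. The value for moduli
-- that are not coprime is a default.
crt : ℕ → ℕ → ℕ → ℕ → ℕ
crt M q c h with coprime? M q
... | no _ = c
... | yes cop with Coprimality.coprime-Bézout cop
...   | Bézout.+- x y _ = c ℕ.+ x ℕ.* ((q ℕ.∸ 1) ℕ.* (c ℕ.+ h)) ℕ.* M
...   | Bézout.-+ x y _ = c ℕ.+ x ℕ.* (c ℕ.+ h) ℕ.* M

crt-mod : ∀ M q c h → crt M q c h ≡ c [mod M ]
crt-mod M q c h with coprime? M q
... | no _ = subst (M ∣_) (sym (ℕₚ.∣n-n∣≡0 c)) (M ℕ.∣0)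
... | yes cop with Coprimality.coprime-Bézout cop
...   | Bézout.+- x y _ = mod-intro {c ℕ.+ x ℕ.* ((q ℕ.∸ 1) ℕ.* (c ℕ.+ h)) ℕ.* M} {c} 0 (x ℕ.* ((q ℕ.∸ 1) ℕ.* (c ℕ.+ h))) (ℕₚ.+-identityʳ _)
...   | Bézout.-+ x y _ = mod-intro {c ℕ.+ x ℕ.* (c ℕ.+ h) ℕ.* M} {c} 0 (x ℕ.* (c ℕ.+ h)) (ℕₚ.+-identityʳ _)

crt-∣ : ∀ {M q} c h → Coprime M q → 1 ℕ.≤ q → q ∣ crt M q c h ℕ.+ h
crt-∣ {M} {q} c h cop₀ 1≤q with coprime? M q
... | no ¬cop = ⊥-elim (¬cop λ {d} → cop₀ {d})
... | yes cop with Coprimality.coprime-Bézout cop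
...   | Bézout.-+ x y eq = divides ((c ℕ.+ h) ℕ.* y) (begin
    c ℕ.+ x ℕ.* (c ℕ.+ h) ℕ.* M ℕ.+ h              ≡⟨ solveℕ 4 (λ c h x M → c :+ᴺ x :*ᴺ (c :+ᴺ h) :*ᴺ M :+ᴺ h :=ᴺ (c :+ᴺ h) :*ᴺ (conᴺ 1 :+ᴺ x :*ᴺ M)) refl c h x M ⟩
    (c ℕ.+ h) ℕ.* (1 ℕ.+ x ℕ.* M)                  ≡⟨ cong ((c ℕ.+ h) ℕ.*_) eq ⟩
    (c ℕ.+ h) ℕ.* (y ℕ.* q)                        ≡⟨ sym (ℕₚ.*-assoc (c ℕ.+ h) y q) ⟩
    (c ℕ.+ h) ℕ.* y ℕ.* q                          ∎)
  where open ≡-Reasoning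
...   | Bézout.+- x y eq with q
...     | suc r = divides ((c ℕ.+ h) ℕ.* (1 ℕ.+ y ℕ.* r)) (begin
    c ℕ.+ x ℕ.* (r ℕ.* (c ℕ.+ h)) ℕ.* M ℕ.+ h      ≡⟨ solveℕ 5 (λ c h x M r → c :+ᴺ x :*ᴺ (r :*ᴺ (c :+ᴺ h)) :*ᴺ M :+ᴺ h :=ᴺ (c :+ᴺ h) :*ᴺ (conᴺ 1 :+ᴺ r :*ᴺ (x :*ᴺ M))) refl c h x M r ⟩
    (c ℕ.+ h) ℕ.* (1 ℕ.+ r ℕ.* (x ℕ.* M))          ≡⟨ cong (λ z → (c ℕ.+ h) ℕ.* (1 ℕ.+ r ℕ.* z)) (sym eq) ⟩
    (c ℕ.+ h) ℕ.* (1 ℕ.+ r ℕ.* (1 ℕ.+ y ℕ.* suc r)) ≡⟨ solveℕ 3 (λ s y r → s :*ᴺ (conᴺ 1 :+ᴺ r :*ᴺ (conᴺ 1 :+ᴺ y :*ᴺ (conᴺ 1 :+ᴺ r))) :=ᴺ s :*ᴺ (conᴺ 1 :+ᴺ y :*ᴺ r) :*ᴺ (conᴺ 1 :+ᴺ r)) refl (c ℕ.+ h) y r ⟩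
    (c ℕ.+ h) ℕ.* (1 ℕ.+ y ℕ.* r) ℕ.* suc r        ∎)
  where open ≡-Reasoning

χ-crt : ∀ {M q} → Coprime M q → 1 ℕ.≤ q → ∀ n c h → χ (n ≡? crt M q c h [mod q ℕ.* M ]) ≡ χ (n ≡? c [mod M ]) * χ (q ∣? n ℕ.+ h)
χ-crt {M} {q} cop 1≤q n c h = sym (χ-× (n ≡? c [mod M ]) (q ∣? n ℕ.+ h) (n ≡? crt M q c h [mod q ℕ.* M ])
  (λ n≡c q∣n+h → coprime-∣* (Coprimality.sym cop) (mod-unshift {n} {crt M q c h} h (∣∣⇒mod q∣n+h (crt-∣ c h cop 1≤q))) (mod-trans {n} {c} n≡c (mod-sym {crt M q c h} (crt-mod M q c h))))
  λ n≡x → mod-trans {n} {crt M q c h} (ℕ.∣-trans (ℕ.n∣m*n q) n≡x) (crt-mod M q c h) , mod-∣ (mod-shift {n} {crt M q c h} h (ℕ.∣-trans (ℕ.m∣m*n M) n≡x)) (crt-∣ c h cop 1≤q))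

-- Residue classes in which given primes divide members of the tuple.

∑ₗ : List ℕ → (ℕ → ℚ) → ℚ
∑ₗ []       f = 0ℚ
∑ₗ (h ∷ hs) f = f h + ∑ₗ hs f

∑ₗ-cong : ∀ hs {f g : ℕ → ℚ} → (∀ h → f h ≡ g h) → ∑ₗ hs f ≡ ∑ₗ hs g
∑ₗ-cong [] eq = refl
∑ₗ-cong (h ∷ hs) eq = cong₂ _+_ (eq h) (∑ₗ-cong hs eq)

∑ₗ-* : ∀ hs c (f : ℕ → ℚ) → ∑ₗ hs (λ h → c * f h) ≡ c * ∑ₗ hs f
∑ₗ-* [] c f = sym (ℚₚ.*-zeroʳ c)
∑ₗ-* (h ∷ hs) c f = trans (cong (c * f h +_) (∑ₗ-* hs c f)) (sym (ℚₚ.*-distribˡ-+ c (f h) (∑ₗ hs f)))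

∑ₗ-+ : ∀ hs (f g : ℕ → ℚ) → ∑ₗ hs (λ h → f h + g h) ≡ ∑ₗ hs f + ∑ₗ hs g
∑ₗ-+ [] f g = refl
∑ₗ-+ (h ∷ hs) f g = trans (cong (f h + g h +_) (∑ₗ-+ hs f g)) (solve 4 (λ a b c d → a :+ b :+ (c :+ d) := a :+ c :+ (b :+ d)) refl (f h) (g h) (∑ₗ hs f) (∑ₗ hs g))

∣∑ₗ∣≤ : ∀ hs {f : ℕ → ℚ} {B} → (∀ {h} → h ∈ hs → ∣ f h ∣ ≤ B) → ∣ ∑ₗ hs f ∣ ≤ fromℕ (length hs) * B
∣∑ₗ∣≤ [] {B = B} b = ℚₚ.≤-reflexive (sym (ℚₚ.*-zeroˡ B))
∣∑ₗ∣≤ (h ∷ hs) {f} {B} b = ≤-≡ refl (∣+∣≤ {f h} {∑ₗ hs f} (b (here refl)) (∣∑ₗ∣≤ hs λ h∈ → b (there h∈)))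
  (trans (solve 2 (λ n b → b :+ n :* b := (con 1ℚ :+ n) :* b) refl (fromℕ (length hs)) B) (cong (_* B) (sym (fromℕ-suc (length hs)))))

∑ₗ-const : ∀ hs x → ∑ₗ hs (λ _ → x) ≡ fromℕ (length hs) * x
∑ₗ-const [] x = sym (ℚₚ.*-zeroˡ x)
∑ₗ-const (h ∷ hs) x = trans (cong (x +_) (∑ₗ-const hs x)) (trans (solve 2 (λ n b → b :+ n :* b := (con 1ℚ :+ n) :* b) refl (fromℕ (length hs)) x) (cong (_* x) (sym (fromℕ-suc (length hs)))))

modulus : ℕ → List ℕ → ℕ
modulus W []       = W
modulus W (q ∷ qs) = q ℕ.* modulus W qs

modulus-product : ∀ W qs → modulus W qs ≡ product qs ℕ.* W
modulus-product W [] = sym (ℕₚ.*-identityˡ W)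
modulus-product W (q ∷ qs) = trans (cong (q ℕ.*_) (modulus-product W qs)) (sym (ℕₚ.*-assoc q (product qs) W))

module Roots (W ν : ℕ) (hs : List ℕ) where
  -- The residues c modulo W ∏ qs with c ≡ ν (mod W) and, for each q, c ≡ -h (mod q) for some h.
  data Root : List ℕ → ℕ → Set where
    []  : Root [] ν
    _∷_ : ∀ {q qs c h} → h ∈ hs → Root qs c → Root (q ∷ qs) (crt (modulus W qs) q c h)

  ∑ᵣ : List ℕ → (ℕ → ℚ) → ℚ
  ∑ᵣ []       f = f ν
  ∑ᵣ (q ∷ qs) f = ∑ᵣ qs (λ c → ∑ₗ hs (λ h → f (crt (modulus W qs) q c h)))

  ∑ᵣ-cong : ∀ qs {f g : ℕ → ℚ} → (∀ c → f c ≡ g c) → ∑ᵣ qs f ≡ ∑ᵣ qs g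
  ∑ᵣ-cong [] eq = eq ν
  ∑ᵣ-cong (q ∷ qs) eq = ∑ᵣ-cong qs λ c → ∑ₗ-cong hs λ h → eq (crt (modulus W qs) q c h)

  ∑ᵣ-* : ∀ qs c (f : ℕ → ℚ) → ∑ᵣ qs (λ x → c * f x) ≡ c * ∑ᵣ qs f
  ∑ᵣ-* [] c f = refl
  ∑ᵣ-* (q ∷ qs) c f = trans (∑ᵣ-cong qs λ x → ∑ₗ-* hs c (λ h → f (crt (modulus W qs) q x h))) (∑ᵣ-* qs c (λ x → ∑ₗ hs (λ h → f (crt (modulus W qs) q x h))))

  ∑ᵣ-+ : ∀ qs (f g : ℕ → ℚ) → ∑ᵣ qs (λ x → f x + g x) ≡ ∑ᵣ qs f + ∑ᵣ qs g
  ∑ᵣ-+ [] f g = refl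
  ∑ᵣ-+ (q ∷ qs) f g = trans (∑ᵣ-cong qs λ x → ∑ₗ-+ hs (λ h → f (crt (modulus W qs) q x h)) (λ h → g (crt (modulus W qs) q x h))) (∑ᵣ-+ qs _ _)

  ∑ᵣ-const : ∀ qs x → ∑ᵣ qs (λ _ → x) ≡ fromℕ (length hs) ^ length qs * x
  ∑ᵣ-const [] x = sym (ℚₚ.*-identityˡ x)
  ∑ᵣ-const (q ∷ qs) x = trans (∑ᵣ-const qs (∑ₗ hs (λ _ → x))) (trans (cong (fromℕ (length hs) ^ length qs *_) (∑ₗ-const hs x)) (solve 3 (λ k p x → p :* (k :* x) := k :* p :* x) refl (fromℕ (length hs)) (fromℕ (length hs) ^ length qs) x))

  ∑-∑ᵣ : ∀ N qs (F : ℕ → ℕ → ℚ) → ∑ N (λ n → ∑ᵣ qs (F n)) ≡ ∑ᵣ qs (λ c → ∑ N (λ n → F n c))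
  ∑-∑ᵣ zero qs F = sym (trans (∑ᵣ-const qs 0ℚ) (ℚₚ.*-zeroʳ (fromℕ (length hs) ^ length qs)))
  ∑-∑ᵣ (suc N) qs F = trans (cong (_+ ∑ᵣ qs (F (suc N))) (∑-∑ᵣ N qs F)) (sym (∑ᵣ-+ qs (λ c → ∑ N (λ n → F n c)) (F (suc N))))

  ∣∑ᵣ∣≤ : ∀ qs {f : ℕ → ℚ} {B} → (∀ c → Root qs c → ∣ f c ∣ ≤ B) → ∣ ∑ᵣ qs f ∣ ≤ fromℕ (length hs) ^ length qs * B
  ∣∑ᵣ∣≤ [] {f} {B} b = ≤-≡ refl (b ν []) (sym (ℚₚ.*-identityˡ B))
  ∣∑ᵣ∣≤ (q ∷ qs) {f} {B} b = ≤-≡ refl (∣∑ᵣ∣≤ qs {B = fromℕ (length hs) * B} λ c r → ∣∑ₗ∣≤ hs λ h∈ → b (crt (modulus W qs) q c _) (h∈ ∷ r))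
    (solve 3 (λ k p x → p :* (k :* x) := k :* p :* x) refl (fromℕ (length hs)) (fromℕ (length hs) ^ length qs) B)

  hits : ℕ → ℕ → ℚ
  hits q n = ∑ₗ hs (λ h → χ (q ∣? n ℕ.+ h))

  allHits : List ℕ → ℕ → ℚ
  allHits []       n = 1ℚ
  allHits (q ∷ qs) n = hits q n * allHits qs n

  χ-roots : ∀ {D qs} → Chosen D W qs → ∀ n → ∑ᵣ qs (λ c → χ (n ≡? c [mod modulus W qs ])) ≡ χ (n ≡? ν [mod W ]) * allHits qs n
  χ-roots [] n = sym (ℚₚ.*-identityʳ (χ (n ≡? ν [mod W ])))
  χ-roots (_∷_ {q} {qs} (pr , _ , q∤) ch) n = trans (∑ᵣ-cong qs λ c → trans (∑ₗ-cong hs λ h →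
        χ-crt (prime-∤⇒coprime pr λ q∣ → q∤ (subst (q ∣_) (modulus-product W qs) q∣)) (prime⇒1≤ pr) n c h)
      (trans (∑ₗ-* hs (χ (n ≡? c [mod modulus W qs ])) (λ h → χ (q ∣? n ℕ.+ h))) (ℚₚ.*-comm (χ (n ≡? c [mod modulus W qs ])) (hits q n))))
    (trans (∑ᵣ-* qs (hits q n) (λ c → χ (n ≡? c [mod modulus W qs ]))) (trans (cong (hits q n *_) (χ-roots ch n))
      (solve 3 (λ a b c → a :* (b :* c) := b :* (a :* c)) refl (hits q n) (χ (n ≡? ν [mod W ])) (allHits qs n))))

+-cancelˡ : ∀ p q r → p + q ≡ p + r → q ≡ r
+-cancelˡ p q r eq = trans (solve 2 (λ p q → q := p :+ q :- p) refl p q) (trans (cong (_- p) eq) (solve 2 (λ p q → p :+ q :- p := q) refl p r))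

-- Counting residue classes; Euler's function.

module _ {m : ℕ} (1≤m : 1 ℕ.≤ m) (c : ℕ) where
  private
    f : ℕ → ℚ
    f n = χ (n ≡? c [mod m ])
    f-periodic : ∀ n → f (m ℕ.+ n) ≡ f n
    f-periodic n = χ-cong (m ℕ.+ n ≡? c [mod m ]) (n ≡? c [mod m ]) (mod-trans {n} {m ℕ.+ n} (mod-sym {m ℕ.+ n} shift)) (mod-trans {m ℕ.+ n} {n} shift)
      where
      shift : m ℕ.+ n ≡ n [mod m ]
      shift = mod-intro 0 1 (trans (ℕₚ.+-identityʳ (m ℕ.+ n)) (trans (ℕₚ.+-comm m n) (cong (n ℕ.+_) (sym (ℕₚ.+-identityʳ m)))))
    S : ℕ → ℚ
    S x = ∑ m (λ i → f (x ℕ.+ i))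
    S-suc : ∀ x → S (suc x) ≡ S x
    S-suc x = +-cancelˡ (f (suc x)) (S (suc x)) (S x) (begin
      f (suc x) + S (suc x)                        ≡⟨ cong (_+ S (suc x)) (sym (trans (ℚₚ.+-identityˡ (f (x ℕ.+ 1))) (cong f (ℕₚ.+-comm x 1)))) ⟩
      ∑ 1 (λ i → f (x ℕ.+ i)) + S (suc x)          ≡⟨ cong (∑ 1 (λ i → f (x ℕ.+ i)) +_) (∑-cong m λ i _ _ → cong f (sym (ℕₚ.+-suc x i))) ⟩
      ∑ 1 (λ i → f (x ℕ.+ i)) + ∑ m (λ i → f (x ℕ.+ (1 ℕ.+ i))) ≡⟨ sym (∑-split 1 m (λ i → f (x ℕ.+ i))) ⟩
      S x + f (x ℕ.+ suc m)                        ≡⟨ cong (S x +_) (trans (cong f (trans (ℕₚ.+-suc x m) (ℕₚ.+-comm (suc x) m))) (f-periodic (suc x))) ⟩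
      S x + f (suc x)                              ≡⟨ ℚₚ.+-comm (S x) (f (suc x)) ⟩
      f (suc x) + S x                              ∎)
      where open ≡-Reasoning
    S-const : ∀ x → S x ≡ S 0
    S-const zero = refl
    S-const (suc x) = trans (S-suc x) (S-const x)
    S[c] : S c ≡ 1ℚ
    S[c] = lemma m 1≤m refl
      where
      lemma : ∀ k → 1 ℕ.≤ k → k ≡ m → ∑ k (λ i → f (c ℕ.+ i)) ≡ 1ℚ
      lemma (suc k) _ refl = trans (cong₂ _+_ (∑-zero k λ i 1≤i i≤k → χ-no (c ℕ.+ i ≡? c [mod m ]) λ m∣ → ℕₚ.<⇒≱ (s≤s i≤k) (ℕ.∣⇒≤ {{ℕ.>-nonZero 1≤i}} (subst (m ∣_) (diff i) m∣)))
          (χ-yes (c ℕ.+ m ≡? c [mod m ]) (subst (m ∣_) (sym (diff m)) ℕ.∣-refl))) refl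
        where
        diff : ∀ i → ℕ.∣ c ℕ.+ i - c ∣ ≡ i
        diff i = trans (cong (ℕ.∣ c ℕ.+ i -_∣) (sym (ℕₚ.+-identityʳ c))) (trans (ℕₚ.∣m+n-m+o∣≡∣n-o∣ c i 0) (ℕₚ.∣-∣-identityʳ i))

  residueCount : ℕ → ℚ
  residueCount x = ∑ x f

  private
    block : ∀ x → S x ≡ 1ℚ
    block x = trans (S-const x) (trans (sym (S-const c)) S[c])
    multiple : ∀ j → residueCount (m ℕ.* j) ≡ fromℕ j
    multiple zero = cong residueCount (ℕₚ.*-zeroʳ m)
    multiple (suc j) = trans (cong residueCount (trans (ℕₚ.*-suc m j) (ℕₚ.+-comm m (m ℕ.* j)))) (trans (∑-split (m ℕ.* j) m f) (trans (cong₂ _+_ (multiple j) (block (m ℕ.* j))) (trans (ℚₚ.+-comm (fromℕ j) 1ℚ) (sym (fromℕ-suc j)))))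

  residueCount-approx : ∀ x → ∣ residueCount x - fromℕ x * rec m ∣ ≤ 1ℚ
  residueCount-approx x = ∣∣-lub {residueCount x - fromℕ x * rec m}
    (by-difference (0≤+ (difference hi) (difference lo′)) (trans (solve 3 (λ a b j → con 1ℚ :+ j :- a :+ (b :- j) := con 1ℚ :- (a :- b)) refl (residueCount x) (fromℕ x * rec m) (fromℕ j)) refl))
    (by-difference (0≤+ (difference hi′) (difference lo)) (solve 3 (λ a b j → con 1ℚ :+ j :- b :+ (a :- j) := con 1ℚ :- (:- (a :- b))) refl (residueCount x) (fromℕ x * rec m) (fromℕ j)))
    where
    instance m≢0 = ℕ.>-nonZero 1≤m
    j = x ℕ./ m
    m*j≤x : m ℕ.* j ℕ.≤ x
    m*j≤x = ℕₚ.≤-trans (ℕₚ.≤-reflexive (ℕₚ.*-comm m j)) (ℕ.m/n*n≤m x m)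
    x≤m*suc : x ℕ.≤ m ℕ.* suc j
    x≤m*suc = ℕₚ.≤-trans (ℕₚ.≤-reflexive (ℕ.m≡m%n+[m/n]*n x m)) (ℕₚ.≤-trans (ℕₚ.+-monoˡ-≤ (j ℕ.* m) (ℕₚ.<⇒≤ (ℕ.m%n<n x m))) (ℕₚ.≤-reflexive (ℕₚ.*-comm (suc j) m)))
    scaled : ∀ i → fromℕ (m ℕ.* i) * rec m ≡ fromℕ i
    scaled i = trans (cong (_* rec m) (fromℕ-* m i)) (trans (solve 3 (λ m i r → m :* i :* r := i :* (m :* r)) refl (fromℕ m) (fromℕ i) (rec m)) (trans (cong (fromℕ i *_) (n*rec 1≤m)) (ℚₚ.*-identityʳ (fromℕ i))))
    lo : fromℕ j ≤ residueCount x
    lo = ≤-≡ (sym (multiple j)) (∑-extend m*j≤x λ n → 0≤χ (n ≡? c [mod m ])) refl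
    hi : residueCount x ≤ 1ℚ + fromℕ j
    hi = ≤-≡ refl (∑-extend x≤m*suc λ n → 0≤χ (n ≡? c [mod m ])) (trans (multiple (suc j)) (fromℕ-suc j))
    lo′ : fromℕ j ≤ fromℕ x * rec m
    lo′ = ≤-≡ (sym (scaled j)) (*-monoʳ (0≤rec m) (fromℕ-mono m*j≤x)) refl
    hi′ : fromℕ x * rec m ≤ 1ℚ + fromℕ j
    hi′ = ≤-≡ refl (*-monoʳ (0≤rec m) (fromℕ-mono x≤m*suc)) (trans (scaled (suc j)) (fromℕ-suc j))

coprimeCount-multiple : ∀ M j → ∑ (M ℕ.* j) (λ n → χ (coprime? n M)) ≡ fromℕ j * coprimeCount M
coprimeCount-multiple M zero = trans (cong (λ x → ∑ x (λ n → χ (coprime? n M))) (ℕₚ.*-zeroʳ M)) (sym (ℚₚ.*-zeroˡ (coprimeCount M)))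
coprimeCount-multiple M (suc j) = trans (cong (λ x → ∑ x (λ n → χ (coprime? n M))) (trans (ℕₚ.*-suc M j) (ℕₚ.+-comm M (M ℕ.* j))))
  (trans (∑-split (M ℕ.* j) M (λ n → χ (coprime? n M))) (trans (cong₂ _+_ (coprimeCount-multiple M j) (∑-cong M λ i _ _ → χ-periodic M j i))
    (trans (solve 2 (λ j c → j :* c :+ c := (con 1ℚ :+ j) :* c) refl (fromℕ j) (coprimeCount M)) (cong (_* coprimeCount M) (sym (fromℕ-suc j))))))

-- Count the integers up to `q M` coprime to `M` in two ways: by periodicity there are q φ(M), and
-- splitting off the multiples of `q` gives φ(q M) + φ(M).
coprimeCount-prime : ∀ {q M} → Prime q → ¬ q ∣ M → coprimeCount (q ℕ.* M) ≡ fromℕ (q ℕ.∸ 1) * coprimeCount M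
coprimeCount-prime {q} {M} pr q∤M = begin
  coprimeCount (q ℕ.* M)                                ≡⟨ solve 2 (λ a b → a := a :+ b :- b) refl (coprimeCount (q ℕ.* M)) (coprimeCount M) ⟩
  coprimeCount (q ℕ.* M) + coprimeCount M - coprimeCount M ≡⟨ cong (_- coprimeCount M) (sym total) ⟩
  fromℕ q * coprimeCount M - coprimeCount M             ≡⟨ cong (λ x → x * coprimeCount M - coprimeCount M) q≡ ⟩
  (1ℚ + fromℕ (q ℕ.∸ 1)) * coprimeCount M - coprimeCount M ≡⟨ solve 2 (λ a c → (con 1ℚ :+ a) :* c :- c := a :* c) refl (fromℕ (q ℕ.∸ 1)) (coprimeCount M) ⟩
  fromℕ (q ℕ.∸ 1) * coprimeCount M                      ∎
  where
  open ≡-Reasoning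
  X = q ℕ.* M
  F : ℕ → ℚ
  F n = χ (n ℕₚ.≤? X)
  q≡ : fromℕ q ≡ 1ℚ + fromℕ (q ℕ.∸ 1)
  q≡ = trans (cong fromℕ (sym (ℕₚ.m+[n∸m]≡n (prime⇒1≤ pr)))) (fromℕ-suc (q ℕ.∸ 1))
  inRange : ∀ W′ → coprimeSum X W′ F ≡ ∑ X (λ n → χ (coprime? n W′))
  inRange W′ = ∑-cong X λ n _ n≤X → trans (cong (χ (coprime? n W′) *_) (χ-yes (n ℕₚ.≤? X) n≤X)) (ℚₚ.*-identityʳ (χ (coprime? n W′)))
  total : fromℕ q * coprimeCount M ≡ coprimeCount X + coprimeCount M
  total = trans (sym (trans (cong (λ x → ∑ x (λ n → χ (coprime? n M))) (ℕₚ.*-comm q M)) (coprimeCount-multiple M q)))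
    (trans (sym (inRange M)) (trans (coprimeSum-split pr q∤M X F λ n X<n → χ-no (n ℕₚ.≤? X) (ℕₚ.<⇒≱ X<n))
      (cong₂ _+_ (inRange X) (trans (∑-truncate (m≤p*m (prime⇒1≤ pr) M) λ n M<n → trans (cong (χ (coprime? n M) *_) (χ-no (q ℕ.* n ℕₚ.≤? X) λ le → ℕₚ.<⇒≱ M<n (ℕₚ.*-cancelˡ-≤ q {{prime⇒nonZero pr}} le))) (ℚₚ.*-zeroʳ (χ (coprime? n M))))
        (∑-cong M λ n _ n≤M → trans (cong (χ (coprime? n M) *_) (χ-yes (q ℕ.* n ℕₚ.≤? X) (ℕₚ.*-monoʳ-≤ q n≤M))) (ℚₚ.*-identityʳ (χ (coprime? n M))))))))

coprimeCount≡φ : ∀ W → coprimeCount W ≡ fromℕ (φ W)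
coprimeCount≡φ W = go W id
  where
  count : (ℕ → ℕ) → ℕ → ℕ
  count f n = length (filter (λ a → coprime? a W) (applyUpTo f n))
  go : ∀ n (f : ℕ → ℕ) → ∑ n (λ i → χ (coprime? (f i) W)) ≡ fromℕ (count (f ∘ suc) n)
  go zero f = refl
  go (suc n) f = trans (∑-split 1 n (λ i → χ (coprime? (f i) W))) (trans (cong₂ _+_ (ℚₚ.+-identityˡ (χ (coprime? (f 1) W))) (go n (f ∘ suc))) (cons (coprime? (f 1) W)))
    where
    rest = applyUpTo (f ∘ suc ∘ suc) n
    cons : Dec (Coprime (f 1) W) → χ (coprime? (f 1) W) + fromℕ (count (f ∘ suc ∘ suc) n) ≡ fromℕ (length (filter (λ a → coprime? a W) (f 1 ∷ rest)))
    cons (yes c) = trans (cong (_+ fromℕ (count (f ∘ suc ∘ suc) n)) (χ-yes (coprime? (f 1) W) λ {d} → c {d})) (trans (sym (fromℕ-suc (count (f ∘ suc ∘ suc) n))) (cong (fromℕ ∘ length) (sym (filter-accept (λ a → coprime? a W) {f 1} {rest} λ {d} → c {d}))))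
    cons (no ¬c) = trans (cong (_+ fromℕ (count (f ∘ suc ∘ suc) n)) (χ-no (coprime? (f 1) W) ¬c)) (trans (ℚₚ.+-identityˡ (fromℕ (count (f ∘ suc ∘ suc) n))) (cong (fromℕ ∘ length) (sym (filter-reject (λ a → coprime? a W) {f 1} {rest} ¬c))))

-- The error of a weighted sum of squares.

module _ (z : ℕ → ℚ) (b : ℕ → ℕ → ℚ) (b² : ∀ p n → b p n * b p n ≡ b p n) where
  open Expansion z
  open ExpansionError z

  -- The error bound needs monotonicity only of the majorant `y`. Thus `y′` may be a difference such
  -- as y(n) - y(p n), as it will be on multiples of p.
  quadratic-error : ∀ N R {ps} → Small ps → {y y′ : ℕ → ℚ} → (∀ n → 0ℚ ≤ y n) → Decreasing y → (∀ n → R ℕ.< n → y n ≡ 0ℚ) → (∀ n → 1 ℕ.≤ n → ∣ y′ n ∣ ≤ y n) →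
    ∀ (w : ℕ → ℚ) x X →
    ∣ ∑ N (λ i → w i * (Op (ξ b b² i) ps y′ 1 * Op (ξ b b² i) ps y′ 1)) - X * G₂ (mean x) (second x) ps (y′ ⊗ y′) ∣ ≤
    Op z ps y 1 * Op z ps y 1 * U (R ℕ.* R) (λ qs → ∣ ∑ N (λ i → w i * bs b b² qs i) - density-product x X qs ∣) ps []
  quadratic-error N R {ps} small {y} {y′} 0≤y dec vanish y′≤y w x X = ≤-≡
    (cong ∣_∣ (trans (cong₂ _-_ main₁ (sym (Bil-main x X ps (y′ ⊗ y′) []))) (sym (Bil-- Φ (density-product x X) ps (y′ ⊗ y′) []))))
    (ℚₚ.≤-trans (∣Bil∣≤ (λ qs → Φ qs - density-product x X qs) small {Z = y ⊗ y} (λ m n 1≤m 1≤n → ∣*∣≤ {y′ m} {y′ n} (y′≤y m 1≤m) (y′≤y n 1≤n)) [])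
      (Bil⁺-≤ z R (λ qs → ℚₚ.0≤∣p∣ (Φ qs - density-product x X qs)) small {a = 1} {b = 1} 0≤y 0≤y dec dec supp supp {[]} ℕₚ.≤-refl)) refl
    where
    Φ : List ℕ → ℚ
    Φ qs = ∑ N (λ i → w i * bs b b² qs i)
    supp = supported λ m _ R< → vanish m (ℕₚ.≤-trans R< (ℕₚ.≤-reflexive (ℕₚ.*-identityˡ m)))
    main₁ : ∑ N (λ i → w i * (Op (ξ b b² i) ps y′ 1 * Op (ξ b b² i) ps y′ 1)) ≡ Bil Φ ps (y′ ⊗ y′) []
    main₁ = trans (∑-cong N λ i _ _ → cong₂ _*_ (sym (ℚₚ.*-identityʳ (w i))) (sym (G₂-square (ξ b b² i) ps y′))) (expand b b² N w ps (y′ ⊗ y′) [])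

-- Tuples and the primes that divide their translates.

data Without (h : ℕ) : List ℕ → List ℕ → Set where
  here  : ∀ {hs} → Without h (h ∷ hs) hs
  there : ∀ {x hs hs′} → Without h hs hs′ → Without h (x ∷ hs) (x ∷ hs′)

remove : ∀ {h hs} → h ∈ hs → ∃[ hs′ ] Without h hs hs′
remove (here refl) = _ , here
remove (there h∈) = _ , there (proj₂ (remove h∈))

without-length : ∀ {h hs hs′} → Without h hs hs′ → length hs ≡ suc (length hs′)
without-length here = refl
without-length (there w) = cong suc (without-length w)

without-∈ : ∀ {h hs hs′ x} → Without h hs hs′ → x ∈ hs′ → x ∈ hs
without-∈ here x∈ = there x∈
without-∈ (there w) (here eq) = here eq
without-∈ (there w) (there x∈) = there (without-∈ w x∈)

Separated : ℕ → List ℕ → Set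
Separated D = AllPairs λ h h′ → h ≢ h′ × ℕ.∣ h - h′ ∣ ℕ.≤ D

without-separated : ∀ {D h hs hs′} → Without h hs hs′ → Separated D hs → Separated D hs′
without-separated here (_ ∷ s) = s
without-separated (there w) (a ∷ s) = All.tabulate (λ x∈ → All.lookup a (without-∈ w x∈)) ∷ without-separated w s

without-self : ∀ {h hs hs′} → Without h hs hs′ → h ∈ hs
without-self here = here refl
without-self (there w) = there (without-self w)

without-≢ : ∀ {D h hs hs′ x} → Without h hs hs′ → Separated D hs → x ∈ hs′ → h ≢ x × ℕ.∣ h - x ∣ ℕ.≤ D
without-≢ here (a ∷ _) x∈ = All.lookup a x∈
without-≢ {h = h} (there w) (a ∷ s) (here refl) with All.lookup a (without-self w)
... | x≢h , le = (λ eq → x≢h (sym eq)) , subst (ℕ._≤ _) (ℕₚ.∣-∣-comm _ h) le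
without-≢ (there w) (a ∷ s) (there x∈) = without-≢ w s x∈

divides? : (hs : List ℕ) (q n : ℕ) → Dec (Any (λ h → q ∣ n ℕ.+ h) hs)
divides? hs q n = any? (λ h → q ∣? n ℕ.+ h) hs

∣-close : ∀ {D q n h h′} → D ℕ.< q → ℕ.∣ h - h′ ∣ ℕ.≤ D → h ≢ h′ → q ∣ n ℕ.+ h → ¬ q ∣ n ℕ.+ h′
∣-close {D} {q} {n} {h} {h′} D<q le h≢h′ q∣ q∣′ = ℕₚ.<⇒≱ D<q (ℕₚ.≤-trans (ℕ.∣⇒≤ {{ℕ.≢-nonZero λ eq → h≢h′ (ℕₚ.∣m-n∣≡0⇒m≡n eq)}}
  (subst (q ∣_) (ℕₚ.∣m+n-m+o∣≡∣n-o∣ n h h′) (∣∣⇒mod {n ℕ.+ h} {n ℕ.+ h′} q∣ q∣′))) le)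

-- A number above `D` divides at most one of the `n + h`, since they differ by at most `D`: the
-- union is disjoint.
χ-divides : ∀ {D q} → D ℕ.< q → ∀ {hs} → Separated D hs → ∀ n → χ (divides? hs q n) ≡ ∑ₗ hs (λ h → χ (q ∣? n ℕ.+ h))
χ-divides D<q [] n = refl
χ-divides {q = q} D<q {h ∷ hs} (a ∷ s) n = case q ∣? n ℕ.+ h of λ
  { (yes q∣) → trans (χ-yes (divides? (h ∷ hs) q n) (here q∣)) (sym (trans (cong₂ _+_ (χ-yes (q ∣? n ℕ.+ h) q∣) (none hs λ h′∈ → let h≢ , le = All.lookup a h′∈ in ∣-close D<q le h≢ q∣)) refl))
  ; (no q∤) → trans (χ-cong (divides? (h ∷ hs) q n) (divides? hs q n) (λ { (here q∣) → contradiction q∣ q∤ ; (there x) → x }) there)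
      (trans (χ-divides D<q s n) (sym (trans (cong (_+ ∑ₗ hs (λ h → χ (q ∣? n ℕ.+ h))) (χ-no (q ∣? n ℕ.+ h) q∤)) (ℚₚ.+-identityˡ (∑ₗ hs (λ h → χ (q ∣? n ℕ.+ h))))))) }
  where
  none : ∀ hs → (∀ {h′} → h′ ∈ hs → ¬ q ∣ n ℕ.+ h′) → ∑ₗ hs (λ h → χ (q ∣? n ℕ.+ h)) ≡ 0ℚ
  none [] f = refl
  none (x ∷ hs) f = cong₂ _+_ (χ-no (q ∣? n ℕ.+ x) (f (here refl))) (none hs λ h′∈ → f (there h′∈))

χ-divides-without : ∀ {h hs hs′} → Without h hs hs′ → ∀ {q n} → ¬ q ∣ n ℕ.+ h → χ (divides? hs q n) ≡ χ (divides? hs′ q n)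
χ-divides-without {h} {hs} {hs′} w {q} {n} q∤ = χ-cong (divides? hs q n) (divides? hs′ q n) (to w) (from w)
  where
  to : ∀ {hs hs′} → Without h hs hs′ → Any (λ h → q ∣ n ℕ.+ h) hs → Any (λ h → q ∣ n ℕ.+ h) hs′
  to here (here q∣) = contradiction q∣ q∤
  to here (there x) = x
  to (there w) (here q∣) = here q∣
  to (there w) (there x) = there (to w x)
  from : ∀ {hs hs′} → Without h hs hs′ → Any (λ h → q ∣ n ℕ.+ h) hs′ → Any (λ h → q ∣ n ℕ.+ h) hs
  from here x = there x
  from (there w) (here q∣) = here q∣
  from (there w) (there x) = there (from w x)

module _ (W ν : ℕ) (hs : List ℕ) (N : ℕ) where
  b-at : ℕ → ℕ → ℚ
  b-at q i = χ (divides? hs q (N ℕ.+ i))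

  b-at² : ∀ q i → b-at q i * b-at q i ≡ b-at q i
  b-at² q i = χ² (divides? hs q (N ℕ.+ i))

  class : ℕ → ℚ
  class i = χ (N ℕ.+ i ≡? ν [mod W ])

  -- The list `hs′` is `hs`, or `hs` without `h` when `g` lives on prime `n + h`, which no sieving
  -- prime divides. The choice decides between `k` and `k - 1` classes per prime.
  Φ-roots : ∀ z hs′ {D} → Separated D hs′ → (g : ℕ → ℚ) → ∀ qs → Chosen D W qs →
    (∀ q i → q ∈ qs → 1 ℕ.≤ i → i ℕ.≤ N → g i * χ (divides? hs q (N ℕ.+ i)) ≡ g i * χ (divides? hs′ q (N ℕ.+ i))) →
    ∑ N (λ i → class i * g i * Expansion.bs z b-at b-at² qs i) ≡ Roots.∑ᵣ W ν hs′ qs (λ c → ∑ N (λ i → g i * χ (N ℕ.+ i ≡? c [mod modulus W qs ])))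
  Φ-roots z hs′ {D} sep g qs ch same = trans (∑-cong N λ i 1≤i i≤N → trans (ℚₚ.*-assoc (class i) (g i) (Expansion.bs z b-at b-at² qs i))
      (trans (cong (class i *_) (hit-list qs ch (λ q q∈ → same q i q∈ 1≤i i≤N))) (trans (solve 3 (λ c g a → c :* (g :* a) := g :* (c :* a)) refl (class i) (g i) (Roots.allHits W ν hs′ qs (N ℕ.+ i)))
        (trans (cong (g i *_) (sym (Roots.χ-roots W ν hs′ ch (N ℕ.+ i)))) (sym (Roots.∑ᵣ-* W ν hs′ qs (g i) (λ c → χ (N ℕ.+ i ≡? c [mod modulus W qs ]))))))))
    (Roots.∑-∑ᵣ W ν hs′ N qs (λ i c → g i * χ (N ℕ.+ i ≡? c [mod modulus W qs ])))
    where
    hit-list : ∀ {i} qs → Chosen D W qs → (∀ q → q ∈ qs → g i * χ (divides? hs q (N ℕ.+ i)) ≡ g i * χ (divides? hs′ q (N ℕ.+ i))) →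
      g i * Expansion.bs z b-at b-at² qs i ≡ g i * Roots.allHits W ν hs′ qs (N ℕ.+ i)
    hit-list [] _ _ = refl
    hit-list {i} (q ∷ qs) ((_ , D<q , _) ∷ ch) same = trans (sym (ℚₚ.*-assoc (g i) (b-at q i) (Expansion.bs z b-at b-at² qs i)))
      (trans (cong (_* Expansion.bs z b-at b-at² qs i) (trans (same q (here refl)) (cong (g i *_) (χ-divides D<q sep (N ℕ.+ i)))))
        (trans (solve 3 (λ g h s → g :* h :* s := h :* (g :* s)) refl (g i) (Roots.hits W ν hs′ q (N ℕ.+ i)) (Expansion.bs z b-at b-at² qs i))
          (trans (cong (Roots.hits W ν hs′ q (N ℕ.+ i) *_) (hit-list qs ch λ q q∈ → same q (there q∈)))
            (solve 3 (λ g h s → h :* (g :* s) := g :* (h :* s)) refl (g i) (Roots.hits W ν hs′ q (N ℕ.+ i)) (Roots.allHits W ν hs′ qs (N ℕ.+ i))))))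

chosen⇒1≤modulus : ∀ {D W qs} → 1 ℕ.≤ W → Chosen D W qs → 1 ℕ.≤ modulus W qs
chosen⇒1≤modulus 1≤W [] = 1≤W
chosen⇒1≤modulus 1≤W ((pr , _) ∷ ch) = ℕₚ.*-mono-≤ (prime⇒1≤ pr) (chosen⇒1≤modulus 1≤W ch)

chosen⇒1≤product : ∀ {D W qs} → Chosen D W qs → 1 ℕ.≤ product qs
chosen⇒1≤product [] = ℕₚ.≤-refl
chosen⇒1≤product ((pr , _) ∷ ch) = ℕₚ.*-mono-≤ (prime⇒1≤ pr) (chosen⇒1≤product ch)

interval-count : ∀ {m} → 1 ℕ.≤ m → ∀ c N → ∣ ∑ N (λ i → χ (N ℕ.+ i ≡? c [mod m ])) - fromℕ N * rec m ∣ ≤ fromℕ 2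
interval-count {m} 1≤m c N = ≤-≡
  (cong ∣_∣ (trans (cong (_- fromℕ N * rec m) (trans (solve 2 (λ a b → b := a :+ b :- a) refl (residueCount 1≤m c N) (∑ N (λ i → χ (N ℕ.+ i ≡? c [mod m ])))) (cong (_- residueCount 1≤m c N) (sym (∑-split N N (λ n → χ (n ≡? c [mod m ])))))))
    (trans (solve 4 (λ a b n r → a :- b :- n :* r := (a :- (n :+ n) :* r) :+ :- (b :- n :* r)) refl (residueCount 1≤m c (N ℕ.+ N)) (residueCount 1≤m c N) (fromℕ N) (rec m))
      (cong (λ x → residueCount 1≤m c (N ℕ.+ N) - x * rec m + - (residueCount 1≤m c N - fromℕ N * rec m)) (sym (fromℕ-+ N N))))))
  (∣+∣≤ {residueCount 1≤m c (N ℕ.+ N) - fromℕ (N ℕ.+ N) * rec m} {(- (residueCount 1≤m c N - fromℕ N * rec m))} (residueCount-approx 1≤m c (N ℕ.+ N))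
    (≤-≡ (ℚₚ.∣-p∣≡∣p∣ (residueCount 1≤m c N - fromℕ N * rec m)) (residueCount-approx 1≤m c N) refl)) refl

Op-weight-mono : ∀ {β γ ps} → Weight β ps → All (λ p → β p ≤ γ p) ps → ∀ {g} → (∀ n → 0ℚ ≤ g n) → ∀ n → Op β ps g n ≤ Op γ ps g n
Op-weight-mono [] [] 0≤g n = ℚₚ.≤-refl
Op-weight-mono {ps = p ∷ ps} (0≤β ∷ w) (le ∷ les) 0≤g n = ℚₚ.+-mono-≤ (Op-weight-mono w les 0≤g n) (*-mono 0≤β (ℚₚ.≤-trans (Op-0≤ w 0≤g (p ℕ.* n)) (Op-weight-mono w les 0≤g (p ℕ.* n))) le (Op-weight-mono w les 0≤g (p ℕ.* n)))

-- Local factors at a single prime.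

-- With r = 1/(p - k), g = 1/p and f = 1/(p - 1).
module LocalFactors {k p : ℕ} (1≤k : 1 ℕ.≤ k) (k<p : k ℕ.< p) where
  private
    B = p ℕ.∸ k
    1≤B : 1 ℕ.≤ B
    1≤B = ℕₚ.m<n⇒0<n∸m k<p
    r = rec B
    f = recφ p
    j = k ℕ.∸ 1
    ζ = fromℕ j * r
    z = fromℕ k * r
    partial : ∀ i → 1 ℕ.≤ B ℕ.+ i → rec (B ℕ.+ i) * (1ℚ + fromℕ i * r) ≡ r
    partial i 1≤ = trans (cong (λ x → rec (B ℕ.+ i) * (x + fromℕ i * r)) (sym (n*rec 1≤B)))
      (trans (solve 4 (λ g b i r → g :* (b :* r :+ i :* r) := (b :+ i) :* g :* r) refl (rec (B ℕ.+ i)) (fromℕ B) (fromℕ i) r)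
        (trans (cong (λ x → x * rec (B ℕ.+ i) * r) (sym (fromℕ-+ B i))) (trans (cong (_* r) (n*rec 1≤)) (ℚₚ.*-identityˡ r))))
    B+k≡p : B ℕ.+ k ≡ p
    B+k≡p = ℕₚ.m∸n+n≡m (ℕₚ.<⇒≤ k<p)
    suc-j≡k : suc j ≡ k
    suc-j≡k = ℕₚ.m+[n∸m]≡n 1≤k
    B+j≡p∸1 : B ℕ.+ j ≡ p ℕ.∸ 1
    B+j≡p∸1 = cong ℕ.pred (trans (sym (ℕₚ.+-suc B j)) (trans (cong (B ℕ.+_) suc-j≡k) B+k≡p))
    g-eq : rec p * (1ℚ + z) ≡ r
    g-eq = trans (cong (λ x → rec x * (1ℚ + z)) (sym B+k≡p)) (partial k (ℕₚ.≤-trans 1≤B (ℕₚ.m≤m+n B k)))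
    f-eq : f * (1ℚ + ζ) ≡ r
    f-eq = trans (cong (λ x → rec x * (1ℚ + ζ)) (sym B+j≡p∸1)) (partial j (ℕₚ.≤-trans 1≤B (ℕₚ.m≤m+n B j)))
    z-eq : z ≡ ζ + r
    z-eq = trans (cong (λ i → fromℕ i * r) (sym suc-j≡k)) (trans (cong (_* r) (fromℕ-suc j)) (solve 2 (λ j r → (con 1ℚ :+ j) :* r := j :* r :+ r) refl (fromℕ j) r))

  -- This is what determines z = k/(p-k): for the density k/p of hits, `ξ` has mean zero. Hence the
  -- quadratic form over the integers is diagonal, with entries z by `second-integers`.
  mean-integers : z - (1ℚ + z) * (fromℕ k * rec p) ≡ 0ℚ
  mean-integers = trans (solve 4 (λ z k g q → z :- q :* (k :* g) := z :- k :* (g :* q)) refl z (fromℕ k) (rec p) (1ℚ + z)) (trans (cong (λ x → z - fromℕ k * x) g-eq) (ℚₚ.+-inverseʳ z))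

  second-integers : z * z + (1ℚ + z) * (1ℚ - z) * (fromℕ k * rec p) ≡ 0ℚ * 0ℚ + z
  second-integers = trans (solve 3 (λ z k g → z :* z :+ (con 1ℚ :+ z) :* (con 1ℚ :- z) :* (k :* g) := z :* z :+ (con 1ℚ :- z) :* (k :* (g :* (con 1ℚ :+ z)))) refl z (fromℕ k) (rec p))
    (trans (cong (λ x → z * z + (1ℚ - z) * (fromℕ k * x)) g-eq) (solve 1 (λ z → z :* z :+ (con 1ℚ :- z) :* z := con 0ℚ :* con 0ℚ :+ z) refl z))

  private
    vx : (1ℚ + z) * (fromℕ j * f) ≡ ζ + ζ * f
    vx = trans (cong (λ x → (1ℚ + x) * (fromℕ j * f)) z-eq)
      (trans (solve 4 (λ ζ r j f → (con 1ℚ :+ (ζ :+ r)) :* (j :* f) := j :* (f :* (con 1ℚ :+ ζ)) :+ j :* r :* f) refl ζ r (fromℕ j) f) (cong (λ x → fromℕ j * x + ζ * f) f-eq))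

  -- When `n + h` is prime the density of hits drops to (k-1)/(p-1) and the mean becomes 1/(p-1),
  -- which is the weight of the inner operator in the main term. The second moment has the form u² +
  -- ζ (1+u)² that `V-≥` expects.
  mean-primes : z - (1ℚ + z) * (fromℕ j * f) ≡ f
  mean-primes = trans (cong₂ _-_ (trans z-eq (cong (ζ +_) (sym f-eq))) vx) (solve 2 (λ ζ f → ζ :+ f :* (con 1ℚ :+ ζ) :- (ζ :+ ζ :* f) := f) refl ζ f)

  second-primes : z * z + (1ℚ + z) * (1ℚ - z) * (fromℕ j * f) ≡ f * f + ζ * ((1ℚ + f) * (1ℚ + f))
  second-primes = trans (solve 3 (λ z q x → z :* z :+ q :* (con 1ℚ :- z) :* x := z :* z :+ (con 1ℚ :- z) :* (q :* x)) refl z (1ℚ + z) (fromℕ j * f))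
    (trans (cong₂ (λ x y → x * x + (1ℚ - x) * y) (trans z-eq (cong (ζ +_) (sym f-eq))) vx)
      (solve 2 (λ ζ f → (ζ :+ f :* (con 1ℚ :+ ζ)) :* (ζ :+ f :* (con 1ℚ :+ ζ)) :+ (con 1ℚ :- (ζ :+ f :* (con 1ℚ :+ ζ))) :* (ζ :+ ζ :* f) := f :* f :+ ζ :* ((con 1ℚ :+ f) :* (con 1ℚ :+ f))) refl ζ f))

  r≤2g : k ℕ.+ k ℕ.≤ p → r ≤ fromℕ 2 * rec p
  r≤2g 2k≤p = inv₀≤ (0<fromℕ⁺ 1≤B) (≤-≡ (sym (n*rec (ℕₚ.≤-trans (s≤s z≤n) k<p)))
    (*-monoʳ (0≤rec p) (≤-≡ refl (fromℕ-mono p≤B+B) (fromℕ-+ B B)))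
    (solve 2 (λ b g → (b :+ b) :* g := con (fromℕ 2) :* g :* b) refl (fromℕ B) (rec p)))
    where
    p≤B+B : p ℕ.≤ B ℕ.+ B
    p≤B+B = ℕₚ.≤-trans (ℕₚ.≤-reflexive (sym B+k≡p)) (ℕₚ.+-monoʳ-≤ B (ℕₚ.≤-trans (ℕₚ.≤-reflexive (sym (ℕₚ.m+n∸n≡m k k))) (ℕₚ.∸-monoˡ-≤ k 2k≤p)))

  z≤1 : k ℕ.+ k ℕ.≤ p → z ≤ 1ℚ
  z≤1 2k≤p = ≤-≡ refl (*-monoʳ (0≤rec B) (fromℕ-mono (ℕₚ.≤-trans (ℕₚ.≤-reflexive (sym (ℕₚ.m+n∸n≡m k k))) (ℕₚ.∸-monoˡ-≤ k 2k≤p)))) (n*rec 1≤B)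

  excess≤ : k ℕ.+ k ℕ.≤ p → excess k p ≤ fromℕ (2 ℕ.* k) * (recφ p - rec p)
  excess≤ 2k≤p = ≤-≡ (trans (cong (_- rec p) (sym g-eq)) (solve 3 (λ g k r → g :* (con 1ℚ :+ k :* r) :- g := k :* (g :* r)) refl (rec p) (fromℕ k) r))
    (*-monoˡ (0≤fromℕ k) (*-monoˡ (0≤rec p) (ℚₚ.≤-trans (r≤2g 2k≤p) (*-monoˡ (0≤fromℕ 2) (rec-anti {p ℕ.∸ 1} {p} 1≤p-1 (ℕₚ.m∸n≤m p 1))))))
    (trans (solve 3 (λ k g f → k :* (g :* (con (fromℕ 2) :* f)) := con (fromℕ 2) :* k :* (g :* f)) refl (fromℕ k) (rec p) f)
      (cong₂ _*_ (sym (fromℕ-* 2 k)) (trans (solve 2 (λ g f → g :* f := g :* (con 1ℚ :+ f) :- g) refl (rec p) f) (cong (_- rec p) (recφ-eq (ℕₚ.≤-trans (s≤s 1≤k) k<p))))))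
    where
    1≤p-1 : 1 ℕ.≤ p ℕ.∸ 1
    1≤p-1 = ℕₚ.≤-trans 1≤B (ℕₚ.∸-monoʳ-≤ p 1≤k)

  z≤2k : k ℕ.+ k ℕ.≤ p → z ≤ fromℕ (2 ℕ.* k) * rec p
  z≤2k 2k≤p = ≤-≡ refl (*-monoˡ (0≤fromℕ k) (r≤2g 2k≤p)) (trans (solve 2 (λ k g → k :* (con (fromℕ 2) :* g) := con (fromℕ 2) :* k :* g) refl (fromℕ k) (rec p)) (cong (_* rec p) (sym (fromℕ-* 2 k))))

density-product-zero : ∀ z x qs → Expansion.density-product z x 0ℚ qs ≡ 0ℚ
density-product-zero z x [] = refl
density-product-zero z x (q ∷ qs) = trans (cong (x q *_) (density-product-zero z x qs)) (ℚₚ.*-zeroʳ (x q))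

∑ᵣ-approx : ∀ W ν hs qs {f : ℕ → ℚ} {x B} → (∀ c → Roots.Root W ν hs qs c → ∣ f c - x ∣ ≤ B) → ∣ Roots.∑ᵣ W ν hs qs f - fromℕ (length hs) ^ length qs * x ∣ ≤ fromℕ (length hs) ^ length qs * B
∑ᵣ-approx W ν hs qs {f} {x} b = ≤-≡ (cong ∣_∣ (sym (trans (Roots.∑ᵣ-+ W ν hs qs f (λ _ → - x)) (cong (Roots.∑ᵣ W ν hs qs f +_) (trans (Roots.∑ᵣ-const W ν hs qs (- x)) (solve 2 (λ p x → p :* (:- x) := :- (p :* x)) refl (fromℕ (length hs) ^ length qs) x))))))
  (Roots.∣∑ᵣ∣≤ W ν hs qs b) refl

∈⇒≤product : ∀ {D W qs q} → Chosen D W qs → q ∈ qs → q ℕ.≤ product qs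
∈⇒≤product (_∷_ {q} {qs} (pr , _) ch) (here refl) = ℕₚ.≤-trans (ℕₚ.≤-reflexive (sym (ℕₚ.*-identityʳ q))) (ℕₚ.*-monoʳ-≤ q (chosen⇒1≤product ch))
∈⇒≤product (_∷_ {q} {qs} (pr , _) ch) (there q∈) = ℕₚ.≤-trans (∈⇒≤product ch q∈) (m≤p*m (prime⇒1≤ pr) (product qs))

chosen⇒prime : ∀ {D W qs q} → Chosen D W qs → q ∈ qs → Prime q
chosen⇒prime ((pr , _) ∷ _) (here refl) = pr
chosen⇒prime (_ ∷ ch) (there q∈) = chosen⇒prime ch q∈

Chosen-∣ : ∀ {D W W′ qs} → W′ ∣ W → Chosen D W qs → Chosen D W′ qs
Chosen-∣ W′∣W [] = []
Chosen-∣ W′∣W (_∷_ {qs = qs} (pr , D<q , q∤) ch) = (pr , D<q , λ q∣ → q∤ (ℕ.∣-trans q∣ (ℕ.*-monoʳ-∣ (product qs) W′∣W))) ∷ Chosen-∣ W′∣W ch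

-- A prime that was fixed before the others, and so sits in the modulus, may be listed as if it had
-- been chosen last: distinctness is symmetric.
chosen-first : ∀ {D W p qs} → Prime p → D ℕ.< p → ¬ p ∣ W → Chosen D (p ℕ.* W) qs → Chosen D W (p ∷ qs)
chosen-first {D} {W} {p} {qs} pr D<p p∤W ch = (pr , D<p , p∤ ch) ∷ Chosen-∣ (ℕ.n∣m*n p) ch
  where
  p∤ : ∀ {qs} → Chosen D (p ℕ.* W) qs → ¬ p ∣ product qs ℕ.* W
  p∤ [] p∣ = p∤W (subst (p ∣_) (ℕₚ.*-identityˡ W) p∣)
  p∤ (_∷_ {q} {qs} (prq , _ , q∤) ch) p∣ with euclidsLemma q (product qs ℕ.* W) pr (subst (p ∣_) (ℕₚ.*-assoc q (product qs) W) p∣)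
  ... | inj₂ p∣′ = p∤ ch p∣′
  ... | inj₁ p∣q with prime⇒irreducible prq p∣q
  ...   | inj₁ refl = ¬prime[1] pr
  ...   | inj₂ refl = q∤ (ℕ.∣-trans (ℕ.m∣m*n W) (ℕ.n∣m*n (product qs)))

sieving-split : ∀ {W} qs {p rs} → Sieving W (qs ++ p ∷ rs) → (Prime p × ¬ p ∣ W) × Sieving (p ℕ.* W) (qs ++ rs)
sieving-split [] (pr ∷ s) = pr , s
sieving-split {W} (q ∷ qs) {p} {rs} ((prq , q∤W) ∷ s) with sieving-split qs s
... | (pr , p∤qW) , s′ = (pr , λ p∣W → p∤qW (ℕ.∣-trans p∣W (ℕ.n∣m*n q))) ,
  (prq , λ q∣pW → case euclidsLemma p W prq q∣pW of λ { (inj₁ q∣p) → case prime⇒irreducible pr q∣p of λ { (inj₁ refl) → ¬prime[1] prq ; (inj₂ refl) → p∤qW (ℕ.m∣m*n W) } ; (inj₂ q∣W) → q∤W q∣W })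
  ∷ subst (λ w → Sieving w (qs ++ rs)) (swap-factors p q W) s′

All-split : ∀ {P : ℕ → Set} qs {p rs} → All P (qs ++ p ∷ rs) → P p × All P (qs ++ rs)
All-split [] (x ∷ xs) = x , xs
All-split (q ∷ qs) (x ∷ xs) with All-split qs xs
... | p , all = p , x ∷ all

∈-split : ∀ {p : ℕ} {ps} → p ∈ ps → ∃[ qs ] ∃[ rs ] ps ≡ qs ++ p ∷ rs
∈-split (here refl) = [] , _ , refl
∈-split (there {x} p∈) with ∈-split p∈
... | qs , rs , refl = x ∷ qs , rs , refl

prime-divides-factorial : ∀ {q n} → Prime q → q ∣ n ! → q ℕ.≤ n
prime-divides-factorial {q} {zero} pr q∣ = contradiction (subst Prime (ℕ.∣1⇒≡1 q∣) pr) ¬prime[1]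
prime-divides-factorial {q} {suc n} pr q∣ with euclidsLemma (suc n) (n !) pr q∣
... | inj₁ q∣n = ℕ.∣⇒≤ q∣n
... | inj₂ q∣n! = ℕₚ.m≤n⇒m≤1+n (prime-divides-factorial pr q∣n!)

≤⇒∣! : ∀ {p n} → 1 ℕ.≤ p → p ℕ.≤ n → p ∣ n !
≤⇒∣! {suc p} _ p≤n = ℕ.∣-trans (ℕ.m∣m*n (p !)) (ℕ.m≤n⇒m!∣n! p≤n)

primeDivisor : ∀ n → 2 ℕ.≤ n → ∃[ p ] Prime p × p ∣ n
primeDivisor n@(suc _) 2≤n with factorise n
... | record { factors = []     ; isFactorisation = eq } = contradiction eq (ℕₚ.>⇒≢ 2≤n)
... | record { factors = p ∷ ps ; isFactorisation = eq ; factorsPrime = pp ∷ _ } = p , pp , subst (p ∣_) (sym eq) (ℕ.m∣m*n (product ps))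

primes-range : ∀ D {R} → 1 ℕ.≤ R → SieveRange (D !) R (primes D R)
primes-range D {R} 1≤R = record
  { 1≤W = ℕₚ.1≤n! D
  ; 1≤R = 1≤R
  ; sieving = primes-sieving D R λ q pr D<q _ q∣ → ℕₚ.<⇒≱ D<q (prime-divides-factorial pr q∣)
  ; covers = λ n 2≤n n≤R cop → let p , pr , p∣n = primeDivisor n 2≤n in
      p , ∈-primes D R pr (ℕₚ.≰⇒> λ p≤D → ¬prime[1] (subst Prime (cop (p∣n , ≤⇒∣! (prime⇒1≤ pr) p≤D)) pr)) (ℕₚ.≤-trans (ℕ.∣⇒≤ {{ℕ.>-nonZero (ℕₚ.≤-trans (s≤s z≤n) 2≤n)}} p∣n) n≤R) , p∣n }

^-distrib-mono : ∀ {x y z} m → 0ℚ ≤ x → 0ℚ ≤ y → x * y ≤ z → x ^ m * y ^ m ≤ z ^ m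
^-distrib-mono {x} {y} m 0≤x 0≤y le = ≤-≡ (sym (*-^ x y m)) (^-mono (0≤* 0≤x 0≤y) le m) refl

-- Sieve sums over integers, signs, primes and multiples of a prime.

module Setup (hs : List ℕ) (D ν N R : ℕ) (d a : ℚ) (2≤k : 2 ℕ.≤ length hs) (2k≤D : length hs ℕ.+ length hs ℕ.≤ D) (sep : Separated D hs)
             (1≤R : 1 ℕ.≤ R) (0<d : 0ℚ < d) (0≤a : 0ℚ ≤ a) (size : D ! ℕ.* (R ℕ.* R) ℕ.≤ N) where
  k W : ℕ
  k = length hs
  W = D !
  ps : List ℕ
  ps = primes D R
  1≤k : 1 ℕ.≤ k
  1≤k = ℕₚ.<⇒≤ 2≤k
  range : SieveRange W R ps
  range = primes-range D 1≤R
  open SieveRange range using (1≤W; sieving)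
  M : ℕ
  M = R ℕ.* R
  1≤M : 1 ℕ.≤ M
  1≤M = ℕₚ.*-mono-≤ 1≤R 1≤R
  -- With this `z`, `ξ` is z where p divides none of the n + h and -1 where it divides one. In
  -- classical terms the sieve sum is the sum of λ_d over d dividing ∏ (n + h), where λ_d is μ(d)
  -- times the sum, over the multiples r of d composed of distinct primes of `ps`, of y(r) ∏ p/(p-k)
  -- over p dividing d and ∏ k/(p-k) over p dividing r/d.
  z : ℕ → ℚ
  z p = fromℕ k * rec (p ℕ.∸ k)
  y : ℕ → ℚ
  y = sieveWeight R d a 0<d 0≤a
  open Expansion z
  open ExpansionError z
  b₀ : ℕ → ℕ → ℚ
  b₀ = b-at W ν hs N
  b₀² : ∀ q i → b₀ q i * b₀ q i ≡ b₀ q i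
  b₀² = b-at² W ν hs N
  cl : ℕ → ℚ
  cl = class W ν hs N
  -- The square of the sieve sum at n = N + i.
  A : ℕ → ℚ
  A i = Op (ξ b₀ b₀² i) ps y 1 * Op (ξ b₀ b₀² i) ps y 1

  0≤A : ∀ i → 0ℚ ≤ A i
  0≤A i = 0≤p² (Op (ξ b₀ b₀² i) ps y 1)

  largeD : All (D ℕ.<_) ps
  largeD = primes-large D R

  k<D : k ℕ.< D
  k<D = ℕₚ.≤-trans (ℕₚ.+-monoˡ-≤ k 1≤k) 2k≤D

  D<⇒k< : ∀ {p} → D ℕ.< p → k ℕ.< p
  D<⇒k< = ℕₚ.<-trans k<D

  D<⇒2k≤ : ∀ {p} → D ℕ.< p → k ℕ.+ k ℕ.≤ p
  D<⇒2k≤ D<p = ℕₚ.≤-trans 2k≤D (ℕₚ.<⇒≤ D<p)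

  large : All (k ℕ.<_) ps
  large = All.map D<⇒k< largeD

  0≤z : ∀ p → 0ℚ ≤ z p
  0≤z p = 0≤* (0≤fromℕ k) (0≤rec (p ℕ.∸ k))

  small-at : ∀ {p} → D ℕ.< p → 1 ℕ.≤ p × 0ℚ ≤ z p × z p ≤ 1ℚ
  small-at {p} D<p = ℕₚ.≤-trans (s≤s z≤n) D<p , 0≤z p , LocalFactors.z≤1 1≤k (D<⇒k< D<p) (D<⇒2k≤ D<p)

  small : Small ps
  small = All.map small-at largeD

  0≤y : ∀ n → 0ℚ ≤ y n
  0≤y = 0≤sieveWeight R d a 0<d 0≤a
  y-dec : Decreasing y
  y-dec = sieveWeight-decreasing R d a 0<d 0≤a
  y-vanish : ∀ n → R ℕ.< n → y n ≡ 0ℚ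
  y-vanish n R<n = sieveWeight-vanish R d a 0<d 0≤a n (ℕₚ.<⇒≤ R<n)

  Z : ℚ
  Z = Op z ps y 1
  0≤Z : 0ℚ ≤ Z
  0≤Z = Op-0≤ (small⇒weight small) 0≤y 1

  Z-≤ : Z ≤ (1ℚ + a) * H R ^ suc (2 ℕ.* k)
  Z-≤ = ℚₚ.≤-trans (Op-mono (small⇒weight small) (small⇒positive small) (λ n _ → y≤ n) 1 ℕₚ.≤-refl)
    (≤-≡ (Op-* z ps ((1ℚ + a) * H R) (λ n → χ (n ℕₚ.≤? R)) 1)
      (*-monoˡ (0≤* (0≤+ 0≤1 0≤a) (0≤H R)) (ℚₚ.≤-trans (Op-weight-mono (small⇒weight small) (All.map (λ D<p → LocalFactors.z≤2k 1≤k (D<⇒k< D<p) (D<⇒2k≤ D<p)) largeD) (λ n → 0≤χ (n ℕₚ.≤? R)) 1)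
        (ℚₚ.≤-trans (Op-log-power sieving 1≤R (2 ℕ.* k) 1 ℕₚ.≤-refl) (*-monoˡ (0≤^ (0≤H R) (2 ℕ.* k)) (χ≤1 (1 ℕₚ.≤? R))))))
      (solve 3 (λ a l q → a :* l :* (q :* con 1ℚ) := a :* (l :* q)) refl (1ℚ + a) (H R) (H R ^ (2 ℕ.* k))))
    where
    y≤ : ∀ n → y n ≤ (1ℚ + a) * H R * χ (n ℕₚ.≤? R)
    y≤ n = case n ℕₚ.≤? R of λ
      { (yes n≤R) → ≤-≡ refl (ℚₚ.≤-trans (sieveWeight-≤ R d a 0<d 0≤a n) (ℚₚ.+-monoʳ-≤ (H R) (*-monoˡ 0≤a (t≤H R n)))) (trans (solve 2 (λ l a → l :+ a :* l := (con 1ℚ :+ a) :* l :* con 1ℚ) refl (H R) a) (cong ((1ℚ + a) * H R *_) (sym (χ-yes (n ℕₚ.≤? R) n≤R))))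
      ; (no n≰R) → ≤-≡ (y-vanish n (ℕₚ.≰⇒> n≰R)) (0≤* (0≤* (0≤+ 0≤1 0≤a) (0≤H R)) (0≤χ (n ℕₚ.≤? R))) refl }

  xᶻ xᵖ : ℕ → ℚ
  xᶻ q = fromℕ k * rec q
  xᵖ q = fromℕ (k ℕ.∸ 1) * recφ q

  dp-integers : ∀ {W qs} → 1 ℕ.≤ W → Chosen D W qs → ∀ X → density-product xᶻ (X * rec W) qs ≡ fromℕ k ^ length qs * (X * rec (modulus W qs))
  dp-integers {W} 1≤W [] X = sym (ℚₚ.*-identityˡ (X * rec W))
  dp-integers {W} 1≤W (_∷_ {q} {qs} (pr , _) ch) X = trans (cong (xᶻ q *_) (dp-integers 1≤W ch X))
    (trans (solve 5 (λ k r p x m → k :* r :* (p :* (x :* m)) := k :* p :* (x :* (r :* m))) refl (fromℕ k) (rec q) (fromℕ k ^ length qs) X (rec (modulus W qs)))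
      (cong (λ x → fromℕ k ^ suc (length qs) * (X * x)) (sym (rec-* (prime⇒1≤ pr) (chosen⇒1≤modulus 1≤W ch)))))

  0<coprimeCount : ∀ {m} → 1 ℕ.≤ m → 1ℚ ≤ coprimeCount m
  0<coprimeCount {m} 1≤m = ≤-≡ (sym (χ-yes (coprime? 1 m) (Coprimality.1-coprimeTo m))) (∑-term m (λ n → 0≤χ (coprime? n m)) ℕₚ.≤-refl 1≤m) refl

  inv-count : ∀ {q m} → Prime q → ¬ q ∣ m → 1 ℕ.≤ m → inv₀ (coprimeCount (q ℕ.* m)) ≡ recφ q * inv₀ (coprimeCount m)
  inv-count {q} {m} pr q∤m 1≤m = trans (cong inv₀ (coprimeCount-prime pr q∤m)) (inv₀-* (0<fromℕ⁺ {q ℕ.∸ 1} (ℕₚ.∸-monoˡ-≤ 1 (prime⇒2≤ pr))) (ℚₚ.<-≤-trans 0<1 (0<coprimeCount 1≤m)))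

  chosen-∤ : ∀ {W q qs} → ¬ q ∣ product qs ℕ.* W → ¬ q ∣ modulus W qs
  chosen-∤ {W} {q} {qs} q∤ q∣ = q∤ (subst (q ∣_) (modulus-product W qs) q∣)

  dp-primes : ∀ {qs} → Chosen D W qs → ∀ X → density-product xᵖ (X * inv₀ (coprimeCount W)) qs ≡ fromℕ (k ℕ.∸ 1) ^ length qs * (X * inv₀ (coprimeCount (modulus W qs)))
  dp-primes [] X = sym (ℚₚ.*-identityˡ (X * inv₀ (coprimeCount W)))
  dp-primes (_∷_ {q} {qs} (pr , _ , q∤) ch) X = trans (cong (xᵖ q *_) (dp-primes ch X))
    (trans (solve 5 (λ k r p x m → k :* r :* (p :* (x :* m)) := k :* p :* (x :* (r :* m))) refl (fromℕ (k ℕ.∸ 1)) (recφ q) (fromℕ (k ℕ.∸ 1) ^ length qs) X (inv₀ (coprimeCount (modulus W qs))))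
      (cong (λ x → fromℕ (k ℕ.∸ 1) ^ suc (length qs) * (X * x)) (sym (inv-count pr (chosen-∤ {W} {q} {qs} q∤) (chosen⇒1≤modulus 1≤W ch)))))

  Φ : (ℕ → ℚ) → List ℕ → ℚ
  Φ w qs = ∑ N (λ i → w i * bs b₀ b₀² qs i)

  quadratic : ∀ (w : ℕ → ℚ) x X → ∣ ∑ N (λ i → w i * A i) - X * G₂ (mean x) (second x) ps (y ⊗ y) ∣ ≤ Z * Z * U M (λ qs → ∣ Φ w qs - density-product x X qs ∣) ps []
  quadratic w x X = quadratic-error z b₀ b₀² N R small 0≤y y-dec y-vanish (λ n _ → 0≤⇒∣∣≤ (0≤y n)) w x X

  G₂-integers : ∀ {ps} → All (D ℕ.<_) ps → ∀ y → G₂ (mean xᶻ) (second xᶻ) ps (y ⊗ y) ≡ Op z ps (λ n → y n * y n) 1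
  G₂-integers {ps} all y = trans (G₂≡V {mean xᶻ} {z} ps (All.map (λ {p} D<p → trans (LocalFactors.second-integers {k} {p} 1≤k (D<⇒k< D<p)) (cong (λ x → x * x + z p) (sym (LocalFactors.mean-integers {k} {p} 1≤k (D<⇒k< D<p))))) all) y)
    (V-diagonal ps (All.map (λ {p} D<p → LocalFactors.mean-integers {k} {p} 1≤k (D<⇒k< D<p)) all) y)

  w₁ : ℕ → ℚ
  w₁ i = cl i * 1ℚ

  e-integers : ∀ qs → Chosen D W qs → ∣ Φ w₁ qs - density-product xᶻ (fromℕ N * rec W) qs ∣ ≤ fromℕ k ^ length qs * fromℕ 2
  e-integers qs ch = ≤-≡ (cong₂ (λ a b → ∣ a - b ∣) (Φ-roots W ν hs N z hs sep (λ _ → 1ℚ) qs ch λ _ _ _ _ _ → refl) (dp-integers 1≤W ch (fromℕ N)))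
    (∑ᵣ-approx W ν hs qs λ c _ → ≤-≡ (cong (λ x → ∣ x - fromℕ N * rec (modulus W qs) ∣) (∑-cong N λ i _ _ → ℚₚ.*-identityˡ _)) (interval-count (chosen⇒1≤modulus 1≤W ch) c N) refl) refl

  2≤ : ∀ {qs} → Chosen D W qs → product qs ℕ.≤ M → fromℕ 2 ≤ fromℕ 2 * fromℕ M * rec (product qs)
  2≤ {qs} ch le = ≤-≡ (solve 1 (λ t → t := t :* con 1ℚ) refl (fromℕ 2)) (*-monoˡ (0≤fromℕ 2) (≤-≡ (sym (n*rec (chosen⇒1≤product ch))) (*-monoʳ (0≤rec (product qs)) (fromℕ-mono le)) refl)) (sym (ℚₚ.*-assoc (fromℕ 2) (fromℕ M) (rec (product qs))))

  sum-integers : ∣ ∑ N (λ i → w₁ i * A i) - fromℕ N * rec W * Op z ps (λ n → y n * y n) 1 ∣ ≤ Z * Z * (fromℕ 2 * fromℕ M * H M ^ (6 ℕ.* k))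
  sum-integers = ≤-≡ (cong (λ x → ∣ ∑ N (λ i → w₁ i * A i) - fromℕ N * rec W * x ∣) (sym (G₂-integers largeD y)))
    (ℚₚ.≤-trans (quadratic w₁ xᶻ (fromℕ N * rec W))
      (*-monoˡ (0≤* 0≤Z 0≤Z) (U-divisor-bound sieving largeD 1≤M 1≤W k (fromℕ 2 * fromℕ M) (0≤* (0≤fromℕ 2) (0≤fromℕ M))
        λ qs ch le → ℚₚ.≤-trans (e-integers qs ch) (*-monoˡ (0≤^ (0≤fromℕ k) (length qs)) (2≤ ch le))))) refl

  modulus≤N : ∀ {qs} → product qs ℕ.≤ M → modulus W qs ℕ.≤ N
  modulus≤N {qs} le = ℕₚ.≤-trans (ℕₚ.≤-reflexive (trans (modulus-product W qs) (ℕₚ.*-comm (product qs) W))) (ℕₚ.≤-trans (ℕₚ.*-monoʳ-≤ W le) size)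

  class-count : ∀ {qs} → Chosen D W qs → product qs ℕ.≤ M → ∀ c → ∑ N (λ i → χ (N ℕ.+ i ≡? c [mod modulus W qs ])) ≤ fromℕ 3 * fromℕ N * rec (product qs)
  class-count {qs} ch le c = ℚₚ.≤-trans (by-difference (difference (∣∣≤⇒ (interval-count 1≤m c N))) (solve 2 (λ s n → con (fromℕ 2) :- (s :- n) := n :+ con (fromℕ 2) :- s) refl (∑ N (λ i → χ (N ℕ.+ i ≡? c [mod m ]))) (fromℕ N * rec m)))
    (ℚₚ.≤-trans (ℚₚ.+-monoʳ-≤ (fromℕ N * rec m) (≤-≡ (solve 1 (λ t → t := t :* con 1ℚ) refl (fromℕ 2)) (*-monoˡ (0≤fromℕ 2) (≤-≡ (sym (n*rec 1≤m)) (*-monoʳ (0≤rec m) (fromℕ-mono (modulus≤N {qs} le))) refl)) refl))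
      (≤-≡ (solve 2 (λ n r → n :* r :+ con (fromℕ 2) :* (n :* r) := con (fromℕ 3) :* n :* r) refl (fromℕ N) (rec m))
        (*-monoˡ (0≤* (0≤fromℕ 3) (0≤fromℕ N)) (rec-anti (chosen⇒1≤product ch) (ℕₚ.≤-trans (m≤p*m 1≤W (product qs)) (ℕₚ.≤-reflexive (trans (ℕₚ.*-comm W (product qs)) (sym (modulus-product W qs))))))) refl))
    where
    m = modulus W qs
    1≤m = chosen⇒1≤modulus 1≤W ch

  modulus-comm : ∀ qs → modulus W qs ≡ W ℕ.* product qs
  modulus-comm qs = trans (modulus-product W qs) (ℕₚ.*-comm (product qs) W)

  -- No main term is expected, so the expansion is compared with the zero density and all of it is
  -- error. The trivial bound for a class modulo m is 3 N/m.
  sum-parity : ∀ (g : ℕ → ℚ) → (∀ i → ∣ g i ∣ ≤ 1ℚ) → ∀ {E : ℕ → ℚ} → (∀ m → 0ℚ ≤ E m) →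
    (∀ m c → 1 ℕ.≤ m → ∣ ∑ N (λ i → g i * χ (N ℕ.+ i ≡? c [mod m ])) ∣ ≤ E m) → ∀ T → 0ℚ < T →
    ∣ ∑ N (λ i → cl i * g i * A i) ∣ ≤ Z * Z * (T * ∑ (W ℕ.* M) E + inv₀ T * (fromℕ 3 * fromℕ N * H M ^ (6 ℕ.* k ℕ.* (6 ℕ.* k))))
  sum-parity g g≤1 {E} 0≤E hyp T 0<T = ≤-≡ (cong ∣_∣ (solve 2 (λ s q → s := s :- con 0ℚ :* q) refl (∑ N (λ i → cl i * g i * A i)) (G₂ (mean xᶻ) (second xᶻ) ps (y ⊗ y))))
    (ℚₚ.≤-trans (quadratic (λ i → cl i * g i) xᶻ 0ℚ) (*-monoˡ (0≤* 0≤Z 0≤Z) (U-trade sieving largeD 1≤M 1≤W k (fromℕ 3 * fromℕ N) T (0≤* (0≤fromℕ 3) (0≤fromℕ N)) 0<T {E} 0≤E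
      (λ qs ch le → bound qs ch λ c → ≤-≡ refl (hyp (modulus W qs) c (chosen⇒1≤modulus 1≤W ch)) (cong E (modulus-comm qs)))
      (λ qs ch le → bound qs ch λ c → ℚₚ.≤-trans (∣∑∣≤ N (λ i → g i * χ (N ℕ.+ i ≡? c [mod modulus W qs ])))
        (ℚₚ.≤-trans (∑-mono N λ i _ _ → ≤-≡ refl (∣*∣≤ {g i} {χ (N ℕ.+ i ≡? c [mod modulus W qs ])} (g≤1 i) (0≤⇒∣∣≤ (0≤χ (N ℕ.+ i ≡? c [mod modulus W qs ])))) (ℚₚ.*-identityˡ (χ (N ℕ.+ i ≡? c [mod modulus W qs ])))) (class-count ch le c)))))) refl
    where
    bound : ∀ qs → Chosen D W qs → ∀ {B} → (∀ c → ∣ ∑ N (λ i → g i * χ (N ℕ.+ i ≡? c [mod modulus W qs ])) ∣ ≤ B) → ∣ Φ (λ i → cl i * g i) qs - density-product xᶻ 0ℚ qs ∣ ≤ fromℕ k ^ length qs * B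
    bound qs ch h = ≤-≡ (cong ∣_∣ (trans (cong₂ _-_ (Φ-roots W ν hs N z hs sep g qs ch λ _ _ _ _ _ → refl) (density-product-zero z xᶻ qs)) (ℚₚ.+-identityʳ _)))
      (Roots.∣∑ᵣ∣≤ W ν hs qs λ c _ → h c) refl

  module _ {h hs′} (wo : Without h hs hs′) (ν-ok : Coprime (ν ℕ.+ h) W) (l : ℕ → ℚ) (0≤l : ∀ p → 0ℚ ≤ l p) {Lmax : ℚ} (l≤ : ∀ i → 1 ℕ.≤ i → i ℕ.≤ N → l (N ℕ.+ i ℕ.+ h) ≤ Lmax) (0≤Lmax : 0ℚ ≤ Lmax) where
    gᵖ : ℕ → ℚ
    gᵖ i = χ (prime? (N ℕ.+ i ℕ.+ h)) * l (N ℕ.+ i ℕ.+ h)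

    private
      sep′ = without-separated wo sep
      k∸1≡ : length hs′ ≡ k ℕ.∸ 1
      k∸1≡ = cong ℕ.pred (sym (without-length wo))

    -- Each q divides some c + h′ with h′ ≠ h and exceeds their distance, so it does not divide c +
    -- h. This is the coprimality required by the maximum in (A).
    root-coprime : ∀ {qs} → Chosen D W qs → ∀ {c} → Roots.Root W ν hs′ qs c → Coprime (c ℕ.+ h) (modulus W qs)
    root-coprime [] Roots.[] = ν-ok
    root-coprime {q ∷ qs} ((pr , D<q , q∤) ∷ ch) (Roots._∷_ {c = c} {h = h′} h′∈ r) = coprime-*ʳ
      (prime-∤⇒coprime pr (∣-close D<q (subst (ℕ._≤ D) (ℕₚ.∣-∣-comm h h′) (proj₂ close)) (λ eq → proj₁ close (sym eq)) (crt-∣ c h′ (prime-∤⇒coprime pr (chosen-∤ {W} {q} {qs} q∤)) (prime⇒1≤ pr))))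
      (λ (e∣x , e∣m) → root-coprime ch r (mod-∣ {c ℕ.+ h} {x ℕ.+ h} (mod-shift {c} {x} h (mod-sym {x} {c} (ℕ.∣-trans e∣m (crt-mod (modulus W qs) q c h′)))) e∣x , e∣m))
      where
      x = crt (modulus W qs) q c h′
      close = without-≢ wo sep h′∈

    -- If n + h is prime and q divides it, then q = n + h > N, whereas q ≤ M ≤ N.
    not-itself : ∀ qs → Chosen D W qs → product qs ℕ.≤ M → ∀ q i → q ∈ qs → 1 ℕ.≤ i → i ℕ.≤ N → gᵖ i * χ (divides? hs q (N ℕ.+ i)) ≡ gᵖ i * χ (divides? hs′ q (N ℕ.+ i))
    not-itself qs ch le q i q∈ 1≤i i≤N = case prime? (N ℕ.+ i ℕ.+ h) of λ
      { (no ¬pr) → trans (null ¬pr (χ (divides? hs q (N ℕ.+ i)))) (sym (null ¬pr (χ (divides? hs′ q (N ℕ.+ i)))))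
      ; (yes pr) → cong (gᵖ i *_) (χ-divides-without wo {q} {N ℕ.+ i} λ q∣ → case prime⇒irreducible pr q∣ of λ
          { (inj₁ refl) → ¬prime[1] (chosen⇒prime ch q∈)
          ; (inj₂ eq) → ℕₚ.<⇒≱ (ℕₚ.≤-trans (ℕₚ.m<m+n N 1≤i) (ℕₚ.m≤m+n (N ℕ.+ i) h)) (ℕₚ.≤-trans (ℕₚ.≤-reflexive (sym eq)) (ℕₚ.≤-trans (∈⇒≤product ch q∈) (ℕₚ.≤-trans le (ℕₚ.≤-trans (m≤p*m 1≤W M) size)))) }) }
      where
      null : ¬ Prime (N ℕ.+ i ℕ.+ h) → ∀ x → gᵖ i * x ≡ 0ℚ
      null ¬pr x = trans (cong (λ c → c * l (N ℕ.+ i ℕ.+ h) * x) (χ-no (prime? (N ℕ.+ i ℕ.+ h)) ¬pr)) (solve 2 (λ l x → con 0ℚ :* l :* x := con 0ℚ) refl (l (N ℕ.+ i ℕ.+ h)) x)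

    inv-count-≤ : ∀ {qs} → Chosen D W qs → inv₀ (coprimeCount (modulus W qs)) ≤ fromℕ 2 ^ length qs * rec (product qs)
    inv-count-≤ [] = inv₀-anti 0<1 (0<coprimeCount 1≤W)
    inv-count-≤ (_∷_ {q} {qs} (pr , _ , q∤) ch) = ≤-≡ (inv-count pr (chosen-∤ {W} {q} {qs} q∤) (chosen⇒1≤modulus 1≤W ch))
      (*-mono (0≤rec (q ℕ.∸ 1)) (0≤* (0≤^ (0≤fromℕ 2) (length qs)) (0≤rec (product qs))) (LocalFactors.r≤2g {1} {q} ℕₚ.≤-refl (prime⇒2≤ pr) (prime⇒2≤ pr)) (inv-count-≤ ch))
      (trans (solve 4 (λ t r p m → t :* r :* (p :* m) := t :* p :* (r :* m)) refl (fromℕ 2) (rec q) (fromℕ 2 ^ length qs) (rec (product qs))) (cong (fromℕ 2 ^ suc (length qs) *_) (sym (rec-* (prime⇒1≤ pr) (chosen⇒1≤product ch)))))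

    ζᵖ : ℕ → ℚ
    ζᵖ p = fromℕ (k ℕ.∸ 1) * rec (p ℕ.∸ k)

    private
      σᵖ τᵖ : ℕ → ℚ
      σᵖ p = ζᵖ p * ((1ℚ + recφ p) * (1ℚ + recφ p))
      τᵖ p = recφ p * recφ p + σᵖ p

    G₂-primes : Op ζᵖ ps (λ n → Op recφ ps y n * Op recφ ps y n) 1 ≤ G₂ (mean xᵖ) (second xᵖ) ps (y ⊗ y)
    G₂-primes = ≤-≡ refl (V-≥ {recφ} {ζᵖ} {ps} (All.universal (λ p → 0≤rec (p ℕ.∸ 1)) ps) (All.universal (λ p → 0≤* (0≤fromℕ (k ℕ.∸ 1)) (0≤rec (p ℕ.∸ k))) ps) (small⇒positive small) {y} 0≤y y-dec)
      (sym (trans (G₂-weights {mean xᵖ} {recφ} {second xᵖ} {τᵖ} ps (All.map mean-eq largeD) (All.map second-eq largeD) (y ⊗ y)) (G₂≡V {recφ} {σᵖ} {τᵖ} ps (All.universal (λ p → refl) ps) y)))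
      where
      mean-eq : ∀ {p} → D ℕ.< p → mean xᵖ p ≡ recφ p
      mean-eq {p} D<p = LocalFactors.mean-primes {k} {p} 1≤k (D<⇒k< D<p)
      second-eq : ∀ {p} → D ℕ.< p → second xᵖ p ≡ τᵖ p
      second-eq {p} D<p = LocalFactors.second-primes {k} {p} 1≤k (D<⇒k< D<p)
      G₂-weights : ∀ {u u′ τ τ′ : ℕ → ℚ} ps → All (λ p → u p ≡ u′ p) ps → All (λ p → τ p ≡ τ′ p) ps → ∀ Y → G₂ u τ ps Y ≡ G₂ u′ τ′ ps Y
      G₂-weights [] [] [] Y = refl
      G₂-weights {u} {u′} {τ} {τ′} (p ∷ ps) (eu ∷ us) (eτ ∷ τs) Y = trans (G₂-weights ps us τs (step₂ (u p) (τ p) p Y)) (G₂-cong u′ τ′ ps λ m n → cong₂ (λ a b → step₂ a b p Y m n) eu eτ)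

    sum-primes : ∀ {E : ℕ → ℚ} → (∀ m → 0ℚ ≤ E m) →
      (∀ m c → 1 ℕ.≤ m → Coprime (c ℕ.+ h) m → ∣ ∑ N (λ i → gᵖ i * χ (N ℕ.+ i ≡? c [mod m ])) - fromℕ N * inv₀ (coprimeCount m) ∣ ≤ E m) → ∀ T → 0ℚ < T →
      fromℕ N * inv₀ (coprimeCount W) * Op ζᵖ ps (λ n → Op recφ ps y n * Op recφ ps y n) 1 ≤
      ∑ N (λ i → cl i * gᵖ i * A i) + Z * Z * (T * ∑ (W ℕ.* M) E + inv₀ T * ((fromℕ 3 * Lmax + 1ℚ) * fromℕ N * H M ^ (6 ℕ.* (2 ℕ.* k) ℕ.* (6 ℕ.* (2 ℕ.* k)))))
    sum-primes {E} 0≤E hyp T 0<T = ℚₚ.≤-trans (*-monoˡ (0≤* (0≤fromℕ N) (ℚₚ.<⇒≤ (0<inv₀ (ℚₚ.<-≤-trans 0<1 (0<coprimeCount 1≤W))))) G₂-primes)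
      (by-difference (difference (ℚₚ.≤-trans (∣∣≤⇒ (≤-≡ (ℚₚ.∣-p∣≡∣p∣ (S - X)) (quadratic (λ i → cl i * gᵖ i) xᵖ (fromℕ N * inv₀ (coprimeCount W))) refl))
          (*-monoˡ (0≤* 0≤Z 0≤Z) (U-trade sieving largeD 1≤M 1≤W (2 ℕ.* k) K T 0≤K 0<T {E} 0≤E bound₁ bound₂))))
        (solve 3 (λ s x b → b :- (:- (s :- x)) := s :+ b :- x) refl S X (Z * Z * (T * ∑ (W ℕ.* M) E + inv₀ T * (K * H M ^ (6 ℕ.* (2 ℕ.* k) ℕ.* (6 ℕ.* (2 ℕ.* k))))))))
      where
      S = ∑ N (λ i → cl i * gᵖ i * A i)
      X = fromℕ N * inv₀ (coprimeCount W) * G₂ (mean xᵖ) (second xᵖ) ps (y ⊗ y)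
      K = (fromℕ 3 * Lmax + 1ℚ) * fromℕ N
      0≤K : 0ℚ ≤ K
      0≤K = 0≤* (0≤+ (0≤* (0≤fromℕ 3) 0≤Lmax) 0≤1) (0≤fromℕ N)
      j = k ℕ.∸ 1
      e-bound : ∀ qs → Chosen D W qs → product qs ℕ.≤ M → ∀ {B} → (∀ c → Coprime (c ℕ.+ h) (modulus W qs) → ∣ ∑ N (λ i → gᵖ i * χ (N ℕ.+ i ≡? c [mod modulus W qs ])) - fromℕ N * inv₀ (coprimeCount (modulus W qs)) ∣ ≤ B) →
        ∣ Φ (λ i → cl i * gᵖ i) qs - density-product xᵖ (fromℕ N * inv₀ (coprimeCount W)) qs ∣ ≤ fromℕ j ^ length qs * B
      e-bound qs ch le {B} b = ≤-≡ (cong₂ (λ x y → ∣ x - y ∣) (Φ-roots W ν hs N z hs′ sep′ gᵖ qs ch (not-itself qs ch le)) (trans (dp-primes ch (fromℕ N)) (cong (λ i → fromℕ i ^ length qs * (fromℕ N * inv₀ (coprimeCount (modulus W qs)))) (sym k∸1≡))))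
        (∑ᵣ-approx W ν hs′ qs λ c r → b c (root-coprime ch r)) (cong (λ i → fromℕ i ^ length qs * B) k∸1≡)
      -- Both bounds must have the same base. It is 2 k because the trivial bound, `bound₂`,
      -- estimates 1/φ(m) by 2^ω/m with m the product of the chosen primes.
      bound₁ : ∀ qs → Chosen D W qs → product qs ℕ.≤ M → ∣ Φ (λ i → cl i * gᵖ i) qs - density-product xᵖ (fromℕ N * inv₀ (coprimeCount W)) qs ∣ ≤ fromℕ (2 ℕ.* k) ^ length qs * E (W ℕ.* product qs)
      bound₁ qs ch le = ℚₚ.≤-trans (e-bound qs ch le λ c cop → ≤-≡ refl (hyp (modulus W qs) c (chosen⇒1≤modulus 1≤W ch) cop) (cong E (modulus-comm qs)))
        (*-monoʳ (0≤E (W ℕ.* product qs)) (^-mono (0≤fromℕ j) (fromℕ-mono (ℕₚ.≤-trans (ℕₚ.m∸n≤m k 1) (ℕₚ.m≤m+n k (k ℕ.+ 0)))) (length qs)))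
      trivial : ∀ qs → Chosen D W qs → product qs ℕ.≤ M → ∀ c → ∣ ∑ N (λ i → gᵖ i * χ (N ℕ.+ i ≡? c [mod modulus W qs ])) - fromℕ N * inv₀ (coprimeCount (modulus W qs)) ∣ ≤ fromℕ 2 ^ length qs * (K * rec (product qs))
      trivial qs ch le c = ℚₚ.≤-trans (∣+∣≤ {S₁} { - (fromℕ N * ι)} {s = fromℕ N * ι} (0≤⇒∣∣≤ 0≤S₁) (0≤⇒∣-∣≤ (0≤* (0≤fromℕ N) 0≤ι)))
        (ℚₚ.≤-trans (ℚₚ.+-mono-≤ (ℚₚ.≤-trans S₁≤ (≤-≡ (sym (ℚₚ.*-identityˡ (Lmax * (fromℕ 3 * fromℕ N * r)))) (*-monoʳ (0≤* 0≤Lmax (0≤* (0≤* (0≤fromℕ 3) (0≤fromℕ N)) (0≤rec (product qs)))) (1≤^ (fromℕ-mono {1} {2} (s≤s z≤n)) (length qs))) refl)) (*-monoˡ (0≤fromℕ N) (inv-count-≤ ch)))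
          (ℚₚ.≤-reflexive (solve 4 (λ t l n r → t :* (l :* (con (fromℕ 3) :* n :* r)) :+ n :* (t :* r) := t :* ((con (fromℕ 3) :* l :+ con 1ℚ) :* n :* r)) refl (fromℕ 2 ^ length qs) Lmax (fromℕ N) r)))
        where
        ι = inv₀ (coprimeCount (modulus W qs))
        0≤ι = ℚₚ.<⇒≤ (0<inv₀ (ℚₚ.<-≤-trans 0<1 (0<coprimeCount (chosen⇒1≤modulus 1≤W ch))))
        r = rec (product qs)
        S₁ = ∑ N (λ i → gᵖ i * χ (N ℕ.+ i ≡? c [mod modulus W qs ]))
        0≤S₁ : 0ℚ ≤ S₁
        0≤S₁ = 0≤∑ N λ i _ _ → 0≤* (0≤* (0≤χ (prime? (N ℕ.+ i ℕ.+ h))) (0≤l (N ℕ.+ i ℕ.+ h))) (0≤χ (N ℕ.+ i ≡? c [mod modulus W qs ]))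
        S₁≤ : S₁ ≤ Lmax * (fromℕ 3 * fromℕ N * r)
        S₁≤ = ℚₚ.≤-trans (∑-mono N λ i 1≤i i≤N → *-monoʳ (0≤χ (N ℕ.+ i ≡? c [mod modulus W qs ])) (≤-≡ refl (*-mono {χ (prime? (N ℕ.+ i ℕ.+ h))} {1ℚ} (0≤χ (prime? (N ℕ.+ i ℕ.+ h))) 0≤Lmax (χ≤1 (prime? (N ℕ.+ i ℕ.+ h))) (l≤ i 1≤i i≤N)) (ℚₚ.*-identityˡ Lmax)))
          (≤-≡ (∑-* N Lmax (λ i → χ (N ℕ.+ i ≡? c [mod modulus W qs ]))) (*-monoˡ 0≤Lmax (class-count ch le c)) refl)
      bound₂ : ∀ qs → Chosen D W qs → product qs ℕ.≤ M → ∣ Φ (λ i → cl i * gᵖ i) qs - density-product xᵖ (fromℕ N * inv₀ (coprimeCount W)) qs ∣ ≤ fromℕ (2 ℕ.* k) ^ length qs * (K * rec (product qs))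
      bound₂ qs ch le = ℚₚ.≤-trans (e-bound qs ch le λ c _ → trivial qs ch le c)
        (≤-≡ (sym (ℚₚ.*-assoc (fromℕ j ^ length qs) (fromℕ 2 ^ length qs) (K * rec (product qs)))) (*-monoʳ (0≤* 0≤K (0≤rec (product qs))) (^-distrib-mono (length qs) (0≤fromℕ j) (0≤fromℕ 2)
          (≤-≡ (sym (fromℕ-* j 2)) (fromℕ-mono (ℕₚ.≤-trans (ℕₚ.≤-reflexive (ℕₚ.*-comm j 2)) (ℕₚ.*-monoʳ-≤ 2 (ℕₚ.m∸n≤m k 1)))) refl))) refl)

  -- On multiples of p the sieve sum is that of the differences y n - y (p n), and y is Lipschitz.
  sum-divisible : ∀ {p} → p ∈ ps → ∑ N (λ i → cl i * b₀ p i * A i) ≤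
    fromℕ k * rec p * (fromℕ N * rec W) * ((d + a) * H p * ((d + a) * H p) * Op z ps (λ n → χ (n ℕₚ.≤? R)) 1) + Z * Z * (fromℕ 2 * fromℕ k * fromℕ M * H M ^ (6 ℕ.* k))
  sum-divisible {p} p∈ = ≤-≡ (∑-cong N λ i _ _ → pointwise i)
    (ℚₚ.≤-trans (by-difference (difference (∣∣≤⇒ (quadratic-error z b₀ b₀² N R small′ 0≤y y-dec y-vanish y′≤y w xᶻ X))) (solve 3 (λ s x b → b :- (s :- x) := x :+ b :- s) refl (∑ N (λ i → w i * (Op (ξ b₀ b₀² i) ps′ y′ 1 * Op (ξ b₀ b₀² i) ps′ y′ 1))) (X * G₂ (mean xᶻ) (second xᶻ) ps′ (y′ ⊗ y′)) (Z′ * Z′ * U M e ps′ [])))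
      (ℚₚ.+-mono-≤ (*-monoˡ 0≤X mainPart) (*-mono (0≤* 0≤Z′ 0≤Z′) (0≤* (0≤* (0≤* (0≤fromℕ 2) (0≤fromℕ k)) (0≤fromℕ M)) (0≤^ (0≤H M) (6 ℕ.* k))) (*-mono 0≤Z′ 0≤Z Z′≤Z Z′≤Z)
        (U-divisor-bound sieving′ largeD′ 1≤M (ℕₚ.*-mono-≤ 1≤p 1≤W) k (fromℕ 2 * fromℕ k * fromℕ M) (0≤* (0≤* (0≤fromℕ 2) (0≤fromℕ k)) (0≤fromℕ M)) e≤))))
    refl
    where
    parts = ∈-split p∈
    qs = proj₁ parts
    rs = proj₁ (proj₂ parts)
    eq = proj₂ (proj₂ parts)
    ps′ = qs ++ rs
    split-ps = sieving-split qs (subst (Sieving W) eq sieving)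
    pr = proj₁ (proj₁ split-ps)
    p∤W = proj₂ (proj₁ split-ps)
    sieving′ = proj₂ split-ps
    1≤p = prime⇒1≤ pr
    split-large = All-split qs (subst (All (D ℕ.<_)) eq largeD)
    D<p = proj₁ split-large
    largeD′ = proj₂ split-large
    small′ : Small ps′
    small′ = All.map small-at largeD′
    y′ w : ℕ → ℚ
    y′ n = y n - y (p ℕ.* n)
    w i = cl i * b₀ p i
    X = fromℕ k * rec p * (fromℕ N * rec W)
    0≤X = 0≤* (0≤* (0≤fromℕ k) (0≤rec p)) (0≤* (0≤fromℕ N) (0≤rec W))
    Z′ = Op z ps′ y 1
    0≤Z′ = Op-0≤ (small⇒weight small′) 0≤y 1
    wq : ∀ {xs} → Weight z xs
    wq = All.universal 0≤z _
    weaken : ∀ {g} → (∀ n → 0ℚ ≤ g n) → Op z ps′ g 1 ≤ Op z ps g 1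
    weaken {g} 0≤g = ≤-≡ refl (weaken-Op p {rs} (wq {qs}) (0≤z p) wq 0≤g 1) (cong (λ xs → Op z xs g 1) (sym eq))
    Z′≤Z = weaken 0≤y
    gap : ∀ n → 1 ℕ.≤ n → 0ℚ ≤ y′ n
    gap n 1≤n = difference (y-dec n (p ℕ.* n) 1≤n (m≤p*m 1≤p n))
    y′≤y : ∀ n → 1 ℕ.≤ n → ∣ y′ n ∣ ≤ y n
    y′≤y n 1≤n = ℚₚ.≤-trans (0≤⇒∣∣≤ (gap n 1≤n)) (by-difference (0≤y (p ℕ.* n)) (solve 2 (λ a b → b := a :- (a :- b)) refl (y n) (y (p ℕ.* n))))
    pointwise : ∀ i → cl i * b₀ p i * A i ≡ w i * (Op (ξ b₀ b₀² i) ps′ y′ 1 * Op (ξ b₀ b₀² i) ps′ y′ 1)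
    pointwise i = case divides? hs p (N ℕ.+ i) of λ
      { (no ¬div) → trans (null ¬div (A i)) (sym (null ¬div _))
      ; (yes div) → cong (λ x → w i * (x * x)) (trans (cong (λ xs → Op (ξ b₀ b₀² i) xs y 1) eq) (trans (Op-move (ξ b₀ b₀² i) qs p rs y 1) (trans (Op-inner (ξ b₀ b₀² i) p ps′ y 1)
          (Op-cong (ξ b₀ b₀² i) ps′ (λ n → trans (cong (λ c → y n + (z p - (1ℚ + z p) * c) * y (p ℕ.* n)) (χ-yes (divides? hs p (N ℕ.+ i)) div)) (solve 3 (λ z a b → a :+ (z :- (con 1ℚ :+ z) :* con 1ℚ) :* b := a :- b) refl (z p) (y n) (y (p ℕ.* n)))) 1)))) }
      where
      null : ¬ Any (λ h → p ∣ N ℕ.+ i ℕ.+ h) hs → ∀ x → cl i * b₀ p i * x ≡ 0ℚ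
      null ¬div x = trans (cong (λ c → cl i * c * x) (χ-no (divides? hs p (N ℕ.+ i)) ¬div)) (solve 2 (λ c x → c :* con 0ℚ :* x := con 0ℚ) refl (cl i) x)
    e : List ℕ → ℚ
    e rs = ∣ Φ w rs - density-product xᶻ X rs ∣
    dp-scale : ∀ rs → density-product xᶻ X rs ≡ density-product xᶻ (fromℕ N * rec W) (p ∷ rs)
    dp-scale [] = refl
    dp-scale (q ∷ rs) = trans (cong (xᶻ q *_) (dp-scale rs)) (solve 3 (λ a b c → a :* (b :* c) := b :* (a :* c)) refl (xᶻ q) (xᶻ p) (density-product xᶻ (fromℕ N * rec W) rs))
    e≤ : ∀ rs → Chosen D (p ℕ.* W) rs → product rs ℕ.≤ M → e rs ≤ fromℕ k ^ length rs * (fromℕ 2 * fromℕ k * fromℕ M * rec (product rs))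
    e≤ rs ch le = ≤-≡ (cong₂ (λ x y → ∣ x - y ∣) (∑-cong N λ i _ _ → solve 3 (λ c b s → c :* b :* s := c :* con 1ℚ :* (b :* s)) refl (cl i) (b₀ p i) (bs b₀ b₀² rs i)) (dp-scale rs))
      (ℚₚ.≤-trans (e-integers (p ∷ rs) (chosen-first pr D<p p∤W ch)) (*-monoˡ (0≤^ (0≤fromℕ k) (suc (length rs))) (2≤ (Chosen-∣ (ℕ.n∣m*n p) ch) le)))
      (solve 4 (λ k q m r → k :* q :* (con (fromℕ 2) :* m :* r) := q :* (con (fromℕ 2) :* k :* m :* r)) refl (fromℕ k) (fromℕ k ^ length rs) (fromℕ M) (rec (product rs)))
    c² = (d + a) * H p * ((d + a) * H p)
    0≤c² = 0≤p² ((d + a) * H p)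
    mainPart : G₂ (mean xᶻ) (second xᶻ) ps′ (y′ ⊗ y′) ≤ c² * Op z ps (λ n → χ (n ℕₚ.≤? R)) 1
    mainPart = ≤-≡ (G₂-integers largeD′ y′) (Op-mono (small⇒weight small′) (small⇒positive small′) {g = λ n → c² * χ (n ℕₚ.≤? R)} square 1 ℕₚ.≤-refl)
      (Op-* z ps′ c² (λ n → χ (n ℕₚ.≤? R)) 1) ⟫ *-monoˡ 0≤c² (weaken λ n → 0≤χ (n ℕₚ.≤? R))
      where
      infixr 5 _⟫_
      _⟫_ : ∀ {p q r} → p ≤ q → q ≤ r → p ≤ r
      _⟫_ = ℚₚ.≤-trans
      square : ∀ n → 1 ℕ.≤ n → y′ n * y′ n ≤ c² * χ (n ℕₚ.≤? R)
      square n 1≤n = case n ℕₚ.≤? R of λ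
        { (yes n≤R) → ≤-≡ refl (*-mono (gap n 1≤n) (ℚₚ.≤-trans (gap n 1≤n) lip) lip lip) (trans (sym (ℚₚ.*-identityʳ c²)) (cong (c² *_) (sym (χ-yes (n ℕₚ.≤? R) n≤R))))
        ; (no n≰R) → ≤-≡ (trans (cong₂ (λ x y → (x - y) * (x - y)) (y-vanish n (ℕₚ.≰⇒> n≰R)) (y-vanish (p ℕ.* n) (ℕₚ.≤-trans (ℕₚ.≰⇒> n≰R) (m≤p*m 1≤p n)))) refl) (0≤* 0≤c² (0≤χ (n ℕₚ.≤? R))) refl }
        where lip = sieveWeight-lipschitz R d a 0<d 0≤a 1≤p 1≤n

-- Partial sums of the logarithm against harmonic numbers.

zq : ℚ → ℚ
zq x = (x - 1ℚ) * inv₀ (x + 1ℚ)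

-- ∑ 2 z^(2j+1) / (2j+1), without the zero coefficients of logCoeff.
artanh : ℚ → ℕ → ℚ
artanh z zero    = 0ℚ
artanh z (suc m) = artanh z m + fromℕ 2 * (rec (suc (m ℕ.+ m)) * z ^ suc (m ℕ.+ m))

n/d≡ : ∀ n d .{{_ : NonZero d}} → ℤ.+ n / d ≡ fromℕ n * rec d
n/d≡ n d = trans (sym (ℚₚ.*-identityʳ (ℤ.+ n / d))) (trans (cong (ℤ.+ n / d *_) (sym (n*rec (ℕ.>-nonZero⁻¹ d))))
  (trans (sym (ℚₚ.*-assoc (ℤ.+ n / d) (fromℕ d) (rec d))) (cong (_* rec d) (/-fromℕ n d))))

2∣m+m : ∀ m → 2 ∣ m ℕ.+ m
2∣m+m m = divides m (trans (cong (m ℕ.+_) (sym (ℕₚ.+-identityʳ m))) (ℕₚ.*-comm 2 m))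

logCoeff-odd : ∀ m → logCoeff (suc (m ℕ.+ m)) ≡ fromℕ 2 * rec (suc (m ℕ.+ m))
logCoeff-odd m = trans (cong (λ b → if b then ℤ.+ 2 / suc (m ℕ.+ m) else 0ℚ) (dec-true (2 ∣? m ℕ.+ m) (2∣m+m m))) (n/d≡ 2 (suc (m ℕ.+ m)))

logCoeff-even : ∀ m → logCoeff (m ℕ.+ m) ≡ 0ℚ
logCoeff-even zero = refl
logCoeff-even (suc m) = cong (λ b → if b then ℤ.+ 2 / suc (m ℕ.+ suc m) else 0ℚ) (dec-false (2 ∣? m ℕ.+ suc m) λ 2∣ →
  case ℕ.∣1⇒≡1 (ℕ.∣m+n∣m⇒∣n (subst (2 ∣_) (trans (ℕₚ.+-suc m m) (ℕₚ.+-comm 1 (m ℕ.+ m))) 2∣) (2∣m+m m)) of λ ())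

log-artanh : ∀ z m → powerSum logCoeff z (m ℕ.+ m) ≡ artanh z m × powerSum logCoeff z (suc (m ℕ.+ m)) ≡ artanh z m
log-artanh z m = even m , odd m (even m)
  where
  odd : ∀ m → powerSum logCoeff z (m ℕ.+ m) ≡ artanh z m → powerSum logCoeff z (suc (m ℕ.+ m)) ≡ artanh z m
  odd m eq = trans (cong₂ (λ x y → x + y * z ^ (m ℕ.+ m)) eq (logCoeff-even m)) (solve 2 (λ a b → a :+ con 0ℚ :* b := a) refl (artanh z m) (z ^ (m ℕ.+ m)))
  even : ∀ m → powerSum logCoeff z (m ℕ.+ m) ≡ artanh z m
  even zero = refl
  even (suc m) = trans (cong (powerSum logCoeff z) (cong suc (ℕₚ.+-suc m m))) (trans (cong₂ (λ x y → x + y * z ^ suc (m ℕ.+ m)) (odd m (even m)) (logCoeff-odd m)) (cong (artanh z m +_) (ℚₚ.*-assoc (fromℕ 2) (rec (suc (m ℕ.+ m))) (z ^ suc (m ℕ.+ m)))))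

half : ∀ n → ∃[ m ] (n ≡ m ℕ.+ m ⊎ n ≡ suc (m ℕ.+ m))
half zero = 0 , inj₁ refl
half (suc n) with half n
... | m , inj₁ refl = m , inj₂ refl
... | m , inj₂ refl = suc m , inj₁ (cong suc (sym (ℕₚ.+-suc m m)))

log-as-artanh : ∀ n → ∃[ m ] n ℕ.≤ suc (m ℕ.+ m) × (∀ z → powerSum logCoeff z n ≡ artanh z m)
log-as-artanh n with half n
... | m , inj₁ refl = m , ℕₚ.n≤1+n _ , λ z → proj₁ (log-artanh z m)
... | m , inj₂ refl = m , ℕₚ.≤-refl , λ z → proj₂ (log-artanh z m)

square-power : ∀ z m → (z * z) ^ m ≡ z ^ (m ℕ.+ m)
square-power z zero = refl
square-power z (suc m) = trans (cong (z * z *_) (square-power z m)) (trans (ℚₚ.*-assoc z z (z ^ (m ℕ.+ m))) (cong (z ^_) (cong suc (sym (ℕₚ.+-suc m m)))))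

artanh-increment-≤ : ∀ {z z′} → 0ℚ ≤ z → z ≤ z′ → ∀ m → artanh z′ m ≤ artanh z m + fromℕ 2 * (z′ - z) * geometric (z′ * z′) m
artanh-increment-≤ {z} {z′} 0≤z z≤z′ zero = ℚₚ.≤-reflexive (solve 1 (λ d → con 0ℚ := con 0ℚ :+ d :* con 0ℚ) refl (fromℕ 2 * (z′ - z)))
artanh-increment-≤ {z} {z′} 0≤z z≤z′ (suc m) = ℚₚ.≤-trans (ℚₚ.+-mono-≤ (artanh-increment-≤ 0≤z z≤z′ m) (*-monoˡ (0≤fromℕ 2) (*-monoˡ (0≤rec (suc k)) (^-increment-≤ 0≤z z≤z′ k))))
  (ℚₚ.≤-reflexive (trans (solve 8 (λ A d G t r p f q → A :+ t :* d :* G :+ t :* (r :* (p :+ f :* q :* d)) := A :+ t :* (r :* p) :+ t :* d :* (G :+ (f :* r) :* q)) refl (artanh z m) (z′ - z) (geometric (z′ * z′) m) (fromℕ 2) (rec (suc k)) (z ^ suc k) (fromℕ (suc k)) (z′ ^ k))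
    (cong₂ (λ x y → artanh z (suc m) + fromℕ 2 * (z′ - z) * (geometric (z′ * z′) m + x * y)) (n*rec {suc k} (s≤s z≤n)) (sym (square-power z′ m)))))
  where k = m ℕ.+ m

artanh-increment-≥ : ∀ {z h} → 0ℚ ≤ z → 0ℚ ≤ h → ∀ m → artanh z m + fromℕ 2 * h * geometric (z * z) m ≤ artanh (z + h) m
artanh-increment-≥ {z} {h} 0≤z 0≤h zero = ℚₚ.≤-reflexive (solve 1 (λ d → con 0ℚ :+ d :* con 0ℚ := con 0ℚ) refl (fromℕ 2 * h))
artanh-increment-≥ {z} {h} 0≤z 0≤h (suc m) = ≤-≡
  (sym (trans (solve 8 (λ A d G t r p f q → A :+ t :* d :* G :+ t :* (r :* (p :+ f :* d :* q)) := A :+ t :* (r :* p) :+ t :* d :* (G :+ (f :* r) :* q)) refl (artanh z m) h (geometric (z * z) m) (fromℕ 2) (rec (suc k)) (z ^ suc k) (fromℕ (suc k)) (z ^ k))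
    (cong₂ (λ x y → artanh z (suc m) + fromℕ 2 * h * (geometric (z * z) m + x * y)) (n*rec {suc k} (s≤s z≤n)) (sym (square-power z m)))))
  (ℚₚ.+-mono-≤ (artanh-increment-≥ 0≤z 0≤h m) (*-monoˡ (0≤fromℕ 2) (*-monoˡ (0≤rec (suc k)) (^-increment-≥ 0≤z 0≤h k)))) refl
  where k = m ℕ.+ m

0≤zq : ∀ {x} → 1ℚ ≤ x → 0ℚ ≤ zq x
0≤zq 1≤x = 0≤* (difference 1≤x) (ℚₚ.<⇒≤ (0<inv₀ (ℚₚ.<-≤-trans 0<1 (ℚₚ.≤-trans 1≤x (p≤p+q 0≤1)))))

zq-mono : ∀ {x x′} → 1ℚ ≤ x → x ≤ x′ → zq x ≤ zq x′
zq-mono {x} {x′} 1≤x x≤x′ = ≤-≡ (as-difference x 0<1+x) (ℚₚ.+-monoʳ-≤ 1ℚ (ℚₚ.neg-antimono-≤ (*-monoˡ (0≤fromℕ 2) (inv₀-anti 0<1+x (ℚₚ.+-monoˡ-≤ 1ℚ x≤x′))))) (sym (as-difference x′ (ℚₚ.<-≤-trans 0<1+x (ℚₚ.+-monoˡ-≤ 1ℚ x≤x′))))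
  where
  0<1+x : 0ℚ < x + 1ℚ
  0<1+x = ℚₚ.<-≤-trans 0<1 (ℚₚ.≤-trans 1≤x (p≤p+q 0≤1))
  as-difference : ∀ x → 0ℚ < x + 1ℚ → zq x ≡ 1ℚ - fromℕ 2 * inv₀ (x + 1ℚ)
  as-difference x 0< = trans (solve 2 (λ x i → (x :- con 1ℚ) :* i := (x :+ con 1ℚ) :* i :- con (fromℕ 2) :* i) refl x (inv₀ (x + 1ℚ))) (cong (_- fromℕ 2 * inv₀ (x + 1ℚ)) (inv₀-inverse 0<))

module ZStep (n : ℕ) where
  -- With x = n + 1, i = 1/(n+2) and j = 1/(n+3).
  private
    x = fromℕ (suc n)
    0≤x = 0≤fromℕ (suc n)
    A = x + 1ℚ
    B = A + 1ℚ
    0<A : 0ℚ < A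
    0<A = ℚₚ.+-mono-≤-< 0≤x 0<1
    0<B : 0ℚ < B
    0<B = ℚₚ.+-mono-< 0<A 0<1
    i = inv₀ A
    j = inv₀ B
    0≤i = ℚₚ.<⇒≤ (0<inv₀ 0<A)
    0≤j = ℚₚ.<⇒≤ (0<inv₀ 0<B)
    Ai = inv₀-inverse 0<A
    Bj = inv₀-inverse 0<B
    suc≡ : fromℕ (suc (suc n)) ≡ A
    suc≡ = trans (fromℕ-suc (suc n)) (ℚₚ.+-comm 1ℚ x)
    z′≡ : zq (fromℕ (suc (suc n))) ≡ x * j
    z′≡ = trans (cong zq suc≡) (solve 2 (λ x j → (x :+ con 1ℚ :- con 1ℚ) :* j := x :* j) refl x j)

  zq-difference : zq (fromℕ (suc (suc n))) - zq x ≡ fromℕ 2 * (i * j)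
  zq-difference = trans (cong (_- zq x) z′≡)
    (trans (solve 3 (λ x j i → x :* j :- (x :- con 1ℚ) :* i := x :* j :* con 1ℚ :- (x :- con 1ℚ) :* i :* con 1ℚ) refl x j i)
    (trans (cong₂ (λ a b → x * j * a - (x - 1ℚ) * i * b) (sym Ai) (sym Bj))
      (solve 3 (λ x i j → x :* j :* ((x :+ con 1ℚ) :* i) :- (x :- con 1ℚ) :* i :* ((x :+ con 1ℚ :+ con 1ℚ) :* j) := con (fromℕ 2) :* (i :* j)) refl x i j)))

  one-minus-z² : 1ℚ - zq x * zq x ≡ fromℕ 4 * (x * (i * i))
  one-minus-z² = trans (cong (λ a → a * a - zq x * zq x) (sym Ai)) (solve 2 (λ x i → (x :+ con 1ℚ) :* i :* ((x :+ con 1ℚ) :* i) :- (x :- con 1ℚ) :* i :* ((x :- con 1ℚ) :* i) := con (fromℕ 4) :* (x :* (i :* i))) refl x i)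

  one-minus-z′² : 1ℚ - zq (fromℕ (suc (suc n))) * zq (fromℕ (suc (suc n))) ≡ fromℕ 4 * (A * (j * j))
  one-minus-z′² = trans (cong₂ (λ a b → a * a - b * b) (sym Bj) z′≡) (solve 2 (λ x j → (x :+ con 1ℚ :+ con 1ℚ) :* j :* ((x :+ con 1ℚ :+ con 1ℚ) :* j) :- x :* j :* (x :* j) := con (fromℕ 4) :* ((x :+ con 1ℚ) :* (j :* j))) refl x j)

  i≡ : i ≡ rec (suc (suc n))
  i≡ = cong inv₀ (sym suc≡)

  private
    -- n B ≤ A² in the form x j ≤ A i⋅(A j) etc.
    key : x * i * i ≤ j
    key = by-difference (0≤* (0≤* 0≤i 0≤i) 0≤j) (trans (solve 3 (λ x i j → i :* i :* j := ((x :+ con 1ℚ) :* i) :* ((x :+ con 1ℚ) :* i) :* j :- x :* i :* i :* ((x :+ con 1ℚ :+ con 1ℚ) :* j)) refl x i j)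
      (trans (cong₂ (λ a b → a * a * j - x * i * i * b) Ai Bj) (solve 4 (λ x i j o → con 1ℚ :* con 1ℚ :* j :- x :* i :* i :* con 1ℚ := j :- x :* i :* i) refl x i j 1ℚ)))

  -- With `lower-step`, the one-step form of 2 dz/(1 - z²) = dx/x for z = (x-1)/(x+1).
  upper-step : fromℕ 2 * (zq (fromℕ (suc (suc n))) - zq x) ≤ rec (suc n) * (1ℚ - zq (fromℕ (suc (suc n))) * zq (fromℕ (suc (suc n))))
  upper-step = ≤-≡ (cong (fromℕ 2 *_) zq-difference)
    (by-difference (0≤* (0≤fromℕ 4) (0≤* (0≤* (0≤rec (suc n)) 0≤i) (0≤* 0≤j 0≤j)))
      (sym (trans (solve 4 (λ r A j i → r :* (con (fromℕ 4) :* (A :* (j :* j))) :- con (fromℕ 2) :* (con (fromℕ 2) :* (i :* j)) := r :* (con (fromℕ 4) :* (A :* con 1ℚ :* (j :* j))) :- con (fromℕ 2) :* (con (fromℕ 2) :* (i :* j :* (con 1ℚ :* con 1ℚ)))) refl r A j i)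
        (trans (cong₂ (λ a b → r * (fromℕ 4 * (A * a * (j * j))) - fromℕ 2 * (fromℕ 2 * (i * j * b))) (sym Ai) (cong₂ _*_ (sym xr) (sym Bj)))
          (solve 4 (λ x i j r → r :* (con (fromℕ 4) :* ((x :+ con 1ℚ) :* ((x :+ con 1ℚ) :* i) :* (j :* j))) :- con (fromℕ 2) :* (con (fromℕ 2) :* (i :* j :* (x :* r :* ((x :+ con 1ℚ :+ con 1ℚ) :* j)))) := con (fromℕ 4) :* (r :* i :* (j :* j))) refl x i j r)))))
    (cong (rec (suc n) *_) (sym one-minus-z′²))
    where
    r = rec (suc n)
    xr : x * r ≡ 1ℚ
    xr = n*rec {suc n} (s≤s z≤n)

  lower-step : rec (suc (suc n)) * (1ℚ - zq x * zq x) ≤ fromℕ 2 * (zq (fromℕ (suc (suc n))) - zq x)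
  lower-step = ≤-≡ (cong₂ _*_ (sym i≡) one-minus-z²)
    (by-difference (0≤* (0≤* (0≤fromℕ 4) 0≤i) (difference key)) (solve 3 (λ x i j → con (fromℕ 4) :* i :* (j :- x :* i :* i) := con (fromℕ 2) :* (con (fromℕ 2) :* (i :* j)) :- i :* (con (fromℕ 4) :* (x :* (i :* i)))) refl x i j))
    (cong (fromℕ 2 *_) (sym zq-difference))

  z<1 : zq x * zq x < 1ℚ
  z<1 = subst₂ _<_ (ℚₚ.+-identityʳ (zq x * zq x)) (trans (cong (zq x * zq x +_) (sym one-minus-z²)) (solve 1 (λ z → z :+ (con 1ℚ :- z) := con 1ℚ) refl (zq x * zq x)))
    (ℚₚ.+-monoʳ-< (zq x * zq x) (0<* (ℚₚ.positive⁻¹ (fromℕ 4)) (0<* (0<fromℕ⁺ {suc n} (s≤s z≤n)) (0<* (0<inv₀ 0<A) (0<inv₀ 0<A)))))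

artanh-0 : ∀ {z} → z ≡ 0ℚ → ∀ m → artanh z m ≡ 0ℚ
artanh-0 refl zero = refl
artanh-0 refl (suc m) = trans (cong (_+ fromℕ 2 * (rec (suc (m ℕ.+ m)) * 0ℚ ^ suc (m ℕ.+ m))) (artanh-0 refl m)) (solve 2 (λ r p → con 0ℚ :+ con (fromℕ 2) :* (r :* (con 0ℚ :* p)) := con 0ℚ) refl (rec (suc (m ℕ.+ m))) (0ℚ ^ (m ℕ.+ m)))

zq-1 : zq (fromℕ 1) ≡ 0ℚ
zq-1 = ℚₚ.*-zeroˡ (inv₀ (1ℚ + 1ℚ))

1≤fromℕ-suc : ∀ n → 1ℚ ≤ fromℕ (suc n)
1≤fromℕ-suc n = fromℕ-mono {1} {suc n} (s≤s z≤n)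

0≤geometric : ∀ {σ} → 0ℚ ≤ σ → ∀ m → 0ℚ ≤ geometric σ m
0≤geometric 0≤σ zero = ℚₚ.≤-refl
0≤geometric 0≤σ (suc m) = 0≤+ (0≤geometric 0≤σ m) (0≤* 0≤1 (0≤^ 0≤σ m))

-- The increment of a truncated series is at most 2 (z′ - z) times a truncated geometric series in
-- z′². By `upper-step` and `geometric-eq` the product is at most 1/(k+1), at every truncation.
artanh-upper : ∀ k m → artanh (zq (fromℕ (suc k))) m ≤ H k
artanh-upper zero m = ℚₚ.≤-reflexive (artanh-0 zq-1 m)
artanh-upper (suc k) m = ℚₚ.≤-trans (artanh-increment-≤ 0≤z z≤z′ m)
  (ℚₚ.+-mono-≤ (artanh-upper k m) (ℚₚ.≤-trans (*-monoʳ (0≤geometric (0≤p² z′) m) (ZStep.upper-step k))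
    (≤-≡ (trans (ℚₚ.*-assoc (rec (suc k)) (1ℚ - z′ * z′) (geometric (z′ * z′) m)) (cong (rec (suc k) *_) (geometric-eq (z′ * z′) m)))
      (*-monoˡ (0≤rec (suc k)) (by-difference (0≤^ (0≤p² z′) m) (solve 1 (λ x → x := con 1ℚ :- (con 1ℚ :- x)) refl ((z′ * z′) ^ m)))) (ℚₚ.*-identityʳ (rec (suc k))))))
  where
  z = zq (fromℕ (suc k))
  z′ = zq (fromℕ (suc (suc k)))
  0≤z = 0≤zq (1≤fromℕ-suc k)
  z≤z′ = zq-mono (1≤fromℕ-suc k) (fromℕ-mono (ℕₚ.n≤1+n (suc k)))

-- Truncating the geometric series at m costs a factor 1 - z^(2m). As z grows with its argument, the
-- value at the endpoint `M` bounds this loss for all steps together.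
artanh-lower : ∀ {M ε m} → (zq (fromℕ M) * zq (fromℕ M)) ^ m ≤ ε → ∀ k → suc k ℕ.≤ M → (1ℚ - ε) * (H (suc k) - 1ℚ) ≤ artanh (zq (fromℕ (suc k))) m
artanh-lower {M} {ε} {m} small zero _ = ℚₚ.≤-reflexive (trans (solve 1 (λ e → (con 1ℚ :- e) :* (con 0ℚ :+ con 1ℚ :- con 1ℚ) := con 0ℚ) refl ε) (sym (artanh-0 zq-1 m)))
artanh-lower {M} {ε} {m} small (suc k) k<M = ≤-≡
  (solve 3 (λ e h r → (con 1ℚ :- e) :* (h :+ r :- con 1ℚ) := (con 1ℚ :- e) :* (h :- con 1ℚ) :+ r :* (con 1ℚ :- e)) refl ε (H (suc k)) (rec (suc (suc k))))
  (ℚₚ.≤-trans (ℚₚ.+-mono-≤ (artanh-lower {M} {ε} {m} small k (ℕₚ.<⇒≤ k<M))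
    (ℚₚ.≤-trans (*-monoˡ (0≤rec (suc (suc k))) (≤-≡ refl (ℚₚ.+-monoʳ-≤ 1ℚ (ℚₚ.neg-antimono-≤ (ℚₚ.≤-trans (^-mono (0≤p² z) (*-mono 0≤z (0≤zq 1≤M) z≤zM z≤zM) m) small))) (sym (geometric-eq (z * z) m))))
      (≤-≡ (sym (ℚₚ.*-assoc (rec (suc (suc k))) (1ℚ - z * z) (geometric (z * z) m))) (*-monoʳ (0≤geometric (0≤p² z) m) (ZStep.lower-step k)) refl)))
    (≤-≡ refl (artanh-increment-≥ 0≤z (difference z≤z′) m) (cong (λ x → artanh x m) (solve 2 (λ a b → a :+ (b :- a) := b) refl z z′)))) refl
  where
  z = zq (fromℕ (suc k))
  z′ = zq (fromℕ (suc (suc k)))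
  0≤z = 0≤zq (1≤fromℕ-suc k)
  z≤z′ = zq-mono (1≤fromℕ-suc k) (fromℕ-mono (ℕₚ.n≤1+n (suc k)))
  1≤M = fromℕ-mono {1} {M} (ℕₚ.≤-trans (s≤s z≤n) k<M)
  z≤zM = zq-mono (1≤fromℕ-suc k) (fromℕ-mono {suc k} {M} (ℕₚ.<⇒≤ k<M))

log-upper : ∀ {M} → 1 ℕ.≤ M → ∀ n → powerSum logCoeff (zq (fromℕ M)) n ≤ H M
log-upper {suc k} _ n = let m , _ , eq = log-as-artanh n in
  ≤-≡ (eq (zq (fromℕ (suc k)))) (ℚₚ.≤-trans (artanh-upper k m) (H-mono (ℕₚ.n≤1+n k))) refl

0≤log : ∀ {x} → 1ℚ ≤ x → ∀ n → 0ℚ ≤ powerSum logCoeff (zq x) n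
0≤log 1≤x zero = ℚₚ.≤-refl
0≤log 1≤x (suc n) = 0≤+ (0≤log 1≤x n) (0≤* (0≤logCoeff n) (0≤^ (0≤zq 1≤x) n))

log-mono : ∀ {x x′} → 1ℚ ≤ x → x ≤ x′ → ∀ n → powerSum logCoeff (zq x) n ≤ powerSum logCoeff (zq x′) n
log-mono 1≤x x≤x′ zero = ℚₚ.≤-refl
log-mono 1≤x x≤x′ (suc n) = ℚₚ.+-mono-≤ (log-mono 1≤x x≤x′ n) (*-monoˡ (0≤logCoeff n) (^-mono (0≤zq 1≤x) (zq-mono 1≤x x≤x′) n))

log-lower′ : ∀ {M} → 1 ℕ.≤ M → ∃[ n₀ ] (∀ n → n₀ ℕ.≤ n → H M - fromℕ 2 ≤ powerSum logCoeff (zq (fromℕ M)) n)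
log-lower′ {M@(suc k)} 1≤M = suc (suc (m₀ ℕ.+ m₀)) , bound
  where
  -- Then the truncation loses ε (`H M` - 1) < 1, and with the 1 already lost in `artanh-lower` the
  -- total is below 2.
  ε = inv₀ (H M)
  0<HM : 0ℚ < H M
  0<HM = ℚₚ.<-≤-trans 0<1 (1≤H 1≤M)
  σ = zq (fromℕ M) * zq (fromℕ M)
  decay = ^-small {σ} (0≤p² (zq (fromℕ M))) (ZStep.z<1 k) ε (0<inv₀ 0<HM)
  m₀ = proj₁ decay
  bound : ∀ n → suc (suc (m₀ ℕ.+ m₀)) ℕ.≤ n → H M - fromℕ 2 ≤ powerSum logCoeff (zq (fromℕ M)) n
  bound n n₀≤n = ℚₚ.≤-trans
    (by-difference (ℚₚ.<⇒≤ (0<inv₀ 0<HM)) (trans (solve 2 (λ h e → e := (con 1ℚ :- e) :* (h :- con 1ℚ) :- (h :- con 1ℚ :- h :* e)) refl (H M) ε) (cong (λ x → (1ℚ - ε) * (H M - 1ℚ) - x) (trans (cong (λ y → H M - 1ℚ - y) (inv₀-inverse 0<HM)) (solve 1 (λ h → h :- con 1ℚ :- con 1ℚ := h :- con (fromℕ 2)) refl (H M))))))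
    (≤-≡ refl (artanh-lower {M} {ε} {m} (proj₂ decay m (half-≤ m (ℕₚ.≤-trans n₀≤n n≤))) k ℕₚ.≤-refl) (sym (eq (zq (fromℕ M)))))
    where
    m = proj₁ (log-as-artanh n)
    n≤ = proj₁ (proj₂ (log-as-artanh n))
    eq = proj₂ (proj₂ (log-as-artanh n))
    half-≤ : ∀ m → suc (suc (m₀ ℕ.+ m₀)) ℕ.≤ suc (m ℕ.+ m) → m₀ ℕ.≤ m
    half-≤ m (s≤s le) = ℕₚ.≮⇒≥ λ m<m₀ → ℕₚ.<⇒≱ (ℕₚ.≤-trans (ℕₚ.+-mono-≤ m<m₀ (ℕₚ.<⇒≤ m<m₀)) ℕₚ.≤-refl) (ℕₚ.≤-trans (ℕₚ.n≤1+n _) le)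

abstract
  log-lower : ∀ {M} → 1 ℕ.≤ M → ∃[ n₀ ] (∀ n → n₀ ℕ.≤ n → H M - fromℕ 2 ≤ powerSum logCoeff (zq (fromℕ M)) n)
  log-lower = log-lower′

-- Partial sums of the exponential at harmonic numbers, and at negative arguments.

E : ℚ → ℕ → ℚ
E = powerSum expCoeff

e : ℚ → ℕ → ℚ
e x k = expCoeff k * x ^ k

expCoeff-suc : ∀ k → fromℕ (suc k) * expCoeff (suc k) ≡ expCoeff k
expCoeff-suc k = trans (cong (fromℕ (suc k) *_) (trans (n/d≡ 1 (suc k !) {{suc k ℕₚ.!≢0}}) (ℚₚ.*-identityˡ (rec (suc k !)))))
  (trans (m*rec[mn] {suc k} {k !} (s≤s z≤n) (ℕₚ.1≤n! k)) (sym (trans (n/d≡ 1 (k !) {{k ℕₚ.!≢0}}) (ℚₚ.*-identityˡ (rec (k !))))))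

0≤E : ∀ {x} → 0ℚ ≤ x → ∀ n → 0ℚ ≤ E x n
0≤E 0≤x zero = ℚₚ.≤-refl
0≤E 0≤x (suc n) = 0≤+ (0≤E 0≤x n) (0≤* (0≤expCoeff n) (0≤^ 0≤x n))

E-mono : ∀ {x x′} → 0ℚ ≤ x → x ≤ x′ → ∀ n → E x n ≤ E x′ n
E-mono 0≤x x≤x′ zero = ℚₚ.≤-refl
E-mono 0≤x x≤x′ (suc n) = ℚₚ.+-mono-≤ (E-mono 0≤x x≤x′ n) (*-monoˡ (0≤expCoeff n) (^-mono 0≤x x≤x′ n))

E-step-≥ : ∀ {x a} → 0ℚ ≤ x → 0ℚ ≤ a → ∀ n → E x (suc n) + a * E x n ≤ E (x + a) (suc n)
E-step-≥ {x} {a} 0≤x 0≤a zero = ℚₚ.≤-reflexive (solve 2 (λ c a → con 0ℚ :+ c :* con 1ℚ :+ a :* con 0ℚ := con 0ℚ :+ c :* con 1ℚ) refl (expCoeff 0) a)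
E-step-≥ {x} {a} 0≤x 0≤a (suc n) = ≤-≡ (solve 5 (λ u v c a w → u :+ c :+ a :* (v :+ w) := u :+ a :* v :+ (c :+ a :* w)) refl (E x (suc n)) (E x n) (e x (suc n)) a (e x n))
  (ℚₚ.+-mono-≤ (E-step-≥ 0≤x 0≤a n) (≤-≡ (trans (cong (λ c → e x (suc n) + a * (c * x ^ n)) (sym (expCoeff-suc n))) (solve 5 (λ c p a f q → c :* p :+ a :* (f :* c :* q) := c :* (p :+ f :* a :* q)) refl (expCoeff (suc n)) (x ^ suc n) a (fromℕ (suc n)) (x ^ n)))
    (*-monoˡ (0≤expCoeff (suc n)) (^-increment-≥ 0≤x 0≤a n)) refl)) refl

E-step-≤ : ∀ {x a} → 0ℚ ≤ x → 0ℚ ≤ a → ∀ n → E (x + a) (suc n) ≤ E x (suc n) + a * E (x + a) n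
E-step-≤ {x} {a} 0≤x 0≤a zero = ℚₚ.≤-reflexive (solve 2 (λ c a → con 0ℚ :+ c :* con 1ℚ := con 0ℚ :+ c :* con 1ℚ :+ a :* con 0ℚ) refl (expCoeff 0) a)
E-step-≤ {x} {a} 0≤x 0≤a (suc n) = ≤-≡ refl
  (ℚₚ.+-mono-≤ (E-step-≤ 0≤x 0≤a n) (≤-≡ refl (*-monoˡ (0≤expCoeff (suc n)) (^-increment-≤ 0≤x (p≤p+q 0≤a) n))
    (trans (solve 6 (λ c p a f q x → c :* (p :+ f :* q :* (x :+ a :- x)) := c :* p :+ a :* (f :* c :* q)) refl (expCoeff (suc n)) (x ^ suc n) a (fromℕ (suc n)) ((x + a) ^ n) x) (cong (λ c → e x (suc n) + a * (c * (x + a) ^ n)) (expCoeff-suc n)))))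
  (solve 5 (λ u v c a w → u :+ a :* v :+ (c :+ a :* w) := u :+ c :+ a :* (v :+ w)) refl (E x (suc n)) (E (x + a) n) (e x (suc n)) a (e (x + a) n))

E-contract : ∀ {x a} → 0ℚ ≤ x → 0ℚ ≤ a → ∀ n → (1ℚ - a) * E (x + a) n ≤ E x n
E-contract {x} {a} 0≤x 0≤a zero = ℚₚ.≤-reflexive (ℚₚ.*-zeroʳ (1ℚ - a))
E-contract {x} {a} 0≤x 0≤a (suc n) = by-difference
  (0≤+ (difference (E-step-≤ 0≤x 0≤a n)) (0≤* 0≤a (0≤* (0≤expCoeff n) (0≤^ (0≤+ 0≤x 0≤a) n))))
  (solve 5 (λ u v a w t → (u :+ a :* v :- (v :+ w)) :+ a :* w := u :- (con 1ℚ :- a) :* (v :+ w)) refl (E x (suc n)) (E (x + a) n) a (e (x + a) n) 0ℚ)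

E-0 : ∀ n → E 0ℚ (suc n) ≡ 1ℚ
E-0 zero = refl
E-0 (suc n) = trans (cong (_+ e 0ℚ (suc n)) (E-0 n)) (solve 2 (λ c p → con 1ℚ :+ c :* (con 0ℚ :* p) := con 1ℚ) refl (expCoeff (suc n)) (0ℚ ^ n))

-- exp (x + 1/m) ≥ (1 + 1/m) exp x, where for partial sums the second summand loses one term; after
-- m such steps n > m terms are needed.
E-H-lower : ∀ m n → m ℕ.< n → fromℕ (suc m) ≤ E (H m) n
E-H-lower zero (suc n) _ = ℚₚ.≤-reflexive (sym (E-0 n))
E-H-lower (suc m) (suc n) (s≤s m<n) = ℚₚ.≤-trans
  (≤-≡ (trans (fromℕ-suc (suc m)) (trans (ℚₚ.+-comm 1ℚ (fromℕ (suc m))) (cong (fromℕ (suc m) +_) (trans (sym (n*rec {suc m} (s≤s z≤n))) (ℚₚ.*-comm (fromℕ (suc m)) (rec (suc m)))))))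
    (ℚₚ.+-mono-≤ (E-H-lower m (suc n) (ℕₚ.m<n⇒m<1+n m<n)) (*-monoˡ (0≤rec (suc m)) (E-H-lower m n m<n))) refl)
  (E-step-≥ (0≤H m) (0≤rec (suc m)) n)

E-lower : ∀ {m x} → H m ≤ x → ∀ n → m ℕ.< n → fromℕ (suc m) ≤ E x n
E-lower {m} le n m<n = ℚₚ.≤-trans (E-H-lower m n m<n) (E-mono (0≤H m) le n)

E-H-upper : ∀ m n → E (H (suc m)) n ≤ fromℕ 4 * fromℕ (suc m)
-- `E-contract` with a = 1 would say nothing, so the value at 1 is reached in two steps of ½. This
-- is the origin of the constant 4.
E-H-upper zero n = *-cancelˡ {r = ½ * ½} (ℚₚ.positive⁻¹ (½ * ½)) (ℚₚ.≤-trans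
    (≤-≡ (ℚₚ.*-assoc ½ ½ (E (0ℚ + 1ℚ) n)) (*-monoˡ (ℚₚ.nonNegative⁻¹ ½) (E-contract {½} {½} (ℚₚ.nonNegative⁻¹ ½) (ℚₚ.nonNegative⁻¹ ½) n)) refl)
    (ℚₚ.≤-trans (E-contract {0ℚ} {½} ℚₚ.≤-refl (ℚₚ.nonNegative⁻¹ ½) n) (E0≤1 n)))
  where
  E0≤1 : ∀ n → E 0ℚ n ≤ 1ℚ
  E0≤1 zero = 0≤1
  E0≤1 (suc n) = ℚₚ.≤-reflexive (E-0 n)
E-H-upper (suc m) n = *-cancelˡ {r = 1ℚ - r} 0<1-r (ℚₚ.≤-trans (E-contract (0≤H (suc m)) (0≤rec (suc (suc m))) n)
  (≤-≡ refl (E-H-upper m n) (sym (trans (solve 3 (λ r f x → (con 1ℚ :- r) :* (f :* x) := f :* (x :- x :* r)) refl r (fromℕ 4) (fromℕ (suc (suc m)))) (cong (fromℕ 4 *_) (trans (cong₂ _-_ (fromℕ-suc (suc m)) (n*rec {suc (suc m)} (s≤s z≤n))) (solve 1 (λ x → con 1ℚ :+ x :- con 1ℚ := x) refl (fromℕ (suc m)))))))))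
  where
  r = rec (suc (suc m))
  0<1-r : 0ℚ < 1ℚ - r
  0<1-r = subst (0ℚ <_) (trans (solve 2 (λ x r → x :* r := (con 1ℚ :+ x) :* r :- r) refl (fromℕ (suc m)) r) (cong (_- r) (trans (cong (_* r) (sym (fromℕ-suc (suc m)))) (n*rec {suc (suc m)} (s≤s z≤n))))) (0<* (0<fromℕ⁺ {suc m} (s≤s z≤n)) (0<rec {suc (suc m)} (s≤s z≤n)))

E-upper : ∀ {m x} → 1 ℕ.≤ m → 0ℚ ≤ x → x ≤ H m → ∀ n → E x n ≤ fromℕ (4 ℕ.* m)
E-upper {suc m} _ 0≤x le n = ≤-≡ refl (ℚₚ.≤-trans (E-mono 0≤x le n) (E-H-upper m n)) (sym (fromℕ-* 4 (suc m)))

-- Cauchy products, by recursion on shifts of the first sequence.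
σ : (ℕ → ℚ) → ℕ → ℚ
σ u zero    = 0ℚ
σ u (suc n) = σ u n + u n

conv tri : (ℕ → ℚ) → (ℕ → ℚ) → ℕ → ℚ
conv u v zero    = u 0 * v 0
conv u v (suc n) = u 0 * v (suc n) + conv (u ∘ suc) v n
tri u v zero    = 0ℚ
tri u v (suc n) = u 0 * σ v (suc n) + tri (u ∘ suc) v n

E≡σ : ∀ x n → E x n ≡ σ (e x) n
E≡σ x zero = refl
E≡σ x (suc n) = cong (_+ e x n) (E≡σ x n)

σ-shift : ∀ u n → σ u (suc n) ≡ u 0 + σ (u ∘ suc) n
σ-shift u zero = ℚₚ.+-comm 0ℚ (u 0)
σ-shift u (suc n) = trans (cong (_+ u (suc n)) (σ-shift u n)) (ℚₚ.+-assoc (u 0) (σ (u ∘ suc) n) (u (suc n)))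

tri-suc : ∀ u v n → tri u v (suc n) ≡ tri u v n + conv u v n
tri-suc u v zero = solve 2 (λ a b → a :* (con 0ℚ :+ b) :+ con 0ℚ := con 0ℚ :+ a :* b) refl (u 0) (v 0)
tri-suc u v (suc n) = trans (cong (u 0 * σ v (suc (suc n)) +_) (tri-suc (u ∘ suc) v n))
  (solve 5 (λ a s b t c → a :* (s :+ b) :+ (t :+ c) := a :* s :+ t :+ (a :* b :+ c)) refl (u 0) (σ v (suc n)) (v (suc n)) (tri (u ∘ suc) v n) (conv (u ∘ suc) v n))

conv-cong : ∀ {u u′ v v′ : ℕ → ℚ} → (∀ i → u i ≡ u′ i) → (∀ i → v i ≡ v′ i) → ∀ n → conv u v n ≡ conv u′ v′ n
conv-cong hu hv zero = cong₂ _*_ (hu 0) (hv 0)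
conv-cong hu hv (suc n) = cong₂ _+_ (cong₂ _*_ (hu 0) (hv (suc n))) (conv-cong (hu ∘ suc) hv n)

conv-+ : ∀ u u′ v n → conv (λ i → u i + u′ i) v n ≡ conv u v n + conv u′ v n
conv-+ u u′ v zero = ℚₚ.*-distribʳ-+ (v 0) (u 0) (u′ 0)
conv-+ u u′ v (suc n) = trans (cong ((u 0 + u′ 0) * v (suc n) +_) (conv-+ (u ∘ suc) (u′ ∘ suc) v n))
  (solve 5 (λ a b c x y → (a :+ b) :* c :+ (x :+ y) := a :* c :+ x :+ (b :* c :+ y)) refl (u 0) (u′ 0) (v (suc n)) (conv (u ∘ suc) v n) (conv (u′ ∘ suc) v n))

conv-*ˡ : ∀ c u v n → conv (λ i → c * u i) v n ≡ c * conv u v n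
conv-*ˡ c u v zero = ℚₚ.*-assoc c (u 0) (v 0)
conv-*ˡ c u v (suc n) = trans (cong (c * u 0 * v (suc n) +_) (conv-*ˡ c (u ∘ suc) v n)) (solve 4 (λ c a b x → c :* a :* b :+ c :* x := c :* (a :* b :+ x)) refl c (u 0) (v (suc n)) (conv (u ∘ suc) v n))

conv-*ʳ : ∀ c u v n → conv u (λ i → c * v i) n ≡ c * conv u v n
conv-*ʳ c u v zero = solve 3 (λ a c b → a :* (c :* b) := c :* (a :* b)) refl (u 0) c (v 0)
conv-*ʳ c u v (suc n) = trans (cong (u 0 * (c * v (suc n)) +_) (conv-*ʳ c (u ∘ suc) v n)) (solve 4 (λ c a b x → a :* (c :* b) :+ c :* x := c :* (a :* b :+ x)) refl c (u 0) (v (suc n)) (conv (u ∘ suc) v n))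

derivative : (ℕ → ℚ) → ℕ → ℚ
derivative u i = fromℕ (suc i) * u (suc i)

leibniz : ∀ u v n → fromℕ (suc n) * conv u v (suc n) ≡ conv (derivative u) v n + conv u (derivative v) n
leibniz u v zero = solve 4 (λ a b c d → con 1ℚ :* (a :* d :+ b :* c) := con 1ℚ :* b :* c :+ a :* (con 1ℚ :* d)) refl (u 0) (u 1) (v 0) (v 1)
leibniz u v (suc n) = trans (cong (_* conv u v (suc (suc n))) (fromℕ-suc (suc n)))
  (trans (solve 4 (λ f a b c → (con 1ℚ :+ f) :* (a :* b :+ c) := a :* ((con 1ℚ :+ f) :* b) :+ (c :+ f :* c)) refl (fromℕ (suc n)) (u 0) (v (suc (suc n))) (conv u′ v (suc n)))
    (trans (cong₂ (λ x y → u 0 * (x * v (suc (suc n))) + (conv u′ v (suc n) + y)) (sym (fromℕ-suc (suc n))) (leibniz u′ v n))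
      (trans (solve 6 (λ a b c d e f → a :* b :+ (c :* d :+ e :+ f) := con 1ℚ :* c :* d :+ (e :+ a :* b) :+ f) refl (u 0) (derivative v (suc n)) (u 1) (v (suc n)) (conv (u′ ∘ suc) v n) (conv (derivative u′) v n + conv u′ (derivative v) n))
        (trans (solve 6 (λ p e q d c r → p :+ (e :+ q) :+ (d :+ c) := p :+ (d :+ e) :+ (q :+ c)) refl (1ℚ * u 1 * v (suc n)) (conv (u′ ∘ suc) v n) (u 0 * derivative v (suc n)) (conv (derivative u′) v n) (conv u′ (derivative v) n) 0ℚ)
          (cong (λ x → 1ℚ * u 1 * v (suc n) + x + (u 0 * derivative v (suc n) + conv u′ (derivative v) n))
            (trans (sym (conv-+ (derivative u′) (u′ ∘ suc) v n)) (conv-cong (λ i → trans (solve 2 (λ f x → f :* x :+ x := (con 1ℚ :+ f) :* x) refl (fromℕ (suc i)) (u′ (suc i))) (cong (_* u′ (suc i)) (sym (fromℕ-suc (suc i))))) (λ _ → refl) n)))))))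
  where u′ = u ∘ suc

-- Both sides satisfy (n+1) c(n+1) = (x+y) c(n), by the Leibniz rule: the binomial theorem without
-- binomial coefficients.
conv-exp : ∀ x y n → conv (e x) (e y) n ≡ e (x + y) n
conv-exp x y zero = refl
conv-exp x y (suc n) = *-cancel (trans (leibniz (e x) (e y) n) (trans (cong₂ _+_ (trans (conv-cong (derivative-e x) (λ _ → refl) n) (conv-*ˡ x (e x) (e y) n)) (trans (conv-cong (λ _ → refl) (derivative-e y) n) (conv-*ʳ y (e x) (e y) n)))
    (trans (sym (ℚₚ.*-distribʳ-+ (conv (e x) (e y) n) x y)) (trans (cong ((x + y) *_) (conv-exp x y n)) (sym (derivative-e (x + y) n))))))
  where
  derivative-e : ∀ x i → derivative (e x) i ≡ x * e x i
  derivative-e x i = trans (solve 4 (λ f c x p → f :* (c :* (x :* p)) := x :* (f :* c :* p)) refl (fromℕ (suc i)) (expCoeff (suc i)) x (x ^ i)) (cong (λ c → x * (c * x ^ i)) (expCoeff-suc i))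
  *-cancel : ∀ {p q} → fromℕ (suc n) * p ≡ fromℕ (suc n) * q → p ≡ q
  *-cancel eq = ℚₚ.≤-antisym (*-cancelˡ (0<fromℕ⁺ {suc n} (s≤s z≤n)) (ℚₚ.≤-reflexive eq)) (*-cancelˡ (0<fromℕ⁺ {suc n} (s≤s z≤n)) (ℚₚ.≤-reflexive (sym eq)))

tri-exp : ∀ x y n → tri (e x) (e y) n ≡ E (x + y) n
tri-exp x y zero = refl
tri-exp x y (suc n) = trans (tri-suc (e x) (e y) n) (cong₂ _+_ (tri-exp x y n) (conv-exp x y n))

σ-mono : ∀ {v} → (∀ i → 0ℚ ≤ v i) → ∀ {m n} → m ℕ.≤ n → σ v m ≤ σ v n
σ-mono 0≤v {n = zero} z≤n = ℚₚ.≤-refl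
σ-mono {v} 0≤v {m} {suc n} m≤n = case ℕₚ.m≤n⇒m<n∨m≡n m≤n of λ
  { (inj₁ (s≤s m≤n′)) → ℚₚ.≤-trans (σ-mono 0≤v m≤n′) (p≤p+q (0≤v n)) ; (inj₂ refl) → ℚₚ.≤-refl }

∣σ-σ∣≤ : ∀ v {m n} → m ℕ.≤ n → ∣ σ v n - σ v m ∣ ≤ σ (λ i → ∣ v i ∣) n - σ (λ i → ∣ v i ∣) m
∣σ-σ∣≤ v {n = zero} z≤n = ℚₚ.≤-refl
∣σ-σ∣≤ v {m} {suc n} m≤n = case ℕₚ.m≤n⇒m<n∨m≡n m≤n of λ
  { (inj₁ (s≤s m≤n′)) → ≤-≡ (cong ∣_∣ (solve 3 (λ a b c → a :+ b :- c := (a :- c) :+ b) refl (σ v n) (v n) (σ v m))) (∣+∣≤ {σ v n - σ v m} {v n} (∣σ-σ∣≤ v m≤n′) ℚₚ.≤-refl)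
      (solve 3 (λ a b c → (a :- c) :+ b := a :+ b :- c) refl (σ (λ i → ∣ v i ∣) n) (∣ v n ∣) (σ (λ i → ∣ v i ∣) m))
  ; (inj₂ refl) → ≤-≡ (cong ∣_∣ (ℚₚ.+-inverseʳ (σ v (suc n)))) ℚₚ.≤-refl (sym (ℚₚ.+-inverseʳ (σ (λ i → ∣ v i ∣) (suc n)))) }

product-remainder : ∀ u v {n m} → n ℕ.≤ m → ∣ σ u n * σ v m - tri u v n ∣ ≤ σ (λ i → ∣ u i ∣) n * σ (λ i → ∣ v i ∣) m - tri (λ i → ∣ u i ∣) (λ i → ∣ v i ∣) n
product-remainder u v {zero} {m} _ = ℚₚ.≤-reflexive (trans (cong ∣_∣ (solve 1 (λ s → con 0ℚ :* s :- con 0ℚ := con 0ℚ) refl (σ v m))) (solve 1 (λ s → con 0ℚ := con 0ℚ :* s :- con 0ℚ) refl (σ (λ i → ∣ v i ∣) m)))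
product-remainder u v {suc n} {m} n<m = ≤-≡ (cong ∣_∣ (rearrange u v))
  (∣+∣≤ {u 0 * (σ v m - σ v (suc n))} {σ (u ∘ suc) n * σ v m - tri (u ∘ suc) v n} (∣*∣≤ {u 0} {σ v m - σ v (suc n)} ℚₚ.≤-refl (∣σ-σ∣≤ v n<m)) (product-remainder (u ∘ suc) v (ℕₚ.<⇒≤ n<m)))
  (sym (rearrange (λ i → ∣ u i ∣) (λ i → ∣ v i ∣)))
  where
  rearrange : ∀ u v → σ u (suc n) * σ v m - tri u v (suc n) ≡ u 0 * (σ v m - σ v (suc n)) + (σ (u ∘ suc) n * σ v m - tri (u ∘ suc) v n)
  rearrange u v = trans (cong (λ x → x * σ v m - tri u v (suc n)) (σ-shift u n)) (solve 5 (λ a s b c t → (a :+ s) :* b :- (a :* c :+ t) := a :* (b :- c) :+ (s :* b :- t)) refl (u 0) (σ (u ∘ suc) n) (σ v m) (σ v (suc n)) (tri (u ∘ suc) v n))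

product-≤-tri : ∀ {u v : ℕ → ℚ} → (∀ i → 0ℚ ≤ u i) → (∀ i → 0ℚ ≤ v i) → ∀ n m → σ u n * σ v m ≤ tri u v (n ℕ.+ m)
product-≤-tri {u} {v} 0≤u 0≤v zero m = ≤-≡ (ℚₚ.*-zeroˡ (σ v m)) (0≤tri u 0≤u m) refl
  where
  0≤tri : ∀ u → (∀ i → 0ℚ ≤ u i) → ∀ n → 0ℚ ≤ tri u v n
  0≤tri u 0≤u zero = ℚₚ.≤-refl
  0≤tri u 0≤u (suc n) = 0≤+ (0≤* (0≤u 0) (σ-mono 0≤v {0} {suc n} z≤n)) (0≤tri (u ∘ suc) (0≤u ∘ suc) n)
product-≤-tri {u} {v} 0≤u 0≤v (suc n) m = ≤-≡ (trans (cong (_* σ v m) (σ-shift u n)) (ℚₚ.*-distribʳ-+ (σ v m) (u 0) (σ (u ∘ suc) n)))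
  (ℚₚ.+-mono-≤ (*-monoˡ (0≤u 0) (σ-mono 0≤v (ℕₚ.≤-trans (ℕₚ.m≤n+m m n) (ℕₚ.n≤1+n (n ℕ.+ m))))) (product-≤-tri (0≤u ∘ suc) 0≤v n m)) refl

-- The triangular part of the product is exactly 1. The rest is at most the same remainder with
-- absolute values, which lies in the tail of the series at 2w.
E-inverse-remainder : ∀ {w} → 0ℚ ≤ w → ∀ n → ∣ E w (suc n) * E (- w) (suc n) - 1ℚ ∣ ≤ E (w + w) (suc n ℕ.+ suc n) - E (w + w) (suc n)
E-inverse-remainder {w} 0≤w n = ℚₚ.≤-trans
  (≤-≡ (cong ∣_∣ (cong₂ _-_ (cong₂ _*_ (E≡σ w N) (E≡σ (- w) N)) (sym (trans (tri-exp w (- w) N) (trans (cong (λ x → E x N) (ℚₚ.+-inverseʳ w)) (E-0 n))))))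
    (product-remainder (e w) (e (- w)) {N} {N} ℕₚ.≤-refl) (cong₂ _-_ (cong₂ _*_ (σ-cong ∣e∣ N) (σ-cong ∣e-∣ N)) (trans (tri-cong ∣e∣ ∣e-∣ N) (tri-exp w w N))))
  (ℚₚ.+-monoˡ-≤ (- E (w + w) N) (≤-≡ refl (product-≤-tri (λ i → 0≤e i) (λ i → 0≤e i) N N) (tri-exp w w (N ℕ.+ N))))
  where
  N = suc n
  0≤e : ∀ i → 0ℚ ≤ e w i
  0≤e i = 0≤* (0≤expCoeff i) (0≤^ 0≤w i)
  ∣e∣ : ∀ i → ∣ e w i ∣ ≡ e w i
  ∣e∣ i = ℚₚ.0≤p⇒∣p∣≡p (0≤e i)
  ∣^∣ : ∀ x i → ∣ x ^ i ∣ ≡ ∣ x ∣ ^ i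
  ∣^∣ x zero = refl
  ∣^∣ x (suc i) = trans (ℚₚ.∣p*q∣≡∣p∣*∣q∣ x (x ^ i)) (cong (∣ x ∣ *_) (∣^∣ x i))
  ∣e-∣ : ∀ i → ∣ e (- w) i ∣ ≡ e w i
  ∣e-∣ i = trans (ℚₚ.∣p*q∣≡∣p∣*∣q∣ (expCoeff i) ((- w) ^ i)) (cong₂ _*_ (ℚₚ.0≤p⇒∣p∣≡p (0≤expCoeff i)) (trans (∣^∣ (- w) i) (cong (_^ i) (trans (ℚₚ.∣-p∣≡∣p∣ w) (ℚₚ.0≤p⇒∣p∣≡p 0≤w)))))
  σ-cong : ∀ {u v : ℕ → ℚ} → (∀ i → u i ≡ v i) → ∀ n → σ u n ≡ σ v n
  σ-cong h zero = refl
  σ-cong h (suc n) = cong₂ _+_ (σ-cong h n) (h n)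
  tri-cong : ∀ {u u′ v v′ : ℕ → ℚ} → (∀ i → u i ≡ u′ i) → (∀ i → v i ≡ v′ i) → ∀ n → tri u v n ≡ tri u′ v′ n
  tri-cong hu hv zero = refl
  tri-cong hu hv (suc n) = cong₂ _+_ (cong₂ _*_ (hu 0) (σ-cong hv (suc n))) (tri-cong (hu ∘ suc) hv n)

-- Uniform in `w`, because `w` will be the n-th approximation of a real number and moves with n.
E-inverse′ : ∀ B .{{_ : NonZero B}} → ∃[ n₀ ] (∀ n → n₀ ℕ.≤ n → ∀ {w} → 0ℚ ≤ w → w + w ≤ fromℕ B → ∣ E w n * E (- w) n - 1ℚ ∣ ≤ 1ℚ)
E-inverse′ B = suc m₀ , λ { (suc n) (s≤s m₀≤n) {w} 0≤w 2w≤B → ℚₚ.≤-trans (E-inverse-remainder 0≤w n) (small (ℕₚ.m≤n⇒m≤1+n m₀≤n) (0≤+ 0≤w 0≤w) 2w≤B) }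
  where
  ½<1 : ½ < 1ℚ
  ½<1 = ℚ.*<* (ℤ.+<+ (s≤s (s≤s z≤n)))
  0≤½ = ℚₚ.nonNegative⁻¹ ½
  K = (2 ℕ.* B) ℕ.^ (2 ℕ.* B)
  0<K : 0ℚ < fromℕ K
  0<K = ℚₚ.<-≤-trans 0<1 (fromℕ-mono (ℕₚ.m^n>0 (2 ℕ.* B) {{ℕₚ.m*n≢0 2 B}} (2 ℕ.* B)))
  Λ = D.L {½} 0≤½ ½<1 {expCoeff} {fromℕ B} {fromℕ K} 0<K (0≤fromℕ B) (exp-major B)
  0<Λ = D.0<L {½} 0≤½ ½<1 {expCoeff} {fromℕ B} {fromℕ K} 0<K (0≤fromℕ B) (exp-major B)
  decay = ^-small {½} 0≤½ ½<1 (inv₀ Λ) (0<inv₀ 0<Λ)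
  m₀ = proj₁ decay
  small : ∀ {m x} → m₀ ℕ.≤ m → 0ℚ ≤ x → x ≤ fromℕ B → E x (m ℕ.+ m) - E x m ≤ 1ℚ
  small {m} {x} m₀≤m 0≤x x≤B = ℚₚ.≤-trans (∣∣≤⇒ (D.tail {½} 0≤½ ½<1 {expCoeff} {fromℕ B} {fromℕ K} 0<K (0≤fromℕ B) (exp-major B) {x} (ℚₚ.≤-trans (0≤⇒∣∣≤ 0≤x) x≤B) m m))
    (ℚₚ.≤-trans (D.geometric-tail {½} 0≤½ ½<1 {expCoeff} {fromℕ B} {fromℕ K} 0<K (0≤fromℕ B) (exp-major B) m m)
      (≤-≡ refl (*-monoˡ (ℚₚ.<⇒≤ 0<Λ) (proj₂ decay m m₀≤m)) (inv₀-inverse 0<Λ)))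

abstract
  E-inverse : ∀ B .{{_ : NonZero B}} → ∃[ n₀ ] (∀ n → n₀ ℕ.≤ n → ∀ {w} → 0ℚ ≤ w → w + w ≤ fromℕ B → ∣ E w n * E (- w) n - 1ℚ ∣ ≤ 1ℚ)
  E-inverse = E-inverse′

-- From real inequalities to rational approximations; growth of H.

-- Past the Cauchy moduli for η/4, one violation by more than η persists with margin η/2 and would
-- prove `y <ᴿ x`.
≤ᴿ⇒′ : ∀ x y → x ≤ᴿ y → ∀ η → 0ℚ < η → ∃[ n₀ ] (∀ n → n₀ ℕ.≤ n → seq x n ≤ seq y n + η)
≤ᴿ⇒′ x y x≤y η 0<η = n₀ , bound
  where
  q = η * (½ * ½)
  0<q = 0<* 0<η (ℚₚ.positive⁻¹ (½ * ½))
  cx = cauchy⁻ (seq x) (cauchy x) q 0<q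
  cy = cauchy⁻ (seq y) (cauchy y) q 0<q
  n₀ = proj₁ cx ℕ.⊔ proj₁ cy
  bound : ∀ n → n₀ ℕ.≤ n → seq x n ≤ seq y n + η
  bound n n₀≤n = case ≤⊎> (seq x n) (seq y n + η) of λ
    { (inj₁ le) → le
    ; (inj₂ gt) → ⊥-elim (x≤y (q + q , ℚₚ.+-mono-< 0<q 0<q , n₀ , λ m n₀≤m → by-difference
    (0≤+ (0≤+ (difference (proj₂ cx n m (⊔-l (proj₁ cx) (proj₁ cy) n₀≤n) (⊔-l (proj₁ cx) (proj₁ cy) n₀≤m))) (difference (proj₂ cy m n (⊔-r (proj₁ cx) (proj₁ cy) n₀≤m) (⊔-r (proj₁ cx) (proj₁ cy) n₀≤n)))) (difference (ℚₚ.<⇒≤ gt)))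
    (solve 5 (λ a b c d h → (c :+ h :* con (½ * ½) :- a) :+ (b :+ h :* con (½ * ½) :- d) :+ (a :- (b :+ h)) := c :- (d :+ (h :* con (½ * ½) :+ h :* con (½ * ½)))) refl (seq x n) (seq y n) (seq x m) (seq y m) η))) }

abstract
  ≤ᴿ⇒ : ∀ x y → x ≤ᴿ y → ∀ η → 0ℚ < η → ∃[ n₀ ] (∀ n → n₀ ℕ.≤ n → seq x n ≤ seq y n + η)
  ≤ᴿ⇒ = ≤ᴿ⇒′

least : ExcludedMiddle 0ℓ → ∀ (P : ℕ → Set) n → P n → ∃[ m ] P m × (∀ j → j ℕ.< m → ¬ P j)
least em P zero p = 0 , p , λ _ ()
least em P (suc n) p with em {P 0}
... | yes p₀ = 0 , p₀ , λ _ ()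
... | no ¬p₀ with least em (P ∘ suc) n p
...   | m , pm , min = suc m , pm , λ { zero _ → ¬p₀ ; (suc j) (s≤s j<m) → min j j<m }

floor′ : ExcludedMiddle 0ℓ → ∀ x → 0ᴿ ≤ᴿ x → ∃[ Q ] IsFloor x Q
floor′ em x 0≤x = Q , lower Q (proj₂ (proj₂ found)) , proj₁ (proj₂ found)
  where
  bdd = bounded (seq x) (cauchy x)
  arch = archimedean (proj₁ bdd)
  found = least em (λ Q → x <ᴿ fromℕᴿ (suc Q)) (proj₁ arch) (1ℚ , 0<1 , proj₁ (proj₂ (proj₂ bdd)) , λ n N≤n →
    ≤-≡ refl (ℚₚ.+-monoˡ-≤ 1ℚ (ℚₚ.≤-trans (ℚₚ.≤-trans (p≤∣p∣ (seq x n)) (proj₂ (proj₂ (proj₂ bdd)) n N≤n)) (proj₂ arch))) (trans (ℚₚ.+-comm (fromℕ (proj₁ arch)) 1ℚ) (sym (fromℕ-suc (proj₁ arch)))))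
  Q = proj₁ found
  lower : ∀ Q → (∀ j → j ℕ.< Q → ¬ (x <ᴿ fromℕᴿ (suc j))) → fromℕᴿ Q ≤ᴿ x
  lower zero _ = 0≤x
  lower (suc Q) min = min Q ℕₚ.≤-refl

abstract
  floor : ExcludedMiddle 0ℓ → ∀ x → 0ᴿ ≤ᴿ x → ∃[ Q ] IsFloor x Q
  floor = floor′

floor-≥ : ∀ {x Q M n₀} → x <ᴿ fromℕᴿ (suc Q) → (∀ n → n₀ ℕ.≤ n → fromℕ M ≤ seq x n) → M ℕ.≤ Q
floor-≥ {x} {Q} {M} {n₀} (δ , 0<δ , n₁ , h) lower = ℕₚ.≤-pred (ℕₚ.≰⇒> λ sucQ≤M → <⇒≱ 0<δ
  (by-difference (0≤+ (difference (ℚₚ.≤-trans (fromℕ-mono sucQ≤M) (lower n (ℕₚ.m≤m⊔n n₀ n₁)))) (difference (h n (ℕₚ.m≤n⊔m n₀ n₁))))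
    (solve 3 (λ x q d → (x :- q) :+ (q :- (x :+ d)) := con 0ℚ :- d) refl (seq x n) (fromℕ (suc Q)) δ)))
  where n = n₀ ℕ.⊔ n₁

H≤n : ∀ n → H n ≤ fromℕ n
H≤n zero = ℚₚ.≤-refl
H≤n (suc n) = ≤-≡ refl (ℚₚ.+-mono-≤ (H≤n n) (rec≤1 (suc n))) (trans (ℚₚ.+-comm (fromℕ n) 1ℚ) (sym (fromℕ-suc n)))

H-power-≤ : ∀ m B → H (m ℕ.^ B) ≤ fromℕ B * H m + 1ℚ
H-power-≤ m zero = ℚₚ.≤-reflexive (solve 1 (λ h → con 0ℚ :+ con 1ℚ := con 0ℚ :* h :+ con 1ℚ) refl (H m))
H-power-≤ m (suc B) = ≤-≡ refl (ℚₚ.≤-trans (H-*-≤ m (m ℕ.^ B)) (ℚₚ.+-monoʳ-≤ (H m) (H-power-≤ m B)))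
  (trans (solve 2 (λ b h → h :+ (b :* h :+ con 1ℚ) := (con 1ℚ :+ b) :* h :+ con 1ℚ) refl (fromℕ B) (H m)) (cong (λ b → b * H m + 1ℚ) (sym (fromℕ-suc B))))

-- H (2ⁿ) ≥ 1 + n/2
H-unbounded′ : ∀ q → ∃[ n ] q ≤ H n
H-unbounded′ q = 2 ℕ.^ m , ℚₚ.≤-trans (proj₂ arch) (ℚₚ.≤-trans (≤-≡ (trans (sym (ℚₚ.*-identityʳ (fromℕ (proj₁ arch)))) (trans (solve 1 (λ a → a :* con 1ℚ := con (fromℕ 2) :* a :* con ½) refl (fromℕ (proj₁ arch))) (cong (_* ½) (sym (fromℕ-* 2 (proj₁ arch)))))) (p≤p+q 0≤1) refl) (grow m))
  where
  arch = archimedean q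
  m = 2 ℕ.* proj₁ arch
  grow : ∀ m → fromℕ m * ½ + 1ℚ ≤ H (2 ℕ.^ m)
  grow zero = ℚₚ.≤-refl
  grow (suc m) = ≤-≡ (trans (cong (λ x → x * ½ + 1ℚ) (fromℕ-suc m)) (solve 1 (λ x → (con 1ℚ :+ x) :* con ½ :+ con 1ℚ := (x :* con ½ :+ con 1ℚ) :+ con ½) refl (fromℕ m)))
    (by-difference (0≤+ (difference (grow m)) (difference (H-*-≥ {2 ℕ.^ m} (ℕₚ.m^n>0 2 m) 1)))
      (trans (solve 3 (λ g h k → (h :- g) :+ (k :+ con 1ℚ :- (h :+ con (H 2))) := k :- (g :+ con ½)) refl (fromℕ m * ½ + 1ℚ) (H (2 ℕ.^ m)) (H (2 ℕ.^ m ℕ.* 2)))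
        (cong (λ x → H x - (fromℕ m * ½ + 1ℚ + ½)) (ℕₚ.*-comm (2 ℕ.^ m) 2)))) refl

abstract
  H-unbounded : ∀ q → ∃[ n ] q ≤ H n
  H-unbounded = H-unbounded′

floorℚ′ : ∀ q → 0ℚ ≤ q → ∃[ m ] fromℕ m ≤ q × q ≤ fromℕ (suc m)
floorℚ′ q 0≤q = search (proj₁ (archimedean q)) (proj₂ (archimedean q))
  where
  search : ∀ n → q ≤ fromℕ n → ∃[ m ] fromℕ m ≤ q × q ≤ fromℕ (suc m)
  search zero le = 0 , 0≤q , ℚₚ.≤-trans le (0≤fromℕ 1)
  search (suc n) le with ℚₚ.≤-total (fromℕ n) q
  ... | inj₁ n≤q = n , n≤q , le
  ... | inj₂ q≤n = search n q≤n

abstract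
  floorℚ : ∀ q → 0ℚ ≤ q → ∃[ m ] fromℕ m ≤ q × q ≤ fromℕ (suc m)
  floorℚ = floorℚ′

-- Levels of distribution in rational form.

-- The approximation to log (log N) at index n.
loglog : ℚ → ℕ → ℚ
loglog l n = powerSum logCoeff (zq l) n

module _ (B : ℕ) where
  private
    -- More than `B` is needed: the comparison of harmonic numbers with log log N loses additive
    -- constants, B (h + 3) + 1 against A (h - 2), and with this `A` they are absorbed once h ≥ 10,
    -- which `K₇` ensures.
    A = suc (2 ℕ.* B)
    K₇ = proj₁ (H-unbounded (fromℕ 10))

  -- exp (- A log log N) is small compared with (H N)^{-B}.
  pow-small : ∀ N → 1 ℕ.≤ N → fromℕ K₇ + fromℕ 3 ≤ H N → ∃[ n₀ ] (∀ n → n₀ ℕ.≤ n →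
    let l = powerSum logCoeff (zq (fromℕ N)) n in 0ℚ ≤ E (- (fromℕ A * loglog l n)) n × E (- (fromℕ A * loglog l n)) n ≤ fromℕ 2 * inv₀ (H N ^ B))
  pow-small N 1≤N big = n₀ , λ n n₀≤n → result n n₀≤n
    where
    fl = floorℚ (H N - fromℕ 2) (by-difference (0≤+ (difference big) (0≤+ (0≤fromℕ K₇) 0≤1)) (solve 2 (λ h k → h :- (k :+ con (fromℕ 3)) :+ (k :+ con 1ℚ) := h :- con (fromℕ 2) :- con 0ℚ) refl (H N) (fromℕ K₇)))
    M = proj₁ fl
    M≤ : fromℕ M ≤ H N - fromℕ 2
    M≤ = proj₁ (proj₂ fl)
    K = 3 ℕ.+ M
    HN≤K : H N ≤ fromℕ K
    HN≤K = by-difference (difference (proj₂ (proj₂ fl))) (trans (solve 2 (λ h m → m :- (h :- con (fromℕ 2)) := con (fromℕ 2) :+ m :- h) refl (H N) (fromℕ (suc M))) (cong (_- H N) (sym (fromℕ-+ 2 (suc M)))))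
    K₇≤M : K₇ ℕ.≤ M
    K₇≤M = ℕₚ.≤-pred (fromℕ-cancel-≤ (ℚₚ.≤-trans (by-difference {q = H N - fromℕ 2} (difference big) (trans (solve 2 (λ h k → h :- (k :+ con (fromℕ 3)) := h :- con (fromℕ 2) :- (con 1ℚ :+ k)) refl (H N) (fromℕ K₇)) (cong (λ x → H N - fromℕ 2 - x) (sym (fromℕ-suc K₇))))) (proj₂ (proj₂ fl))))
    10≤HM : fromℕ 10 ≤ H M
    10≤HM = ℚₚ.≤-trans (proj₂ (H-unbounded (fromℕ 10))) (H-mono K₇≤M)
    1≤M : 1 ℕ.≤ M
    1≤M = ℕₚ.n≢0⇒n>0 λ eq → <⇒≱ (ℚₚ.positive⁻¹ (fromℕ 10)) (≤-≡ refl 10≤HM (cong H eq))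
    m = K ℕ.^ B
    instance
      A*K≢0 : NonZero (2 ℕ.* (A ℕ.* K))
      A*K≢0 = ℕₚ.m*n≢0 2 (A ℕ.* K)
    ll₁ = log-lower 1≤N
    ll₂ = log-lower 1≤M
    inv = E-inverse (2 ℕ.* (A ℕ.* K))
    n₀ = (proj₁ ll₁ ℕ.⊔ proj₁ ll₂) ℕ.⊔ (proj₁ inv ℕ.⊔ suc m)
    result : ∀ n → n₀ ℕ.≤ n → let l = powerSum logCoeff (zq (fromℕ N)) n in 0ℚ ≤ E (- (fromℕ A * loglog l n)) n × E (- (fromℕ A * loglog l n)) n ≤ fromℕ 2 * inv₀ (H N ^ B)
    result n n₀≤n = 0≤E- , E-≤
      where
      n≥₁ = ⊔-l (proj₁ ll₁) (proj₁ ll₂) (⊔-l (proj₁ ll₁ ℕ.⊔ proj₁ ll₂) (proj₁ inv ℕ.⊔ suc m) n₀≤n)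
      n≥₂ = ⊔-r (proj₁ ll₁) (proj₁ ll₂) (⊔-l (proj₁ ll₁ ℕ.⊔ proj₁ ll₂) (proj₁ inv ℕ.⊔ suc m) n₀≤n)
      n≥₃ = ⊔-l (proj₁ inv) (suc m) (⊔-r (proj₁ ll₁ ℕ.⊔ proj₁ ll₂) (proj₁ inv ℕ.⊔ suc m) n₀≤n)
      n≥₄ = ⊔-r (proj₁ inv) (suc m) (⊔-r (proj₁ ll₁ ℕ.⊔ proj₁ ll₂) (proj₁ inv ℕ.⊔ suc m) n₀≤n)
      l = powerSum logCoeff (zq (fromℕ N)) n
      M≤l : fromℕ M ≤ l
      M≤l = ℚₚ.≤-trans M≤ (proj₂ ll₁ n n≥₁)
      1≤l : 1ℚ ≤ l
      1≤l = ℚₚ.≤-trans (fromℕ-mono 1≤M) M≤l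
      v = loglog l n
      0≤v = 0≤log 1≤l n
      v-lower : H M - fromℕ 2 ≤ v
      v-lower = ℚₚ.≤-trans (proj₂ ll₂ n n≥₂) (log-mono (fromℕ-mono 1≤M) M≤l n)
      v-upper : v ≤ fromℕ K
      v-upper = ℚₚ.≤-trans (log-mono 1≤l (ℚₚ.≤-trans (log-upper 1≤N n) HN≤K) n) (ℚₚ.≤-trans (log-upper {K} (s≤s z≤n) n) (H≤n K))
      w = fromℕ A * v
      0≤w = 0≤* (0≤fromℕ A) 0≤v
      near = proj₂ inv n n≥₃ 0≤w (≤-≡ refl (ℚₚ.+-mono-≤ (*-monoˡ (0≤fromℕ A) v-upper) (*-monoˡ (0≤fromℕ A) v-upper))
        (trans (solve 2 (λ a k → a :* k :+ a :* k := con (fromℕ 2) :* (a :* k)) refl (fromℕ A) (fromℕ K)) (trans (cong (fromℕ 2 *_) (sym (fromℕ-* A K))) (sym (fromℕ-* 2 (A ℕ.* K))))))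
      -- H (K^B) ≤ B (H M + 3) + 1 ≤ (2 B + 1) (H M - 2)
      HK : H K ≤ H M + fromℕ 3
      HK = ≤-≡ (trans (∑-split 3 M rec) refl) (ℚₚ.≤-trans (ℚₚ.+-mono-≤ (H≤n 3) (∑-mono M λ i 1≤i _ → rec-anti 1≤i (ℕₚ.m≤n+m i 3))) (ℚₚ.≤-reflexive (ℚₚ.+-comm (fromℕ 3) (H M)))) refl
      Hm≤w : H m ≤ w
      Hm≤w = ℚₚ.≤-trans (H-power-≤ K B) (ℚₚ.≤-trans (ℚₚ.+-monoˡ-≤ 1ℚ (*-monoˡ (0≤fromℕ B) HK))
        (ℚₚ.≤-trans (by-difference {d = fromℕ B * (H M - fromℕ 10) + fromℕ 3 * fromℕ B + (H M - fromℕ 10) + fromℕ 7} (0≤+ (0≤+ (0≤+ (0≤* (0≤fromℕ B) (difference 10≤HM)) (0≤* (0≤fromℕ 3) (0≤fromℕ B))) (difference 10≤HM)) (0≤fromℕ 7))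
            (trans (solve 2 (λ b h → b :* (h :- con (fromℕ 10)) :+ con (fromℕ 3) :* b :+ (h :- con (fromℕ 10)) :+ con (fromℕ 7) := (con 1ℚ :+ con (fromℕ 2) :* b) :* (h :- con (fromℕ 2)) :- (b :* (h :+ con (fromℕ 3)) :+ con 1ℚ)) refl (fromℕ B) (H M))
              (cong (λ x → x * (H M - fromℕ 2) - (fromℕ B * (H M + fromℕ 3) + 1ℚ)) (sym (trans (fromℕ-suc (2 ℕ.* B)) (cong (1ℚ +_) (fromℕ-* 2 B)))))))
          (*-monoˡ (0≤fromℕ A) v-lower)))
      big-E : H N ^ B ≤ E w n
      big-E = ℚₚ.≤-trans (≤-≡ refl (^-mono (0≤H N) HN≤K B) (sym (fromℕ-^ K B))) (ℚₚ.≤-trans (fromℕ-mono (ℕₚ.n≤1+n m)) (E-lower {m} Hm≤w n n≥₄))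
      0<HB : 0ℚ < H N ^ B
      0<HB = 0<^ (ℚₚ.<-≤-trans 0<1 (1≤H 1≤N)) B
      0<Ew = ℚₚ.<-≤-trans 0<HB big-E
      0≤E- : 0ℚ ≤ E (- w) n
      0≤E- = *-cancelˡ 0<Ew (≤-≡ (ℚₚ.*-zeroʳ (E w n)) (by-difference {d = 1ℚ - (- (E w n * E (- w) n - 1ℚ))} (difference (ℚₚ.≤-trans (p≤∣p∣ (- (E w n * E (- w) n - 1ℚ))) (≤-≡ (ℚₚ.∣-p∣≡∣p∣ (E w n * E (- w) n - 1ℚ)) near refl))) (solve 1 (λ x → con 1ℚ :- (:- (x :- con 1ℚ)) := x :- con 0ℚ) refl (E w n * E (- w) n))) refl)
      E-≤ : E (- w) n ≤ fromℕ 2 * inv₀ (H N ^ B)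
      E-≤ = *-cancelˡ 0<HB (ℚₚ.≤-trans (*-monoʳ 0≤E- big-E) (ℚₚ.≤-trans (by-difference (difference (∣∣≤⇒ near)) (solve 1 (λ x → con 1ℚ :- (x :- con 1ℚ) := con (fromℕ 2) :- x) refl (E w n * E (- w) n)))
        (ℚₚ.≤-reflexive (sym (trans (solve 3 (λ h t i → h :* (t :* i) := t :* (h :* i)) refl (H N ^ B) (fromℕ 2) (inv₀ (H N ^ B))) (trans (cong (fromℕ 2 *_) (inv₀-inverse 0<HB)) (ℚₚ.*-identityʳ (fromℕ 2))))))))

  -- The strict inequality provides δ with ϑ - δ ≥ θ₀, which serves as ε, so the floor of N^(ϑ-ε) is
  -- at least any M with `H M` below θ₀ times the lower bound `H N` - 2 for log N. The index n₀
  -- depends on N.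
  level-bound : ExcludedMiddle 0ℓ → ∀ {S ϑ} → LevelOfDistribution S ϑ → ∀ {θ₀} → 0ℚ ≤ θ₀ → fromℚᴿ θ₀ <ᴿ ϑ →
    ∃[ C ] 0ℚ ≤ C × ∃[ N₀ ] (∀ N → N₀ ℕ.≤ N → ∀ M → H M ≤ θ₀ * (H N - fromℕ 2) →
      ∃[ Q ] M ℕ.≤ Q × ∃[ n₀ ] (∀ n → n₀ ℕ.≤ n → seq (S N Q) n ≤ C * (fromℕ N * inv₀ (H N ^ B))))
  level-bound em {S} {ϑ} lod {θ₀} 0≤θ₀ (δ , 0<δ , nϑ , hϑ) = fromℕ 2 * Cb + 1ℚ , 0≤+ (0≤* (0≤fromℕ 2) 0≤Cb) 0≤1 , N₀ , at
    where
    ε = fromℚᴿ δ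
    Aᴿ = fromℕᴿ A
    given = lod ε Aᴿ (δ , 0<δ , 0 , λ _ _ → ℚₚ.≤-reflexive (ℚₚ.+-identityˡ δ)) (0<fromℕ A)
    Cᴿ = proj₁ given
    bdd = bounded (seq Cᴿ) (cauchy Cᴿ)
    Cb = proj₁ bdd
    0≤Cb = ℚₚ.<⇒≤ (proj₁ (proj₂ bdd))
    N₁ = proj₁ (H-unbounded (fromℕ K₇ + fromℕ 3))
    N₀ = 2 ℕ.⊔ N₁
    at : ∀ N → N₀ ℕ.≤ N → ∀ M → H M ≤ θ₀ * (H N - fromℕ 2) → ∃[ Q ] M ℕ.≤ Q × ∃[ n₀ ] (∀ n → n₀ ℕ.≤ n → seq (S N Q) n ≤ (fromℕ 2 * Cb + 1ℚ) * (fromℕ N * inv₀ (H N ^ B)))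
    at zero N₀≤N = contradiction (⊔-l 2 N₁ N₀≤N) λ ()
    at (suc zero) N₀≤N = contradiction (⊔-l 2 N₁ N₀≤N) λ { (s≤s ()) }
    at N@(suc (suc _)) N₀≤N M HM≤ = Q , floor-≥ {x} {Q} {M} {suc M ℕ.⊔ n₁} (proj₂ (proj₂ fl)) lower , n₂ , bound
      where
      x = powℕ N (ϑ -ᴿ ε)
      bigN : fromℕ K₇ + fromℕ 3 ≤ H N
      bigN = ℚₚ.≤-trans (proj₂ (H-unbounded (fromℕ K₇ + fromℕ 3))) (H-mono (⊔-r 2 N₁ N₀≤N))
      ll = log-lower {N} (s≤s z≤n)
      n₁ = nϑ ℕ.⊔ proj₁ ll
      0≤HN-2 : 0ℚ ≤ H N - fromℕ 2
      0≤HN-2 = by-difference (0≤+ (difference bigN) (0≤+ (0≤fromℕ K₇) 0≤1)) (solve 2 (λ h k → h :- (k :+ con (fromℕ 3)) :+ (k :+ con 1ℚ) := h :- con (fromℕ 2) :- con 0ℚ) refl (H N) (fromℕ K₇))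
      exponent : ∀ n → n₁ ℕ.≤ n → H M ≤ (seq ϑ n - δ) * powerSum logCoeff (zq (fromℕ N)) n
      exponent n n₁≤n = ℚₚ.≤-trans HM≤ (*-mono 0≤θ₀ (ℚₚ.≤-trans 0≤HN-2 (proj₂ ll n (⊔-r nϑ (proj₁ ll) n₁≤n)))
        (by-difference {q = seq ϑ n - δ} (difference (hϑ n (⊔-l nϑ (proj₁ ll) n₁≤n))) (solve 3 (λ t d o → t :- (o :+ d) := t :- d :- o) refl (seq ϑ n) δ θ₀)) (proj₂ ll n (⊔-r nϑ (proj₁ ll) n₁≤n)))
      lower : ∀ n → suc M ℕ.⊔ n₁ ℕ.≤ n → fromℕ M ≤ seq x n
      lower n le = ℚₚ.≤-trans (fromℕ-mono (ℕₚ.n≤1+n M)) (E-lower {M} (exponent n (⊔-r (suc M) n₁ le)) n (⊔-l (suc M) n₁ le))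
      0≤x : 0ᴿ ≤ᴿ x
      0≤x (η , 0<η , n₃ , h) = <⇒≱ 0<η (ℚₚ.≤-trans (p≤q+p (ℚₚ.≤-trans (0≤fromℕ M) (lower n (ℕₚ.m≤n⊔m n₃ (suc M ℕ.⊔ n₁))))) (h n (ℕₚ.m≤m⊔n n₃ (suc M ℕ.⊔ n₁))))
        where n = n₃ ℕ.⊔ (suc M ℕ.⊔ n₁)
      fl = floor em x 0≤x
      Q = proj₁ fl
      -- The slack of `≤ᴿ⇒` is taken as large as the bound itself; it is the 1 in 2 `Cb` + 1.
      ηN = fromℕ N * inv₀ (H N ^ B)
      0<ηN : 0ℚ < ηN
      0<ηN = 0<* (0<fromℕ⁺ {N} (s≤s z≤n)) (0<inv₀ (0<^ (ℚₚ.<-≤-trans 0<1 (1≤H {N} (s≤s z≤n))) B))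
      rhs = Cᴿ *ᴿ (fromℕᴿ N *ᴿ pow (logℕ N) (0<logℕ N) (-ᴿ Aᴿ))
      ev = ≤ᴿ⇒ (S N Q) rhs (proj₂ given N Q (proj₂ fl)) ηN 0<ηN
      ps = pow-small N (s≤s z≤n) bigN
      n₂ = (proj₁ ev ℕ.⊔ proj₁ ps) ℕ.⊔ proj₁ (proj₂ (proj₂ bdd))
      bound : ∀ n → n₂ ℕ.≤ n → seq (S N Q) n ≤ (fromℕ 2 * Cb + 1ℚ) * ηN
      bound n n₂≤n = ℚₚ.≤-trans (proj₂ ev n (⊔-l (proj₁ ev) (proj₁ ps) (⊔-l (proj₁ ev ℕ.⊔ proj₁ ps) (proj₁ (proj₂ (proj₂ bdd))) n₂≤n)))
        (ℚₚ.≤-trans (ℚₚ.+-monoˡ-≤ ηN (*-mono′ (ℚₚ.≤-trans (p≤∣p∣ (seq Cᴿ n)) (proj₂ (proj₂ (proj₂ bdd)) n (⊔-r (proj₁ ev ℕ.⊔ proj₁ ps) (proj₁ (proj₂ (proj₂ bdd))) n₂≤n)))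
            (0≤* (0≤fromℕ N) (≤-≡ refl (proj₁ small) (sym neg))) (*-monoˡ (0≤fromℕ N) (≤-≡ neg (proj₂ small) refl)) ))
          (ℚₚ.≤-reflexive (solve 3 (λ c n i → c :* (n :* (con (fromℕ 2) :* i)) :+ n :* i := (con (fromℕ 2) :* c :+ con 1ℚ) :* (n :* i)) refl Cb (fromℕ N) (inv₀ (H N ^ B)))))
        where
        small = proj₂ ps n (⊔-r (proj₁ ev) (proj₁ ps) (⊔-l (proj₁ ev ℕ.⊔ proj₁ ps) (proj₁ (proj₂ (proj₂ bdd))) n₂≤n))
        v = loglog (powerSum logCoeff (zq (fromℕ N)) n) n
        neg : seq (pow (logℕ N) (0<logℕ N) (-ᴿ Aᴿ)) n ≡ E (- (fromℕ A * v)) n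
        neg = cong (λ y → E y n) (solve 2 (λ a v → (:- a) :* v := :- (a :* v)) refl (fromℕ A) v)
        *-mono′ : ∀ {p r s} → p ≤ Cb → 0ℚ ≤ r → r ≤ s → p * r ≤ Cb * s
        *-mono′ p≤q 0≤r r≤s = ℚₚ.≤-trans (*-monoʳ 0≤r p≤q) (*-monoˡ 0≤Cb r≤s)

-- The errors of (A) and (B) at a fixed index of approximation.

seq-∑ᴿ : ∀ ι N {f : (n : ℕ) .{{_ : NonZero n}} → ℝ} {F : ℕ → ℚ} → (∀ n → seq (f (suc n)) ι ≡ F (suc n)) → seq (∑ᴿ N f) ι ≡ ∑ N F
seq-∑ᴿ ι zero eq = refl
seq-∑ᴿ ι (suc N) {f} {F} eq = cong₂ _+_ (seq-∑ᴿ ι N {f} {F} eq) (eq N)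

at : ((n : ℕ) .{{_ : NonZero n}} → ℝ) → ℕ → ℕ → ℚ
at f ι zero    = 0ℚ
at f ι (suc n) = seq (f (suc n)) ι

∑-at : ∀ ι N f → seq (∑ᴿ N f) ι ≡ ∑ N (at f ι)
∑-at ι zero f = refl
∑-at ι (suc N) f = cong (_+ seq (f (suc N)) ι) (∑-at ι N f)

seq≤maxᴿ : ∀ ι {x xs} → x ∈ xs → seq x ι ≤ seq (maxᴿ xs) ι
seq≤maxᴿ ι {x} {_ ∷ xs} (here refl) = ℚₚ.p≤p⊔q (seq x ι) (seq (maxᴿ xs) ι)
seq≤maxᴿ ι {x} {y ∷ xs} (there x∈) = ℚₚ.≤-trans (seq≤maxᴿ ι x∈) (ℚₚ.p≤q⊔p (seq y ι) (seq (maxᴿ xs) ι))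

0≤seq-maxᴿ : ∀ ι xs → 0ℚ ≤ seq (maxᴿ xs) ι
0≤seq-maxᴿ ι [] = ℚₚ.≤-refl
0≤seq-maxᴿ ι (x ∷ xs) = ℚₚ.≤-trans (0≤seq-maxᴿ ι xs) (ℚₚ.p≤q⊔p (seq x ι) (seq (maxᴿ xs) ι))

-- The ι-th approximation to log p.
logAt : ℕ → ℕ → ℚ
logAt ι zero    = 0ℚ
logAt ι (suc p) = powerSum logCoeff (zq (fromℕ (suc p))) ι

0≤logAt : ∀ ι p → 0ℚ ≤ logAt ι p
0≤logAt ι zero = ℚₚ.≤-refl
0≤logAt ι (suc p) = 0≤log (1≤fromℕ-suc p) ι

logAt≤H : ∀ ι p → logAt ι p ≤ H p
logAt≤H ι zero = ℚₚ.≤-refl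
logAt≤H ι (suc p) = log-upper {suc p} (s≤s z≤n) ι

Θ : ℕ → ℕ → ℕ → ℕ → ℚ
Θ ι x m a = ∑ x (λ p → χ (prime? p) * logAt ι p * χ (p ≡? a [mod m ]))

seq-θ : ∀ ι x m a → seq (θ x m a) ι ≡ Θ ι x m a
seq-θ ι x m a = seq-∑ᴿ ι x λ p → cases (suc p) (does (prime? (suc p))) (does (suc p ≡? a [mod m ])) 
  where
  cases : ∀ p .{{_ : NonZero p}} → ∀ b c → seq (if b ∧ c then logℕ p else 0ᴿ) ι ≡ (if b then 1ℚ else 0ℚ) * seq (logℕ p) ι * (if c then 1ℚ else 0ℚ)
  cases p true true = solve 1 (λ l → l := con 1ℚ :* l :* con 1ℚ) refl (seq (logℕ p) ι)
  cases p true false = solve 1 (λ l → con 0ℚ := con 1ℚ :* l :* con 0ℚ) refl (seq (logℕ p) ι)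
  cases p false true = solve 1 (λ l → con 0ℚ := con 0ℚ :* l :* con 1ℚ) refl (seq (logℕ p) ι)
  cases p false false = solve 1 (λ l → con 0ℚ := con 0ℚ :* l :* con 0ℚ) refl (seq (logℕ p) ι)

primeErrorᴿ : ℕ → (q : ℕ) .{{_ : NonZero q}} → ℝ
primeErrorᴿ x q = primeError x q

conditionA : ∀ {ϑ} → ConditionA ϑ → LevelOfDistribution (λ N Q → ∑ᴿ Q (primeErrorᴿ N)) ϑ
conditionA c = c

primeErr : ℕ → ℕ → ℕ → ℚ
primeErr ι x = at (primeErrorᴿ x) ι

0≤primeErr : ∀ ι x q → 0ℚ ≤ primeErr ι x q
0≤primeErr ι x zero = ℚₚ.≤-refl
0≤primeErr ι x (suc q) = 0≤seq-maxᴿ ι (map (λ a → ∣ θ x (suc q) a -ᴿ fromℚᴿ (_/_ (ℤ.+ x) (φ (suc q)) {{φ≢0 (suc q)}}) ∣ᴿ) (filter (λ a → coprime? a (suc q)) (upTo (suc q))))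

mod-% : ∀ n m .{{_ : NonZero m}} → n ≡ n ℕ.% m [mod m ]
mod-% n m = mod-intro {n} {n ℕ.% m} 0 (n ℕ./ m) (trans (ℕₚ.+-identityʳ n) (ℕ.m≡m%n+[m/n]*n n m))

primeErr-≥ : ∀ ι x {m c} → 1 ℕ.≤ m → Coprime c m → ∣ Θ ι x m c - fromℕ x * inv₀ (coprimeCount m) ∣ ≤ primeErr ι x m
primeErr-≥ ι x {m@(suc q)} {c} 1≤m cop = ≤-≡ (cong ∣_∣ (cong₂ _-_ same (trans (cong (λ y → fromℕ x * inv₀ y) (coprimeCount≡φ m)) (sym (n/d≡ x (φ m) {{φ≢0 m}})))))
  (ℚₚ.≤-trans (∣∣-lub {X} (ℚₚ.p≤p⊔q X (- X)) (ℚₚ.p≤q⊔p X (- X))) (seq≤maxᴿ ι (∈-map⁺ f (∈-filter⁺ (λ a → coprime? a m) (∈-upTo⁺ (ℕ.m%n<n c m)) a-coprime)))) refl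
  where
  a = c ℕ.% m
  f : ℕ → ℝ
  f a = ∣ θ x m a -ᴿ fromℚᴿ (_/_ (ℤ.+ x) (φ m) {{φ≢0 m}}) ∣ᴿ
  X = seq (θ x m a -ᴿ fromℚᴿ (_/_ (ℤ.+ x) (φ m) {{φ≢0 m}})) ι
  same : Θ ι x m c ≡ seq (θ x m a) ι
  same = trans (∑-cong x λ p _ _ → cong (χ (prime? p) * logAt ι p *_) (χ-cong (p ≡? c [mod m ]) (p ≡? a [mod m ]) (λ e → mod-trans {p} {c} e (mod-% c m)) (λ e → mod-trans {p} {a} e (mod-sym {c} {a} (mod-% c m))))) (sym (seq-θ ι x m a))
  a-coprime : Coprime a m
  a-coprime (d∣a , d∣m) = cop (mod-∣ {c} {a} (ℕ.∣-trans d∣m (mod-% c m)) d∣a , d∣m)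

shift-sum : ∀ N h (F : ℕ → ℚ) → ∑ N (λ i → F (N ℕ.+ i ℕ.+ h)) ≡ ∑ (N ℕ.+ h ℕ.+ N) F - ∑ (N ℕ.+ h) F
shift-sum N h F = trans (∑-cong N λ i _ _ → cong F (trans (ℕₚ.+-assoc N i h) (trans (cong (N ℕ.+_) (ℕₚ.+-comm i h)) (sym (ℕₚ.+-assoc N h i)))))
  (trans (solve 2 (λ a b → b := a :+ b :- a) refl (∑ (N ℕ.+ h) F) (∑ N (λ i → F (N ℕ.+ h ℕ.+ i)))) (cong (_- ∑ (N ℕ.+ h) F) (sym (∑-split (N ℕ.+ h) N F))))

shift-class : ∀ N h m c i → χ (N ℕ.+ i ≡? c [mod m ]) ≡ χ (N ℕ.+ i ℕ.+ h ≡? c ℕ.+ h [mod m ])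
shift-class N h m c i = χ-cong (N ℕ.+ i ≡? c [mod m ]) (N ℕ.+ i ℕ.+ h ≡? c ℕ.+ h [mod m ]) (mod-shift {N ℕ.+ i} {c} h) (mod-unshift {N ℕ.+ i} {c} h)

primes-in-class : ∀ ι N h m c → 1 ℕ.≤ m → Coprime (c ℕ.+ h) m →
  ∣ ∑ N (λ i → χ (prime? (N ℕ.+ i ℕ.+ h)) * logAt ι (N ℕ.+ i ℕ.+ h) * χ (N ℕ.+ i ≡? c [mod m ])) - fromℕ N * inv₀ (coprimeCount m) ∣ ≤ primeErr ι (N ℕ.+ h ℕ.+ N) m + primeErr ι (N ℕ.+ h) m
primes-in-class ι N h m c 1≤m cop = ≤-≡ (cong ∣_∣ (trans (cong (_- fromℕ N * i) (trans (∑-cong N λ i _ _ → cong (χ (prime? (N ℕ.+ i ℕ.+ h)) * logAt ι (N ℕ.+ i ℕ.+ h) *_) (shift-class N h m c i)) (shift-sum N h (λ p → χ (prime? p) * logAt ι p * χ (p ≡? c ℕ.+ h [mod m ])))))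
    (trans (solve 5 (λ a b n x i → a :- b :- n :* i := (a :- (x :+ n) :* i) :+ :- (b :- x :* i)) refl A B (fromℕ N) (fromℕ (N ℕ.+ h)) i) (cong (λ y → A - y * i + - (B - fromℕ (N ℕ.+ h) * i)) (sym (fromℕ-+ (N ℕ.+ h) N))))))
  (∣+∣≤ {A - fromℕ (N ℕ.+ h ℕ.+ N) * i} { - (B - fromℕ (N ℕ.+ h) * i)} (primeErr-≥ ι (N ℕ.+ h ℕ.+ N) 1≤m cop) (≤-≡ (ℚₚ.∣-p∣≡∣p∣ (B - fromℕ (N ℕ.+ h) * i)) (primeErr-≥ ι (N ℕ.+ h) 1≤m cop) refl)) refl
  where
  i = inv₀ (coprimeCount m)
  A = Θ ι (N ℕ.+ h ℕ.+ N) m (c ℕ.+ h)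
  B = Θ ι (N ℕ.+ h) m (c ℕ.+ h)

fromℤ : ℤ → ℚ
fromℤ i = i / 1

fromℤ-+ : ∀ i j → fromℤ (i ℤ.+ j) ≡ fromℤ i + fromℤ j
fromℤ-+ i j = ℚₚ.toℚᵘ-injective (begin
  ℚ.toℚᵘ (fromℤ (i ℤ.+ j))                    ≈⟨ ℚₚ.toℚᵘ-fromℚᵘ (ℚᵘ.mkℚᵘ (i ℤ.+ j) 0) ⟩
  ℚᵘ.mkℚᵘ (i ℤ.+ j) 0                         ≈⟨ ℚᵘ.*≡* (cong (ℤ._* (ℤ.+ 1)) (cong₂ ℤ._+_ (sym (ℤₚ.*-identityʳ i)) (sym (ℤₚ.*-identityʳ j)))) ⟩
  ℚᵘ.mkℚᵘ i 0 ℚᵘ.+ ℚᵘ.mkℚᵘ j 0                ≈⟨ ℚᵘₚ.≃-sym (ℚᵘₚ.+-cong (ℚₚ.toℚᵘ-fromℚᵘ (ℚᵘ.mkℚᵘ i 0)) (ℚₚ.toℚᵘ-fromℚᵘ (ℚᵘ.mkℚᵘ j 0))) ⟩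
  ℚ.toℚᵘ (fromℤ i) ℚᵘ.+ ℚ.toℚᵘ (fromℤ j)      ≈⟨ ℚᵘₚ.≃-sym (ℚₚ.toℚᵘ-homo-+ (fromℤ i) (fromℤ j)) ⟩
  ℚ.toℚᵘ (fromℤ i + fromℤ j)                  ∎)
  where open ℚᵘₚ.≃-Reasoning

∣fromℤ∣ : ∀ i → ∣ fromℤ i ∣ ≡ fromℕ ℤ.∣ i ∣
∣fromℤ∣ (ℤ.+ n) = ℚₚ.0≤p⇒∣p∣≡p (0≤fromℕ n)
∣fromℤ∣ ℤ.-[1+ n ] = trans (ℚₚ.∣-p∣≡∣p∣ (fromℕ (suc n))) (ℚₚ.0≤p⇒∣p∣≡p (0≤fromℕ (suc n)))

lam : ℕ → ℚ
lam zero    = 0ℚ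
lam (suc n) = fromℤ (liouville (suc n))

∣-1^∣ : ∀ k → ℤ.∣ ℤ.-1ℤ ℤ.^ k ∣ ≡ 1
∣-1^∣ zero = refl
∣-1^∣ (suc k) = trans (ℤₚ.abs-* ℤ.-1ℤ (ℤ.-1ℤ ℤ.^ k)) (trans (ℕₚ.*-identityˡ _) (∣-1^∣ k))

∣lam∣≤1 : ∀ n → ∣ lam n ∣ ≤ 1ℚ
∣lam∣≤1 zero = 0≤1
∣lam∣≤1 (suc n) = ℚₚ.≤-reflexive (trans (∣fromℤ∣ (liouville (suc n))) (cong fromℕ (∣-1^∣ (Ω (suc n)))))

liouvilleSum-ℚ : ∀ x m a → fromℤ (liouvilleSum x m a) ≡ ∑ x (λ n → lam n * χ (n ≡? a [mod m ]))
liouvilleSum-ℚ zero m a = refl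
liouvilleSum-ℚ (suc x) m a = trans (fromℤ-+ (liouvilleSum x m a) (if does (suc x ≡? a [mod m ]) then liouville (suc x) else ℤ.0ℤ))
  (cong₂ _+_ (liouvilleSum-ℚ x m a) (cases (does (suc x ≡? a [mod m ]))))
  where
  cases : ∀ b → fromℤ (if b then liouville (suc x) else ℤ.0ℤ) ≡ fromℤ (liouville (suc x)) * (if b then 1ℚ else 0ℚ)
  cases true = sym (ℚₚ.*-identityʳ (fromℤ (liouville (suc x))))
  cases false = sym (ℚₚ.*-zeroʳ (fromℤ (liouville (suc x))))

≤max-max : ∀ (F : ℕ → ℕ → ℕ) {X m y a} → y ℕ.< X → a ℕ.< m → F y a ℕ.≤ max 0 (map (λ y → max 0 (map (λ a → F y a) (upTo m))) (upTo X))
≤max-max F {X} {m} {y} y<X a<m = ℕₚ.≤-trans (All.lookup (xs≤max 0 (map (F y) (upTo m))) (∈-map⁺ (F y) (∈-upTo⁺ a<m)))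
  (All.lookup (xs≤max 0 (map g (upTo X))) (∈-map⁺ g (∈-upTo⁺ y<X)))
  where
  g : ℕ → ℕ
  g y = max 0 (map (λ a → F y a) (upTo m))

≤liouvilleError : ∀ {x y m a} → y ℕ.≤ x → a ℕ.< m → ℤ.∣ liouvilleSum y m a ∣ ℕ.≤ liouvilleError x m
≤liouvilleError {x} {y} {m} y≤x a<m = ≤max-max (λ y a → ℤ.∣ liouvilleSum y m a ∣) {suc x} {m} (s≤s y≤x) a<m

liouvilleErr-≥ : ∀ {x y m} c → y ℕ.≤ x → 1 ℕ.≤ m → ∣ ∑ y (λ n → lam n * χ (n ≡? c [mod m ])) ∣ ≤ fromℕ (liouvilleError x m)
liouvilleErr-≥ {x} {y} {m} c y≤x 1≤m = ≤-≡ (trans (cong ∣_∣ (trans (∑-cong y λ n _ _ → cong (lam n *_) (χ-cong (n ≡? c [mod m ]) (n ≡? a [mod m ]) (λ e → mod-trans {n} {c} e (mod-% c m)) (λ e → mod-trans {n} {a} e (mod-sym {c} {a} (mod-% c m))))) (sym (liouvilleSum-ℚ y m a)))) (∣fromℤ∣ (liouvilleSum y m a)))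
  (fromℕ-mono (≤liouvilleError {x} {y} {m} {a} y≤x (ℕ.m%n<n c m))) refl
  where
  instance m≢0 = ℕ.>-nonZero 1≤m
  a = c ℕ.% m

parity-in-class : ∀ N h m c → 1 ℕ.≤ m → ∣ ∑ N (λ i → lam (N ℕ.+ i ℕ.+ h) * χ (N ℕ.+ i ≡? c [mod m ])) ∣ ≤ fromℕ 2 * fromℕ (liouvilleError (N ℕ.+ h ℕ.+ N) m)
parity-in-class N h m c 1≤m = ≤-≡ (cong ∣_∣ (trans (∑-cong N λ i _ _ → cong (lam (N ℕ.+ i ℕ.+ h) *_) (shift-class N h m c i)) (shift-sum N h (λ n → lam n * χ (n ≡? c ℕ.+ h [mod m ])))))
  (∣+∣≤ {A} { - B} {fromℕ (liouvilleError (N ℕ.+ h ℕ.+ N) m)} {fromℕ (liouvilleError (N ℕ.+ h ℕ.+ N) m)} (liouvilleErr-≥ {N ℕ.+ h ℕ.+ N} {N ℕ.+ h ℕ.+ N} {m} (c ℕ.+ h) ℕₚ.≤-refl 1≤m) (≤-≡ (ℚₚ.∣-p∣≡∣p∣ B) (liouvilleErr-≥ {N ℕ.+ h ℕ.+ N} {N ℕ.+ h} {m} (c ℕ.+ h) (ℕₚ.m≤m+n (N ℕ.+ h) N) 1≤m) refl))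
  (solve 1 (λ x → x :+ x := con (fromℕ 2) :* x) refl (fromℕ (liouvilleError (N ℕ.+ h ℕ.+ N) m)))
  where
  A = ∑ (N ℕ.+ h ℕ.+ N) (λ n → lam n * χ (n ≡? c ℕ.+ h [mod m ]))
  B = ∑ (N ℕ.+ h) (λ n → lam n * χ (n ≡? c ℕ.+ h [mod m ]))

sum-primeErr : ∀ ι x Q → ∑ Q (primeErr ι x) ≡ seq (∑ᴿ Q (primeErrorᴿ x)) ι
sum-primeErr ι x Q = sym (∑-at ι Q (primeErrorᴿ x))

sum-liouvilleErr : ∀ x Q → ∑ Q (λ q → fromℕ (liouvilleError x q)) ≡ fromℕ (∑ℕ Q λ q → liouvilleError x q)
sum-liouvilleErr x zero = refl
sum-liouvilleErr x (suc Q) = trans (cong (_+ fromℕ (liouvilleError x (suc Q))) (sum-liouvilleErr x Q)) (sym (fromℕ-+ (∑ℕ Q λ q → liouvilleError x q) (liouvilleError x (suc Q))))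

-- A Chebyshev-Mertens upper bound; unions of conditions.

-- The primes dividing n, up to y, multiply to a divisor P of n, and H p - 1 is superadditive.
prime-divisors-bound : ∀ n → 1 ℕ.≤ n → ∀ y → ∃[ P ] 1 ℕ.≤ P × P ∣ n × (∀ q → Prime q → q ∣ P → q ℕ.≤ y) ×
  ∑ y (λ p → χ (prime? p) * χ (p ∣? n) * (H p - 1ℚ)) ≤ H P - 1ℚ
prime-divisors-bound n 1≤n zero = 1 , ℕₚ.≤-refl , ℕ.1∣ n , (λ q pr q∣1 → ⊥-elim (¬prime[1] (subst Prime (ℕ.∣1⇒≡1 q∣1) pr))) , ℚₚ.≤-reflexive refl
prime-divisors-bound n 1≤n (suc y) = go (prime-divisors-bound n 1≤n y) (prime? (suc y)) (suc y ∣? n)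
  where
  p = suc y
  Claim : ℕ → Set
  Claim y = ∃[ P ] 1 ℕ.≤ P × P ∣ n × (∀ q → Prime q → q ∣ P → q ℕ.≤ y) × ∑ y (λ p → χ (prime? p) * χ (p ∣? n) * (H p - 1ℚ)) ≤ H P - 1ℚ
  skip : Claim y → χ (prime? p) * χ (p ∣? n) ≡ 0ℚ → Claim (suc y)
  skip (P , 1≤P , P∣n , below , le) eq = P , 1≤P , P∣n , (λ q pr q∣ → ℕₚ.m≤n⇒m≤1+n (below q pr q∣)) ,
    ≤-≡ (trans (cong (λ x → ∑ y (λ p → χ (prime? p) * χ (p ∣? n) * (H p - 1ℚ)) + x * (H p - 1ℚ)) eq) (solve 2 (λ s h → s :+ con 0ℚ :* h := s) refl (∑ y (λ p → χ (prime? p) * χ (p ∣? n) * (H p - 1ℚ))) (H p - 1ℚ))) le refl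
  go : Claim y → Dec (Prime p) → Dec (p ∣ n) → Claim (suc y)
  go c (no ¬pr) _ = skip c (trans (cong (_* χ (p ∣? n)) (χ-no (prime? p) ¬pr)) (ℚₚ.*-zeroˡ (χ (p ∣? n))))
  go c (yes _) (no ¬p∣) = skip c (trans (cong (χ (prime? p) *_) (χ-no (p ∣? n) ¬p∣)) (ℚₚ.*-zeroʳ (χ (prime? p))))
  go (P@(suc P-1) , 1≤P , P∣n , below , le) (yes pr) (yes p∣n) = p ℕ.* P , s≤s z≤n , coprime-∣* (Coprimality.sym (prime-∤⇒coprime pr λ p∣P → ℕₚ.<⇒≱ ℕₚ.≤-refl (below p pr p∣P))) p∣n P∣n ,
    (λ q prq q∣ → case euclidsLemma p P prq q∣ of λ { (inj₁ q∣p) → ℕ.∣⇒≤ q∣p ; (inj₂ q∣P) → ℕₚ.m≤n⇒m≤1+n (below q prq q∣P) }) ,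
    ≤-≡ (cong (λ x → ∑ y (λ p → χ (prime? p) * χ (p ∣? n) * (H p - 1ℚ)) + x * (H p - 1ℚ)) (trans (cong₂ _*_ (χ-yes (prime? p) pr) (χ-yes (p ∣? n) p∣n)) refl))
      (by-difference (0≤+ (difference le) (difference (H-*-≥ {p} (s≤s z≤n) P-1))) (solve 4 (λ s P p q → (P :- con 1ℚ :- s) :+ (q :+ con 1ℚ :- (p :+ P)) := q :- con 1ℚ :- (s :+ con 1ℚ :* (p :- con 1ℚ))) refl (∑ y (λ p → χ (prime? p) * χ (p ∣? n) * (H p - 1ℚ))) (H P) (H p) (H (p ℕ.* P)))) refl

3/2≤H : ∀ {p} → 2 ℕ.≤ p → H p ≤ fromℕ 3 * (H p - 1ℚ)
3/2≤H {p} 2≤p = by-difference (0≤* (0≤fromℕ 2) (difference (H-mono {2} 2≤p))) (solve 1 (λ h → con (fromℕ 2) :* (h :- con (H 2)) := con (fromℕ 3) :* (h :- con 1ℚ) :- h) refl (H p))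

prime-divisors-H : ∀ n → 1 ℕ.≤ n → ∀ y → ∑ y (λ p → χ (prime? p) * χ (p ∣? n) * H p) ≤ fromℕ 3 * H n
prime-divisors-H n 1≤n y = let P , 1≤P , P∣n , _ , le = prime-divisors-bound n 1≤n y in
  ℚₚ.≤-trans (∑-mono y pointwise)
    (≤-≡ (trans (∑-cong y λ p _ _ → solve 2 (λ c h → c :* (con (fromℕ 3) :* h) := con (fromℕ 3) :* (c :* h)) refl (χ (prime? p) * χ (p ∣? n)) (H p - 1ℚ)) (∑-* y (fromℕ 3) (λ p → χ (prime? p) * χ (p ∣? n) * (H p - 1ℚ))))
      (*-monoˡ (0≤fromℕ 3) (ℚₚ.≤-trans le (ℚₚ.≤-trans (by-difference 0≤1 (solve 1 (λ h → con 1ℚ := h :- (h :- con 1ℚ)) refl (H P))) (H-mono (ℕ.∣⇒≤ {{ℕ.>-nonZero 1≤n}} P∣n))))) refl)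
  where
  pointwise : ∀ p → 1 ℕ.≤ p → p ℕ.≤ y → χ (prime? p) * χ (p ∣? n) * H p ≤ χ (prime? p) * χ (p ∣? n) * (fromℕ 3 * (H p - 1ℚ))
  pointwise p _ _ = case prime? p of λ
    { (yes pr) → *-monoˡ (0≤* (0≤χ (prime? p)) (0≤χ (p ∣? n))) (3/2≤H (prime⇒2≤ pr))
    ; (no ¬pr) → ℚₚ.≤-reflexive (trans (null ¬pr (H p)) (sym (null ¬pr (fromℕ 3 * (H p - 1ℚ))))) }
    where
    null : ¬ Prime p → ∀ x → χ (prime? p) * χ (p ∣? n) * x ≡ 0ℚ
    null ¬pr x = trans (cong (λ c → c * χ (p ∣? n) * x) (χ-no (prime? p) ¬pr)) (solve 2 (λ a b → con 0ℚ :* a :* b := con 0ℚ) refl (χ (p ∣? n)) x)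

-- (∑ H p / p) (∑ 1/m) is a sum over n = p m ≤ y².
prime-sum : ∀ y → 1 ℕ.≤ y → ∑ y (λ p → χ (prime? p) * (rec p * H p)) ≤ fromℕ 12 * H y
prime-sum y 1≤y = *-cancelˡ {r = H y} (ℚₚ.<-≤-trans 0<1 (1≤H 1≤y)) (≤-≡ (trans (ℚₚ.*-comm (H y) S) (sym (∑-*ʳ y (H y) (λ p → χ (prime? p) * (rec p * H p)))))
  (ℚₚ.≤-trans (∑-mono y per-prime)
  (≤-≡ (∑-swap y (y ℕ.* y) (λ p n → χ (p ∣? n) * (χ (prime? p) * (rec n * H p))))
    (ℚₚ.≤-trans (∑-mono (y ℕ.* y) per-n)
    (≤-≡ (trans (∑-cong (y ℕ.* y) λ n _ _ → ℚₚ.*-comm (rec n) (fromℕ 3 * H (y ℕ.* y))) (∑-* (y ℕ.* y) (fromℕ 3 * H (y ℕ.* y)) rec))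
      (*-mono {fromℕ 3 * H (y ℕ.* y)} {fromℕ 3 * (H y + H y)} {H (y ℕ.* y)} {H y + H y} (0≤* (0≤fromℕ 3) (0≤H (y ℕ.* y))) (0≤+ (0≤H y) (0≤H y)) (*-monoˡ (0≤fromℕ 3) (H-*-≤ y y)) (H-*-≤ y y))
      (solve 1 (λ h → con (fromℕ 3) :* (h :+ h) :* (h :+ h) := h :* (con (fromℕ 12) :* h)) refl (H y)))) refl)) refl)
  where
  S = ∑ y (λ p → χ (prime? p) * (rec p * H p))
  per-prime : ∀ p → 1 ℕ.≤ p → p ℕ.≤ y → χ (prime? p) * (rec p * H p) * H y ≤ ∑ (y ℕ.* y) (λ n → χ (p ∣? n) * (χ (prime? p) * (rec n * H p)))
  per-prime p 1≤p p≤y = ≤-≡ (trans (sym (∑-* y (χ (prime? p) * (rec p * H p)) rec)) (trans (∑-cong y λ m 1≤m _ → trans (solve 4 (λ c r h m → c :* (r :* h) :* m := c :* (r :* m :* h)) refl (χ (prime? p)) (rec p) (H p) (rec m)) (cong (λ x → χ (prime? p) * (x * H p)) (sym (rec-* 1≤p 1≤m))))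
      (sym (∑-multiples′ p (λ n → χ (prime? p) * (rec n * H p)) y 1≤p))))
    (∑-extend (ℕₚ.*-monoˡ-≤ y p≤y) λ n → 0≤* (0≤χ (p ∣? n)) (0≤* (0≤χ (prime? p)) (0≤* (0≤rec n) (0≤H p)))) refl
  per-n : ∀ n → 1 ℕ.≤ n → n ℕ.≤ y ℕ.* y → ∑ y (λ p → χ (p ∣? n) * (χ (prime? p) * (rec n * H p))) ≤ rec n * (fromℕ 3 * H (y ℕ.* y))
  per-n n 1≤n n≤ = ≤-≡ (trans (∑-cong y λ p _ _ → solve 4 (λ a b r h → a :* (b :* (r :* h)) := r :* (b :* a :* h)) refl (χ (p ∣? n)) (χ (prime? p)) (rec n) (H p)) (∑-* y (rec n) (λ p → χ (prime? p) * χ (p ∣? n) * H p)))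
    (*-monoˡ (0≤rec n) (ℚₚ.≤-trans (prime-divisors-H n 1≤n y) (*-monoˡ (0≤fromℕ 3) (H-mono n≤)))) refl

∑ₗ-mono : ∀ {xs} {f g : ℕ → ℚ} → (∀ {x} → x ∈ xs → f x ≤ g x) → ∑ₗ xs f ≤ ∑ₗ xs g
∑ₗ-mono {[]} h = ℚₚ.≤-refl
∑ₗ-mono {x ∷ xs} h = ℚₚ.+-mono-≤ (h (here refl)) (∑ₗ-mono λ x∈ → h (there x∈))

∑-∑ₗ : ∀ N xs (F : ℕ → ℕ → ℚ) → ∑ N (λ i → ∑ₗ xs (F i)) ≡ ∑ₗ xs (λ x → ∑ N (λ i → F i x))
∑-∑ₗ N [] F = ∑-zero N λ _ _ _ → refl
∑-∑ₗ N (x ∷ xs) F = trans (∑-+ N (λ i → F i x) (λ i → ∑ₗ xs (F i))) (cong (∑ N (λ i → F i x) +_) (∑-∑ₗ N xs F))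

∑ₗ-primes-≤ : ∀ D n {f : ℕ → ℚ} → (∀ p → 0ℚ ≤ f p) → ∑ₗ (primes D n) f ≤ ∑ n (λ p → χ (prime? p) * f p)
∑ₗ-primes-≤ D zero 0≤f = ℚₚ.≤-refl
∑ₗ-primes-≤ D (suc n) {f} 0≤f = cases (prime? (suc n)) (D ℕₚ.<? suc n) refl refl
  where
  IH = ∑ₗ-primes-≤ D n 0≤f
  below : ∑ₗ (primes D n) f ≤ ∑ n (λ p → χ (prime? p) * f p) + χ (prime? (suc n)) * f (suc n)
  below = ℚₚ.≤-trans IH (p≤p+q (0≤* (0≤χ (prime? (suc n))) (0≤f (suc n))))
  cases : (d : Dec (Prime (suc n))) (e : Dec (D ℕ.< suc n)) → d ≡ prime? (suc n) → e ≡ (D ℕₚ.<? suc n) → ∑ₗ (primes D (suc n)) f ≤ ∑ n (λ p → χ (prime? p) * f p) + χ (prime? (suc n)) * f (suc n)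
  cases d e eq₁ eq₂ with prime? (suc n) | D ℕₚ.<? suc n
  ... | yes _ | yes _ = ≤-≡ (ℚₚ.+-comm (f (suc n)) (∑ₗ (primes D n) f)) (ℚₚ.+-mono-≤ IH (ℚₚ.≤-reflexive (sym (ℚₚ.*-identityˡ (f (suc n)))))) refl
  ... | yes _ | no _ = ℚₚ.≤-trans IH (p≤p+q (0≤* 0≤1 (0≤f (suc n))))
  ... | no _ | yes _ = ℚₚ.≤-trans IH (p≤p+q (0≤* ℚₚ.≤-refl (0≤f (suc n))))
  ... | no _ | no _ = ℚₚ.≤-trans IH (p≤p+q (0≤* ℚₚ.≤-refl (0≤f (suc n))))

χ-any : ∀ {P : ℕ → Set} (P? : ∀ p → Dec (P p)) xs → χ (any? P? xs) ≤ ∑ₗ xs (λ p → χ (P? p))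
χ-any P? [] = ℚₚ.≤-refl
χ-any P? (x ∷ xs) = case P? x of λ
  { (yes px) → ℚₚ.≤-trans (χ≤1 (any? P? (x ∷ xs))) (≤-≡ (sym (χ-yes (P? x) px)) (p≤p+q (0≤∑ₗ xs)) refl)
  ; (no ¬px) → ℚₚ.≤-trans (χ-mono (any? P? (x ∷ xs)) (any? P? xs) (λ { (here px) → contradiction px ¬px ; (there a) → a })) (ℚₚ.≤-trans (χ-any P? xs) (p≤q+p (0≤χ (P? x)))) }
  where
  0≤∑ₗ : ∀ xs → 0ℚ ≤ ∑ₗ xs (λ p → χ (P? p))
  0≤∑ₗ [] = ℚₚ.≤-refl
  0≤∑ₗ (x ∷ xs) = 0≤+ (0≤χ (P? x)) (0≤∑ₗ xs)

H-suc≤ : ∀ n → H (suc n) ≤ H n + 1ℚ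
H-suc≤ n = ℚₚ.+-monoʳ-≤ (H n) (rec≤1 (suc n))

H-inverse′ : ∀ q → 1ℚ ≤ q → ∃[ n ] 1 ℕ.≤ n × H n ≤ q × q ≤ H n + 1ℚ
H-inverse′ q 1≤q = search (proj₁ (H-unbounded q)) (proj₂ (H-unbounded q))
  where
  search : ∀ m → q ≤ H m → ∃[ n ] 1 ℕ.≤ n × H n ≤ q × q ≤ H n + 1ℚ
  search zero le = contradiction (ℚₚ.≤-trans 1≤q le) (<⇒≱ 0<1)
  search (suc zero) le = 1 , ℕₚ.≤-refl , 1≤q , ℚₚ.≤-trans le (p≤p+q 0≤1)
  search (suc (suc m)) le = [ (λ Hm≤q → suc m , s≤s z≤n , Hm≤q , ℚₚ.≤-trans le (H-suc≤ (suc m))) , search (suc m) ]′ (ℚₚ.≤-total (H (suc m)) q)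

abstract
  H-inverse : ∀ q → 1ℚ ≤ q → ∃[ n ] 1 ℕ.≤ n × H n ≤ q × q ≤ H n + 1ℚ
  H-inverse = H-inverse′

H-sublinear : ∀ K m → 1 ℕ.≤ K → H m ≤ H K + fromℕ m * rec K
H-sublinear K m 1≤K = case ℕₚ.≤-total m K of λ
  { (inj₁ m≤K) → ℚₚ.≤-trans (H-mono m≤K) (p≤p+q (0≤* (0≤fromℕ m) (0≤rec K)))
  ; (inj₂ K≤m) → ≤-≡ (trans (cong H (sym (ℕₚ.m+[n∸m]≡n K≤m))) (∑-split K (m ℕ.∸ K) rec)) (ℚₚ.+-monoʳ-≤ (H K) (ℚₚ.≤-trans (∑-mono (m ℕ.∸ K) λ i _ _ → rec-anti 1≤K (ℕₚ.m≤m+n K i)) (≤-≡ (∑-const (m ℕ.∸ K) (rec K)) (*-monoʳ (0≤rec K) (fromℕ-mono (ℕₚ.m∸n≤m m K))) refl))) refl }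

-- Comparison of growth, and elementary inequalities for the final estimates.

Eventually : (ℕ → Set) → Set
Eventually P = ∃[ N₀ ] (∀ N → N₀ ℕ.≤ N → P N)

both : ∀ {P Q : ℕ → Set} → Eventually P → Eventually Q → Eventually (λ N → P N × Q N)
both (m , p) (n , q) = m ℕ.⊔ n , λ N le → p N (⊔-l m n le) , q N (⊔-r m n le)

H-eventually : ∀ K {c} → 0ℚ < c → Eventually (λ N → K ≤ c * H N)
H-eventually K {c} 0<c = proj₁ found , λ N le → ≤-≡ (sym (trans (solve 3 (λ c k v → c :* (k :* v) := k :* (c :* v)) refl c K (inv₀ c)) (trans (cong (K *_) (inv₀-inverse 0<c)) (ℚₚ.*-identityʳ K))))
  (*-monoˡ (ℚₚ.<⇒≤ 0<c) (ℚₚ.≤-trans (proj₂ found) (H-mono le))) refl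
  where
  found = H-unbounded (K * inv₀ c)

abstract
  ceiling : ∀ q → ∃[ n ] 1 ℕ.≤ n × q ≤ fromℕ n
  ceiling q = suc (proj₁ (archimedean q)) , s≤s z≤n , ℚₚ.≤-trans (proj₂ (archimedean q)) (fromℕ-mono (ℕₚ.n≤1+n (proj₁ (archimedean q))))

rec-small : ∀ {c τ} → 0ℚ < τ → ∃[ K ] 1 ℕ.≤ K × c * rec K ≤ τ
rec-small {c} {τ} 0<τ = let K , 1≤K , le = ceiling (c * inv₀ τ) in K , 1≤K ,
  ≤-≡ refl (*-monoʳ (0≤rec K) (≤-≡ (trans (sym (ℚₚ.*-identityʳ c)) (trans (cong (c *_) (sym (inv₀-inverse 0<τ))) (solve 3 (λ c t v → c :* (t :* v) := t :* (c :* v)) refl c τ (inv₀ τ)))) (*-monoˡ (ℚₚ.<⇒≤ 0<τ) le) refl))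
    (trans (ℚₚ.*-assoc τ (fromℕ K) (rec K)) (trans (cong (τ *_) (n*rec 1≤K)) (ℚₚ.*-identityʳ τ)))

-- log log N is small compared to log N.
polylog : ∀ {τ} → 0ℚ < τ → ∀ C B → Eventually (λ N → ∀ m → H m ≤ (1ℚ - τ) * H N → C * (fromℕ m * H N ^ B) ≤ fromℕ N)
polylog {τ} 0<τ C B = proj₁ large , λ N le m Hm≤ → bound N m Hm≤ (proj₂ large N le)
  where
  0<½τ : 0ℚ < ½ * τ
  0<½τ = 0<* (ℚₚ.positive⁻¹ ½) 0<τ
  -- By `H-sublinear` the harmonic number of (log N)^B is at most B (log N)/K up to constants; K is
  -- chosen so that this uses only half of τ log N.
  Kfound = rec-small {fromℕ B} 0<½τ
  K = proj₁ Kfound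
  1≤K = proj₁ (proj₂ Kfound)
  cfound = ceiling C
  c = proj₁ cfound
  shift = H c + fromℕ B * H K + ½ * τ + fromℕ 2
  large = H-eventually shift 0<½τ
  bound : ∀ N m → H m ≤ (1ℚ - τ) * H N → shift ≤ ½ * τ * H N → C * (fromℕ m * H N ^ B) ≤ fromℕ N
  bound N m Hm≤ big = ℚₚ.≤-trans
    (ℚₚ.≤-trans (*-monoʳ (0≤* (0≤fromℕ m) (0≤^ (0≤H N) B)) (proj₂ (proj₂ cfound))) (*-monoˡ (0≤fromℕ c) (*-monoˡ (0≤fromℕ m) (^-mono (0≤H N) h≤n B))))
    (≤-≡ (trans (cong (λ x → fromℕ c * (fromℕ m * x)) (sym (fromℕ-^ n B))) (trans (cong (fromℕ c *_) (sym (fromℕ-* m (n ℕ.^ B)))) (sym (fromℕ-* c (m ℕ.* n ℕ.^ B)))))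
      (fromℕ-mono {c ℕ.* (m ℕ.* n ℕ.^ B)} {N} (ℕₚ.<⇒≤ (H-cancel-< {c ℕ.* (m ℕ.* n ℕ.^ B)} {N} (ℚₚ.≤-<-trans total (less big))))) refl)
    where
    nfound = floorℚ (H N) (0≤H N)
    n = suc (proj₁ nfound)
    h≤n : H N ≤ fromℕ n
    h≤n = proj₂ (proj₂ nfound)
    n≤h : fromℕ n ≤ H N + 1ℚ
    n≤h = ≤-≡ (trans (fromℕ-suc (proj₁ nfound)) (ℚₚ.+-comm 1ℚ (fromℕ (proj₁ nfound)))) (ℚₚ.+-monoˡ-≤ 1ℚ (proj₁ (proj₂ nfound))) refl
    total : H (c ℕ.* (m ℕ.* n ℕ.^ B)) ≤ H c + ((1ℚ - τ) * H N + (fromℕ B * (H K + (H N + 1ℚ) * rec K) + 1ℚ))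
    total = ℚₚ.≤-trans (H-*-≤ c (m ℕ.* n ℕ.^ B)) (ℚₚ.+-monoʳ-≤ (H c) (ℚₚ.≤-trans (H-*-≤ m (n ℕ.^ B)) (ℚₚ.+-mono-≤ Hm≤
      (ℚₚ.≤-trans (H-power-≤ n B) (ℚₚ.+-monoˡ-≤ 1ℚ (*-monoˡ (0≤fromℕ B) (ℚₚ.≤-trans (H-sublinear K n 1≤K) (ℚₚ.+-monoʳ-≤ (H K) (*-monoʳ (0≤rec K) n≤h)))))))))
    less : shift ≤ ½ * τ * H N → H c + ((1ℚ - τ) * H N + (fromℕ B * (H K + (H N + 1ℚ) * rec K) + 1ℚ)) < H N
    less big = ℚₚ.<-≤-trans (ℚₚ.≤-<-trans (ℚₚ.+-monoʳ-≤ (H c) (ℚₚ.+-monoʳ-≤ ((1ℚ - τ) * H N) (ℚₚ.+-monoˡ-≤ 1ℚ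
        (≤-≡ (solve 4 (λ b k x r → b :* (k :+ x :* r) := b :* k :+ x :* (b :* r)) refl (fromℕ B) (H K) (H N + 1ℚ) (rec K)) (ℚₚ.+-monoʳ-≤ (fromℕ B * H K) (*-monoˡ (0≤+ (0≤H N) 0≤1) (proj₂ (proj₂ Kfound)))) refl))))
      (subst (_< H N) (solve 5 (λ s c bk t h → h :- (con ½ :* t :* h :- (c :+ bk :+ con ½ :* t :+ con (fromℕ 2))) :- con 1ℚ := c :+ ((con 1ℚ :- t) :* h :+ (bk :+ (h :+ con 1ℚ) :* (con ½ :* t) :+ con 1ℚ))) refl 0ℚ (H c) (fromℕ B * H K) τ (H N))
        (ℚₚ.<-≤-trans (ℚₚ.+-monoʳ-< (H N - (½ * τ * H N - shift)) {x = - 1ℚ} (ℚₚ.negative⁻¹ (- 1ℚ)))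
          (≤-≡ (ℚₚ.+-identityʳ (H N - (½ * τ * H N - shift))) (by-difference (difference big) (solve 2 (λ h x → x := h :- (h :- x)) refl (H N) (½ * τ * H N - shift))) refl)))) ℚₚ.≤-refl

bernoulli-upper : ∀ {ε} → 0ℚ ≤ ε → ∀ n → fromℕ 2 * (fromℕ n * ε) ≤ 1ℚ → (1ℚ + ε) ^ n ≤ 1ℚ + fromℕ 2 * (fromℕ n * ε)
bernoulli-upper {ε} 0≤ε zero le = ℚₚ.≤-reflexive (solve 1 (λ e → con 1ℚ := con 1ℚ :+ con (fromℕ 2) :* (con 0ℚ :* e)) refl ε)
bernoulli-upper {ε} 0≤ε (suc n) le = ℚₚ.≤-trans (*-monoˡ (0≤+ 0≤1 0≤ε) (bernoulli-upper 0≤ε n le′))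
  (by-difference (0≤* 0≤ε (difference le′)) (trans (solve 2 (λ e n → e :* (con 1ℚ :- con (fromℕ 2) :* (n :* e)) := con 1ℚ :+ con (fromℕ 2) :* ((con 1ℚ :+ n) :* e) :- (con 1ℚ :+ e) :* (con 1ℚ :+ con (fromℕ 2) :* (n :* e))) refl ε (fromℕ n))
    (cong (λ x → 1ℚ + fromℕ 2 * (x * ε) - (1ℚ + ε) * (1ℚ + fromℕ 2 * (fromℕ n * ε))) (sym (fromℕ-suc n)))))
  where
  le′ : fromℕ 2 * (fromℕ n * ε) ≤ 1ℚ
  le′ = ℚₚ.≤-trans (*-monoˡ (0≤fromℕ 2) (*-monoʳ 0≤ε (fromℕ-mono (ℕₚ.n≤1+n n)))) le

bernoulli-lower : ∀ {ε} → 0ℚ ≤ ε → ε ≤ 1ℚ → ∀ n → 1ℚ - fromℕ n * ε ≤ (1ℚ - ε) ^ n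
bernoulli-lower {ε} 0≤ε ε≤1 zero = ℚₚ.≤-reflexive (solve 1 (λ e → con 1ℚ :- con 0ℚ :* e := con 1ℚ) refl ε)
bernoulli-lower {ε} 0≤ε ε≤1 (suc n) = ℚₚ.≤-trans
  (by-difference (0≤* (0≤fromℕ n) (0≤* 0≤ε 0≤ε)) (trans (solve 2 (λ e n → n :* (e :* e) := (con 1ℚ :- e) :* (con 1ℚ :- n :* e) :- (con 1ℚ :- (con 1ℚ :+ n) :* e)) refl ε (fromℕ n))
    (cong (λ x → (1ℚ - ε) * (1ℚ - fromℕ n * ε) - (1ℚ - x * ε)) (sym (fromℕ-suc n)))))
  (*-monoˡ (difference ε≤1) (bernoulli-lower 0≤ε ε≤1 n))

∑-witness : ∀ N {f g : ℕ → ℚ} → ∑ N g < ∑ N f → ∃[ i ] 1 ℕ.≤ i × i ℕ.≤ N × g i < f i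
∑-witness zero lt = contradiction lt (ℚₚ.<-irrefl refl)
∑-witness (suc N) {f} {g} lt = [ (λ f≤g → let i , 1≤i , i≤N , gi<fi = ∑-witness N {f} {g} (ℚₚ.≰⇒> λ F≤G → <⇒≱ lt (ℚₚ.+-mono-≤ F≤G f≤g)) in i , 1≤i , ℕₚ.m≤n⇒m≤1+n i≤N , gi<fi)
  , (λ g<f → suc N , s≤s z≤n , ℕₚ.≤-refl , g<f) ]′ (≤⊎> (f (suc N)) (g (suc N)))

inv₀-^-cancel : ∀ {h} → 0ℚ < h → ∀ p q → h ^ p * inv₀ (h ^ (p ℕ.+ q)) ≡ inv₀ (h ^ q)
inv₀-^-cancel {h} 0<h p q = trans (cong (λ x → h ^ p * inv₀ x) (^-+ h p q)) (trans (cong (h ^ p *_) (inv₀-* (0<^ 0<h p) (0<^ 0<h q)))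
  (trans (sym (ℚₚ.*-assoc (h ^ p) (inv₀ (h ^ p)) (inv₀ (h ^ q)))) (trans (cong (_* inv₀ (h ^ q)) (inv₀-inverse (0<^ 0<h p))) (ℚₚ.*-identityˡ (inv₀ (h ^ q))))))

-- With T = h^B the two sides of the trade balance.
trade-balance : ∀ {h n Z S J zc c₁ c₂} p q → 1ℚ ≤ h → 0ℚ ≤ Z → 0ℚ ≤ zc → 0ℚ ≤ n → 0ℚ ≤ c₁ → 0ℚ ≤ c₂ →
  Z ≤ zc * h ^ p → let B = p ℕ.+ p ℕ.+ (q ℕ.+ 1) in
  S ≤ c₁ * (n * inv₀ (h ^ (p ℕ.+ p ℕ.+ (B ℕ.+ 1)))) → J ≤ c₂ * (n * h ^ q) →
  Z * Z * (h ^ B * S + inv₀ (h ^ B) * J) ≤ zc * zc * (c₁ + c₂) * (n * inv₀ h)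
trade-balance {h} {n} {Z} {S} {J} {zc} {c₁} {c₂} p q 1≤h 0≤Z 0≤zc 0≤n 0≤c₁ 0≤c₂ Z≤ S≤ J≤ = ℚₚ.≤-trans
  (ℚₚ.≤-trans (*-monoˡ (0≤* 0≤Z 0≤Z) inner) (*-monoʳ 0≤I (≤-≡ refl (*-mono 0≤Z (0≤* 0≤zc (0≤^ 0≤h p)) Z≤ Z≤) refl)))
  (ℚₚ.≤-reflexive (trans (solve 6 (λ z x c d n i → (z :* x) :* (z :* x) :* ((c :+ d) :* (n :* i)) := z :* z :* (c :+ d) :* (n :* (x :* x :* i))) refl zc (h ^ p) c₁ c₂ n (inv₀ (h ^ (p ℕ.+ p ℕ.+ 1))))
    (cong (λ x → zc * zc * (c₁ + c₂) * (n * x)) (trans (cong (_* inv₀ (h ^ (p ℕ.+ p ℕ.+ 1))) (sym (^-+ h p p))) (trans (inv₀-^-cancel 0<h (p ℕ.+ p) 1) (cong inv₀ (ℚₚ.*-identityʳ h)))))))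
  where
  -- Both terms are to end at n/h after multiplication by Z², that is by h^(2p). The second one
  -- fixes B = 2p + q + 1, and the first one then asks for the saving h^(2p + B + 1).
  B = p ℕ.+ p ℕ.+ (q ℕ.+ 1)
  0<h = ℚₚ.<-≤-trans 0<1 1≤h
  0≤h = ℚₚ.<⇒≤ 0<h
  I = inv₀ (h ^ (p ℕ.+ p ℕ.+ 1))
  0≤I : 0ℚ ≤ (c₁ + c₂) * (n * I)
  0≤I = 0≤* (0≤+ 0≤c₁ 0≤c₂) (0≤* 0≤n (ℚₚ.<⇒≤ (0<inv₀ (0<^ 0<h (p ℕ.+ p ℕ.+ 1)))))
  inner : h ^ B * S + inv₀ (h ^ B) * J ≤ (c₁ + c₂) * (n * I)
  inner = ≤-≡ refl (ℚₚ.+-mono-≤ (*-monoˡ (0≤^ 0≤h B) S≤) (*-monoˡ (ℚₚ.<⇒≤ (0<inv₀ (0<^ 0<h B))) J≤))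
    (trans (cong₂ _+_
      (trans (solve 4 (λ b c n i → b :* (c :* (n :* i)) := c :* (n :* (b :* i))) refl (h ^ B) c₁ n (inv₀ (h ^ (p ℕ.+ p ℕ.+ (B ℕ.+ 1)))))
        (cong (λ x → c₁ * (n * x)) (trans (cong (λ e → h ^ B * inv₀ (h ^ e)) (solveℕ 2 (λ p b → p :+ᴺ p :+ᴺ (b :+ᴺ conᴺ 1) :=ᴺ b :+ᴺ (p :+ᴺ p :+ᴺ conᴺ 1)) refl p B)) (inv₀-^-cancel 0<h B (p ℕ.+ p ℕ.+ 1)))))
      (trans (solve 4 (λ b c n i → b :* (c :* (n :* i)) := c :* (n :* (i :* b))) refl (inv₀ (h ^ B)) c₂ n (h ^ q))
        (cong (λ x → c₂ * (n * x)) (trans (cong (λ e → h ^ q * inv₀ (h ^ e)) (solveℕ 2 (λ p q → p :+ᴺ p :+ᴺ (q :+ᴺ conᴺ 1) :=ᴺ q :+ᴺ (p :+ᴺ p :+ᴺ conᴺ 1)) refl p q)) (inv₀-^-cancel 0<h q (p ℕ.+ p ℕ.+ 1))))))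
      (solve 4 (λ c d n i → c :* (n :* i) :+ d :* (n :* i) := (c :+ d) :* (n :* i)) refl c₁ c₂ n I))

^-exponent-mono : ∀ {h} → 1ℚ ≤ h → ∀ {m n} → m ℕ.≤ n → h ^ m ≤ h ^ n
^-exponent-mono 1≤h {n = n} z≤n = 1≤^ 1≤h n
^-exponent-mono 1≤h (s≤s m≤n) = *-monoˡ (ℚₚ.≤-trans 0≤1 1≤h) (^-exponent-mono 1≤h m≤n)

lowerShift-≤ : ∀ {W R ps} (range : SieveRange W R ps) k large m j → lowerShift range k large m j ≤ fromℕ (j ℕ.* (j ℕ.+ m)) * H W
lowerShift-≤ {W} range k large m zero = ℚₚ.≤-reflexive (sym (ℚₚ.*-zeroˡ (H W)))
lowerShift-≤ {W} range k large m (suc j) = ℚₚ.≤-trans (ℚₚ.+-monoˡ-≤ (fromℕ (suc (j ℕ.+ m)) * H W) (lowerShift-≤ range k large m j))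
  (≤-≡ (trans (sym (ℚₚ.*-distribʳ-+ (H W) (fromℕ (j ℕ.* (j ℕ.+ m))) (fromℕ (suc (j ℕ.+ m))))) (cong (_* H W) (sym (fromℕ-+ (j ℕ.* (j ℕ.+ m)) (suc (j ℕ.+ m))))))
    (*-monoʳ (0≤H W) (fromℕ-mono (ℕₚ.≤-trans (ℕₚ.+-monoˡ-≤ (suc (j ℕ.+ m)) (ℕₚ.*-monoʳ-≤ j (ℕₚ.n≤1+n (j ℕ.+ m)))) (ℕₚ.≤-reflexive (ℕₚ.+-comm (j ℕ.* suc (j ℕ.+ m)) (suc (j ℕ.+ m))))))) refl)

fall≤1 : ∀ m j → fall m j ≤ 1ℚ
fall≤1 m zero = ℚₚ.≤-refl
fall≤1 m (suc j) = *-mono {rec (suc (j ℕ.+ m))} {1ℚ} {fall m j} {1ℚ} (0≤rec (suc (j ℕ.+ m))) 0≤1 (rec≤1 (suc (j ℕ.+ m))) (fall≤1 m j)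

integerConst primeConst : ℕ → ℚ → ℚ
integerConst k a = fall 0 k + fromℕ 2 * a * fall 1 k + a * a * fall 2 k
primeConst j a = fall 2 j + a * fall 3 j + ½ * ½ * (a * a) * fall 4 j

-- Per unit, the weighted counts on the two sides of the comparison in the sieve argument.
cost : ℕ → (a η : ℚ) → ℚ
cost j a η = ½ * (integerConst (suc j) a * (1ℚ + η) + η * integerConst (suc j) a + η * integerConst (suc j) a) + fromℕ j * (η * integerConst (suc j) a)

gain : ℕ → (θ₀ a η : ℚ) → ℚ
gain j θ₀ a η = fromℕ j * (½ * θ₀ * (1ℚ - η) * primeConst j a - η * integerConst (suc j) a)

0≤primeConst : ∀ j {a} → 0ℚ ≤ a → 0ℚ ≤ primeConst j a
0≤primeConst j {a} 0≤a = 0≤+ (0≤+ (0≤fall 2 j) (0≤* 0≤a (0≤fall 3 j))) (0≤* (0≤* (ℚₚ.nonNegative⁻¹ (½ * ½)) (0≤* 0≤a 0≤a)) (0≤fall 4 j))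

0≤integerConst : ∀ k {a} → 0ℚ ≤ a → 0ℚ ≤ integerConst k a
0≤integerConst k {a} 0≤a = 0≤+ (0≤+ (0≤fall 0 k) (0≤* (0≤* (0≤fromℕ 2) 0≤a) (0≤fall 1 k))) (0≤* (0≤* 0≤a 0≤a) (0≤fall 2 k))

primes-≤ : ∀ D n → All (ℕ._≤ n) (primes D n)
primes-≤ D zero = []
primes-≤ D (suc n) with prime? (suc n) | D ℕₚ.<? suc n
... | yes _ | yes _ = ℕₚ.≤-refl ∷ All.map ℕₚ.m≤n⇒m≤1+n (primes-≤ D n)
... | yes _ | no _ = All.map ℕₚ.m≤n⇒m≤1+n (primes-≤ D n)
... | no _ | yes _ = All.map ℕₚ.m≤n⇒m≤1+n (primes-≤ D n)
... | no _ | no _ = All.map ℕₚ.m≤n⇒m≤1+n (primes-≤ D n)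

-- The two sides of the sieve inequality.

module Comparison (h₀ : ℕ) (hs₁ : List ℕ) (D ν N R : ℕ) (ε η a : ℚ)
  (1≤j : 1 ℕ.≤ length hs₁) (2k≤D : suc (length hs₁) ℕ.+ suc (length hs₁) ℕ.≤ D) (sep : Separated D (h₀ ∷ hs₁))
  (1≤R : 1 ℕ.≤ R) (D≤R : D ℕ.≤ R) (size : D ! ℕ.* (R ℕ.* R) ℕ.≤ N)
  (0<ε : 0ℚ < ε) (ε≤1 : ε ≤ 1ℚ) (0≤a : 0ℚ ≤ a) (η≤1 : η ≤ 1ℚ)
  (up : (1ℚ + ε) ^ (suc (length hs₁) ℕ.+ suc (length hs₁) ℕ.+ 2) ≤ 1ℚ + η)
  (small-D : fromℕ (2 ℕ.* suc (length hs₁)) * rec D ≤ ½ * ε)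
  (shift-up : fromℕ (suc (length hs₁)) * upperShift (D !) ≤ ε * H R)
  (shift-low : 1ℚ + (fromℕ 2 * H (D !) + fromℕ (length hs₁ ℕ.* (length hs₁ ℕ.+ 4)) * H (D !)) ≤ ½ * ε * H R) where

  hs : List ℕ
  hs = h₀ ∷ hs₁
  j : ℕ
  j = length hs₁
  0<½ε : 0ℚ < ½ * ε
  0<½ε = 0<* (ℚₚ.positive⁻¹ ½) 0<ε
  0≤ε = ℚₚ.<⇒≤ 0<ε
  -- The slope 2/ε of the ramp at u = 1: the weight has its intended shape once t ≥ ½ ε `H R`, so
  -- making it Lipschitz costs only ε in the main terms.
  d : ℚ
  d = inv₀ (½ * ε)
  0<d : 0ℚ < d
  0<d = 0<inv₀ 0<½ε

  open Setup hs D ν N R d a (s≤s 1≤j) 2k≤D sep 1≤R 0<d 0≤a size public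

  -- `unit` is the common scale of all main terms. The sum over primes carries one more `H R`, which
  -- is to be weighed against the logarithm of the prime.
  α β κ X unit : ℚ
  α = integerConst k a
  β = primeConst j a
  κ = density W
  X = fromℕ N * rec W
  unit = X * κ ^ k * (H R ^ k * H R ^ 2)

  private
    L = H R
    0≤L = 0≤H R
    1≤W = ℕₚ.1≤n! D
    0≤κ = ℚₚ.<⇒≤ (0<density {W} 1≤W)
    Π = ∏₁ (excess k) ps
    Y = L + fromℕ k * upperShift W
    1+ε = 1ℚ + ε
    0≤1+ε = 0≤+ 0≤1 0≤ε
    0≤up = 0≤upperShift range
    0≤Y = 0≤+ 0≤L (0≤* (0≤fromℕ k) 0≤up)
    0≤X : 0ℚ ≤ X
    0≤X = 0≤* (0≤fromℕ N) (0≤rec W)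
    0≤Π : 0ℚ ≤ Π
    0≤Π = ℚₚ.≤-trans 0≤1 (1≤∏₁ (All.map (λ {p} k<p → difference (rec-anti {p ℕ.∸ k} {p} (ℕₚ.m<n⇒0<n∸m k<p) (ℕₚ.m∸n≤m p k))) large))

  0≤unit : 0ℚ ≤ unit
  0≤unit = 0≤* (0≤* 0≤X (0≤^ 0≤κ k)) (0≤* (0≤^ 0≤L k) (0≤^ 0≤L 2))

  private
    -- Π (1 - ε/2) ≤ 1 ≤ (1 + ε) (1 - ε/2)
    Π≤ : Π ≤ 1+ε
    Π≤ = *-cancelˡ {r = 1ℚ - ½ * ε} pos (ℚₚ.≤-trans (≤-≡ (ℚₚ.*-comm (1ℚ - ½ * ε) Π) (*-monoˡ 0≤Π (ℚₚ.+-monoʳ-≤ 1ℚ (ℚₚ.neg-antimono-≤ tail≤))) refl)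
      (ℚₚ.≤-trans product≤ (by-difference (0≤* (0≤* (ℚₚ.nonNegative⁻¹ ½) 0≤ε) (difference ε≤1)) (solve 1 (λ e → con ½ :* e :* (con 1ℚ :- e) := (con 1ℚ :- con ½ :* e) :* (con 1ℚ :+ e) :- con 1ℚ) refl ε))))
      where
      c = fromℕ (2 ℕ.* k)
      product≤ : Π * (1ℚ - c * (rec D - rec R)) ≤ 1ℚ
      product≤ = ∏₁-primes {D} {excess k} {c} (ℕₚ.≤-trans (s≤s z≤n) 2k≤D) (0≤fromℕ (2 ℕ.* k))
        (λ p D<p → difference (rec-anti {p ℕ.∸ k} {p} (ℕₚ.m<n⇒0<n∸m (D<⇒k< D<p)) (ℕₚ.m∸n≤m p k))) (λ p D<p → LocalFactors.excess≤ 1≤k (D<⇒k< D<p) (D<⇒2k≤ D<p)) R D≤R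
      tail≤ : c * (rec D - rec R) ≤ ½ * ε
      tail≤ = ℚₚ.≤-trans (*-monoˡ (0≤fromℕ (2 ℕ.* k)) (by-difference {q = rec D} (0≤rec R) (solve 2 (λ d r → r := d :- (d :- r)) refl (rec D) (rec R)))) small-D
      pos : 0ℚ < 1ℚ - ½ * ε
      pos = ℚₚ.<-≤-trans (ℚₚ.positive⁻¹ ½) (by-difference (0≤* (ℚₚ.nonNegative⁻¹ ½) (difference ε≤1)) (solve 1 (λ e → con ½ :* (con 1ℚ :- e) := con 1ℚ :- con ½ :* e :- con ½) refl ε))

    Πκ≤ : (Π * κ) ^ k ≤ 1+ε ^ k * κ ^ k
    Πκ≤ = ≤-≡ refl (^-mono (0≤* 0≤Π 0≤κ) (*-monoʳ 0≤κ Π≤) k) (*-^ 1+ε κ k)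

    Y≤ : ∀ m → Y ^ m ≤ 1+ε ^ m * L ^ m
    Y≤ m = ≤-≡ refl (^-mono 0≤Y (≤-≡ refl (ℚₚ.+-monoʳ-≤ L shift-up) (solve 2 (λ l e → l :+ e :* l := (con 1ℚ :+ e) :* l) refl L ε)) m) (*-^ 1+ε L m)

  integers-≤ : ∑ N (λ i → w₁ i * A i) ≤ unit * (α * (1ℚ + η)) + Z * Z * (fromℕ 2 * fromℕ M * H M ^ (6 ℕ.* k))
  integers-≤ = ℚₚ.≤-trans (by-difference (difference (∣∣≤⇒ sum-integers)) (solve 3 (λ s x e → e :- (s :- x) := x :+ e :- s) refl (∑ N (λ i → w₁ i * A i)) (X * Op z ps (λ n → y n * y n) 1) (Z * Z * (fromℕ 2 * fromℕ M * H M ^ (6 ℕ.* k)))))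
    (ℚₚ.+-monoˡ-≤ (Z * Z * (fromℕ 2 * fromℕ M * H M ^ (6 ℕ.* k))) (ℚₚ.≤-trans (*-monoˡ 0≤X (main-upper range k large d a 0<d 0≤a))
      (ℚₚ.≤-trans (*-monoˡ 0≤X (*-monoʳ (0≤integerConst k 0≤a) scaled))
        (≤-≡ (trans (solve 8 (λ x p q kk l l₂ q₂ c → x :* (p :* kk :* (q :* l :* (q₂ :* l₂)) :* c) := x :* kk :* (l :* l₂) :* (c :* (p :* q :* q₂))) refl X (1+ε ^ k) (1+ε ^ k) (κ ^ k) (L ^ k) (L ^ 2) (1+ε ^ 2) α)
            (cong (λ t → unit * (α * t)) (trans (cong (_* 1+ε ^ 2) (sym (^-+ 1+ε k k))) (sym (^-+ 1+ε (k ℕ.+ k) 2)))))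
          (*-monoˡ 0≤unit (*-monoˡ (0≤integerConst k 0≤a) up)) refl))))
    where
    scaled : (Π * κ) ^ k * (Y ^ k * Y ^ 2) ≤ 1+ε ^ k * κ ^ k * (1+ε ^ k * L ^ k * (1+ε ^ 2 * L ^ 2))
    scaled = *-mono (0≤^ (0≤* 0≤Π 0≤κ) k) (0≤* (0≤* (0≤^ 0≤1+ε k) (0≤^ 0≤L k)) (0≤* (0≤^ 0≤1+ε 2) (0≤^ 0≤L 2))) Πκ≤
      (*-mono (0≤^ 0≤Y k) (0≤* (0≤^ 0≤1+ε 2) (0≤^ 0≤L 2)) (Y≤ k) (Y≤ 2))

  private
    1≤L = 1≤H 1≤R
    0<c : 0ℚ < ½ * ε * L
    0<c = 0<* 0<½ε (ℚₚ.<-≤-trans 0<1 1≤L)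
    dc≡L : d * (½ * ε * L) ≡ L
    dc≡L = trans (solve 3 (λ v e l → v :* (e :* l) := e :* v :* l) refl d (½ * ε) L) (trans (cong (_* L) (inv₀-inverse 0<½ε)) (ℚₚ.*-identityˡ L))
    shift = ½ * ε * L + fromℕ 2 * H W + lowerShift range k large 4 j
    X̂ = t R 1 - shift
    X̂≥ : (1ℚ - ε) * L ≤ X̂
    X̂≥ = by-difference (0≤+ (0≤+ (difference shift-low) (difference (lowerShift-≤ range k large 4 j))) (difference (H-mono {1 ℕ.⊓ R} {1} (ℕₚ.m⊓n≤m 1 R))))
      (solve 6 (λ e l w s b h → (con ½ :* e :* l :- (con 1ℚ :+ (con (fromℕ 2) :* w :+ b))) :+ (b :- s) :+ (con (H 1) :- h) := (l :- h) :- (con ½ :* e :* l :+ con (fromℕ 2) :* w :+ s) :- (con 1ℚ :- e) :* l)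
        refl ε L (H W) (lowerShift range k large 4 j) (fromℕ (j ℕ.* (j ℕ.+ 4)) * H W) (H (1 ℕ.⊓ R)))
    0≤1-ε = difference ε≤1
    0≤X̂ : 0ℚ ≤ X̂
    0≤X̂ = ℚₚ.≤-trans (0≤* 0≤1-ε 0≤L) X̂≥
    X̂^≥ : ∀ m → (1ℚ - ε) ^ m * L ^ m ≤ X̂ ^ m
    X̂^≥ m = ≤-≡ (sym (*-^ (1ℚ - ε) L m)) (^-mono (0≤* 0≤1-ε 0≤L) X̂≥ m) refl
    count≡ : fromℕ N * inv₀ (coprimeCount W) ≡ X * inv₀ κ
    count≡ = sym (trans (solve 3 (λ n r i → n :* r :* i := n :* (i :* r)) refl (fromℕ N) (rec W) (inv₀ κ)) (cong (fromℕ N *_)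
      (inv₀-unique (ℚₚ.<-≤-trans 0<1 (0<coprimeCount 1≤W)) (trans (solve 3 (λ c i r → c :* (i :* r) := c :* r :* i) refl (coprimeCount W) (inv₀ κ) (rec W)) (inv₀-inverse (0<density {W} 1≤W))))))

  ζ : ℕ → ℚ
  ζ p = fromℕ j * rec (p ℕ.∸ suc j)

  primes-≥ : unit * (H R * ((1ℚ - ε) ^ (j ℕ.+ 4) * β)) ≤ fromℕ N * inv₀ (coprimeCount W) * Op ζ ps (λ n → Op recφ ps y n * Op recφ ps y n) 1
  primes-≥ = ≤-≡
    (trans (cong (λ t → X * κ ^ k * (L ^ k * L ^ 2) * (L * (t * β))) (^-+ (1ℚ - ε) j 4))
      (trans (solve 7 (λ x kk lj l e₁ e₄ b → x :* kk :* (l :* lj :* (l :* (l :* con 1ℚ))) :* (l :* (e₁ :* e₄ :* b)) := x :* (kk :* (e₁ :* lj :* (e₄ :* (l :* (l :* (l :* (l :* con 1ℚ)))))) :* b)) refl X (κ ^ k) (L ^ j) L ((1ℚ - ε) ^ j) ((1ℚ - ε) ^ 4) β)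
        refl))
    (*-monoˡ 0≤X (*-monoʳ (0≤primeConst j 0≤a) (*-monoˡ (0≤^ 0≤κ k) (*-mono (0≤* (0≤^ 0≤1-ε j) (0≤^ 0≤L j)) (0≤^ 0≤X̂ 4) (X̂^≥ j) (X̂^≥ 4)))))
    (trans (sym (trans (cong (_* P) (count≡)) (trans (solve 6 (λ x i kk kj p b → x :* i :* (kk :* kk :* kj :* p :* b) := kk :* i :* (x :* (kk :* kj :* p :* b))) refl X (inv₀ κ) κ (κ ^ j) (X̂ ^ j * X̂ ^ 4) β)
      (trans (cong (_* (X * (κ ^ k * (X̂ ^ j * X̂ ^ 4) * β))) (inv₀-inverse (0<density {W} 1≤W))) (ℚₚ.*-identityˡ _))))) refl)
    ⟫ *-monoˡ (0≤* (0≤fromℕ N) (ℚₚ.<⇒≤ (0<inv₀ (ℚₚ.<-≤-trans 0<1 (0<coprimeCount 1≤W)))))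
        (main-lower range k large d a 0<d 0≤a j ℕₚ.≤-refl {½ * ε * L} 0<c dc≡L 0≤X̂)
    where
    P = κ * κ * κ ^ j * (X̂ ^ j * X̂ ^ 4) * β
    infixr 5 _⟫_
    _⟫_ : ∀ {p q r} → p ≤ q → q ≤ r → p ≤ r
    _⟫_ = ℚₚ.≤-trans

  bad : ℕ → ℕ → ℚ
  bad y₀ i = χ (any? (λ p → divides? hs p (N ℕ.+ i)) (primes D y₀))

  -- Union bound. The main terms add up (H p)²/p, at most 12 (`H y₀`)² by `prime-sum`, hence a
  -- fraction c₀² of the scale; 24 is 12 times the 2 of `O≤`. The errors are just multiplied by
  -- `y₀`.
  bad-≤ : ∀ {y₀ c₀} → 1 ℕ.≤ y₀ → y₀ ℕ.≤ R → H y₀ ≤ c₀ * H R →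
    ∑ N (λ i → cl i * bad y₀ i * A i) ≤ unit * (fromℕ 24 * fromℕ k * ((d + a) * (d + a)) * (c₀ * c₀)) + fromℕ y₀ * (Z * Z * (fromℕ 2 * fromℕ k * fromℕ M * H M ^ (6 ℕ.* k)))
  bad-≤ {y₀} {c₀} 1≤y₀ y₀≤R Hy≤ = ℚₚ.≤-trans (∑-mono N union) (≤-≡ (∑-∑ₗ N (primes D y₀) (λ i p → cl i * b₀ p i * A i))
    (ℚₚ.≤-trans (∑ₗ-mono {primes D y₀} each) (ℚₚ.≤-trans (∑ₗ-primes-≤ D y₀ {f} 0≤f) (ℚₚ.≤-trans (∑-mono y₀ pointwise)
      (≤-≡ (trans (∑-+ y₀ (λ p → Q * (χ (prime? p) * (rec p * H p))) (λ _ → err)) (cong₂ _+_ (∑-* y₀ Q (λ p → χ (prime? p) * (rec p * H p))) (∑-const y₀ err)))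
        (ℚₚ.+-monoˡ-≤ (fromℕ y₀ * err) (ℚₚ.≤-trans (*-monoˡ 0≤Q (prime-sum y₀ 1≤y₀)) final)) refl)))) refl)
    where
    err = Z * Z * (fromℕ 2 * fromℕ k * fromℕ M * H M ^ (6 ℕ.* k))
    0≤err : 0ℚ ≤ err
    0≤err = 0≤* (0≤* 0≤Z 0≤Z) (0≤* (0≤* (0≤* (0≤fromℕ 2) (0≤fromℕ k)) (0≤fromℕ M)) (0≤^ (0≤H M) (6 ℕ.* k)))
    O = Op z ps (λ n → χ (n ℕₚ.≤? R)) 1
    0≤O : 0ℚ ≤ O
    0≤O = Op-0≤ (ExpansionError.small⇒weight z small) (λ n → 0≤χ (n ℕₚ.≤? R)) 1
    b = d + a
    f : ℕ → ℚ
    f p = fromℕ k * rec p * X * (b * H p * (b * H p) * O) + err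
    0≤f : ∀ p → 0ℚ ≤ f p
    0≤f p = 0≤+ (0≤* (0≤* (0≤* (0≤fromℕ k) (0≤rec p)) 0≤X) (0≤* (0≤p² (b * H p)) 0≤O)) 0≤err
    Q₀ = fromℕ k * X * (b * b) * O
    0≤Q₀ : 0ℚ ≤ Q₀
    0≤Q₀ = 0≤* (0≤* (0≤* (0≤fromℕ k) 0≤X) (0≤p² b)) 0≤O
    Q = Q₀ * H y₀
    0≤Q : 0ℚ ≤ Q
    0≤Q = 0≤* 0≤Q₀ (0≤H y₀)
    union : ∀ i → 1 ℕ.≤ i → i ℕ.≤ N → cl i * bad y₀ i * A i ≤ ∑ₗ (primes D y₀) (λ p → cl i * b₀ p i * A i)
    union i _ _ = ≤-≡ (solve 3 (λ c b a → c :* b :* a := c :* a :* b) refl (cl i) (bad y₀ i) (A i)) (*-monoˡ (0≤* (0≤χ (N ℕ.+ i ≡? ν [mod W ])) (0≤A i)) (χ-any (λ p → divides? hs p (N ℕ.+ i)) (primes D y₀)))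
      (trans (sym (∑ₗ-* (primes D y₀) (cl i * A i) (λ p → b₀ p i))) (∑ₗ-cong (primes D y₀) λ p → solve 3 (λ c b a → c :* a :* b := c :* b :* a) refl (cl i) (b₀ p i) (A i)))
    each : ∀ {p} → p ∈ primes D y₀ → ∑ N (λ i → cl i * b₀ p i * A i) ≤ f p
    each {p} p∈ = sum-divisible (∈-primes D R (All.lookup (primes-prime D y₀) p∈) (All.lookup (primes-large D y₀) p∈) (ℕₚ.≤-trans (All.lookup (primes-≤ D y₀) p∈) y₀≤R))
    pointwise : ∀ p → 1 ℕ.≤ p → p ℕ.≤ y₀ → χ (prime? p) * f p ≤ Q * (χ (prime? p) * (rec p * H p)) + err
    pointwise p _ p≤y₀ = ≤-≡ (solve 8 (λ c k r x b h o e → c :* (k :* r :* x :* (b :* h :* (b :* h) :* o) :+ e) := k :* x :* (b :* b) :* o :* h :* (c :* (r :* h)) :+ c :* e) refl (χ (prime? p)) (fromℕ k) (rec p) X b (H p) O err)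
      (ℚₚ.+-mono-≤ (*-monoʳ (0≤* (0≤χ (prime? p)) (0≤* (0≤rec p) (0≤H p))) (*-monoˡ 0≤Q₀ (H-mono p≤y₀)))
        (≤-≡ refl (*-monoʳ 0≤err (χ≤1 (prime? p))) (ℚₚ.*-identityˡ err))) refl
    O≤ : O ≤ fromℕ 2 * (κ ^ k * L ^ k)
    O≤ = ℚₚ.≤-trans (≤-≡ (Op-cong z ps (λ n → sym (ℚₚ.*-identityʳ (χ (n ℕₚ.≤? R)))) 1) (Op-full-1 range k large d a 0<d 0≤a 0) refl)
      (ℚₚ.≤-trans (*-mono (0≤^ (0≤* 0≤Π 0≤κ) k) (0≤* (0≤^ 0≤1+ε k) (0≤^ 0≤L k)) Πκ≤
          (ℚₚ.≤-trans (*-monoʳ (0≤* (0≤^ 0≤Y k) 0≤1) (fall≤1 0 k)) (≤-≡ (trans (ℚₚ.*-identityˡ (Y ^ k * 1ℚ)) (ℚₚ.*-identityʳ (Y ^ k))) (Y≤ k) refl)))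
        (≤-≡ (trans (solve 3 (λ p kk l → p :* kk :* (p :* l) := p :* p :* (kk :* l)) refl (1+ε ^ k) (κ ^ k) (L ^ k)) (cong (_* (κ ^ k * L ^ k)) (sym (^-+ 1+ε k k))))
          (*-monoʳ (0≤* (0≤^ 0≤κ k) (0≤^ 0≤L k)) (ℚₚ.≤-trans (^-exponent-mono (p≤p+q 0≤ε) (ℕₚ.m≤m+n (k ℕ.+ k) 2)) (ℚₚ.≤-trans up (ℚₚ.+-monoʳ-≤ 1ℚ η≤1)))) refl))
    final : Q * (fromℕ 12 * H y₀) ≤ unit * (fromℕ 24 * fromℕ k * (b * b) * (c₀ * c₀))
    final = ≤-≡ (solve 6 (λ k x b o h t → k :* x :* b :* o :* h :* (t :* h) := k :* x :* b :* t :* (o :* (h :* h))) refl (fromℕ k) X (b * b) O (H y₀) (fromℕ 12))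
      (*-monoˡ (0≤* (0≤* (0≤* (0≤fromℕ k) 0≤X) (0≤p² b)) (0≤fromℕ 12))
        (*-mono 0≤O (0≤p² (c₀ * L)) O≤ (*-mono (0≤H y₀) (ℚₚ.≤-trans (0≤H y₀) Hy≤) Hy≤ Hy≤)))
      (solve 7 (λ k x b kk l lk c → k :* x :* b :* con (fromℕ 12) :* (con (fromℕ 2) :* (kk :* lk) :* (c :* l :* (c :* l))) := x :* kk :* (lk :* (l :* (l :* con 1ℚ))) :* (con (fromℕ 24) :* k :* b :* (c :* c))) refl (fromℕ k) X (b * b) (κ ^ k) L (L ^ k) c₀)

  primeCount : ℕ → ℚ
  primeCount h = ∑ N (λ i → cl i * χ (prime? (N ℕ.+ i ℕ.+ h)) * A i)

  -- Bounding every logarithm by `Lmax`, about log N, and dividing by it turns the extra factor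
  -- `H R` of `primes-≥` into about θ₀/2.
  primeCount-≥ : ∀ {h ι Lmax θ₀ δ e} → 1ℚ ≤ Lmax → 0ℚ ≤ θ₀ → 0ℚ ≤ δ → 1ℚ - η ≤ (1ℚ - ε) ^ suc (j ℕ.+ 4) →
    (∀ i → 1 ℕ.≤ i → i ℕ.≤ N → H (N ℕ.+ i ℕ.+ h) ≤ Lmax) → ½ * θ₀ * (1ℚ - ε) * Lmax ≤ H R →
    fromℕ N * inv₀ (coprimeCount W) * Op ζ ps (λ n → Op recφ ps y n * Op recφ ps y n) 1 ≤ ∑ N (λ i → cl i * (χ (prime? (N ℕ.+ i ℕ.+ h)) * logAt ι (N ℕ.+ i ℕ.+ h)) * A i) + e → e ≤ unit * δ →
    unit * (½ * θ₀ * (1ℚ - η) * β - δ) ≤ primeCount h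
  primeCount-≥ {h} {ι} {Lmax} {θ₀} {δ} {e} 1≤Lmax 0≤θ₀ 0≤δ low H≤ ratio main e≤ = *-cancelˡ {r = Lmax} (ℚₚ.<-≤-trans 0<1 1≤Lmax)
    (by-difference (0≤+ (0≤+ (0≤+ (0≤+ (difference part₁) (difference part₂)) (difference (ℚₚ.≤-trans primes-≥ main))) (difference e≤)) (difference part₅))
      (solve 11 (λ u l q b m s h δ e p c → (u :* (l :* (q :* b)) :- u :* (s :* m :* h :* b)) :+ (m :* (u :* δ) :- u :* δ) :+ (p :+ e :- u :* (l :* (q :* b))) :+ (u :* δ :- e) :+ (m :* c :- p)
          := m :* c :- m :* (u :* (s :* h :* b :- δ))) refl unit (H R) ((1ℚ - ε) ^ (j ℕ.+ 4)) β Lmax (½ * θ₀) (1ℚ - η) δ e Pl (primeCount h)))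
    where
    0≤Lmax = ℚₚ.≤-trans 0≤1 1≤Lmax
    0≤s : 0ℚ ≤ ½ * θ₀
    0≤s = 0≤* (ℚₚ.nonNegative⁻¹ ½) 0≤θ₀
    0≤pw = 0≤^ (difference ε≤1) (j ℕ.+ 4)
    Pl = ∑ N (λ i → cl i * (χ (prime? (N ℕ.+ i ℕ.+ h)) * logAt ι (N ℕ.+ i ℕ.+ h)) * A i)
    part₁ : unit * (½ * θ₀ * Lmax * (1ℚ - η) * β) ≤ unit * (H R * ((1ℚ - ε) ^ (j ℕ.+ 4) * β))
    part₁ = *-monoˡ 0≤unit (ℚₚ.≤-trans (*-monoʳ (0≤primeConst j 0≤a) (ℚₚ.≤-trans (*-monoˡ (0≤* 0≤s 0≤Lmax) low)
        (≤-≡ (solve 4 (λ s m q p → s :* m :* (q :* p) := s :* q :* m :* p) refl (½ * θ₀) Lmax (1ℚ - ε) ((1ℚ - ε) ^ (j ℕ.+ 4))) (*-monoʳ 0≤pw ratio) refl)))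
      (ℚₚ.≤-reflexive (ℚₚ.*-assoc (H R) ((1ℚ - ε) ^ (j ℕ.+ 4)) β)))
    part₂ : unit * δ ≤ Lmax * (unit * δ)
    part₂ = ≤-≡ (sym (ℚₚ.*-identityˡ (unit * δ))) (*-monoʳ (0≤* 0≤unit 0≤δ) 1≤Lmax) refl
    part₅ : Pl ≤ Lmax * primeCount h
    part₅ = ≤-≡ refl (∑-mono N λ i 1≤i i≤N → *-monoʳ (0≤A i) (*-monoˡ (0≤χ (N ℕ.+ i ≡? ν [mod W ])) (*-monoˡ (0≤χ (prime? (N ℕ.+ i ℕ.+ h))) (ℚₚ.≤-trans (logAt≤H ι (N ℕ.+ i ℕ.+ h)) (H≤ i 1≤i i≤N)))))
      (trans (∑-cong N λ i _ _ → solve 4 (λ c p m a → c :* (p :* m) :* a := m :* (c :* p :* a)) refl (cl i) (χ (prime? (N ℕ.+ i ℕ.+ h))) Lmax (A i)) (∑-* N Lmax (λ i → cl i * χ (prime? (N ℕ.+ i ℕ.+ h)) * A i)))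

  -- The number of primes is compared on average with (1 + λ)/2 + j · bad. Since this number never
  -- exceeds j, an `n` at which it is strictly larger cannot be bad.
  detect : ∀ {y₀ j₀ hs′ δ p} → length hs′ ≡ j → 0ℚ < unit →
    ∑ N (λ i → w₁ i * A i) ≤ unit * (α * (1ℚ + η)) + unit * δ → ∣ ∑ N (λ i → cl i * lam (N ℕ.+ i ℕ.+ j₀) * A i) ∣ ≤ unit * δ →
    ∑ N (λ i → cl i * bad y₀ i * A i) ≤ unit * δ → (∀ {h} → h ∈ hs′ → unit * p ≤ primeCount h) →
    ½ * (α * (1ℚ + η) + δ + δ) + fromℕ j * δ < fromℕ j * p →
    ∃[ i ] 1 ℕ.≤ i × i ℕ.≤ N × N ℕ.+ i ≡ ν [mod W ] × ¬ Any (λ p → Any (λ h → p ∣ N ℕ.+ i ℕ.+ h) hs) (primes D y₀) ×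
      ½ * (1ℚ + lam (N ℕ.+ i ℕ.+ j₀)) < ∑ₗ hs′ (λ h → χ (prime? (N ℕ.+ i ℕ.+ h)))
  detect {y₀} {j₀} {hs′} {δ} {p} len 0<unit ints parity bads prim numeric = let i , 1≤i , i≤N , lt = ∑-witness N {f} {g} (ℚₚ.≤-<-trans g≤ (ℚₚ.<-≤-trans strict f≥)) in
    i , 1≤i , i≤N , in-class i lt , not-bad i lt , many i lt
    where
    count share : ℕ → ℚ
    count i = ∑ₗ hs′ (λ h → χ (prime? (N ℕ.+ i ℕ.+ h)))
    share i = ½ * (1ℚ + lam (N ℕ.+ i ℕ.+ j₀))
    f g : ℕ → ℚ
    f i = cl i * A i * count i
    g i = cl i * A i * (share i + fromℕ j * bad y₀ i)
    strict : unit * (½ * (α * (1ℚ + η) + δ + δ) + fromℕ j * δ) < unit * (fromℕ j * p)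
    strict = ℚₚ.*-monoʳ-<-pos unit {{positive 0<unit}} numeric
    f≥ : unit * (fromℕ j * p) ≤ ∑ N f
    f≥ = ≤-≡ (trans (solve 3 (λ u j p → u :* (j :* p) := j :* (u :* p)) refl unit (fromℕ j) p) (trans (cong (λ m → fromℕ m * (unit * p)) (sym len)) (sym (∑ₗ-const hs′ (unit * p))))) (∑ₗ-mono {hs′} prim)
      (trans (sym (∑-∑ₗ N hs′ (λ i h → cl i * χ (prime? (N ℕ.+ i ℕ.+ h)) * A i))) (∑-cong N λ i _ _ → trans (∑ₗ-cong hs′ λ h → solve 3 (λ c x a → c :* x :* a := c :* a :* x) refl (cl i) (χ (prime? (N ℕ.+ i ℕ.+ h))) (A i)) (∑ₗ-* hs′ (cl i * A i) (λ h → χ (prime? (N ℕ.+ i ℕ.+ h))))))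
    S = ∑ N (λ i → w₁ i * A i)
    Λ = ∑ N (λ i → cl i * lam (N ℕ.+ i ℕ.+ j₀) * A i)
    Bad = ∑ N (λ i → cl i * bad y₀ i * A i)
    g-split : ∑ N g ≡ ½ * S + ½ * Λ + fromℕ j * Bad
    g-split = trans (∑-cong N λ i _ _ → solve 5 (λ c a l b j → c :* a :* (con ½ :* (con 1ℚ :+ l) :+ j :* b) := con ½ :* (c :* con 1ℚ :* a) :+ con ½ :* (c :* l :* a) :+ j :* (c :* b :* a)) refl (cl i) (A i) (lam (N ℕ.+ i ℕ.+ j₀)) (bad y₀ i) (fromℕ j))
      (trans (∑-+ N (λ i → ½ * (w₁ i * A i) + ½ * (cl i * lam (N ℕ.+ i ℕ.+ j₀) * A i)) (λ i → fromℕ j * (cl i * bad y₀ i * A i)))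
        (cong₂ _+_ (trans (∑-+ N (λ i → ½ * (w₁ i * A i)) (λ i → ½ * (cl i * lam (N ℕ.+ i ℕ.+ j₀) * A i))) (cong₂ _+_ (∑-* N ½ (λ i → w₁ i * A i)) (∑-* N ½ (λ i → cl i * lam (N ℕ.+ i ℕ.+ j₀) * A i))))
          (∑-* N (fromℕ j) (λ i → cl i * bad y₀ i * A i))))
    0≤½ = ℚₚ.nonNegative⁻¹ ½
    g≤ : ∑ N g ≤ unit * (½ * (α * (1ℚ + η) + δ + δ) + fromℕ j * δ)
    g≤ = ≤-≡ g-split (ℚₚ.+-mono-≤ (ℚₚ.+-mono-≤ (*-monoˡ 0≤½ ints) (*-monoˡ 0≤½ (∣∣≤⇒ parity))) (*-monoˡ (0≤fromℕ j) bads))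
      (solve 4 (λ u x d j → con ½ :* (u :* x :+ u :* d) :+ con ½ :* (u :* d) :+ j :* (u :* d) := u :* (con ½ :* (x :+ d :+ d) :+ j :* d)) refl unit (α * (1ℚ + η)) δ (fromℕ j))
    0≤cA : ∀ i → 0ℚ ≤ cl i * A i
    0≤cA i = 0≤* (0≤χ (N ℕ.+ i ≡? ν [mod W ])) (0≤A i)
    0≤share : ∀ i → 0ℚ ≤ share i
    0≤share i = 0≤* 0≤½ (by-difference {q = 1ℚ + lam n} (difference (∣∣≤⇒ (≤-≡ (ℚₚ.∣-p∣≡∣p∣ (lam n)) (∣lam∣≤1 n) refl))) (solve 1 (λ l → con 1ℚ :- (:- l) := con 1ℚ :+ l :- con 0ℚ) refl (lam n)))
      where n = N ℕ.+ i ℕ.+ j₀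
    0≤jbad : ∀ i → 0ℚ ≤ fromℕ j * bad y₀ i
    0≤jbad i = 0≤* (0≤fromℕ j) (0≤χ (any? (λ p → divides? hs p (N ℕ.+ i)) (primes D y₀)))
    in-class : ∀ i → g i < f i → N ℕ.+ i ≡ ν [mod W ]
    in-class i lt = case N ℕ.+ i ≡? ν [mod W ] of λ
      { (yes eq) → eq
      ; (no neq) → contradiction (subst₂ _<_ (null neq (share i + fromℕ j * bad y₀ i)) (null neq (count i)) lt) (ℚₚ.<-irrefl refl) }
      where
      null : ¬ N ℕ.+ i ≡ ν [mod W ] → ∀ x → cl i * A i * x ≡ 0ℚ
      null neq x = trans (cong (λ c → c * A i * x) (χ-no (N ℕ.+ i ≡? ν [mod W ]) neq)) (solve 2 (λ a x → con 0ℚ :* a :* x := con 0ℚ) refl (A i) x)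
    not-bad : ∀ i → g i < f i → ¬ Any (λ p → Any (λ h → p ∣ N ℕ.+ i ℕ.+ h) hs) (primes D y₀)
    not-bad i lt is-bad = <⇒≱ lt (*-monoˡ (0≤cA i) (ℚₚ.≤-trans count≤ (p≤q+p (0≤share i))))
      where
      count≤ : count i ≤ fromℕ j * bad y₀ i
      count≤ = ≤-≡ refl (∑ₗ-mono {hs′} λ {h} _ → χ≤1 (prime? (N ℕ.+ i ℕ.+ h))) (trans (∑ₗ-const hs′ 1ℚ) (cong₂ (λ m x → fromℕ m * x) len (sym (χ-yes (any? (λ p → divides? hs p (N ℕ.+ i)) (primes D y₀)) is-bad))))
    many : ∀ i → g i < f i → share i < count i
    many i lt = ℚₚ.≰⇒> λ le → <⇒≱ lt (*-monoˡ (0≤cA i) (ℚₚ.≤-trans le (p≤p+q (0≤jbad i))))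

-- Reading off primes, prime factors and powers; the pigeonhole principle.

0<∑ₗχ⇒ : ∀ {P : ℕ → Set} (P? : ∀ h → Dec (P h)) hs → 0ℚ < ∑ₗ hs (λ h → χ (P? h)) → ∃[ h ] h ∈ hs × P h
0<∑ₗχ⇒ P? [] lt = contradiction lt (ℚₚ.<-irrefl refl)
0<∑ₗχ⇒ P? (x ∷ hs) lt = [ (λ px → x , here refl , px) , (λ ¬px → let h , h∈ , ph = 0<∑ₗχ⇒ P? hs (subst (0ℚ <_) (skip ¬px) lt) in h , there h∈ , ph) ]′ (toSum (P? x))
  where
  skip : ¬ _ → χ (P? x) + ∑ₗ hs (λ h → χ (P? h)) ≡ ∑ₗ hs (λ h → χ (P? h))
  skip ¬px = trans (cong (_+ ∑ₗ hs (λ h → χ (P? h))) (χ-no (P? x) ¬px)) (ℚₚ.+-identityˡ (∑ₗ hs (λ h → χ (P? h))))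

1<∑ₗχ⇒ : ∀ {P : ℕ → Set} (P? : ∀ h → Dec (P h)) {D hs} → Separated D hs → 1ℚ < ∑ₗ hs (λ h → χ (P? h)) → ∃[ h ] ∃[ h′ ] h ∈ hs × h′ ∈ hs × h ℕ.< h′ × P h × P h′
1<∑ₗχ⇒ P? [] lt = contradiction lt (ℚₚ.<-asym 0<1)
1<∑ₗχ⇒ {P} P? {D} {x ∷ hs} (apart ∷ sep) lt = [ found , (λ ¬px → let h , h′ , h∈ , h′∈ , rest = 1<∑ₗχ⇒ P? {D} {hs} sep (subst (1ℚ <_) (skip ¬px) lt) in h , h′ , there h∈ , there h′∈ , rest) ]′ (toSum (P? x))
  where
  S = ∑ₗ hs (λ h → χ (P? h))
  skip : ¬ P x → χ (P? x) + S ≡ S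
  skip ¬px = trans (cong (_+ S) (χ-no (P? x) ¬px)) (ℚₚ.+-identityˡ S)
  found : P x → ∃[ h ] ∃[ h′ ] h ∈ x ∷ hs × h′ ∈ x ∷ hs × h ℕ.< h′ × P h × P h′
  found px = pair (0<∑ₗχ⇒ P? hs (subst (0ℚ <_) (solve 1 (λ s → con 1ℚ :+ s :- con 1ℚ := s) refl S) (difference< {1ℚ} {1ℚ + S} (subst (λ c → 1ℚ < c + S) (χ-yes (P? x) px) lt))))
    where
    pair : ∃[ h ] h ∈ hs × P h → ∃[ h ] ∃[ h′ ] h ∈ x ∷ hs × h′ ∈ x ∷ hs × h ℕ.< h′ × P h × P h′
    pair (h , h∈ , ph) = [ (λ x≤h → x , h , here refl , there h∈ , ℕₚ.≤∧≢⇒< x≤h x≢h , px , ph) , (λ h≤x → h , x , there h∈ , here refl , ℕₚ.≤∧≢⇒< h≤x (λ eq → x≢h (sym eq)) , ph , px) ]′ (ℕₚ.≤-total x h)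
      where
      x≢h = proj₁ (All.lookup apart h∈)

liouville-even : ∀ n .{{_ : NonZero n}} → 2 ∣ Ω n → liouville n ≡ ℤ.1ℤ
liouville-even n (divides m eq) = trans (cong (ℤ.-1ℤ ℤ.^_) eq) (go m)
  where
  go : ∀ m → ℤ.-1ℤ ℤ.^ (m ℕ.* 2) ≡ ℤ.1ℤ
  go zero = refl
  go (suc m) = cong (λ x → ℤ.-1ℤ ℤ.* (ℤ.-1ℤ ℤ.* x)) (go m)

-- H - 1 is superadditive on products.
length-factors : ∀ {y} qs → All (y ℕ.<_) qs → 1 ℕ.≤ y → fromℕ (length qs) * (H y - 1ℚ) ≤ H (product qs) - 1ℚ
length-factors {y} [] [] 1≤y = ℚₚ.≤-reflexive (ℚₚ.*-zeroˡ (H y - 1ℚ))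
length-factors {y} (x ∷ qs) (y<x ∷ all) 1≤y = ≤-≡ (trans (cong (_* (H y - 1ℚ)) (fromℕ-suc (length qs))) (solve 2 (λ n h → (con 1ℚ :+ n) :* h := h :+ n :* h) refl (fromℕ (length qs)) (H y - 1ℚ)))
  (ℚₚ.+-mono-≤ (ℚₚ.+-monoˡ-≤ (- 1ℚ) (H-mono (ℕₚ.<⇒≤ y<x))) (length-factors qs all 1≤y)) refl ⟫ super (product qs) (positive-product qs all)
  where
  infixr 5 _⟫_
  _⟫_ : ∀ {p q r} → p ≤ q → q ≤ r → p ≤ r
  _⟫_ = ℚₚ.≤-trans
  positive-product : ∀ qs → All (y ℕ.<_) qs → 1 ℕ.≤ product qs
  positive-product [] [] = ℕₚ.≤-refl
  positive-product (q ∷ qs) (y<q ∷ all) = ℕₚ.*-mono-≤ (ℕₚ.≤-trans (s≤s z≤n) y<q) (positive-product qs all)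
  super : ∀ m → 1 ℕ.≤ m → (H x - 1ℚ) + (H m - 1ℚ) ≤ H (x ℕ.* m) - 1ℚ
  super (suc m) _ = by-difference (difference (H-*-≥ {x} (ℕₚ.≤-trans (s≤s z≤n) y<x) m)) (solve 3 (λ a b c → c :+ con 1ℚ :- (a :+ b) := c :- con 1ℚ :- ((a :- con 1ℚ) :+ (b :- con 1ℚ))) refl (H x) (H (suc m)) (H (x ℕ.* suc m)))

rough-factors : ∀ {y n} .{{_ : NonZero n}} → (∀ q → Prime q → q ∣ n → y ℕ.< q) → All (y ℕ.<_) (factors (factorise n))
rough-factors {y} {n} rough = All.tabulate λ {q} q∈ → rough q (All.lookup (PrimeFactorisation.factorsPrime (factorise n)) q∈) (subst (q ∣_) (sym (PrimeFactorisation.isFactorisation (factorise n))) (∈⇒∣product q∈))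
  where
  ∈⇒∣product : ∀ {q qs} → q ∈ qs → q ∣ product qs
  ∈⇒∣product {q} (here {xs = qs} refl) = ℕ.m∣m*n (product qs)
  ∈⇒∣product (there {x} q∈) = ℕ.∣-trans (∈⇒∣product q∈) (ℕ.n∣m*n x)

rough-Ω : ∀ {y n} .{{_ : NonZero n}} → 1 ℕ.≤ y → (∀ q → Prime q → q ∣ n → y ℕ.< q) → fromℕ (Ω n) * (H y - 1ℚ) ≤ H n - 1ℚ
rough-Ω {y} {n} 1≤y rough = ≤-≡ refl (length-factors (factors (factorise n)) (rough-factors rough) 1≤y) (cong (λ m → H m - 1ℚ) (sym (PrimeFactorisation.isFactorisation (factorise n))))

rough-P⁻ : ∀ {y n} .{{_ : NonZero n}} → 2 ℕ.≤ n → (∀ q → Prime q → q ∣ n → y ℕ.< q) → y ℕ.< P⁻ n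
rough-P⁻ {y} {n} 2≤n rough = v<min⁺ (let q , pr , q∣n = primeDivisor n 2≤n in ℕₚ.<-≤-trans (rough q pr q∣n) (ℕ.∣⇒≤ q∣n)) (rough-factors rough)

power-< : ∀ p .{{_ : NonZero p}} {c m P} → 0ℚ ≤ c → c * H p ≤ H m → 1 ℕ.≤ m → 4 ℕ.* m ℕ.< P → powℕ p (fromℚᴿ c) <ᴿ fromℕᴿ P
power-< (suc p) {c} {m} {P} 0≤c cH≤ 1≤m lt = 1ℚ , 0<1 , 0 , λ n _ → ℚₚ.≤-trans
  (ℚₚ.+-monoˡ-≤ 1ℚ (E-upper {m} {c * logAt n (suc p)} 1≤m (0≤* 0≤c (0≤logAt n (suc p))) (ℚₚ.≤-trans (*-monoˡ 0≤c (logAt≤H n (suc p))) cH≤) n))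
  (≤-≡ (trans (ℚₚ.+-comm (fromℕ (4 ℕ.* m)) 1ℚ) (sym (fromℕ-suc (4 ℕ.* m)))) (fromℕ-mono lt) refl)

-- Pays for the 4 of `E-upper`: the power of p is bounded by 4 m, which must not exceed the
-- roughness bound y.
quarter : ∀ y → ∃[ m ] 4 ℕ.* m ℕ.≤ y × H y ≤ H m + fromℕ 4
quarter y = m , ℕₚ.≤-trans (ℕₚ.≤-reflexive (ℕₚ.*-comm 4 m)) (ℕ.m/n*n≤m y 4) ,
  ℚₚ.≤-trans (H-mono y≤) (ℚₚ.≤-trans (H-*-≤ 4 (suc m)) (≤-≡ (ℚₚ.+-comm (H 4) (H (suc m))) (ℚₚ.+-mono-≤ (H-suc≤ m) H4≤3) (ℚₚ.+-assoc (H m) 1ℚ (fromℕ 3))))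
  where
  m = y ℕ./ 4
  y≤ : y ℕ.≤ 4 ℕ.* suc m
  y≤ = ℕₚ.≤-trans (ℕₚ.≤-reflexive (ℕ.m≡m%n+[m/n]*n y 4)) (ℕₚ.≤-trans (ℕₚ.+-monoˡ-≤ (m ℕ.* 4) (ℕₚ.<⇒≤ (ℕ.m%n<n y 4))) (ℕₚ.≤-reflexive (solveℕ 1 (λ m → conᴺ 4 :+ᴺ m :*ᴺ conᴺ 4 :=ᴺ conᴺ 4 :*ᴺ (conᴺ 1 :+ᴺ m)) refl m)))
  H4≤3 : H 4 ≤ fromℕ 3
  H4≤3 = by-difference {d = rec 3 + rec 3 + rec 4} (0≤+ (0≤+ (0≤rec 3) (0≤rec 3)) (0≤rec 4)) refl

Infinitely : (ℕ → Set) → Set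
Infinitely P = ∀ m → ∃[ n ] m ℕ.< n × P n

pigeonhole : ExcludedMiddle 0ℓ → ∀ (xs : List ℕ) (P : ℕ → ℕ → Set) → Infinitely (λ n → ∃[ x ] x ∈ xs × P x n) → ∃[ x ] x ∈ xs × Infinitely (P x)
pigeonhole em [] P inf = case inf 0 of λ { (_ , _ , _ , () , _) }
pigeonhole em (x ∷ xs) P inf with em {Infinitely (P x)}
... | yes infx = x , here refl , infx
... | no ¬infx with em {∃[ m ] (∀ n → m ℕ.< n → ¬ P x n)}
...   | no ¬bounded = contradiction (λ m → decide m em) ¬infx
  where
  decide : ∀ m → Dec (∃[ n ] m ℕ.< n × P x n) → ∃[ n ] m ℕ.< n × P x n
  decide m (yes w) = w
  decide m (no ¬w) = contradiction (m , λ n m<n px → ¬w (n , m<n , px)) ¬bounded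
...   | yes (m₀ , none) = let y , y∈ , infy = pigeonhole em xs P (λ m → later m (inf (m ℕ.⊔ m₀))) in y , there y∈ , infy
  where
  later : ∀ m → ∃[ n ] m ℕ.⊔ m₀ ℕ.< n × ∃[ y ] y ∈ x ∷ xs × P y n → ∃[ n ] m ℕ.< n × ∃[ y ] y ∈ xs × P y n
  later m (n , lt , y , here refl , py) = contradiction py (none n (ℕₚ.≤-<-trans (ℕₚ.m≤n⊔m m m₀) lt))
  later m (n , lt , y , there y∈ , py) = n , ℕₚ.≤-<-trans (ℕₚ.m≤m⊔n m m₀) lt , y , y∈ , py

-- Prime gaps and the lower limit.

nthPrime-< : ∀ n → nthPrime n ℕ.< nthPrime (suc n)
nthPrime-< n = proj₁ (proj₂ (nextPrime (nthPrime n)))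

nthPrime-mono : ∀ {m n} → m ℕ.≤ n → nthPrime m ℕ.≤ nthPrime n
nthPrime-mono {m} m≤n = go (ℕₚ.≤⇒≤′ m≤n)
  where
  go : ∀ {n} → m ℕ.≤′ n → nthPrime m ℕ.≤ nthPrime n
  go ℕ.≤′-refl = ℕₚ.≤-refl
  go (ℕ.≤′-step {n} le) = ℕₚ.≤-trans (go le) (ℕₚ.<⇒≤ (nthPrime-< n))

n<nthPrime : ∀ n → n ℕ.< nthPrime n
n<nthPrime zero = s≤s z≤n
n<nthPrime (suc n) = ℕₚ.≤-<-trans (n<nthPrime n) (nthPrime-< n)

index : ∀ {q} → Prime q → ∃[ n ] nthPrime n ≡ q
index {q} pr = search q (ℕₚ.<⇒≤ (n<nthPrime q))
  where
  search : ∀ n → q ℕ.≤ nthPrime n → ∃[ n ] nthPrime n ≡ q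
  search zero q≤2 = 0 , ℕₚ.≤-antisym (prime⇒2≤ pr) q≤2
  search (suc n) q≤ with ℕₚ.≤-<-connex q (nthPrime n)
  ... | inj₁ q≤n = search n q≤n
  ... | inj₂ n<q = suc n , ℕₚ.≤-antisym (proj₂ (proj₂ (proj₂ (nextPrime (nthPrime n)))) q n<q pr) q≤

-- The lower limit is the least v such that f ≤ v infinitely often. Tail infima are attained, so an
-- upper bound U for all of them is itself such a v.
liminf-≤ : ExcludedMiddle 0ℓ → ∀ (f : ℕ → ℕ) D → (∀ m → ∃[ n ] m ℕ.≤ n × f n ℕ.≤ D) → ∃[ L ] IsLiminf f L × L ℕ.≤ D
liminf-≤ em f D often = l , (above , below) , ℕₚ.≮⇒≥ λ D<l → proj₂ (proj₂ found) D D<l often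
  where
  Often : ℕ → Set
  Often v = ∀ m → ∃[ n ] m ℕ.≤ n × f n ℕ.≤ v
  found = least em Often D often
  l = proj₁ found
  above : ∀ m i → IsTailInf f m i → i ℕ.≤ l
  above m i (lower , _) = let n , m≤n , fn≤ = proj₁ (proj₂ found) m in ℕₚ.≤-trans (lower n m≤n) fn≤
  tail-inf : ∀ m → ∃[ i ] IsTailInf f m i × ∃[ n ] m ℕ.≤ n × f n ≡ i
  tail-inf m = let i , (n , m≤n , eq) , min = least em (λ v → ∃[ n ] m ℕ.≤ n × f n ≡ v) (f m) (m , ℕₚ.≤-refl , refl) in
    i , ((λ n′ m≤n′ → ℕₚ.≮⇒≥ λ lt → min (f n′) lt (n′ , m≤n′ , refl)) , λ j lower → ℕₚ.≤-trans (lower n m≤n) (ℕₚ.≤-reflexive eq)) , n , m≤n , eq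
  below : ∀ U → (∀ m i → IsTailInf f m i → i ℕ.≤ U) → l ℕ.≤ U
  below U bound = ℕₚ.≮⇒≥ λ U<l → proj₂ (proj₂ found) U U<l λ m → let i , inf , n , m≤n , eq = tail-inf m in n , m≤n , ℕₚ.≤-trans (ℕₚ.≤-reflexive eq) (bound m i inf)

close-primes : ExcludedMiddle 0ℓ → ∀ D → (∀ m → ∃[ p ] ∃[ q ] m ℕ.< p × p ℕ.< q × q ℕ.≤ p ℕ.+ D × Prime p × Prime q) → AlternativeII D
close-primes em D pairs = liminf-≤ em primeGap D gap
  where
  gap : ∀ m → ∃[ n ] m ℕ.≤ n × primeGap n ℕ.≤ D
  gap m = let p , q , m<p , p<q , q≤ , prp , prq = pairs (nthPrime m) ; n , eq = index prp in
    n , ℕₚ.≮⇒≥ (λ n<m → ℕₚ.<⇒≱ m<p (ℕₚ.≤-trans (ℕₚ.≤-reflexive (sym eq)) (nthPrime-mono (ℕₚ.<⇒≤ n<m)))) ,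
    ℕₚ.≤-trans (ℕₚ.∸-monoˡ-≤ (nthPrime n) (ℕₚ.≤-trans (proj₂ (proj₂ (proj₂ (nextPrime (nthPrime n)))) q (ℕₚ.≤-<-trans (ℕₚ.≤-reflexive eq) p<q) prq) q≤))
      (ℕₚ.≤-reflexive (trans (cong (p ℕ.+ D ℕ.∸_) eq) (ℕₚ.m+n∸m≡n p D)))

-- Admissible translates modulo factorials.

module _ {hs : List ℕ} (B : ℕ) (below : ∀ {h} → h ∈ hs → suc h ℕ.< B) where
  Avoids : ℕ → ℕ → Set
  Avoids D ν = ∀ {h} → h ∈ hs → ∀ q → Prime q → q ℕ.< D → ¬ q ∣ ν ℕ.+ h

  -- A prime larger than the whole tuple always leaves a free residue class, so admissibility is a
  -- finite check below `B`.
  avoid-next : ∀ D → B ℕ.≤ D → ∃[ ν ] Avoids D ν → ∃[ ν ] Avoids (suc D) ν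
  avoid-next zero B≤0 (ν , av) = ν , λ h∈ → contradiction (ℕₚ.≤-trans (below h∈) B≤0) λ ()
  avoid-next D@(suc D-1) B≤D (ν , av) with prime? D
  ... | no ¬pr = ν , λ h∈ q pr q≤D → av h∈ q pr (ℕₚ.≤∧≢⇒< (ℕₚ.≤-pred q≤D) λ { refl → ¬pr pr })
  ... | yes prD = x , avoids
    where
    m = D-1 !
    -- Makes D divide x + (D - 1). All h are below D - 1, so D divides no x + h; modulo (D - 1)!
    -- nothing changes.
    x = crt m D ν D-1
    avoids : Avoids (suc D) x
    avoids {h} h∈ q pr q≤D q∣ with q ℕₚ.≟ D
    ... | yes refl = ∣-close {D-1} {D} {x} {D-1} {h} ℕₚ.≤-refl (ℕₚ.≤-trans (ℕₚ.∣m-n∣≤m⊔n D-1 h) (ℕₚ.⊔-lub ℕₚ.≤-refl (ℕₚ.≤-pred (ℕₚ.≤-trans (ℕₚ.≤-trans (ℕₚ.n≤1+n (suc h)) (below h∈)) B≤D))))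
        (λ eq → ℕₚ.<⇒≢ (ℕₚ.≤-pred (ℕₚ.≤-trans (below h∈) B≤D)) (sym eq)) (crt-∣ ν D-1 (prime-∤⇒coprime prD λ D∣ → ℕₚ.<⇒≱ ℕₚ.≤-refl (prime-divides-factorial prD D∣)) (s≤s z≤n)) q∣
    ... | no q≢D = av h∈ q pr q<D (mod-∣ {ν ℕ.+ h} {x ℕ.+ h} (mod-shift {ν} {x} h (mod-sym {x} {ν} (ℕ.∣-trans (≤⇒∣! (prime⇒1≤ pr) (ℕₚ.≤-pred q<D)) (crt-mod m D ν D-1)))) q∣)
      where
      q<D = ℕₚ.≤∧≢⇒< (ℕₚ.≤-pred q≤D) q≢D

  avoid-from : ∃[ ν ] Avoids B ν → ∀ e → ∃[ ν ] Avoids (e ℕ.+ B) ν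
  avoid-from base zero = base
  avoid-from base (suc e) = avoid-next (e ℕ.+ B) (ℕₚ.m≤n+m B e) (avoid-from base e)

  admissible : ∃[ ν ] Avoids B ν → ∀ D → ∃[ ν ] (∀ {h} → h ∈ hs → Coprime (ν ℕ.+ h) (D !))
  admissible base D = let ν , av = avoid-from base (suc D) in ν , λ h∈ {e} (e∣ν , e∣D!) → trivial-divisor av h∈ e e∣ν e∣D!
    where
    trivial-divisor : ∀ {ν} → Avoids (suc D ℕ.+ B) ν → ∀ {h} → h ∈ hs → ∀ e → e ∣ ν ℕ.+ h → e ∣ D ! → e ≡ 1
    trivial-divisor av h∈ zero _ 0∣ = contradiction (ℕ.0∣⇒≡0 0∣) (ℕₚ.>⇒≢ (ℕₚ.1≤n! D))
    trivial-divisor av h∈ (suc zero) _ _ = refl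
    trivial-divisor av h∈ e@(suc (suc _)) e∣ν e∣D! = let q , pr , q∣e = primeDivisor e (s≤s (s≤s z≤n)) in
      contradiction (ℕ.∣-trans q∣e e∣ν) (av h∈ q pr (ℕₚ.≤-trans (s≤s (prime-divides-factorial pr (ℕ.∣-trans q∣e e∣D!))) (ℕₚ.m≤m+n (suc D) B)))

avoids-all : ∀ {hs B ν} → All (λ h → All (λ q → ¬ suc (suc q) ∣ ν ℕ.+ h) (upTo B)) hs → ∀ {h} → h ∈ hs → ∀ q → Prime q → q ℕ.< B → ¬ q ∣ ν ℕ.+ h
avoids-all all h∈ zero pr _ = contradiction (prime⇒1≤ pr) λ ()
avoids-all all h∈ (suc zero) pr _ = contradiction pr ¬prime[1]
avoids-all {B = B} all h∈ (suc (suc q)) pr q<B = All.lookup (All.lookup all h∈) (∈-upTo⁺ (ℕₚ.≤-trans (ℕₚ.n≤1+n (suc q)) (ℕₚ.≤-trans (ℕₚ.n≤1+n (suc (suc q))) q<B)))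

-- From detected integers to the two alternatives.

module Conclusion (hs : List ℕ) (j₀ : ℕ) (hs′ : List ℕ) (wo : Without j₀ hs hs′) (D₀ : ℕ) (sep₀ : Separated D₀ hs) (hs≤D₀ : All (ℕ._≤ D₀) hs)
  (D ν : ℕ) (ν-ok : ∀ {h} → h ∈ hs → Coprime (ν ℕ.+ h) (D !)) (c₁ : ℚ) (0<c₁ : 0ℚ < c₁)
  (D₆ : ℕ) (shifts : All (λ h → 2 ∣ ℤ.∣ ℤ.+ j₀ ℤ.- ℤ.+ h ∣ × 0 ℕ.< ℤ.∣ ℤ.+ j₀ ℤ.- ℤ.+ h ∣ × ℤ.∣ ℤ.+ j₀ ℤ.- ℤ.+ h ∣ ℕ.≤ D₆) hs′)
  (c : ℚ) (0≤c : 0ℚ ≤ c) (c≤ : c ≤ ½ * c₁) (C : ℕ) (C≥ : fromℕ 4 * inv₀ c₁ ≤ fromℕ C) where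

  Detects : ℕ → Set
  Detects N = ∃[ y₀ ] c₁ * H N ≤ H y₀ × ∃[ i ] 1 ℕ.≤ i × i ℕ.≤ N × N ℕ.+ i ≡ ν [mod D ! ] × ¬ Any (λ p → Any (λ h → p ∣ N ℕ.+ i ℕ.+ h) hs) (primes D y₀) ×
    ½ * (1ℚ + lam (N ℕ.+ i ℕ.+ j₀)) < ∑ₗ hs′ (λ h → χ (prime? (N ℕ.+ i ℕ.+ h)))

  Pair : ℕ → Set
  Pair N = ∃[ p ] ∃[ q ] N ℕ.< p × p ℕ.< q × q ℕ.≤ p ℕ.+ D₀ × Prime p × Prime q

  Shifted : ℕ → ℕ → ℕ → Set
  Shifted h b p = ¬ 2 ∣ b × Σ[ pr ∈ Prime p ] AlmostPrimeShift (fromℚᴿ c) b (ℤ.+ j₀ ℤ.- ℤ.+ h) p pr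

  Single : ℕ → Set
  Single N = ∃[ p ] N ℕ.< p × ∃[ h ] h ∈ hs′ × ∃[ b ] b ∈ upTo (suc C) × Shifted h b p

  private
    0≤c₁ = ℚₚ.<⇒≤ 0<c₁

  module _ (N : ℕ) (D₀≤N : D₀ ℕ.≤ N) (large : c₁ + fromℕ 4 ≤ ½ * c₁ * H N) (2≤h : fromℕ 2 ≤ H N) where
    outcome : Detects N → Single N ⊎ Pair N
    outcome (y₀ , Hy≥ , i , 1≤i , i≤N , n≡ν , good , many) = split (2 ∣? Ω n′)
      where
      n n′ : ℕ
      n = N ℕ.+ i
      n′ = n ℕ.+ j₀
      N<n : N ℕ.< n
      N<n = ℕₚ.m<m+n N 1≤i
      instance
        n′≢0 : NonZero n′
        n′≢0 = ℕ.>-nonZero (ℕₚ.≤-trans (ℕₚ.≤-trans (s≤s z≤n) N<n) (ℕₚ.m≤m+n n j₀))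
      rough : ∀ {h} → h ∈ hs → ∀ q → Prime q → q ∣ n ℕ.+ h → y₀ ℕ.< q
      rough {h} h∈ q pr q∣ = ℕₚ.≰⇒> λ q≤y → [ (λ q≤D → ¬prime[1] (subst Prime (ν-ok h∈ (mod-∣ {ν ℕ.+ h} {n ℕ.+ h} (mod-shift {ν} {n} h (mod-sym {n} {ν} (ℕ.∣-trans (≤⇒∣! (prime⇒1≤ pr) q≤D) n≡ν))) q∣ , ≤⇒∣! (prime⇒1≤ pr) q≤D)) pr))
        , (λ D<q → good (lose (∈-primes D y₀ pr D<q q≤y) (lose h∈ q∣))) ]′ (ℕₚ.≤-<-connex q D)
      h≤N : ∀ {h} → h ∈ hs → h ℕ.≤ N
      h≤N h∈ = ℕₚ.≤-trans (All.lookup hs≤D₀ h∈) D₀≤N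
      H≤ : ∀ {h} → h ∈ hs → H (n ℕ.+ h) ≤ H N + fromℕ 2
      H≤ {h} h∈ = ℚₚ.≤-trans (H-mono (ℕₚ.≤-trans (ℕₚ.+-mono-≤ (ℕₚ.+-monoʳ-≤ N i≤N) (h≤N h∈)) (ℕₚ.≤-reflexive (solveℕ 1 (λ n → n :+ᴺ n :+ᴺ n :=ᴺ conᴺ 3 :*ᴺ n) refl N))))
        (ℚₚ.≤-trans (H-*-≤ 3 N) (≤-≡ (ℚₚ.+-comm (H 3) (H N)) (ℚₚ.+-monoʳ-≤ (H N) (by-difference {H 3} {fromℕ 2} {½ * rec 3} (0≤* (ℚₚ.nonNegative⁻¹ ½) (0≤rec 3)) refl)) refl))
      c₁h≥ : ½ * c₁ * H N + c₁ + fromℕ 4 ≤ H y₀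
      c₁h≥ = ℚₚ.≤-trans (by-difference {q = c₁ * H N} (difference large) (solve 2 (λ c h → con ½ :* c :* h :- (c :+ con (fromℕ 4)) := c :* h :- (con ½ :* c :* h :+ c :+ con (fromℕ 4))) refl c₁ (H N))) Hy≥
      1≤y₀ : 1 ℕ.≤ y₀
      1≤y₀ = H-cancel-< {0} {y₀} (ℚₚ.<-≤-trans (ℚₚ.<-≤-trans (ℚₚ.positive⁻¹ (fromℕ 4)) (p≤q+p (0≤+ (0≤* (0≤* (ℚₚ.nonNegative⁻¹ ½) 0≤c₁) (0≤H N)) 0≤c₁))) c₁h≥)
      j₀∈ = without-self wo
      -- All prime factors of n′ exceed y₀, so Ω(n′) times ½ c₁ `H N` is at most 2 `H N`; this gives
      -- the bound 4/c₁.
      Ω≤C : Ω n′ ℕ.≤ C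
      Ω≤C = fromℕ-cancel-≤ (ℚₚ.≤-trans (*-cancelˡ {fromℕ (Ω n′)} {fromℕ 4 * inv₀ c₁} {½ * c₁ * H N} (0<* (0<* (ℚₚ.positive⁻¹ ½) 0<c₁) (ℚₚ.<-≤-trans (ℚₚ.positive⁻¹ (fromℕ 2)) 2≤h))
        (≤-≡ (ℚₚ.*-comm (½ * c₁ * H N) (fromℕ (Ω n′)))
          (ℚₚ.≤-trans (*-monoˡ (0≤fromℕ (Ω n′)) (by-difference {q = H y₀ - 1ℚ} (0≤+ (difference c₁h≥) (0≤+ 0≤c₁ (0≤fromℕ 3))) (solve 3 (λ x c y → (y :- (x :+ c :+ con (fromℕ 4))) :+ (c :+ con (fromℕ 3)) := y :- con 1ℚ :- x) refl (½ * c₁ * H N) c₁ (H y₀))))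
            (ℚₚ.≤-trans (rough-Ω {y₀} {n′} 1≤y₀ (rough j₀∈)) (by-difference {q = fromℕ 2 * H N} (0≤+ (0≤+ (difference (H≤ j₀∈)) (difference 2≤h)) 0≤1) (solve 2 (λ x h → (h :+ con (fromℕ 2) :- x) :+ (h :- con (fromℕ 2)) :+ con 1ℚ := con (fromℕ 2) :* h :- (x :- con 1ℚ)) refl (H n′) (H N)))))
          (trans (solve 1 (λ h → con (fromℕ 2) :* h := con 1ℚ :* (con (fromℕ 2) :* h)) refl (H N)) (trans (cong (_* (fromℕ 2 * H N)) (sym (inv₀-inverse 0<c₁))) (solve 3 (λ c v h → c :* v :* (con (fromℕ 2) :* h) := con ½ :* c :* h :* (con (fromℕ 4) :* v)) refl c₁ (inv₀ c₁) (H N)))))) C≥)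
      2≤n′ : 2 ℕ.≤ n′
      2≤n′ = ℕₚ.≤-trans (ℕₚ.≤-trans (s≤s (H-cancel-< {0} {N} (ℚₚ.<-≤-trans (ℚₚ.positive⁻¹ (fromℕ 2)) 2≤h))) N<n) (ℕₚ.m≤m+n n j₀)
      single : ∀ {h} → h ∈ hs′ → Prime (n ℕ.+ h) → ¬ 2 ∣ Ω n′ → Single N
      single {h} h∈ pr odd = n ℕ.+ h , ℕₚ.≤-trans N<n (ℕₚ.m≤m+n n h) , h , h∈ , Ω n′ , ∈-upTo⁺ (s≤s Ω≤C) , odd , pr , n′ , n′≢0 ,
        shift-eq , power-< (n ℕ.+ h) {{prime⇒nonZero pr}} {c} {m} {P⁻ n′} 0≤c c≤H 1≤m (ℕₚ.≤-<-trans (proj₁ (proj₂ q)) (rough-P⁻ 2≤n′ (rough j₀∈))) , refl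
        where
        shift-eq : ℤ.+ n′ ≡ ℤ.+ (n ℕ.+ h) ℤ.+ (ℤ.+ j₀ ℤ.- ℤ.+ h)
        shift-eq = trans (ℤₚ.pos-+ n j₀) (trans (solveℤ 3 (λ n j h → n :+ᶻ j :=ᶻ n :+ᶻ h :+ᶻ (j :-ᶻ h)) refl (ℤ.+ n) (ℤ.+ j₀) (ℤ.+ h)) (cong (ℤ._+ (ℤ.+ j₀ ℤ.- ℤ.+ h)) (sym (ℤₚ.pos-+ n h))))
        q = quarter y₀
        m = proj₁ q
        c≤H : c * H (n ℕ.+ h) ≤ H m
        c≤H = ℚₚ.≤-trans (*-mono 0≤c (0≤+ (0≤H N) (0≤fromℕ 2)) c≤ (H≤ (without-∈ wo h∈)))
          (by-difference (0≤+ (difference c₁h≥) (difference (proj₂ (proj₂ q)))) (solve 4 (λ c h y m → (y :- (con ½ :* c :* h :+ c :+ con (fromℕ 4))) :+ (m :+ con (fromℕ 4) :- y) := m :- con ½ :* c :* (h :+ con (fromℕ 2))) refl c₁ (H N) (H y₀) (H m)))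
        1≤m : 1 ℕ.≤ m
        1≤m = H-cancel-< {0} {m} (ℚₚ.<-≤-trans (0<* (ℚₚ.positive⁻¹ ½) 0<c₁) (by-difference {q = H m} (0≤+ (0≤+ (difference c₁h≥) (difference (proj₂ (proj₂ q)))) (0≤+ (0≤* (0≤* (ℚₚ.nonNegative⁻¹ ½) 0≤c₁) (0≤H N)) (0≤* (ℚₚ.nonNegative⁻¹ ½) 0≤c₁)))
          (solve 4 (λ c h y m → (y :- (con ½ :* c :* h :+ c :+ con (fromℕ 4))) :+ (m :+ con (fromℕ 4) :- y) :+ (con ½ :* c :* h :+ con ½ :* c) := m :- con ½ :* c) refl c₁ (H N) (H y₀) (H m))))
      split : Dec (2 ∣ Ω n′) → Single N ⊎ Pair N
      split (no odd) = inj₁ (let h , h∈ , pr = 0<∑ₗχ⇒ (λ h → prime? (n ℕ.+ h)) hs′ (ℚₚ.≤-<-trans 0≤share many) in single h∈ pr odd)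
        where
        0≤share : 0ℚ ≤ ½ * (1ℚ + lam n′)
        0≤share = 0≤* (ℚₚ.nonNegative⁻¹ ½) (by-difference {q = 1ℚ + lam n′} (difference (∣∣≤⇒ (≤-≡ (ℚₚ.∣-p∣≡∣p∣ (lam n′)) (∣lam∣≤1 n′) refl))) (solve 1 (λ l → con 1ℚ :- (:- l) := con 1ℚ :+ l :- con 0ℚ) refl (lam n′)))
      split (yes even) = inj₂ (let h , h′ , h∈ , h′∈ , h<h′ , prp , prq = 1<∑ₗχ⇒ (λ h → prime? (n ℕ.+ h)) (without-separated wo sep₀) (subst (_< _) (trans (cong (λ l → ½ * (1ℚ + l)) (lam-even n′ even)) refl) many) in
        n ℕ.+ h , n ℕ.+ h′ , ℕₚ.≤-trans N<n (ℕₚ.m≤m+n n h) , ℕₚ.+-monoʳ-< n h<h′ , ℕₚ.≤-trans (ℕₚ.+-monoʳ-≤ n (All.lookup hs≤D₀ (without-∈ wo h′∈))) (ℕₚ.+-monoˡ-≤ D₀ (ℕₚ.m≤m+n n h)) , prp , prq)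
        where
        lam-even : ∀ m .{{_ : NonZero m}} → 2 ∣ Ω m → lam m ≡ 1ℚ
        lam-even (suc m) even = cong fromℤ (liouville-even (suc m) even)

  -- If pairs occur beyond every bound, (ii) holds. Otherwise they stop somewhere and every later N
  -- yields a `Single`; there are finitely many shifts h and values b ≤ C, so one pair (h, b) recurs
  -- for infinitely many primes.
  conclusion : ExcludedMiddle 0ℓ → Eventually Detects → AlternativeI (fromℕᴿ C) (fromℚᴿ c) D₆ ⊎ AlternativeII D₀
  conclusion em detects = cases (em {∀ m → Pair m}) (em {∃[ m ] (∀ N → m ℕ.≤ N → ¬ Pair N)})
    where
    all = both detects (both {λ N → D₀ ℕ.≤ N} (D₀ , λ _ le → le) (both (H-eventually (c₁ + fromℕ 4) (0<* (ℚₚ.positive⁻¹ ½) 0<c₁)) (H-eventually (fromℕ 2) 0<1)))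
    at-N : ∀ N → proj₁ all ℕ.≤ N → Single N ⊎ Pair N
    at-N N le = let det , D₀≤N , large , 2≤h = proj₂ all N le in outcome N D₀≤N large (≤-≡ refl 2≤h (ℚₚ.*-identityˡ (H N))) det
    alternative : Infinitely (λ p → ∃[ h ] h ∈ hs′ × ∃[ b ] b ∈ upTo (suc C) × Shifted h b p) → AlternativeI (fromℕᴿ C) (fromℚᴿ c) D₆
    alternative inf =
      let h , h∈ , infₕ = pigeonhole em hs′ (λ h p → ∃[ b ] b ∈ upTo (suc C) × Shifted h b p) inf
          b , b∈ , infᵦ = pigeonhole em (upTo (suc C)) (Shifted h) infₕ
          even , nonzero , d≤ = All.lookup shifts h∈
      in b , ℤ.+ j₀ ℤ.- ℤ.+ h , (proj₁ (proj₂ (proj₂ (infᵦ 0)))) , bound b (ℕₚ.≤-pred (∈-upTo⁻ b∈)) , even , nonzero , d≤ ,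
        λ m → let p , m<p , _ , almost = infᵦ m in p , m<p , almost
      where
      bound : ∀ b → b ℕ.≤ C → fromℕᴿ b ≤ᴿ fromℕᴿ C
      bound b b≤C (δ , 0<δ , n , lt) = <⇒≱ (ℚₚ.<-≤-trans (subst (_< fromℕ C + δ) (ℚₚ.+-identityʳ (fromℕ C)) (ℚₚ.+-monoʳ-< (fromℕ C) 0<δ)) (lt n ℕₚ.≤-refl)) (fromℕ-mono b≤C)
    cases : Dec (∀ m → Pair m) → Dec (∃[ m ] (∀ N → m ℕ.≤ N → ¬ Pair N)) → AlternativeI (fromℕᴿ C) (fromℚᴿ c) D₆ ⊎ AlternativeII D₀
    cases (yes pairs) _ = inj₂ (close-primes em D₀ pairs)
    cases (no ¬pairs) (no ¬bounded) = contradiction (λ m → find m em) ¬pairs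
      where
      find : ∀ m → Dec (∃[ N ] m ℕ.≤ N × Pair N) → Pair m
      find m (yes (N , m≤N , p , q , N<p , rest)) = p , q , ℕₚ.≤-<-trans m≤N N<p , rest
      find m (no none) = contradiction (m , λ N m≤N pair → none (N , m≤N , pair)) ¬bounded
    cases (no _) (yes (m₀ , none)) = inj₁ (alternative λ m → pick m (at-N (m ℕ.⊔ (m₀ ℕ.⊔ proj₁ all)) (⊔-r m₀ (proj₁ all) (ℕₚ.m≤n⊔m m (m₀ ℕ.⊔ proj₁ all)))))
      where
      pick : ∀ m → Single (m ℕ.⊔ (m₀ ℕ.⊔ proj₁ all)) ⊎ Pair (m ℕ.⊔ (m₀ ℕ.⊔ proj₁ all)) → ∃[ p ] m ℕ.< p × ∃[ h ] h ∈ hs′ × ∃[ b ] b ∈ upTo (suc C) × Shifted h b p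
      pick m (inj₁ (p , lt , rest)) = p , ℕₚ.≤-<-trans (ℕₚ.m≤m⊔n m (m₀ ℕ.⊔ proj₁ all)) lt , rest
      pick m (inj₂ pair) = contradiction pair (none (m ℕ.⊔ (m₀ ℕ.⊔ proj₁ all)) (⊔-l m₀ (proj₁ all) (ℕₚ.m≤n⊔m m (m₀ ℕ.⊔ proj₁ all))))

-- Choice of the parameters.

Holds : ℕ → ℚ → ℚ × ℕ × ℕ → Set
Holds C c (θ₀ , D₆ , D₅) = ∀ ϑ → fromℚᴿ θ₀ <ᴿ ϑ → ConditionA ϑ → ConditionB ϑ → AlternativeI (fromℕᴿ C) (fromℚᴿ c) D₆ ⊎ AlternativeII D₅

-- One C and one c must serve all triples and every ϑ. Each case is therefore proved for all large C
-- and all small c, so that the six can be intersected.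
ForSmall : (ℕ → ℚ → Set) → Set₁
ForSmall P = ∃[ C₀ ] ∃[ c₀ ] 0ℚ < c₀ × (∀ C c → C₀ ℕ.≤ C → 0ℚ ≤ c → c ≤ c₀ → ExcludedMiddle 0ℓ → P C c)

Claim : ℚ × ℕ × ℕ → Set₁
Claim triple = ForSmall λ C c → Holds C c triple

0<fall : ∀ m j → 0ℚ < fall m j
0<fall m zero = 0<1
0<fall m (suc j) = 0<* (0<rec {suc (j ℕ.+ m)} (s≤s z≤n)) (0<fall m j)

0<integerConst : ∀ k {a} → 0ℚ ≤ a → 0ℚ < integerConst k a
0<integerConst k {a} 0≤a = ℚₚ.+-mono-<-≤ (ℚₚ.+-mono-<-≤ (0<fall 0 k) (0≤* (0≤* (0≤fromℕ 2) 0≤a) (0≤fall 1 k))) (0≤* (0≤* 0≤a 0≤a) (0≤fall 2 k))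

-- The sums run to N + h and 2 N + h, but all bounds are to be stated in terms of N.
level-near : ExcludedMiddle 0ℓ → ∀ B {S ϑ} → LevelOfDistribution S ϑ → ∀ {θ₀} → 0ℚ ≤ θ₀ → fromℚᴿ θ₀ <ᴿ ϑ →
  ∃[ C ] 0ℚ ≤ C × ∃[ N₀ ] (∀ N N′ → N₀ ℕ.≤ N → 1 ℕ.≤ N → N ℕ.≤ N′ → N′ ℕ.≤ 3 ℕ.* N → ∀ M → H M ≤ θ₀ * (H N - fromℕ 2) →
    ∃[ Q ] M ℕ.≤ Q × ∃[ n₀ ] (∀ n → n₀ ℕ.≤ n → seq (S N′ Q) n ≤ fromℕ 3 * C * (fromℕ N * inv₀ (H N ^ B))))
level-near em B {S} {ϑ} lod {θ₀} 0≤θ₀ lt = let C , 0≤C , N₀ , bound = level-bound B em {S} {ϑ} lod {θ₀} 0≤θ₀ lt in C , 0≤C , N₀ , λ N N′ N₀≤N 1≤N N≤N′ N′≤3N M HM≤ →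
  let Q , M≤Q , n₀ , le = bound N′ (ℕₚ.≤-trans N₀≤N N≤N′) M (ℚₚ.≤-trans HM≤ (*-monoˡ 0≤θ₀ (ℚₚ.+-monoˡ-≤ (- fromℕ 2) (H-mono N≤N′)))) in
  Q , M≤Q , n₀ , λ n n₀≤n → ℚₚ.≤-trans (le n n₀≤n)
    (≤-≡ refl (*-monoˡ 0≤C (*-mono (0≤fromℕ N′) (ℚₚ.<⇒≤ (0<inv₀ (0<^ (ℚₚ.<-≤-trans 0<1 (1≤H 1≤N)) B))) (≤-≡ refl (fromℕ-mono {N′} {3 ℕ.* N} N′≤3N) (fromℕ-* 3 N)) (inv₀-anti (0<^ (ℚₚ.<-≤-trans 0<1 (1≤H 1≤N)) B) (^-mono (0≤H N) (H-mono N≤N′) B))))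
      (solve 4 (λ c t n i → c :* (t :* n :* i) := t :* c :* (n :* i)) refl C (fromℕ 3) (fromℕ N) (inv₀ (H N ^ B))))

module Case (h₀ : ℕ) (hs₁ : List ℕ) (j₀ : ℕ) (hs′ : List ℕ) (wo : Without j₀ (h₀ ∷ hs₁) hs′) (1≤j : 1 ℕ.≤ length hs₁)
  (D₀ : ℕ) (sep₀ : Separated D₀ (h₀ ∷ hs₁)) (hs≤D₀ : All (ℕ._≤ D₀) (h₀ ∷ hs₁))
  (θ₀ a η : ℚ) (0<θ₀ : 0ℚ < θ₀) (θ₀<1 : θ₀ < 1ℚ) (0≤a : 0ℚ ≤ a) (0<η : 0ℚ < η) (η≤1 : η ≤ 1ℚ)
  (numeric : cost (length hs₁) a η < gain (length hs₁) θ₀ a η)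
  (translates : ∀ D → ∃[ ν ] (∀ {h} → h ∈ h₀ ∷ hs₁ → Coprime (ν ℕ.+ h) (D !))) where

  private
    j k n₁ : ℕ
    j = length hs₁
    k = suc j
    hs : List ℕ
    hs = h₀ ∷ hs₁
    -- The number of factors 1 + ε that accumulate in `integers-≤`; ε = η/(2 n₁) keeps their product
    -- below 1 + η.
    n₁ = k ℕ.+ k ℕ.+ 2
    α δ ε : ℚ
    α = integerConst k a
    δ = η * α
    ε = η * rec (2 ℕ.* n₁)
    0≤η = ℚₚ.<⇒≤ 0<η
    0<α : 0ℚ < α
    0<α = 0<integerConst k 0≤a
    0<δ : 0ℚ < δ
    0<δ = 0<* 0<η 0<α
    0≤δ = ℚₚ.<⇒≤ 0<δ
    0<ε : 0ℚ < ε
    0<ε = 0<* 0<η (0<rec {2 ℕ.* n₁} (s≤s z≤n))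
    0≤ε = ℚₚ.<⇒≤ 0<ε
    2nε≡η : fromℕ 2 * (fromℕ n₁ * ε) ≡ η
    2nε≡η = trans (solve 4 (λ t n e r → t :* (n :* (e :* r)) := e :* (t :* n :* r)) refl (fromℕ 2) (fromℕ n₁) η (rec (2 ℕ.* n₁)))
      (trans (cong (λ x → η * (x * rec (2 ℕ.* n₁))) (sym (fromℕ-* 2 n₁))) (trans (cong (η *_) (n*rec {2 ℕ.* n₁} (s≤s z≤n))) (ℚₚ.*-identityʳ η)))
    ε≤1 : ε ≤ 1ℚ
    ε≤1 = *-mono {η} {1ℚ} {rec (2 ℕ.* n₁)} {1ℚ} 0≤η 0≤1 η≤1 (rec≤1 (2 ℕ.* n₁))
    up : (1ℚ + ε) ^ n₁ ≤ 1ℚ + η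
    up = ≤-≡ refl (bernoulli-upper 0≤ε n₁ (≤-≡ 2nε≡η η≤1 refl)) (cong (1ℚ +_) 2nε≡η)
    low : 1ℚ - η ≤ (1ℚ - ε) ^ suc (j ℕ.+ 4)
    low = ℚₚ.≤-trans (ℚₚ.+-monoʳ-≤ 1ℚ (ℚₚ.neg-antimono-≤ (≤-≡ refl (ℚₚ.≤-trans (*-monoʳ 0≤ε (fromℕ-mono {suc (j ℕ.+ 4)} {n₁} exps)) double) 2nε≡η))) (bernoulli-lower 0≤ε ε≤1 (suc (j ℕ.+ 4)))
      where
      exps : suc (j ℕ.+ 4) ℕ.≤ n₁
      exps = ℕₚ.≤-trans (s≤s (ℕₚ.+-monoʳ-≤ j (s≤s (s≤s (s≤s 1≤j))))) (ℕₚ.≤-reflexive (solveℕ 1 (λ j → conᴺ 1 :+ᴺ (j :+ᴺ (conᴺ 3 :+ᴺ j)) :=ᴺ conᴺ 1 :+ᴺ j :+ᴺ (conᴺ 1 :+ᴺ j) :+ᴺ conᴺ 2) refl j))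
      double : fromℕ n₁ * ε ≤ fromℕ 2 * (fromℕ n₁ * ε)
      double = by-difference (0≤* (0≤fromℕ n₁) 0≤ε) (solve 1 (λ x → x := con (fromℕ 2) :* x :- x) refl (fromℕ n₁ * ε))
    0<½ε : 0ℚ < ½ * ε
    0<½ε = 0<* (ℚₚ.positive⁻¹ ½) 0<ε
    Kfound : ∃[ K ] 1 ℕ.≤ K × fromℕ (2 ℕ.* k) * rec K ≤ ½ * ε
    Kfound = rec-small {fromℕ (2 ℕ.* k)} {½ * ε} 0<½ε
    K = proj₁ Kfound

  D : ℕ
  -- K makes the product over primes above D close to 1, 2k gives z ≤ 1 at those primes, and D₀
  -- bounds the distances in the tuple.
  D = K ℕ.+ (k ℕ.+ k ℕ.+ D₀)
  ν : ℕ
  ν = proj₁ (translates D)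

  private
    2k≤D : k ℕ.+ k ℕ.≤ D
    2k≤D = ℕₚ.≤-trans (ℕₚ.m≤m+n (k ℕ.+ k) D₀) (ℕₚ.m≤n+m (k ℕ.+ k ℕ.+ D₀) K)
    D₀≤D : D₀ ℕ.≤ D
    D₀≤D = ℕₚ.≤-trans (ℕₚ.m≤n+m D₀ (k ℕ.+ k)) (ℕₚ.m≤n+m (k ℕ.+ k ℕ.+ D₀) K)
    sep : Separated D hs
    sep = AllPairs.map (λ (neq , close) → neq , ℕₚ.≤-trans close D₀≤D) sep₀
    small-D : fromℕ (2 ℕ.* k) * rec D ≤ ½ * ε
    small-D = ℚₚ.≤-trans (*-monoˡ (0≤fromℕ (2 ℕ.* k)) (rec-anti (proj₁ (proj₂ Kfound)) (ℕₚ.m≤m+n K (k ℕ.+ k ℕ.+ D₀)))) (proj₂ (proj₂ Kfound))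
    W : ℕ
    W = D !
    1≤W = ℕₚ.1≤n! D
    κ d G s ω : ℚ
    κ = density W
    d = inv₀ (½ * ε)
    0<½δ : 0ℚ < ½ * δ
    0<½δ = 0<* (ℚₚ.positive⁻¹ ½) 0<δ
    g = fromℕ 24 * fromℕ k * ((d + a) * (d + a))
    0≤g : 0ℚ ≤ g
    0≤g = 0≤* (0≤* (0≤fromℕ 24) (0≤fromℕ k)) (0≤p² (d + a))
    -- With c₀ = s/G the share g c₀² of the `n` with small prime factors is at most δ/2; the other
    -- half of δ is left for their error terms.
    G = g * inv₀ (½ * δ) + 1ℚ
    1≤G : 1ℚ ≤ G
    1≤G = p≤q+p (0≤* 0≤g (ℚₚ.<⇒≤ (0<inv₀ 0<½δ)))
    0<G = ℚₚ.<-≤-trans 0<1 1≤G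
    -- Half of the room between R², about N^θ₀, and N. As c₀ ≤ s, the product y₀ R² stays below
    -- N^(1-s), and the factor N^s beats all powers of log N.
    s = ½ * (1ℚ - θ₀)
    0<s : 0ℚ < s
    0<s = 0<* (ℚₚ.positive⁻¹ ½) (difference< θ₀<1)
    0≤θ₀ = ℚₚ.<⇒≤ 0<θ₀
    s≤1 : s ≤ 1ℚ
    s≤1 = by-difference (0≤+ (ℚₚ.nonNegative⁻¹ ½) (0≤* (ℚₚ.nonNegative⁻¹ ½) 0≤θ₀)) (solve 1 (λ t → con ½ :+ con ½ :* t := con 1ℚ :- con ½ :* (con 1ℚ :- t)) refl θ₀)
    c₀ : ℚ
    c₀ = s * inv₀ G
    0<c₀ : 0ℚ < c₀
    0<c₀ = 0<* 0<s (0<inv₀ 0<G)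
    0≤c₀ = ℚₚ.<⇒≤ 0<c₀
    c₀≤s : c₀ ≤ s
    c₀≤s = ≤-≡ refl (*-monoˡ (ℚₚ.<⇒≤ 0<s) (inv₀-anti 0<1 1≤G)) (ℚₚ.*-identityʳ s)
    c₀≤1 = ℚₚ.≤-trans c₀≤s s≤1
    gc₀≤ : g * (c₀ * c₀) ≤ ½ * δ
    gc₀≤ = ℚₚ.≤-trans (*-monoˡ 0≤g (≤-≡ refl (*-monoˡ 0≤c₀ c₀≤1) (ℚₚ.*-identityʳ c₀)))
      (≤-≡ (trans (solve 2 (λ g c → g :* c := g :* con 1ℚ :* c) refl g c₀) (trans (cong (λ x → g * x * c₀) (sym (inv₀-inverse 0<½δ))) (solve 4 (λ g t v c → g :* (t :* v) :* c := t :* (g :* v :* c)) refl g (½ * δ) (inv₀ (½ * δ)) c₀)))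
        (*-monoˡ (ℚₚ.<⇒≤ 0<½δ) (ℚₚ.≤-trans (*-monoʳ {g * inv₀ (½ * δ)} {G} {c₀} 0≤c₀ (p≤p+q 0≤1)) (≤-≡ {q = s} (trans (solve 3 (λ G s v → G :* (s :* v) := s :* (G :* v)) refl G s (inv₀ G)) (trans (cong (s *_) (inv₀-inverse 0<G)) (ℚₚ.*-identityʳ s))) s≤1 refl))) (ℚₚ.*-identityʳ (½ * δ)))
    ω = rec W * κ ^ k
    0<ω : 0ℚ < ω
    0<ω = 0<* (0<rec 1≤W) (0<^ (0<density {W} 1≤W) k)
    K₁ K₂ : ℚ
    -- What `H R` can fall short of ½ θ₀ `H N`.
    K₁ = θ₀ + ½ * H W + 1ℚ
    u₁ = fromℕ k * upperShift W
    u₂ = 1ℚ + (fromℕ 2 * H W + fromℕ (j ℕ.* (j ℕ.+ 4)) * H W)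
    v₁ = u₁ * inv₀ ε
    v₂ = u₂ * inv₀ (½ * ε)
    v₃ = 1ℚ * inv₀ c₀
    v₄ = H D + 1ℚ
    0≤u₁ : 0ℚ ≤ u₁
    0≤u₁ = 0≤* (0≤fromℕ k) (0≤+ 0≤1 (0≤* (0≤fromℕ W) (ℚₚ.<⇒≤ (0<inv₀ (0<density {W} 1≤W)))))
    0≤u₂ : 0ℚ ≤ u₂
    0≤u₂ = 0≤+ 0≤1 (0≤+ (0≤* (0≤fromℕ 2) (0≤H W)) (0≤* (0≤fromℕ (j ℕ.* (j ℕ.+ 4))) (0≤H W)))
    0≤v₁ = 0≤* 0≤u₁ (ℚₚ.<⇒≤ (0<inv₀ 0<ε))
    0≤v₂ = 0≤* 0≤u₂ (ℚₚ.<⇒≤ (0<inv₀ 0<½ε))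
    0≤v₃ = 0≤* 0≤1 (ℚₚ.<⇒≤ (0<inv₀ 0<c₀))
    0≤v₄ = 0≤+ (0≤H D) 0≤1
    -- A lower bound for `H R` that implies all four requirements on R: the two shift conditions, 1
    -- ≤ c₀ `H R`, and D ≤ R.
    K₂ = v₁ + v₂ + v₃ + v₄
    Q₀ p q B B′ B₄ : ℕ
    Q₀ = 6 ℕ.* (2 ℕ.* k) ℕ.* (6 ℕ.* (2 ℕ.* k))
    -- Exponents of `H N`: p is that of `Z-≤`; q is that of the trivial error, one factor coming
    -- from `Lmax`; B is that of the trading parameter, B′ that of the saving demanded from (A) and
    -- (B), and B₄ that of the error in `bad-≤`.
    p = suc (2 ℕ.* k)
    q = suc Q₀
    B = p ℕ.+ p ℕ.+ (q ℕ.+ 1)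
    B′ = p ℕ.+ p ℕ.+ (B ℕ.+ 1)
    B₄ = p ℕ.+ p ℕ.+ 6 ℕ.* k
    zc C₄ : ℚ
    zc = 1ℚ + a
    0≤zc = 0≤+ 0≤1 0≤a
    C₄ = zc * zc * (fromℕ 2 * fromℕ k)
    scale : ∀ {u v L} → 0ℚ < v → u * inv₀ v ≤ L → u ≤ v * L
    scale {u} {v} {L} 0<v le = ≤-≡ (trans (sym (ℚₚ.*-identityʳ u)) (trans (cong (u *_) (sym (inv₀-inverse 0<v))) (solve 3 (λ u v i → u :* (v :* i) := v :* (u :* i)) refl u v (inv₀ v)))) (*-monoˡ (ℚₚ.<⇒≤ 0<v) le) refl

  -- About half of `H y₀` / `H N`, since `H y₀` is near c₀ `H R` and `H R` near ½ θ₀ `H N`; the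
  -- other half absorbs constants.
  c₁ : ℚ
  c₁ = ½ * ½ * (c₀ * θ₀)
  0<c₁ : 0ℚ < c₁
  0<c₁ = 0<* (ℚₚ.positive⁻¹ (½ * ½)) (0<* 0<c₀ 0<θ₀)

  Detected : ℕ → Set
  Detected N = ∃[ y₀ ] c₁ * H N ≤ H y₀ × ∃[ i ] 1 ℕ.≤ i × i ℕ.≤ N × N ℕ.+ i ≡ ν [mod D ! ] × ¬ Any (λ p → Any (λ h → p ∣ N ℕ.+ i ℕ.+ h) hs) (primes D y₀) ×
    ½ * (1ℚ + lam (N ℕ.+ i ℕ.+ j₀)) < ∑ₗ hs′ (λ h → χ (prime? (N ℕ.+ i ℕ.+ h)))

  -- How large N has to be: `e₁` makes R large, `e₂` brings `H R` / (`H N` + 2) close to θ₀/2, `e₃`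
  -- bounds `H y₀` from below, `e₄` lets a power of N beat powers of log N, and `e₅` beats the
  -- constants of (A) and (B) by one logarithm.
  module At (N : ℕ) (1≤N : 1 ℕ.≤ N) (e₁ : K₁ + K₂ ≤ ½ * θ₀ * H N) (e₂ : θ₀ + K₁ ≤ ½ * θ₀ * ε * H N) (e₃ : c₀ * K₁ + 1ℚ ≤ c₁ * H N)
    (e₄ : ∀ m → H m ≤ (1ℚ - s) * H N → C₄ * inv₀ (½ * δ * ω) * (fromℕ m * H N ^ B₄) ≤ fromℕ N)
    (C : ℚ) (0≤C : 0ℚ ≤ C) (e₅ : zc * zc * (fromℕ 6 * C + fromℕ 10) ≤ δ * ω * H N)
    (levelA : ∀ N′ → N ℕ.≤ N′ → N′ ℕ.≤ 3 ℕ.* N → ∀ M → H M ≤ θ₀ * (H N - fromℕ 2) →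
      ∃[ Q ] M ℕ.≤ Q × ∃[ n₀ ] (∀ n → n₀ ℕ.≤ n → seq (∑ᴿ Q (primeErrorᴿ N′)) n ≤ fromℕ 3 * C * (fromℕ N * inv₀ (H N ^ B′))))
    (levelB : ∀ N′ → N ℕ.≤ N′ → N′ ℕ.≤ 3 ℕ.* N → ∀ M → H M ≤ θ₀ * (H N - fromℕ 2) →
      ∃[ Q ] M ℕ.≤ Q × fromℕ (∑ℕ Q λ q → liouvilleError N′ q) ≤ fromℕ 3 * C * (fromℕ N * inv₀ (H N ^ B′))) where
    private
      h = H N
      1≤h = 1≤H 1≤N
      0≤h = 0≤H N
      -- Chosen so that the largest modulus, W R², meets the hypothesis of `levelA` and `levelB`.
      target = ½ * (θ₀ * (h - fromℕ 2) - H W)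
      0≤K₂ = 0≤+ (0≤+ (0≤+ 0≤v₁ 0≤v₂) 0≤v₃) 0≤v₄
      target≥ : K₂ + 1ℚ ≤ target
      target≥ = by-difference (difference e₁) (solve 4 (λ k t h w → con ½ :* t :* h :- (t :+ con ½ :* w :+ con 1ℚ :+ k) := con ½ :* (t :* (h :- con (fromℕ 2)) :- w) :- (k :+ con 1ℚ)) refl K₂ θ₀ h (H W))
      Rfound : ∃[ n ] 1 ℕ.≤ n × H n ≤ target × target ≤ H n + 1ℚ
      Rfound = H-inverse target (ℚₚ.≤-trans (p≤q+p 0≤K₂) target≥)
      R = proj₁ Rfound
      1≤R = proj₁ (proj₂ Rfound)
      L = H R
      L≥ : ½ * θ₀ * h - K₁ ≤ L
      L≥ = by-difference (difference (proj₂ (proj₂ (proj₂ Rfound)))) (solve 4 (λ l t h w → l :+ con 1ℚ :- con ½ :* (t :* (h :- con (fromℕ 2)) :- w) := l :- (con ½ :* t :* h :- (t :+ con ½ :* w :+ con 1ℚ))) refl L θ₀ h (H W))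
      K₂≤L : K₂ ≤ L
      K₂≤L = ℚₚ.≤-trans (by-difference (difference e₁) (solve 3 (λ k l t → t :- (k :+ l) := t :- k :- l) refl K₁ K₂ (½ * θ₀ * h))) L≥
      M = R ℕ.* R
      HWM≤ : H (W ℕ.* M) ≤ θ₀ * (h - fromℕ 2)
      HWM≤ = ℚₚ.≤-trans (H-*-≤ W M) (ℚₚ.≤-trans (ℚₚ.+-monoʳ-≤ (H W) (ℚₚ.≤-trans (H-*-≤ R R) (ℚₚ.+-mono-≤ (proj₁ (proj₂ (proj₂ Rfound))) (proj₁ (proj₂ (proj₂ Rfound))))))
        (ℚₚ.≤-reflexive (solve 2 (λ w x → w :+ (con ½ :* (x :- w) :+ con ½ :* (x :- w)) := x) refl (H W) (θ₀ * (h - fromℕ 2)))))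
      θ₀h-2 : θ₀ * (h - fromℕ 2) ≤ θ₀ * h
      θ₀h-2 = *-monoˡ 0≤θ₀ (by-difference {q = h} (0≤fromℕ 2) (solve 2 (λ h t → t := h :- (h :- t)) refl h (fromℕ 2)))
      0<h = ℚₚ.<-≤-trans 0<1 1≤h
      size : W ℕ.* M ℕ.≤ N
      size = ℕₚ.<⇒≤ (H-cancel-< {W ℕ.* M} {N} (ℚₚ.≤-<-trans (ℚₚ.≤-trans HWM≤ θ₀h-2) (subst (θ₀ * h <_) (ℚₚ.*-identityˡ h) (ℚₚ.*-monoˡ-<-pos h {{positive 0<h}} θ₀<1))))
      M≤WM : M ℕ.≤ W ℕ.* M
      M≤WM = m≤p*m 1≤W M
      HM≤θh : H M ≤ θ₀ * h
      HM≤θh = ℚₚ.≤-trans (H-mono M≤WM) (ℚₚ.≤-trans HWM≤ θ₀h-2)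
      M≤N = ℕₚ.≤-trans M≤WM size
      HM≤h : H M ≤ h
      HM≤h = H-mono M≤N
      R≤N : R ℕ.≤ N
      R≤N = ℕₚ.≤-trans (m≤p*m 1≤R R) M≤N
      L≤h : L ≤ h
      L≤h = H-mono R≤N
      4th : v₄ ≤ L
      4th = ℚₚ.≤-trans (p≤q+p (0≤+ (0≤+ 0≤v₁ 0≤v₂) 0≤v₃)) K₂≤L
      D≤R : D ℕ.≤ R
      D≤R = ℕₚ.<⇒≤ (H-cancel-< {D} {R} (ℚₚ.<-≤-trans (subst (_< H D + 1ℚ) (ℚₚ.+-identityʳ (H D)) (ℚₚ.+-monoʳ-< (H D) 0<1)) 4th))
      shift-up : u₁ ≤ ε * L
      shift-up = scale 0<ε (ℚₚ.≤-trans (ℚₚ.≤-trans (p≤p+q 0≤v₂) (ℚₚ.≤-trans (p≤p+q 0≤v₃) (p≤p+q 0≤v₄))) K₂≤L)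
      shift-low : u₂ ≤ ½ * ε * L
      shift-low = scale 0<½ε (ℚₚ.≤-trans (ℚₚ.≤-trans (p≤q+p 0≤v₁) (ℚₚ.≤-trans (p≤p+q 0≤v₃) (p≤p+q 0≤v₄))) K₂≤L)
      1≤c₀L : 1ℚ ≤ c₀ * L
      1≤c₀L = scale 0<c₀ (ℚₚ.≤-trans (ℚₚ.≤-trans (p≤q+p (0≤+ 0≤v₁ 0≤v₂)) (p≤p+q 0≤v₄)) K₂≤L)
      yfound : ∃[ n ] 1 ℕ.≤ n × H n ≤ c₀ * L × c₀ * L ≤ H n + 1ℚ
      yfound = H-inverse (c₀ * L) 1≤c₀L
      y₀ = proj₁ yfound
      1≤y₀ = proj₁ (proj₂ yfound)
      Hy≤ = proj₁ (proj₂ (proj₂ yfound))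
      y₀≤R : y₀ ℕ.≤ R
      y₀≤R = ℕₚ.≮⇒≥ λ R<y → <⇒≱ (subst (L <_) refl (ℚₚ.<-≤-trans (subst (_< H (suc R)) (ℚₚ.+-identityʳ L) (ℚₚ.+-monoʳ-< L (0<rec {suc R} (s≤s z≤n)))) (H-mono R<y)))
        (ℚₚ.≤-trans Hy≤ (≤-≡ refl (*-monoʳ (0≤H R) c₀≤1) (ℚₚ.*-identityˡ L)))
      Hy≥ : c₁ * h ≤ H y₀
      Hy≥ = by-difference (0≤+ (0≤+ (difference e₃) (difference (proj₂ (proj₂ (proj₂ yfound))))) (0≤* 0≤c₀ (difference L≥)))
        (solve 6 (λ c t h k y l → (con ½ :* con ½ :* (c :* t) :* h :- (c :* k :+ con 1ℚ)) :+ (y :+ con 1ℚ :- c :* l) :+ c :* (l :- (con ½ :* t :* h :- k)) := y :- con ½ :* con ½ :* (c :* t) :* h) refl c₀ θ₀ h K₁ (H y₀) L)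

    module Cmp = Comparison h₀ hs₁ D ν N R ε η a 1≤j 2k≤D sep 1≤R D≤R size 0<ε ε≤1 0≤a η≤1 up small-D shift-up shift-low

    private
      Z = Cmp.Z
      0≤Z = Cmp.0≤Z
      Z≤ : Z ≤ zc * h ^ p
      Z≤ = ℚₚ.≤-trans Cmp.Z-≤ (*-monoˡ 0≤zc (^-mono (0≤H R) L≤h p))
      unit = Cmp.unit
      unit≥ : fromℕ N * ω ≤ unit
      unit≥ = ≤-≡ (solve 3 (λ n r k → n :* (r :* k) := n :* r :* k :* con 1ℚ) refl (fromℕ N) (rec W) (κ ^ k))
        (*-monoˡ (0≤* (0≤* (0≤fromℕ N) (0≤rec W)) (0≤^ (ℚₚ.<⇒≤ (0<density {W} 1≤W)) k)) (*-mono {1ℚ} {L ^ k} {1ℚ} {L ^ 2} 0≤1 (0≤^ (0≤H R) 2) (1≤^ (1≤H 1≤R) k) (1≤^ (1≤H 1≤R) 2))) refl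
      0<unit : 0ℚ < unit
      0<unit = ℚₚ.<-≤-trans (0<* (0<fromℕ⁺ 1≤N) 0<ω) unit≥
      err = Z * Z * (fromℕ 2 * fromℕ k * fromℕ M * H M ^ (6 ℕ.* k))
      0≤err : 0ℚ ≤ err
      0≤err = 0≤* (0≤* 0≤Z 0≤Z) (0≤* (0≤* (0≤* (0≤fromℕ 2) (0≤fromℕ k)) (0≤fromℕ M)) (0≤^ (0≤H M) (6 ℕ.* k)))
      0<½δω : 0ℚ < ½ * δ * ω
      0<½δω = 0<* 0<½δ 0<ω
      y₀err≤ : fromℕ y₀ * err ≤ unit * (½ * δ)
      y₀err≤ = ℚₚ.≤-trans (*-monoˡ (0≤fromℕ y₀) (*-mono (0≤* 0≤Z 0≤Z) (0≤* (0≤* (0≤* (0≤fromℕ 2) (0≤fromℕ k)) (0≤fromℕ M)) (0≤^ 0≤h (6 ℕ.* k)))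
          (*-mono 0≤Z (0≤* 0≤zc (0≤^ 0≤h p)) Z≤ Z≤) (*-monoˡ (0≤* (0≤* (0≤fromℕ 2) (0≤fromℕ k)) (0≤fromℕ M)) (^-mono (0≤H M) HM≤h (6 ℕ.* k)))))
        (ℚₚ.≤-trans (≤-≡ (trans (solve 7 (λ y z hp t k m hk → y :* (z :* hp :* (z :* hp) :* (t :* k :* m :* hk)) := z :* z :* (t :* k) :* (y :* m :* (hp :* hp :* hk))) refl (fromℕ y₀) zc (h ^ p) (fromℕ 2) (fromℕ k) (fromℕ M) (h ^ (6 ℕ.* k)))
            (cong₂ (λ x e → C₄ * (x * e)) (sym (fromℕ-* y₀ M)) (trans (cong (_* h ^ (6 ℕ.* k)) (sym (^-+ h p p))) (sym (^-+ h (p ℕ.+ p) (6 ℕ.* k))))))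
          (scale {C₄ * (fromℕ (y₀ ℕ.* M) * h ^ B₄)} 0<½δω (≤-≡ (solve 3 (λ c x i → c :* x :* i := c :* i :* x) refl C₄ (fromℕ (y₀ ℕ.* M) * h ^ B₄) (inv₀ (½ * δ * ω))) (e₄ (y₀ ℕ.* M) HyM≤) refl)) refl)
        (≤-≡ (solve 3 (λ x w n → x :* w :* n := n :* w :* x) refl (½ * δ) ω (fromℕ N)) (*-monoʳ (ℚₚ.<⇒≤ 0<½δ) unit≥) refl))
        where
        HyM≤ : H (y₀ ℕ.* M) ≤ (1ℚ - s) * h
        HyM≤ = ℚₚ.≤-trans (H-*-≤ y₀ M) (ℚₚ.≤-trans (ℚₚ.+-mono-≤ (ℚₚ.≤-trans Hy≤ (*-mono 0≤c₀ 0≤h c₀≤s L≤h)) HM≤θh)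
          (ℚₚ.≤-reflexive (solve 2 (λ t h → con ½ :* (con 1ℚ :- t) :* h :+ t :* h := (con 1ℚ :- con ½ :* (con 1ℚ :- t)) :* h) refl θ₀ h)))
      integers : ∑ N (λ i → Cmp.w₁ i * Cmp.A i) ≤ unit * (α * (1ℚ + η)) + unit * δ
      integers = ℚₚ.≤-trans Cmp.integers-≤ (ℚₚ.+-monoʳ-≤ (unit * (α * (1ℚ + η))) (ℚₚ.≤-trans (*-monoˡ (0≤* 0≤Z 0≤Z) (*-monoʳ (0≤^ (0≤H M) (6 ℕ.* k)) (*-monoʳ (0≤fromℕ M)
            (≤-≡ (sym (ℚₚ.*-identityʳ (fromℕ 2))) (*-monoˡ (0≤fromℕ 2) (fromℕ-mono {1} {k} (s≤s z≤n))) refl))))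
        (ℚₚ.≤-trans (≤-≡ (sym (ℚₚ.*-identityˡ err)) (*-monoʳ 0≤err (fromℕ-mono {1} {y₀} 1≤y₀)) refl) (ℚₚ.≤-trans y₀err≤ (*-monoˡ (ℚₚ.<⇒≤ 0<unit) (by-difference (ℚₚ.<⇒≤ 0<½δ) (solve 1 (λ x → con ½ :* x := x :- con ½ :* x) refl δ)))))))
      bads : ∑ N (λ i → Cmp.cl i * Cmp.bad y₀ i * Cmp.A i) ≤ unit * δ
      bads = ℚₚ.≤-trans (Cmp.bad-≤ {y₀} {c₀} 1≤y₀ y₀≤R Hy≤) (≤-≡ refl (ℚₚ.+-mono-≤ (*-monoˡ (ℚₚ.<⇒≤ 0<unit) gc₀≤) y₀err≤) (solve 2 (λ u x → u :* (con ½ :* x) :+ u :* (con ½ :* x) := u :* x) refl unit δ))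
      0<T : 0ℚ < h ^ B
      0<T = 0<^ 0<h B
      trade : ∀ {S J} → S ≤ fromℕ 6 * C * (fromℕ N * inv₀ (h ^ B′)) → J ≤ fromℕ 10 * (fromℕ N * h ^ q) → Z * Z * (h ^ B * S + inv₀ (h ^ B) * J) ≤ unit * δ
      trade {S} {J} S≤ J≤ = ℚₚ.≤-trans (trade-balance {h} {fromℕ N} {Z} {S} {J} {zc} {fromℕ 6 * C} {fromℕ 10} p q 1≤h 0≤Z 0≤zc (0≤fromℕ N) (0≤* (0≤fromℕ 6) 0≤C) (0≤fromℕ 10) Z≤ S≤ J≤)
        (ℚₚ.≤-trans (≤-≡ (solve 3 (λ c n i → c :* (n :* i) := n :* i :* c) refl (zc * zc * (fromℕ 6 * C + fromℕ 10)) (fromℕ N) (inv₀ h)) (*-monoˡ (0≤* (0≤fromℕ N) (ℚₚ.<⇒≤ (0<inv₀ 0<h))) e₅)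
            (trans (solve 5 (λ n i d w h → n :* i :* (d :* w :* h) := n :* w :* d :* (h :* i)) refl (fromℕ N) (inv₀ h) δ ω h) (trans (cong (fromℕ N * ω * δ *_) (inv₀-inverse 0<h)) (ℚₚ.*-identityʳ (fromℕ N * ω * δ)))))
          (*-monoʳ 0≤δ unit≥))
      N+h≤ : ∀ {h′} → h′ ∈ hs → h′ ℕ.≤ N
      N+h≤ h∈ = ℕₚ.≤-trans (All.lookup hs≤D₀ h∈) (ℕₚ.≤-trans D₀≤D (ℕₚ.≤-trans D≤R R≤N))
      below-3N : ∀ {h′ i} → h′ ℕ.≤ N → i ℕ.≤ N → N ℕ.+ i ℕ.+ h′ ℕ.≤ 3 ℕ.* N
      below-3N h≤ i≤ = ℕₚ.≤-trans (ℕₚ.+-mono-≤ (ℕₚ.+-monoʳ-≤ N i≤) h≤) (ℕₚ.≤-reflexive (solveℕ 1 (λ n → n :+ᴺ n :+ᴺ n :=ᴺ n :+ᴺ (n :+ᴺ (n :+ᴺ conᴺ 0))) refl N))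
      parity : ∣ ∑ N (λ i → Cmp.cl i * lam (N ℕ.+ i ℕ.+ j₀) * Cmp.A i) ∣ ≤ unit * δ
      parity = ℚₚ.≤-trans (Cmp.sum-parity (λ i → lam (N ℕ.+ i ℕ.+ j₀)) (λ i → ∣lam∣≤1 (N ℕ.+ i ℕ.+ j₀)) {λ m → fromℕ 2 * fromℕ (liouvilleError (N ℕ.+ j₀ ℕ.+ N) m)} (λ m → 0≤* (0≤fromℕ 2) (0≤fromℕ (liouvilleError (N ℕ.+ j₀ ℕ.+ N) m)))
          (λ m c 1≤m → parity-in-class N j₀ m c 1≤m) (h ^ B) 0<T)
        (trade sum≤ (≤-≡ (ℚₚ.*-assoc (fromℕ 3) (fromℕ N) (H M ^ (6 ℕ.* k ℕ.* (6 ℕ.* k)))) (*-mono {fromℕ 3} {fromℕ 10} (0≤fromℕ 3) (0≤* (0≤fromℕ N) (0≤^ 0≤h q)) (fromℕ-mono {3} {10} (ℕₚ.m≤m+n 3 7))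
          (*-monoˡ (0≤fromℕ N) (ℚₚ.≤-trans (^-mono (0≤H M) HM≤h (6 ℕ.* k ℕ.* (6 ℕ.* k))) (^-exponent-mono 1≤h (ℕₚ.m≤n⇒m≤1+n (ℕₚ.*-mono-≤ 6k≤ 6k≤)))))) refl))
        where
        j₀≤N : j₀ ℕ.≤ N
        j₀≤N = N+h≤ (without-self wo)
        level = levelB (N ℕ.+ j₀ ℕ.+ N) (ℕₚ.m≤n+m N (N ℕ.+ j₀)) (below-3N {N} {j₀} ℕₚ.≤-refl j₀≤N) (W ℕ.* M) HWM≤
        6k≤ : 6 ℕ.* k ℕ.≤ 6 ℕ.* (2 ℕ.* k)
        6k≤ = ℕₚ.*-monoʳ-≤ 6 (ℕₚ.m≤m+n k (k ℕ.+ 0))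
        sum≤ : ∑ (W ℕ.* M) (λ m → fromℕ 2 * fromℕ (liouvilleError (N ℕ.+ j₀ ℕ.+ N) m)) ≤ fromℕ 6 * C * (fromℕ N * inv₀ (h ^ B′))
        sum≤ = ≤-≡ (∑-* (W ℕ.* M) (fromℕ 2) (λ m → fromℕ (liouvilleError (N ℕ.+ j₀ ℕ.+ N) m))) (*-monoˡ (0≤fromℕ 2) (ℚₚ.≤-trans (∑-extend {W ℕ.* M} {proj₁ level} (proj₁ (proj₂ level)) λ m → 0≤fromℕ (liouvilleError (N ℕ.+ j₀ ℕ.+ N) m))
            (≤-≡ (sum-liouvilleErr (N ℕ.+ j₀ ℕ.+ N) (proj₁ level)) (proj₂ (proj₂ level)) refl)))
          (solve 2 (λ c x → con (fromℕ 2) :* (con (fromℕ 3) :* c :* x) := con (fromℕ 6) :* c :* x) refl C (fromℕ N * inv₀ (h ^ B′)))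
      Lmax : ℚ
      Lmax = h + fromℕ 2
      0≤Lmax = 0≤+ 0≤h (0≤fromℕ 2)
      1≤Lmax : 1ℚ ≤ Lmax
      1≤Lmax = ℚₚ.≤-trans 1≤h (p≤p+q (0≤fromℕ 2))
      H≤Lmax : ∀ {n} → n ℕ.≤ 3 ℕ.* N → H n ≤ Lmax
      H≤Lmax {n} le = ℚₚ.≤-trans (H-mono le) (ℚₚ.≤-trans (H-*-≤ 3 N) (≤-≡ (ℚₚ.+-comm (H 3) h) (ℚₚ.+-monoʳ-≤ h H3≤2) refl))
        where
        H3≤2 : H 3 ≤ fromℕ 2
        H3≤2 = by-difference {d = ½ * rec 3} (0≤* (ℚₚ.nonNegative⁻¹ ½) (0≤rec 3)) refl
      ratio : ½ * θ₀ * (1ℚ - ε) * Lmax ≤ L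
      ratio = ℚₚ.≤-trans (by-difference (0≤+ (difference e₂) (0≤* 0≤θ₀ 0≤ε)) (solve 4 (λ t e h k → (con ½ :* t :* e :* h :- (t :+ k)) :+ t :* e := con ½ :* t :* h :- k :- con ½ :* t :* (con 1ℚ :- e) :* (h :+ con (fromℕ 2))) refl θ₀ ε h K₁)) L≥
      count : ∀ {h′} → h′ ∈ hs → unit * (½ * θ₀ * (1ℚ - η) * Cmp.β - δ) ≤ Cmp.primeCount h′
      count {h′} h∈ = Cmp.primeCount-≥ {h′} {ι} {Lmax} {θ₀} {δ} {error} 1≤Lmax 0≤θ₀ 0≤δ low H-bound ratio main (trade sum≤ J≤)
        where
        h′≤N : h′ ℕ.≤ N
        h′≤N = N+h≤ h∈
        H-bound : ∀ i → 1 ℕ.≤ i → i ℕ.≤ N → H (N ℕ.+ i ℕ.+ h′) ≤ Lmax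
        H-bound i _ i≤N = H≤Lmax (below-3N {h′} {i} h′≤N i≤N)
        level₁ = levelA (N ℕ.+ h′) (ℕₚ.m≤m+n N h′) (ℕₚ.≤-trans (ℕₚ.m≤m+n (N ℕ.+ h′) N) (below-3N {N} {h′} ℕₚ.≤-refl h′≤N)) (W ℕ.* M) HWM≤
        level₂ = levelA (N ℕ.+ h′ ℕ.+ N) (ℕₚ.m≤n+m N (N ℕ.+ h′)) (below-3N {N} {h′} ℕₚ.≤-refl h′≤N) (W ℕ.* M) HWM≤
        n₁′ = proj₁ (proj₂ (proj₂ level₁))
        n₂′ = proj₁ (proj₂ (proj₂ level₂))
        -- The index may depend on N and h′, because the resulting bound for `primeCount` no longer
        -- mentions it.
        ι : ℕ
        ι = n₁′ ℕ.⊔ n₂′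
        one-sum : ∀ x → ∀ {Q} → W ℕ.* M ℕ.≤ Q → ∀ {b} → seq (∑ᴿ Q (primeErrorᴿ x)) ι ≤ b → ∑ (W ℕ.* M) (primeErr ι x) ≤ b
        one-sum x {Q} M≤Q le = ℚₚ.≤-trans (∑-extend {W ℕ.* M} {Q} M≤Q (0≤primeErr ι x)) (≤-≡ (sum-primeErr ι x Q) le refl)
        sum≤ : ∑ (W ℕ.* M) (λ m → primeErr ι (N ℕ.+ h′ ℕ.+ N) m + primeErr ι (N ℕ.+ h′) m) ≤ fromℕ 6 * C * (fromℕ N * inv₀ (h ^ B′))
        sum≤ = ≤-≡ (∑-+ (W ℕ.* M) (primeErr ι (N ℕ.+ h′ ℕ.+ N)) (primeErr ι (N ℕ.+ h′))) (ℚₚ.+-mono-≤ (one-sum (N ℕ.+ h′ ℕ.+ N) (proj₁ (proj₂ level₂)) (proj₂ (proj₂ (proj₂ level₂)) ι (ℕₚ.m≤n⊔m n₁′ n₂′))) (one-sum (N ℕ.+ h′) (proj₁ (proj₂ level₁)) (proj₂ (proj₂ (proj₂ level₁)) ι (ℕₚ.m≤m⊔n n₁′ n₂′))))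
          (solve 2 (λ c x → con (fromℕ 3) :* c :* x :+ con (fromℕ 3) :* c :* x := con (fromℕ 6) :* c :* x) refl C (fromℕ N * inv₀ (h ^ B′)))
        J≤ : (fromℕ 3 * Lmax + 1ℚ) * fromℕ N * H M ^ Q₀ ≤ fromℕ 10 * (fromℕ N * h ^ q)
        J≤ = ≤-≡ refl (*-mono {(fromℕ 3 * Lmax + 1ℚ) * fromℕ N} {fromℕ 10 * h * fromℕ N} (0≤* (0≤+ (0≤* (0≤fromℕ 3) 0≤Lmax) 0≤1) (0≤fromℕ N)) (0≤^ 0≤h Q₀)
            (*-monoʳ {fromℕ 3 * Lmax + 1ℚ} {fromℕ 10 * h} {fromℕ N} (0≤fromℕ N) (by-difference (0≤* (0≤fromℕ 7) (difference 1≤h)) (solve 1 (λ h → con (fromℕ 7) :* (h :- con 1ℚ) := con (fromℕ 10) :* h :- (con (fromℕ 3) :* (h :+ con (fromℕ 2)) :+ con 1ℚ)) refl h))) (^-mono (0≤H M) HM≤h Q₀))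
          (solve 4 (λ t h n x → t :* h :* n :* x := t :* (n :* (h :* x))) refl (fromℕ 10) h (fromℕ N) (h ^ Q₀))
        error : ℚ
        error = Z * Z * (h ^ B * ∑ (W ℕ.* M) (λ m → primeErr ι (N ℕ.+ h′ ℕ.+ N) m + primeErr ι (N ℕ.+ h′) m) + inv₀ (h ^ B) * ((fromℕ 3 * Lmax + 1ℚ) * fromℕ N * H M ^ Q₀))
        0≤errors : ∀ m → 0ℚ ≤ primeErr ι (N ℕ.+ h′ ℕ.+ N) m + primeErr ι (N ℕ.+ h′) m
        0≤errors m = 0≤+ (0≤primeErr ι (N ℕ.+ h′ ℕ.+ N) m) (0≤primeErr ι (N ℕ.+ h′) m)
        l≤ : ∀ i → 1 ℕ.≤ i → i ℕ.≤ N → logAt ι (N ℕ.+ i ℕ.+ h′) ≤ Lmax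
        l≤ i 1≤i i≤N = ℚₚ.≤-trans (logAt≤H ι (N ℕ.+ i ℕ.+ h′)) (H-bound i 1≤i i≤N)
        in-class : ∀ m c → 1 ℕ.≤ m → Coprime (c ℕ.+ h′) m → ∣ ∑ N (λ i → χ (prime? (N ℕ.+ i ℕ.+ h′)) * logAt ι (N ℕ.+ i ℕ.+ h′) * χ (N ℕ.+ i ≡? c [mod m ])) - fromℕ N * inv₀ (coprimeCount m) ∣ ≤ primeErr ι (N ℕ.+ h′ ℕ.+ N) m + primeErr ι (N ℕ.+ h′) m
        in-class m c 1≤m cop = primes-in-class ι N h′ m c 1≤m cop
        main : fromℕ N * inv₀ (coprimeCount W) * Op Cmp.ζ Cmp.ps (λ n → Op recφ Cmp.ps Cmp.y n * Op recφ Cmp.ps Cmp.y n) 1 ≤ ∑ N (λ i → Cmp.cl i * (χ (prime? (N ℕ.+ i ℕ.+ h′)) * logAt ι (N ℕ.+ i ℕ.+ h′)) * Cmp.A i) + error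
        main = sum-p {λ m → primeErr ι (N ℕ.+ h′ ℕ.+ N) m + primeErr ι (N ℕ.+ h′) m} 0≤errors in-class (h ^ B) 0<T
          where
          sum-p = Cmp.sum-primes (proj₂ (remove h∈)) (proj₂ (translates D) h∈) (logAt ι) (0≤logAt ι) {Lmax} l≤ 0≤Lmax

    detected : Detected N
    detected = y₀ , Hy≥ , Cmp.detect {y₀} {j₀} {hs′} {δ} {½ * θ₀ * (1ℚ - η) * Cmp.β - δ} (cong ℕ.pred (sym (without-length wo))) 0<unit integers parity bads (λ h∈ → count (without-∈ wo h∈)) numeric

  detection : ExcludedMiddle 0ℓ → ∀ {ϑ} → fromℚᴿ θ₀ <ᴿ ϑ → ConditionA ϑ → ConditionB ϑ → Eventually Detected
  detection em {ϑ} lt condA condB = proj₁ all , λ N le → let E₁ , E₂ , E₃ , E₄ , E₅ , NA≤ , NB≤ , 1≤N = proj₂ all N le in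
    At.detected N 1≤N E₁ E₂ E₃ E₄ C 0≤C E₅
      (λ N′ N≤ ≤3N M HM → let Q , M≤Q , n₀ , bound = proj₂ (proj₂ (proj₂ lA)) N N′ NA≤ 1≤N N≤ ≤3N M HM in Q , M≤Q , n₀ , λ n n₀≤ → ℚₚ.≤-trans (bound n n₀≤) (weaken N 1≤N {CA} (p≤p+q {CA} {CB} 0≤CB)))
      (λ N′ N≤ ≤3N M HM → let Q , M≤Q , n₀ , bound = proj₂ (proj₂ (proj₂ lB)) N N′ NB≤ 1≤N N≤ ≤3N M HM in Q , M≤Q , ℚₚ.≤-trans (bound n₀ ℕₚ.≤-refl) (weaken N 1≤N {CB} (p≤q+p {CB} {CA} 0≤CA)))
    where
    lA = level-near em B′ {λ N Q → ∑ᴿ Q (primeErrorᴿ N)} {ϑ} (conditionA {ϑ} condA) {θ₀} 0≤θ₀ lt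
    lB = level-near em B′ {λ N Q → fromℕᴿ (∑ℕ Q λ q → liouvilleError N q)} {ϑ} condB {θ₀} 0≤θ₀ lt
    CA = proj₁ lA
    CB = proj₁ lB
    0≤CA = proj₁ (proj₂ lA)
    0≤CB = proj₁ (proj₂ lB)
    C = CA + CB
    0≤C = 0≤+ 0≤CA 0≤CB
    weaken : ∀ N → 1 ℕ.≤ N → ∀ {c} → c ≤ C → fromℕ 3 * c * (fromℕ N * inv₀ (H N ^ B′)) ≤ fromℕ 3 * C * (fromℕ N * inv₀ (H N ^ B′))
    weaken N 1≤N le = *-monoʳ (0≤* (0≤fromℕ N) (ℚₚ.<⇒≤ (0<inv₀ (0<^ (ℚₚ.<-≤-trans 0<1 (1≤H 1≤N)) B′)))) (*-monoˡ (0≤fromℕ 3) le)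
    0<½θ₀ = 0<* (ℚₚ.positive⁻¹ ½) 0<θ₀
    all = both (H-eventually (K₁ + K₂) 0<½θ₀) (both (H-eventually (θ₀ + K₁) (0<* 0<½θ₀ 0<ε)) (both (H-eventually (c₀ * K₁ + 1ℚ) 0<c₁)
      (both (polylog 0<s (C₄ * inv₀ (½ * δ * ω)) B₄) (both (H-eventually (zc * zc * (fromℕ 6 * C + fromℕ 10)) (0<* 0<δ 0<ω))
        (both {λ N → proj₁ (proj₂ (proj₂ lA)) ℕ.≤ N} (proj₁ (proj₂ (proj₂ lA)) , λ _ le → le) (both {λ N → proj₁ (proj₂ (proj₂ lB)) ℕ.≤ N} (proj₁ (proj₂ (proj₂ lB)) , λ _ le → le) (1 , λ _ le → le)))))))

  settled : ∀ D₆ → All (λ h → 2 ∣ ℤ.∣ ℤ.+ j₀ ℤ.- ℤ.+ h ∣ × 0 ℕ.< ℤ.∣ ℤ.+ j₀ ℤ.- ℤ.+ h ∣ × ℤ.∣ ℤ.+ j₀ ℤ.- ℤ.+ h ∣ ℕ.≤ D₆) hs′ → Claim (θ₀ , D₆ , D₀)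
  settled D₆ shifts = proj₁ bound , ½ * c₁ , 0<* (ℚₚ.positive⁻¹ ½) 0<c₁ , λ C c C₀≤C 0≤c c≤ em ϑ lt condA condB →
    Conclusion.conclusion hs j₀ hs′ wo D₀ sep₀ hs≤D₀ D ν (proj₂ (translates D)) c₁ 0<c₁ D₆ shifts c 0≤c c≤ C (ℚₚ.≤-trans (proj₂ (proj₂ bound)) (fromℕ-mono C₀≤C)) em (detection em {ϑ} lt condA condB)
    where
    bound = ceiling (fromℕ 4 * inv₀ c₁)

-- The six numerical cases.

-- To first order in η the requirement gain > cost reads (k - 1) ϑ₀ β/α > 1 + 4 k η. The tightest
-- case is k = 7, where the left side exceeds 1 by about 0.0017, against 0.0014 for this value.
η₀ : ℚ
η₀ = rec 20000

-- ν₀ witnesses that hs is admissible: ν₀ + h has no prime factor up to D₅ + 2.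
Valid : (hs hs′ : List ℕ) (j₀ ν₀ a : ℕ) → ℚ → ℕ → ℕ → Set
Valid hs hs′ j₀ ν₀ a θ₀ D₆ D₅ = Separated D₅ hs × All (ℕ._≤ D₅) hs ×
  All (λ h → 2 ∣ ℤ.∣ ℤ.+ j₀ ℤ.- ℤ.+ h ∣ × 0 ℕ.< ℤ.∣ ℤ.+ j₀ ℤ.- ℤ.+ h ∣ × ℤ.∣ ℤ.+ j₀ ℤ.- ℤ.+ h ∣ ℕ.≤ D₆) hs′ ×
  All (λ h → All (λ q → ¬ suc (suc q) ∣ ν₀ ℕ.+ h) (upTo (suc (suc D₅)))) hs ×
  0ℚ < θ₀ × θ₀ < 1ℚ × cost (length hs′) (fromℕ a) η₀ < gain (length hs′) θ₀ (fromℕ a) η₀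

valid? : ∀ hs hs′ j₀ ν₀ a θ₀ D₆ D₅ → Dec (Valid hs hs′ j₀ ν₀ a θ₀ D₆ D₅)
valid? hs hs′ j₀ ν₀ a θ₀ D₆ D₅ = AllPairs.allPairs? (λ h h′ → ¬? (h ℕₚ.≟ h′) ×-dec ℕ.∣ h - h′ ∣ ℕₚ.≤? D₅) hs ×-dec All.all? (ℕₚ._≤? D₅) hs ×-dec
  All.all? (λ h → 2 ∣? ℤ.∣ ℤ.+ j₀ ℤ.- ℤ.+ h ∣ ×-dec 0 ℕₚ.<? ℤ.∣ ℤ.+ j₀ ℤ.- ℤ.+ h ∣ ×-dec ℤ.∣ ℤ.+ j₀ ℤ.- ℤ.+ h ∣ ℕₚ.≤? D₆) hs′ ×-dec
  All.all? (λ h → All.all? (λ q → ¬? (suc (suc q) ∣? ν₀ ℕ.+ h)) (upTo (suc (suc D₅)))) hs ×-dec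
  0ℚ ℚₚ.<? θ₀ ×-dec θ₀ ℚₚ.<? 1ℚ ×-dec cost (length hs′) (fromℕ a) η₀ ℚₚ.<? gain (length hs′) θ₀ (fromℕ a) η₀

claim : ∀ h₀ hs₁ {hs′ j₀} → Without j₀ (h₀ ∷ hs₁) hs′ → 1 ℕ.≤ length hs₁ → ∀ ν₀ a θ₀ D₆ D₅ → Valid (h₀ ∷ hs₁) hs′ j₀ ν₀ a θ₀ D₆ D₅ → Claim (θ₀ , D₆ , D₅)
claim h₀ hs₁ {hs′} {j₀} wo 1≤j ν₀ a θ₀ D₆ D₅ (sep , hs≤ , shifts , avoids , 0<θ₀ , θ₀<1 , numeric) =
  Case.settled h₀ hs₁ j₀ hs′ wo 1≤j D₅ sep hs≤ θ₀ (fromℕ a) η₀ 0<θ₀ θ₀<1 (0≤fromℕ a) 0<η₀ (rec≤1 20000) (subst (λ j → cost j (fromℕ a) η₀ < gain j θ₀ (fromℕ a) η₀) same numeric) tuple D₆ shifts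
  where
  0<η₀ : 0ℚ < η₀
  0<η₀ = 0<rec {20000} (s≤s z≤n)
  tuple : ∀ D → ∃[ ν ] (∀ {h} → h ∈ h₀ ∷ hs₁ → Coprime (ν ℕ.+ h) (D !))
  tuple = admissible {h₀ ∷ hs₁} (suc (suc D₅)) (λ h∈ → s≤s (s≤s (All.lookup hs≤ h∈))) (ν₀ , avoids-all {h₀ ∷ hs₁} {suc (suc D₅)} {ν₀} avoids)
  same : length hs′ ≡ length hs₁
  same = cong ℕ.pred (sym (without-length wo))

abstract
  -- In each case the tuple has diameter D₅ and the marked element is an inner one, at distance at
  -- most D₆ from the others. The parameter `a` is the integer nearest to the point where α/β is
  -- smallest.
  claim₃ : Claim ((ℤ.+ 924 / 1000) , 4 , 6)
  claim₃ = claim 0 (2 ∷ 6 ∷ []) (there here) (s≤s z≤n) 41 3 (ℤ.+ 924 / 1000) 4 6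
    (from-yes (valid? (0 ∷ 2 ∷ 6 ∷ []) (0 ∷ 6 ∷ []) 2 41 3 (ℤ.+ 924 / 1000) 4 6))

  claim₄ : Claim ((ℤ.+ 739 / 1000) , 6 , 8)
  claim₄ = claim 0 (2 ∷ 6 ∷ 8 ∷ []) (there here) (s≤s z≤n) 101 6 (ℤ.+ 739 / 1000) 6 8
    (from-yes (valid? (0 ∷ 2 ∷ 6 ∷ 8 ∷ []) (0 ∷ 6 ∷ 8 ∷ []) 2 101 6 (ℤ.+ 739 / 1000) 6 8))

  claim₅ : Claim ((ℤ.+ 643 / 1000) , 6 , 12)
  claim₅ = claim 0 (4 ∷ 6 ∷ 10 ∷ 12 ∷ []) (there (there here)) (s≤s z≤n) 97 9 (ℤ.+ 643 / 1000) 6 12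
    (from-yes (valid? (0 ∷ 4 ∷ 6 ∷ 10 ∷ 12 ∷ []) (0 ∷ 4 ∷ 10 ∷ 12 ∷ []) 6 97 9 (ℤ.+ 643 / 1000) 6 12))

  claim₆ : Claim ((ℤ.+ 584 / 1000) , 10 , 16)
  claim₆ = claim 0 (4 ∷ 6 ∷ 10 ∷ 12 ∷ 16 ∷ []) (there (there here)) (s≤s z≤n) 97 13 (ℤ.+ 584 / 1000) 10 16
    (from-yes (valid? (0 ∷ 4 ∷ 6 ∷ 10 ∷ 12 ∷ 16 ∷ []) (0 ∷ 4 ∷ 10 ∷ 12 ∷ 16 ∷ []) 6 97 13 (ℤ.+ 584 / 1000) 10 16))

  claim₇ : Claim ((ℤ.+ 544 / 1000) , 12 , 20)
  claim₇ = claim 0 (2 ∷ 6 ∷ 8 ∷ 12 ∷ 18 ∷ 20 ∷ []) (there (there (there here))) (s≤s z≤n) 8621 17 (ℤ.+ 544 / 1000) 12 20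
    (from-yes (valid? (0 ∷ 2 ∷ 6 ∷ 8 ∷ 12 ∷ 18 ∷ 20 ∷ []) (0 ∷ 2 ∷ 6 ∷ 12 ∷ 18 ∷ 20 ∷ []) 8 8621 17 (ℤ.+ 544 / 1000) 12 20))

  claim₈ : Claim ((ℤ.+ 516 / 1000) , 14 , 26)
  claim₈ = claim 0 (2 ∷ 6 ∷ 8 ∷ 12 ∷ 18 ∷ 20 ∷ 26 ∷ []) (there (there (there (there here)))) (s≤s z≤n) 8621 22 (ℤ.+ 516 / 1000) 14 26
    (from-yes (valid? (0 ∷ 2 ∷ 6 ∷ 8 ∷ 12 ∷ 18 ∷ 20 ∷ 26 ∷ []) (0 ∷ 2 ∷ 6 ∷ 8 ∷ 18 ∷ 20 ∷ 26 ∷ []) 12 8621 22 (ℤ.+ 516 / 1000) 14 26))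

claims : All Claim triples
claims = claim₃ ∷ claim₄ ∷ claim₅ ∷ claim₆ ∷ claim₇ ∷ claim₈ ∷ []

0<⊓ : ∀ {p q} → 0ℚ < p → 0ℚ < q → 0ℚ < p ⊓ q
0<⊓ {p} {q} 0<p 0<q = [ (λ eq → subst (0ℚ <_) (sym eq) 0<p) , (λ eq → subst (0ℚ <_) (sym eq) 0<q) ]′ (ℚₚ.⊓-sel p q)

×-forSmall : ∀ {P Q : ℕ → ℚ → Set} → ForSmall P → ForSmall Q → ForSmall λ C c → P C c × Q C c
×-forSmall (C₁ , c₁ , 0<c₁ , p) (C₂ , c₂ , 0<c₂ , q) = C₁ ℕ.⊔ C₂ , c₁ ⊓ c₂ , 0<⊓ 0<c₁ 0<c₂ , λ C c C≥ 0≤c c≤ em →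
  p C c (⊔-l C₁ C₂ C≥) 0≤c (ℚₚ.≤-trans c≤ (ℚₚ.p⊓q≤p c₁ c₂)) em , q C c (⊔-r C₁ C₂ C≥) 0≤c (ℚₚ.≤-trans c≤ (ℚₚ.p⊓q≤q c₁ c₂)) em

uniform : ∀ {xs} → All Claim xs → ForSmall λ C c → All (Holds C c) xs
uniform [] = 0 , 1ℚ , 0<1 , λ _ _ _ _ _ _ → []
uniform (p ∷ ps) = let C₀ , c₀ , 0<c₀ , both = ×-forSmall p (uniform ps) in C₀ , c₀ , 0<c₀ , λ C c C≥ 0≤c c≤ em → proj₁ (both C c C≥ 0≤c c≤ em) ∷ proj₂ (both C c C≥ 0≤c c≤ em)

abstract
  constants : ForSmall λ C c → All (Holds C c) triples
  constants = uniform claims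

theorem8 : ExcludedMiddle 0ℓ →
    ∃[ C ] ∃[ c ] 0ᴿ <ᴿ c ×
    ((ϑ₀ : ℚ) (D₆ D₅ : ℕ) → (ϑ₀ , D₆ , D₅) ∈ triples →
    (ϑ : ℝ) → fromℚᴿ ϑ₀ <ᴿ ϑ → ConditionA ϑ → ConditionB ϑ →
    AlternativeI C c D₆ ⊎ AlternativeII D₅)
theorem8 em = let C , c , 0<c , holds = constants in
  fromℕᴿ C , fromℚᴿ c , (c , 0<c , 0 , λ _ _ → ℚₚ.≤-reflexive (ℚₚ.+-identityˡ c)) ,
  λ _ _ _ triple∈ → All.lookup (holds C c ℕₚ.≤-refl (ℚₚ.<⇒≤ 0<c) ℚₚ.≤-refl em) triple∈
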